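{- Let $\chi_1$ and $\chi_2$ be two primitive Dirichlet characters with prime conductors $q_1$ and $q_2$ respectively, $q_1 \leqslant q_2$, let $T > 1$ and let $r\geqslant 2$ be an integer. Put $\nu_r := 1$ if $r = 2$ and $\nu_r := 0$ otherwise. Set $$T_r := q_1^{\frac{(r+1)^2}{4r}} q_2^{\frac{r+1}{4r}} (\log q_1)^{r+1} (\log q_2)^{\nu_r r (r+1) + r^2 + 1}.$$ Then $$\sum_{0 < xy \leqslant T}\chi_1(x)\chi_2(y) \ll \begin{cases} T^{1-\frac 1 r} (q_1q_2)^{\frac{r+1}{4r^2}} (\log q_1)^{\frac 1 r}(\log q_2)^{\frac 1 r+\nu_r + 1} & \text{if } (q_1q_2)^{\frac{r+1}{4r}} \leqslant T\leqslant T_r,\\ T^{\frac{r}{r+1}} q_2^{\frac 1 {4r}} (\log q_2)^{\frac{2}{r+1}} & \text{if } T_r \leqslant T, \end{cases}$$ with an implied constant depending at most on $r$.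
   Context: The sum $\sum_{0<xy\leqslant T}$ runs over all pairs $(x,y)$ of positive integers with $xy\leqslant T$; $T$ is a real number. The notation $A\ll B$ means $|A|\leqslant C B$ for some constant $C>0$; here $C$ may depend on $r$ but not on $\chi_1,\chi_2,q_1,q_2,T$. -}

module Defs where

open import Algebra.Bundles.Raw using (RawSemiring)
import Algebra.Definitions.RawSemiring as RawSemiringDefs
open import Data.Integer as ℤ using (ℤ; +_)
import Data.Integer.Coprimality as ℤ
import Data.Integer.Divisibility as ℤ
import Data.Integer.Properties as ℤ
open import Data.List using (List; foldr; map)
open import Data.List.Membership.Propositional using (_∈_)
open import Data.List.Relation.Unary.Unique.Propositional using (Unique)
open import Data.Nat as ℕ using (ℕ; zero; suc)
import Data.Nat.Divisibility as ℕ
import Data.Nat.Properties as ℕ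
open import Data.Nat.Solver using (module +-*-Solver)
open import Data.Product using (_×_; _,_; ∃-syntax; uncurry)
open import Data.Rational as ℚ using (ℚ; 0ℚ; 1ℚ; ½; _/_)
import Data.Rational.Properties as ℚ
open import Data.Rational.Solver renaming (module +-*-Solver to ℚ-Solver)
import Data.Rational.Unnormalised as ℚᵘ
import Data.Rational.Unnormalised.Properties as ℚᵘ
open import Data.Sum using (inj₁; inj₂)
open import Function using (_⇔_; _∘_)
open import Level using (0ℓ)
open import Relation.Binary.PropositionalEquality
  using (_≡_; refl; sym; trans; cong; cong₂; subst)
open import Relation.Nullary using (¬_; yes; no)

open RawSemiringDefs ℚ.+-*-rawSemiring public using () renaming (_^_ to _^ℚ_)

module Rational where
  open import Data.Rational using (_+_; _*_; _-_; -_; _≤_; _<_; ∣_∣; _⊔_)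
  open ℚ.≤-Reasoning

  ≤-+ʳ : ∀ p {q} → 0ℚ ≤ q → p ≤ p + q
  ≤-+ʳ p {q} 0≤q = begin
    p       ≡⟨ ℚ.+-identityʳ p ⟨
    p + 0ℚ  ≤⟨ ℚ.+-monoʳ-≤ p 0≤q ⟩
    p + q   ∎

  <-+ʳ : ∀ p {q} → 0ℚ < q → p < p + q
  <-+ʳ p {q} 0<q = begin-strict
    p       ≡⟨ ℚ.+-identityʳ p ⟨
    p + 0ℚ  <⟨ ℚ.+-monoʳ-< p 0<q ⟩
    p + q   ∎

  *-mono : ∀ {a b c d} → 0ℚ ≤ a → a ≤ b → 0ℚ ≤ c → c ≤ d → a * c ≤ b * d
  *-mono {a} {b} {c} {d} 0≤a a≤b 0≤c c≤d = begin
    a * c  ≤⟨ ℚ.*-monoʳ-≤-nonNeg c {{ℚ.nonNegative 0≤c}} a≤b ⟩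
    b * c  ≤⟨ ℚ.*-monoˡ-≤-nonNeg b {{ℚ.nonNegative (ℚ.≤-trans 0≤a a≤b)}} c≤d ⟩
    b * d  ∎

  *-nonneg : ∀ {a b} → 0ℚ ≤ a → 0ℚ ≤ b → 0ℚ ≤ a * b
  *-nonneg = λ 0≤a 0≤b → *-mono ℚ.≤-refl 0≤a ℚ.≤-refl 0≤b

  *-pos : ∀ {a b} → 0ℚ < a → 0ℚ < b → 0ℚ < a * b
  *-pos {a} {b} 0<a 0<b =
    ℚ.positive⁻¹ (a * b)
      {{ℚ.pos*pos⇒pos a {{ℚ.positive 0<a}} b {{ℚ.positive 0<b}}}}

  +-nonneg : ∀ {a b} → 0ℚ ≤ a → 0ℚ ≤ b → 0ℚ ≤ a + b
  +-nonneg = λ 0≤a 0≤b → ℚ.+-mono-≤ 0≤a 0≤b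

  half : ℚ → ℚ
  half ε = ½ * ε

  half-pos : ∀ {ε} → 0ℚ < ε → 0ℚ < half ε
  half-pos = *-pos (ℚ.positive⁻¹ ½)

  half+half : ∀ ε → half ε + half ε ≡ ε
  half+half ε = trans (sym (ℚ.*-distribʳ-+ ε ½ ½)) (ℚ.*-identityˡ ε)

  ∣-∣≤ : ∀ p q {ε} → p ≤ q + ε → q ≤ p + ε → ∣ p - q ∣ ≤ ε
  ∣-∣≤ p q {ε} p≤ q≤ with ℚ.∣p∣≡p∨∣p∣≡-p (p - q)
  ... | inj₁ eq rewrite eq = begin
    p - q      ≤⟨ ℚ.+-monoˡ-≤ (- q) p≤ ⟩
    q + ε - q  ≡⟨ solve 2 (λ q ε → q :+ ε :- q := ε) refl q ε ⟩
    ε          ∎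
    where open ℚ-Solver
  ... | inj₂ eq rewrite eq = begin
    - (p - q)  ≡⟨ solve 2 (λ p q → :- (p :- q) := q :- p) refl p q ⟩
    q - p      ≤⟨ ℚ.+-monoˡ-≤ (- p) q≤ ⟩
    p + ε - p  ≡⟨ solve 2 (λ q ε → q :+ ε :- q := ε) refl p ε ⟩
    ε          ∎
    where open ℚ-Solver

  p≤∣p∣ : ∀ p → p ≤ ∣ p ∣
  p≤∣p∣ p with ℚ.≤-total 0ℚ p
  ... | inj₁ 0≤p = ℚ.≤-reflexive (sym (ℚ.0≤p⇒∣p∣≡p 0≤p))
  ... | inj₂ p≤0 = ℚ.≤-trans p≤0 (ℚ.0≤∣p∣ p)

  ≤-∣-∣ : ∀ p q {ε} → ∣ p - q ∣ ≤ ε → p ≤ q + ε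
  ≤-∣-∣ p q {ε} h = begin
    p            ≡⟨ solve 2 (λ p q → p := q :+ (p :- q)) refl p q ⟩
    q + (p - q)  ≤⟨ ℚ.+-monoʳ-≤ q (ℚ.≤-trans (p≤∣p∣ (p - q)) h) ⟩
    q + ε        ∎
    where open ℚ-Solver

  fromℚᵘ-mono-≤ : ∀ {p q} → p ℚᵘ.≤ q → ℚ.fromℚᵘ p ≤ ℚ.fromℚᵘ q
  fromℚᵘ-mono-≤ {p} {q} p≤q = ℚ.toℚᵘ-cancel-≤
    (ℚᵘ.≤-respˡ-≃ (ℚᵘ.≃-sym (ℚ.toℚᵘ-fromℚᵘ p))
      (ℚᵘ.≤-respʳ-≃ (ℚᵘ.≃-sym (ℚ.toℚᵘ-fromℚᵘ q)) p≤q))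

  fromℚᵘ-homo-* : ∀ p q → ℚ.fromℚᵘ p * ℚ.fromℚᵘ q ≡ ℚ.fromℚᵘ (p ℚᵘ.* q)
  fromℚᵘ-homo-* p q = ℚ.toℚᵘ-injective
    (ℚᵘ.≃-trans (ℚ.toℚᵘ-homo-* (ℚ.fromℚᵘ p) (ℚ.fromℚᵘ q))
    (ℚᵘ.≃-trans (ℚᵘ.*-cong (ℚ.toℚᵘ-fromℚᵘ p) (ℚ.toℚᵘ-fromℚᵘ q))
                (ℚᵘ.≃-sym (ℚ.toℚᵘ-fromℚᵘ (p ℚᵘ.* q)))))

  fromℚᵘ-homo-+ : ∀ p q → ℚ.fromℚᵘ p + ℚ.fromℚᵘ q ≡ ℚ.fromℚᵘ (p ℚᵘ.+ q)
  fromℚᵘ-homo-+ p q = ℚ.toℚᵘ-injective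
    (ℚᵘ.≃-trans (ℚ.toℚᵘ-homo-+ (ℚ.fromℚᵘ p) (ℚ.fromℚᵘ q))
    (ℚᵘ.≃-trans (ℚᵘ.+-cong (ℚ.toℚᵘ-fromℚᵘ p) (ℚ.toℚᵘ-fromℚᵘ q))
                (ℚᵘ.≃-sym (ℚ.toℚᵘ-fromℚᵘ (p ℚᵘ.+ q)))))

  inv : ℕ → ℚ
  inv n = + 1 / suc n

  inv-pos : ∀ n → 0ℚ < inv n
  inv-pos n = ℚ.positive⁻¹ (inv n) {{ℚ.normalize-pos 1 (suc n)}}

  inv-anti : ∀ {m n} → m ℕ.≤ n → inv n ≤ inv m
  inv-anti {m} {n} m≤n = fromℚᵘ-mono-≤ {ℚᵘ.mkℚᵘ (+ 1) n} {ℚᵘ.mkℚᵘ (+ 1) m}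
    (ℚᵘ.*≤* (ℤ.*-monoˡ-≤-nonNeg (+ 1) (ℤ.+≤+ (ℕ.s≤s m≤n))))

  archimedean : ∀ {ε} → 0ℚ < ε → ∃[ N ] inv N ≤ ε
  archimedean {ε@(ℚ.mkℚ (+ zero) d c)} 0<ε
    with () ← ℚ.positive 0<ε
  archimedean {ε@(ℚ.mkℚ (+ suc n) d c)} 0<ε = d , (begin
    inv d                                ≤⟨ fromℚᵘ-mono-≤ {ℚᵘ.mkℚᵘ (+ 1) d} {ℚᵘ.mkℚᵘ (+ suc n) d}
                                              (ℚᵘ.*≤* (ℤ.*-monoʳ-≤-nonNeg (+ suc d) (ℤ.+≤+ (ℕ.s≤s (ℕ.z≤n {n}))))) ⟩
    + suc n / suc d                      ≡⟨ ℚ.↥p/↧p≡p ε ⟩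
    ε                                    ∎)
  archimedean {ε@(ℚ.mkℚ (ℤ.-[1+ n ]) d c)} 0<ε
    with () ← ℚ.positive 0<ε

  ^-nonneg : ∀ {a} n → 0ℚ ≤ a → 0ℚ ≤ a ^ℚ n
  ^-nonneg zero    0≤a = ℚ.nonNegative⁻¹ 1ℚ
  ^-nonneg (suc n) 0≤a = *-nonneg 0≤a (^-nonneg n 0≤a)

  ^-pos : ∀ {a} n → 0ℚ < a → 0ℚ < a ^ℚ n
  ^-pos zero    0<a = ℚ.positive⁻¹ 1ℚ
  ^-pos (suc n) 0<a = *-pos 0<a (^-pos n 0<a)

  ^-mono : ∀ a b n → 0ℚ ≤ a → a ≤ b → a ^ℚ n ≤ b ^ℚ n
  ^-mono a b zero    0≤a a≤b = ℚ.≤-refl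
  ^-mono a b (suc n) 0≤a a≤b = *-mono 0≤a a≤b (^-nonneg n 0≤a) (^-mono a b n 0≤a a≤b)

  1≤^ : ∀ {a} n → 1ℚ ≤ a → 1ℚ ≤ a ^ℚ n
  1≤^ zero    1≤a = ℚ.≤-refl
  1≤^ (suc n) 1≤a = *-mono (ℚ.nonNegative⁻¹ 1ℚ) 1≤a (ℚ.nonNegative⁻¹ 1ℚ) (1≤^ n 1≤a)

  ^-increasing : ∀ {a} n → 1ℚ ≤ a → a ≤ a ^ℚ suc n
  ^-increasing {a} n 1≤a = begin
    a           ≡⟨ ℚ.*-identityʳ a ⟨
    a * 1ℚ      ≤⟨ *-mono 0≤a ℚ.≤-refl (ℚ.nonNegative⁻¹ 1ℚ) (1≤^ n 1≤a) ⟩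
    a ^ℚ suc n  ∎
    where 0≤a = ℚ.≤-trans (ℚ.nonNegative⁻¹ 1ℚ) 1≤a

  ^-super : ∀ {a b} n → 0ℚ ≤ a → 0ℚ ≤ b →
            a ^ℚ suc n + b ^ℚ suc n ≤ (a + b) ^ℚ suc n
  ^-super {a} {b} zero    0≤a 0≤b = ℚ.≤-reflexive (sym (ℚ.*-distribʳ-+ 1ℚ a b))
  ^-super {a} {b} (suc n) 0≤a 0≤b = begin
    a * aⁿ + b * bⁿ                  ≤⟨ ℚ.+-mono-≤ (≤-+ʳ (a * aⁿ) (*-nonneg 0≤a (^-nonneg (suc n) 0≤b)))
                                                   (≤-+ʳ (b * bⁿ) (*-nonneg 0≤b (^-nonneg (suc n) 0≤a))) ⟩
    a * aⁿ + a * bⁿ + (b * bⁿ + b * aⁿ)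
      ≡⟨ solve 4 (λ a b x y → a :* x :+ a :* y :+ (b :* y :+ b :* x)
                           := (a :+ b) :* (x :+ y)) refl a b aⁿ bⁿ ⟩
    (a + b) * (aⁿ + bⁿ)              ≤⟨ *-mono (+-nonneg 0≤a 0≤b) ℚ.≤-refl
                                          (+-nonneg (^-nonneg (suc n) 0≤a) (^-nonneg (suc n) 0≤b))
                                          (^-super n 0≤a 0≤b) ⟩
    (a + b) * (a + b) ^ℚ suc n       ∎
    where
    open ℚ-Solver
    aⁿ = a ^ℚ suc n
    bⁿ = b ^ℚ suc n

  Σ< : ℕ → (ℕ → ℚ) → ℚ
  Σ< zero    f = 0ℚ
  Σ< (suc n) f = Σ< n f + f n

  Σ<-mono : ∀ n {f g} → (∀ i → i ℕ.< n → f i ≤ g i) → Σ< n f ≤ Σ< n g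
  Σ<-mono zero    f≤g = ℚ.≤-refl
  Σ<-mono (suc n) f≤g =
    ℚ.+-mono-≤ (Σ<-mono n (λ i i<n → f≤g i (ℕ.m<n⇒m<1+n i<n))) (f≤g n ℕ.≤-refl)

  Σ<-cong : ∀ n {f g} → (∀ i → f i ≡ g i) → Σ< n f ≡ Σ< n g
  Σ<-cong zero    f≡g = refl
  Σ<-cong (suc n) f≡g = cong₂ _+_ (Σ<-cong n f≡g) (f≡g n)

  Σ<-+ : ∀ m n f → Σ< (n ℕ.+ m) f ≡ Σ< m f + Σ< n (λ i → f (i ℕ.+ m))
  Σ<-+ m zero    f = sym (ℚ.+-identityʳ _)
  Σ<-+ m (suc n) f =
    trans (cong (_+ f (n ℕ.+ m)) (Σ<-+ m n f)) (ℚ.+-assoc (Σ< m f) _ _)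

  ι : ℕ → ℚ
  ι n = + n / 1

  ι-suc : ∀ n → ι n + 1ℚ ≡ ι (suc n)
  ι-suc n = trans (fromℚᵘ-homo-+ (ℚᵘ.mkℚᵘ (+ n) 0) ℚᵘ.1ℚᵘ)
                  (cong (λ k → k / 1) (trans (cong (ℤ._+ + 1) (ℤ.*-identityʳ (+ n)))
                                             (cong +_ (ℕ.+-comm n 1))))

  Σ<-const : ∀ n c → Σ< n (λ _ → c) ≡ ι n * c
  Σ<-const zero    c = sym (ℚ.*-zeroˡ c)
  Σ<-const (suc n) c = begin-equality
    Σ< n (λ _ → c) + c  ≡⟨ cong (_+ c) (Σ<-const n c) ⟩
    ι n * c + c         ≡⟨ solve 2 (λ x c → x :* c :+ c := (x :+ con 1ℚ) :* c) refl (ι n) c ⟩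
    (ι n + 1ℚ) * c      ≡⟨ cong (_* c) (ι-suc n) ⟩
    ι (suc n) * c       ∎
    where open ℚ-Solver

  -- n · 1/(n m) = 1/m for n = k + 1 and m = j + 1
  Σ<-inv : ∀ k j → Σ< (suc k) (λ _ → inv (k ℕ.+ j ℕ.* suc k)) ≡ inv j
  Σ<-inv k j = trans (Σ<-const (suc k) (inv (k ℕ.+ j ℕ.* suc k)))
    (trans (fromℚᵘ-homo-* (ℚᵘ.mkℚᵘ (+ suc k) 0) (ℚᵘ.mkℚᵘ (+ 1) (k ℕ.+ j ℕ.* suc k)))
      (ℚ.fromℚᵘ-cong {ℚᵘ.mkℚᵘ (+ suc k) 0 ℚᵘ.* ℚᵘ.mkℚᵘ (+ 1) (k ℕ.+ j ℕ.* suc k)}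
                     {ℚᵘ.mkℚᵘ (+ 1) j}
        (ℚᵘ.*≡* (cong +_ (solve 2 (λ k j → ((con 1 :+ k) :* con 1) :* (con 1 :+ j)
            := con 1 :* (con 1 :* ((con 1 :+ j) :* (con 1 :+ k)))) refl k j)))))
    where open +-*-Solver

  Σ<-blocks-≤ : ∀ K n {f g} → (∀ i → Σ< K (λ k → f (k ℕ.+ i ℕ.* K)) ≤ g i) →
                Σ< (n ℕ.* K) f ≤ Σ< n g
  Σ<-blocks-≤ K zero    h = ℚ.≤-refl
  Σ<-blocks-≤ K (suc n) {f} h = ℚ.≤-trans (ℚ.≤-reflexive (Σ<-+ (n ℕ.* K) K f))
    (ℚ.+-mono-≤ (Σ<-blocks-≤ K n h) (h n))

  Σ<-blocks-≥ : ∀ K n {f g} → (∀ i → g i ≤ Σ< K (λ k → f (k ℕ.+ i ℕ.* K))) →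
                Σ< n g ≤ Σ< (n ℕ.* K) f
  Σ<-blocks-≥ K zero    h = ℚ.≤-refl
  Σ<-blocks-≥ K (suc n) {f} h = ℚ.≤-trans
    (ℚ.+-mono-≤ (Σ<-blocks-≥ K n h) (h n)) (ℚ.≤-reflexive (sym (Σ<-+ (n ℕ.* K) K f)))

  Σ<-shift : ∀ n f → Σ< n f + f n ≡ f 0 + Σ< n (f ∘ suc)
  Σ<-shift zero    f = ℚ.+-comm 0ℚ (f 0)
  Σ<-shift (suc n) f =
    trans (cong (_+ f (suc n)) (Σ<-shift n f)) (ℚ.+-assoc (f 0) _ _)

open Rational using (Σ<)

IsCauchy : (ℕ → ℚ) → Set
IsCauchy x = ∀ {ε} → 0ℚ ℚ.< ε →
  ∃[ N ] (∀ m n → N ℕ.≤ m → N ℕ.≤ n → ℚ.∣ x m ℚ.- x n ∣ ℚ.≤ ε)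

record ℝ : Set where
  constructor mkℝ
  field
    seq    : ℕ → ℚ
    cauchy : IsCauchy seq

open ℝ

infix 4 _≤_ _<_ _≈_

_≤_ : ℝ → ℝ → Set
x ≤ y = ∀ {ε} → 0ℚ ℚ.< ε → ∃[ N ] (∀ n → N ℕ.≤ n → seq x n ℚ.≤ seq y n ℚ.+ ε)

_<_ : ℝ → ℝ → Set
x < y = ∃[ ε ] 0ℚ ℚ.< ε × ∃[ N ] (∀ n → N ℕ.≤ n → seq x n ℚ.+ ε ℚ.≤ seq y n)

_≈_ : ℝ → ℝ → Set
x ≈ y = x ≤ y × y ≤ x

module Cauchy where
  open Rational
  open import Data.Rational using (_+_; _*_; _-_; -_; ∣_∣; _⊔_) renaming (_≤_ to _≤ℚ_; _<_ to _<ℚ_)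
  open ℚ.≤-Reasoning

  one-sided : ∀ {x} → (∀ {ε} → 0ℚ <ℚ ε →
                ∃[ N ] (∀ m n → N ℕ.≤ m → N ℕ.≤ n → x m ≤ℚ x n + ε)) → IsCauchy x
  one-sided {x} h 0<ε with h 0<ε
  ... | N , H = N , λ m n N≤m N≤n → ∣-∣≤ (x m) (x n) (H m n N≤m N≤n) (H n m N≤n N≤m)

  const-cauchy : ∀ p → IsCauchy (λ _ → p)
  const-cauchy p = one-sided λ 0<ε → 0 , λ _ _ _ _ → ≤-+ʳ p (ℚ.<⇒≤ 0<ε)

  +-cauchy : ∀ x y → IsCauchy (λ n → seq x n + seq y n)
  +-cauchy x y = one-sided λ {ε} 0<ε →
    let N₁ , H₁ = cauchy x (half-pos 0<ε)
        N₂ , H₂ = cauchy y (half-pos 0<ε)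
    in N₁ ℕ.⊔ N₂ , λ m n N≤m N≤n → begin
      seq x m + seq y m
        ≤⟨ ℚ.+-mono-≤
             (≤-∣-∣ (seq x m) (seq x n) (H₁ m n (ℕ.m⊔n≤o⇒m≤o N₁ N₂ N≤m) (ℕ.m⊔n≤o⇒m≤o N₁ N₂ N≤n)))
             (≤-∣-∣ (seq y m) (seq y n) (H₂ m n (ℕ.m⊔n≤o⇒n≤o N₁ N₂ N≤m) (ℕ.m⊔n≤o⇒n≤o N₁ N₂ N≤n))) ⟩
      (seq x n + half ε) + (seq y n + half ε)
        ≡⟨ solve 3 (λ a b h → (a :+ h) :+ (b :+ h) := (a :+ b) :+ (h :+ h))
             refl (seq x n) (seq y n) (half ε) ⟩
      (seq x n + seq y n) + (half ε + half ε)
        ≡⟨ cong (λ t → seq x n + seq y n + t) (half+half ε) ⟩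
      (seq x n + seq y n) + ε ∎
    where open ℚ-Solver

  neg-cauchy : ∀ x → IsCauchy (λ n → - seq x n)
  neg-cauchy x = one-sided λ {ε} 0<ε →
    let N , H = cauchy x 0<ε
    in N , λ m n N≤m N≤n → begin
      - seq x m
        ≡⟨ solve 2 (λ a e → :- a := :- (a :+ e) :+ e) refl (seq x m) ε ⟩
      - (seq x m + ε) + ε
        ≤⟨ ℚ.+-monoˡ-≤ ε (ℚ.neg-antimono-≤ (≤-∣-∣ (seq x n) (seq x m) (H n m N≤n N≤m))) ⟩
      - seq x n + ε ∎
    where open ℚ-Solver

  bounded : ∀ x → ∃[ B ] 0ℚ <ℚ B × ∃[ N ] (∀ n → N ℕ.≤ n → ∣ seq x n ∣ ≤ℚ B)
  bounded x with cauchy x (ℚ.positive⁻¹ 1ℚ)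
  ... | N , H = ∣ seq x N ∣ + 1ℚ , ℚ.≤-<-trans (ℚ.0≤∣p∣ (seq x N)) (<-+ʳ ∣ seq x N ∣ (ℚ.positive⁻¹ 1ℚ))
              , N , λ n N≤n → begin
    ∣ seq x n ∣                          ≡⟨ cong ∣_∣ (solve 2 (λ a b → a := b :+ (a :- b)) refl (seq x n) (seq x N)) ⟩
    ∣ seq x N + (seq x n - seq x N) ∣    ≤⟨ ℚ.∣p+q∣≤∣p∣+∣q∣ (seq x N) _ ⟩
    ∣ seq x N ∣ + ∣ seq x n - seq x N ∣  ≤⟨ ℚ.+-monoʳ-≤ ∣ seq x N ∣ (H n N N≤n ℕ.≤-refl) ⟩
    ∣ seq x N ∣ + 1ℚ                     ∎
    where open ℚ-Solver

  *-diff : ∀ {a b c d A D δ} → ∣ a ∣ ≤ℚ A → ∣ d ∣ ≤ℚ D → ∣ b - d ∣ ≤ℚ δ → ∣ a - c ∣ ≤ℚ δ →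
           ∣ a * b - c * d ∣ ≤ℚ (A + D) * δ
  *-diff {a} {b} {c} {d} {A} {D} {δ} a≤ d≤ bd ac = begin
    ∣ a * b - c * d ∣
      ≡⟨ cong ∣_∣ (solve 4 (λ a b c d → a :* b :- c :* d := a :* (b :- d) :+ d :* (a :- c))
           refl a b c d) ⟩
    ∣ a * (b - d) + d * (a - c) ∣
      ≤⟨ ℚ.∣p+q∣≤∣p∣+∣q∣ (a * (b - d)) (d * (a - c)) ⟩
    ∣ a * (b - d) ∣ + ∣ d * (a - c) ∣
      ≡⟨ cong₂ _+_ (ℚ.∣p*q∣≡∣p∣*∣q∣ a (b - d)) (ℚ.∣p*q∣≡∣p∣*∣q∣ d (a - c)) ⟩
    ∣ a ∣ * ∣ b - d ∣ + ∣ d ∣ * ∣ a - c ∣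
      ≤⟨ ℚ.+-mono-≤ (*-mono (ℚ.0≤∣p∣ a) a≤ (ℚ.0≤∣p∣ (b - d)) bd)
                    (*-mono (ℚ.0≤∣p∣ d) d≤ (ℚ.0≤∣p∣ (a - c)) ac) ⟩
    A * δ + D * δ
      ≡⟨ ℚ.*-distribʳ-+ δ A D ⟨
    (A + D) * δ ∎
    where open ℚ-Solver

  divide : ∀ {B ε} → 0ℚ <ℚ B → 0ℚ <ℚ ε → ∃[ δ ] 0ℚ <ℚ δ × B * δ ≡ ε
  divide {B} {ε} 0<B 0<ε = 1/B * ε , *-pos (ℚ.positive⁻¹ 1/B {{ℚ.1/pos⇒pos B {{ℚ.positive 0<B}}}}) 0<ε
    , trans (sym (ℚ.*-assoc B 1/B ε))
        (trans (cong (_* ε) (ℚ.*-inverseʳ B {{ℚ.>-nonZero 0<B}})) (ℚ.*-identityˡ ε))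
    where 1/B = (ℚ.1/ B) {{ℚ.>-nonZero 0<B}}

  *-cauchy : ∀ x y → IsCauchy (λ n → seq x n * seq y n)
  *-cauchy x y {ε} 0<ε =
    let A , 0<A , M₁ , K₁ = bounded x
        D , 0<D , M₂ , K₂ = bounded y
        δ , 0<δ , eq = divide (ℚ.<-trans 0<A (<-+ʳ A 0<D)) 0<ε
        N₁ , H₁ = cauchy x 0<δ
        N₂ , H₂ = cauchy y 0<δ
        M = M₁ ℕ.⊔ M₂
        N = N₁ ℕ.⊔ N₂
    in M ℕ.⊔ N , λ m n ≤m ≤n →
      ℚ.≤-trans
        (*-diff (K₁ m (ℕ.m⊔n≤o⇒m≤o M₁ M₂ (ℕ.m⊔n≤o⇒m≤o M N ≤m)))
                (K₂ n (ℕ.m⊔n≤o⇒n≤o M₁ M₂ (ℕ.m⊔n≤o⇒m≤o M N ≤n)))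
                (H₂ m n (ℕ.m⊔n≤o⇒n≤o N₁ N₂ (ℕ.m⊔n≤o⇒n≤o M N ≤m))
                        (ℕ.m⊔n≤o⇒n≤o N₁ N₂ (ℕ.m⊔n≤o⇒n≤o M N ≤n)))
                (H₁ m n (ℕ.m⊔n≤o⇒m≤o N₁ N₂ (ℕ.m⊔n≤o⇒n≤o M N ≤m))
                        (ℕ.m⊔n≤o⇒m≤o N₁ N₂ (ℕ.m⊔n≤o⇒n≤o M N ≤n))))
        (ℚ.≤-reflexive eq)

infixl 6 _+_
infixl 7 _*_

fromℚ : ℚ → ℝ
fromℚ p = mkℝ (λ _ → p) (Cauchy.const-cauchy p)

fromℕ : ℕ → ℝ
fromℕ n = fromℚ (+ n / 1)

0ℝ 1ℝ : ℝ
0ℝ = fromℚ 0ℚ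
1ℝ = fromℚ 1ℚ

_+_ _*_ : ℝ → ℝ → ℝ
x + y = mkℝ (λ n → seq x n ℚ.+ seq y n) (Cauchy.+-cauchy x y)
x * y = mkℝ (λ n → seq x n ℚ.* seq y n) (Cauchy.*-cauchy x y)

-_ : ℝ → ℝ
- x = mkℝ (λ n → ℚ.- seq x n) (Cauchy.neg-cauchy x)

+-*-rawSemiring : RawSemiring 0ℓ 0ℓ
+-*-rawSemiring = record { _≈_ = _≈_ ; _+_ = _+_ ; _*_ = _*_ ; 0# = 0ℝ ; 1# = 1ℝ }

open RawSemiringDefs +-*-rawSemiring using (_^_) public

-- The greatest multiple j · 1/(n + 1) with j ≤ b whose k-th power is at most a.

searchRoot : (k : ℕ) (a : ℚ) (n b : ℕ) → ℚ
searchRoot k a n zero = 0ℚ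
searchRoot k a n (suc b) with ((+ suc b / 1) ℚ.* (+ 1 / suc n)) ^ℚ k ℚ.≤? a
... | yes _ = (+ suc b / 1) ℚ.* (+ 1 / suc n)
... | no  _ = searchRoot k a n b

-- The bound on j is large enough not to affect the result: for k ≥ 1 and a ≥ 0 the
-- value t satisfies t ^ k ≤ a < (t + 1/(n + 1)) ^ k.

approxRoot : (k : ℕ) (a : ℚ) (n : ℕ) → ℚ
approxRoot k a n = searchRoot k a n (ℤ.∣ ℚ.numerator a ∣ ℕ.* suc n)

module Root where
  open Rational
  open import Data.Rational using (_⊔_) renaming (_+_ to _+ℚ_; _*_ to _*ℚ_; _≤_ to _≤ℚ_; _<_ to _<ℚ_)
  open ℚ.≤-Reasoning

  ι-nonneg : ∀ n → 0ℚ ≤ℚ ι n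
  ι-nonneg n = ℚ.nonNegative⁻¹ (ι n) {{ℚ.normalize-nonNeg n 1}}

  search-nonneg : ∀ k a n b → 0ℚ ≤ℚ searchRoot k a n b
  search-nonneg k a n zero = ℚ.≤-refl
  search-nonneg k a n (suc b) with (ι (suc b) *ℚ inv n) ^ℚ k ℚ.≤? a
  ... | yes _ = *-nonneg (ι-nonneg (suc b)) (ℚ.<⇒≤ (inv-pos n))
  ... | no  _ = search-nonneg k a n b

  search-lower : ∀ k a n b → 0ℚ ≤ℚ a → searchRoot (suc k) a n b ^ℚ suc k ≤ℚ a
  search-lower k a n zero    0≤a = ℚ.≤-trans (ℚ.≤-reflexive (ℚ.*-zeroˡ (0ℚ ^ℚ k))) 0≤a
  search-lower k a n (suc b) 0≤a with (ι (suc b) *ℚ inv n) ^ℚ suc k ℚ.≤? a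
  ... | yes h = h
  ... | no  _ = search-lower k a n b 0≤a

  step : ∀ b n → (ι b *ℚ inv n) +ℚ inv n ≡ ι (suc b) *ℚ inv n
  step b n = trans (solve 2 (λ x y → x :* y :+ y := (x :+ con 1ℚ) :* y) refl (ι b) (inv n))
                   (cong (_*ℚ inv n) (ι-suc b))
    where open ℚ-Solver

  search-upper : ∀ k a n b → a <ℚ ((ι (suc b) *ℚ inv n) ^ℚ k) →
                 a <ℚ ((searchRoot k a n b +ℚ inv n) ^ℚ k)
  search-upper k a n zero    h = subst (λ t → a <ℚ (t ^ℚ k))
    (trans (ℚ.*-identityˡ (inv n)) (sym (ℚ.+-identityˡ (inv n)))) h
  search-upper k a n (suc b) h with (ι (suc b) *ℚ inv n) ^ℚ k ℚ.≤? a
  ... | yes _ = subst (λ t → a <ℚ (t ^ℚ k)) (sym (step (suc b) n)) h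
  ... | no ¬p = search-upper k a n b (ℚ.≰⇒> ¬p)

  ι-*-inv : ∀ p n → ι (p ℕ.* suc n) *ℚ inv n ≡ ι p
  ι-*-inv p n =
    trans (fromℚᵘ-homo-* (ℚᵘ.mkℚᵘ (+ (p ℕ.* suc n)) 0) (ℚᵘ.mkℚᵘ (+ 1) n))
      (ℚ.fromℚᵘ-cong {ℚᵘ.mkℚᵘ (+ (p ℕ.* suc n)) 0 ℚᵘ.* ℚᵘ.mkℚᵘ (+ 1) n} {ℚᵘ.mkℚᵘ (+ p) 0}
        (ℚᵘ.*≡* (trans (cong (λ z → z ℤ.* + 1) (sym (ℤ.pos-* (p ℕ.* suc n) 1)))
          (trans (sym (ℤ.pos-* (p ℕ.* suc n ℕ.* 1) 1))
          (trans (cong +_ (solve 2 (λ p n → ((p :* (con 1 :+ n)) :* con 1) :* con 1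
            := p :* (con 1 :* (con 1 :+ n))) refl p n))
            (ℤ.pos-* p (1 ℕ.* suc n)))))))
    where open +-*-Solver

  a≤num : ∀ {a} → 0ℚ ≤ℚ a → a ≤ℚ ι ℤ.∣ ℚ.numerator a ∣
  a≤num {a@(ℚ.mkℚ (+ p) d c)} _ = begin
    a            ≡⟨ ℚ.↥p/↧p≡p a ⟨
    + p / suc d  ≤⟨ fromℚᵘ-mono-≤ {ℚᵘ.mkℚᵘ (+ p) d} {ℚᵘ.mkℚᵘ (+ p) 0}
                      (ℚᵘ.*≤* (ℤ.*-monoˡ-≤-nonNeg (+ p) (ℤ.+≤+ (ℕ.s≤s (ℕ.z≤n {d}))))) ⟩
    ι p          ∎
  a≤num {ℚ.mkℚ (ℤ.-[1+ p ]) d c} 0≤a with () ← ℚ.nonNegative 0≤a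

  1≤ι : ∀ p → 1ℚ ≤ℚ ι (suc p)
  1≤ι p = fromℚᵘ-mono-≤ {ℚᵘ.mkℚᵘ (+ 1) 0} {ℚᵘ.mkℚᵘ (+ suc p) 0}
            (ℚᵘ.*≤* (ℤ.*-monoʳ-≤-nonNeg (+ 1) (ℤ.+≤+ (ℕ.s≤s (ℕ.z≤n {p})))))

  <-inv : ∀ p n → p <ℚ (p +ℚ inv n)
  <-inv p n = <-+ʳ p (inv-pos n)

  bound-enough : ∀ k a n p → a ≤ℚ ι p →
                 a <ℚ ((ι (suc (p ℕ.* suc n)) *ℚ inv n) ^ℚ suc k)
  bound-enough k a n p a≤p = subst (λ t → a <ℚ (t ^ℚ suc k)) eq (go p a≤p)
    where
    eq : ι p +ℚ inv n ≡ ι (suc (p ℕ.* suc n)) *ℚ inv n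
    eq = trans (cong (_+ℚ inv n) (sym (ι-*-inv p n))) (step (p ℕ.* suc n) n)
    go : ∀ p → a ≤ℚ ι p → a <ℚ ((ι p +ℚ inv n) ^ℚ suc k)
    go zero    a≤0 = ℚ.≤-<-trans a≤0
      (^-pos (suc k) (ℚ.<-≤-trans (inv-pos n) (ℚ.≤-reflexive (sym (ℚ.+-identityˡ (inv n))))))
    go (suc p) a≤p = ℚ.<-≤-trans (ℚ.≤-<-trans a≤p (<-inv (ι (suc p)) n))
      (^-increasing k (ℚ.≤-trans (1≤ι p) (ℚ.<⇒≤ (<-inv (ι (suc p)) n))))

  lower : ∀ k a n → 0ℚ ≤ℚ a → (approxRoot (suc k) a n ^ℚ suc k) ≤ℚ a
  lower k a n = search-lower k a n (ℤ.∣ ℚ.numerator a ∣ ℕ.* suc n)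

  upper : ∀ k a n → 0ℚ ≤ℚ a → a <ℚ ((approxRoot (suc k) a n +ℚ inv n) ^ℚ suc k)
  upper k a n 0≤a = search-upper (suc k) a n (ℤ.∣ ℚ.numerator a ∣ ℕ.* suc n)
    (bound-enough k a n ℤ.∣ ℚ.numerator a ∣ (a≤num 0≤a))

  root-cauchy : ∀ k .{{_ : ℕ.NonZero k}} x → IsCauchy (λ n → approxRoot k (0ℚ ⊔ seq x n) n)
  root-cauchy (suc k) x = Cauchy.one-sided {λ n → approxRoot (suc k) (0ℚ ⊔ seq x n) n} λ {ε} 0<ε →
    let N₁ , H = cauchy x (^-pos (suc k) (half-pos 0<ε))
        N₂ , A = archimedean (half-pos 0<ε)
    in N₁ ℕ.⊔ N₂ , λ m n N≤m N≤n →
      let η  = half ε ^ℚ suc k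
          am = 0ℚ ⊔ seq x m
          an = 0ℚ ⊔ seq x n
          sm = approxRoot (suc k) am m
          sn = approxRoot (suc k) an n
          0≤am = ℚ.p≤p⊔q 0ℚ (seq x m)
          0≤an = ℚ.p≤p⊔q 0ℚ (seq x n)
          0≤h  = ℚ.<⇒≤ (half-pos 0<ε)
          0≤sn = search-nonneg (suc k) an n (ℤ.∣ ℚ.numerator an ∣ ℕ.* suc n)
          0≤δ  = ℚ.<⇒≤ (inv-pos n)
          δ≤h  = ℚ.≤-trans (inv-anti (ℕ.m⊔n≤o⇒n≤o N₁ N₂ N≤n)) A
          am≤ : am ≤ℚ an +ℚ η
          am≤ = ℚ.⊔-lub (+-nonneg 0≤an (^-nonneg (suc k) 0≤h))
            (ℚ.≤-trans
              (≤-∣-∣ (seq x m) (seq x n) (H m n (ℕ.m⊔n≤o⇒m≤o N₁ N₂ N≤m) (ℕ.m⊔n≤o⇒m≤o N₁ N₂ N≤n)))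
              (ℚ.+-monoˡ-≤ η (ℚ.p≤q⊔p 0ℚ (seq x n))))
          main : (sm ^ℚ suc k) <ℚ ((sn +ℚ ε) ^ℚ suc k)
          main = begin-strict
            sm ^ℚ suc k                          ≤⟨ lower k am m 0≤am ⟩
            am                                   ≤⟨ am≤ ⟩
            an +ℚ η                              <⟨ ℚ.+-monoˡ-< η (upper k an n 0≤an) ⟩
            ((sn +ℚ inv n) ^ℚ suc k) +ℚ η        ≤⟨ ^-super k (+-nonneg 0≤sn 0≤δ) 0≤h ⟩
            ((sn +ℚ inv n) +ℚ half ε) ^ℚ suc k   ≤⟨ ^-mono ((sn +ℚ inv n) +ℚ half ε) ((sn +ℚ half ε) +ℚ half ε) (suc k) (+-nonneg (+-nonneg 0≤sn 0≤δ) 0≤h)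
                                                     (ℚ.+-monoˡ-≤ (half ε) (ℚ.+-monoʳ-≤ sn δ≤h)) ⟩
            ((sn +ℚ half ε) +ℚ half ε) ^ℚ suc k  ≡⟨ cong (_^ℚ suc k) (trans (ℚ.+-assoc sn (half ε) (half ε))
                                                     (cong (sn +ℚ_) (half+half ε))) ⟩
            (sn +ℚ ε) ^ℚ suc k                   ∎
      in ℚ.≮⇒≥ λ lt → ℚ.<-irrefl refl (ℚ.<-≤-trans main
           (^-mono (sn +ℚ ε) sm (suc k) (+-nonneg 0≤sn (ℚ.<⇒≤ 0<ε)) (ℚ.<⇒≤ lt)))

-- The nonnegative k-th root of x for k ≥ 1, with value 0 for negative x; the 0-th root
-- is a dummy value making the function total.

root : ℕ → ℝ → ℝ
root zero      x = 1ℝ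
root k@(suc _) x = mkℝ (λ n → approxRoot k (0ℚ ℚ.⊔ seq x n) n) (Root.root-cauchy k x)

-- x ^[ a / b ] is x to the power a/b, for x ≥ 0 and b ≥ 1.

infixr 8 _^[_/_]

_^[_/_] : ℝ → ℕ → ℕ → ℝ
x ^[ a / b ] = root b (x ^ a)

-- log n is ∫₁ⁿ dt/t; this is the Riemann sum with step 1/M, M = m + 1, at right endpoints,
-- ∑_{0 ≤ i < (n - 1) M} 1/M · 1/(1 + (i + 1)/M).

riemannSum : (n m : ℕ) → ℚ
riemannSum n m = Σ< ((n ℕ.∸ 1) ℕ.* suc m) (λ i → + 1 / suc (i ℕ.+ suc m))

module Log where
  open Rational
  open import Data.Rational using () renaming (_+_ to _+ℚ_; _≤_ to _≤ℚ_)
  open ℚ.≤-Reasoning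

  refine-≥ : ∀ m k L → Σ< L (λ i → inv (i ℕ.+ suc m)) ≤ℚ
                       Σ< (L ℕ.* suc k) (λ i → inv (i ℕ.+ suc m ℕ.* suc k))
  refine-≥ m k L = Σ<-blocks-≥ (suc k) L λ i → begin
    inv (i ℕ.+ suc m)                                           ≡⟨ Σ<-inv k (i ℕ.+ suc m) ⟨
    Σ< (suc k) (λ _ → inv (k ℕ.+ (i ℕ.+ suc m) ℕ.* suc k))      ≤⟨ Σ<-mono (suc k) (λ j j<k → inv-anti (le i j j<k)) ⟩
    Σ< (suc k) (λ j → inv (j ℕ.+ i ℕ.* suc k ℕ.+ suc m ℕ.* suc k)) ∎
    where
    le : ∀ i j → j ℕ.< suc k →
         j ℕ.+ i ℕ.* suc k ℕ.+ suc m ℕ.* suc k ℕ.≤ k ℕ.+ (i ℕ.+ suc m) ℕ.* suc k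
    le i j (ℕ.s≤s j≤k) = ℕ.≤-trans
      (ℕ.≤-reflexive (trans (ℕ.+-assoc j (i ℕ.* suc k) (suc m ℕ.* suc k))
        (cong (j ℕ.+_) (sym (ℕ.*-distribʳ-+ (suc k) i (suc m))))))
      (ℕ.+-monoˡ-≤ ((i ℕ.+ suc m) ℕ.* suc k) j≤k)

  refine-≤ : ∀ m k L → Σ< (L ℕ.* suc k) (λ i → inv (i ℕ.+ suc m ℕ.* suc k)) ≤ℚ
                       Σ< L (λ i → inv (i ℕ.+ m))
  refine-≤ m k L = Σ<-blocks-≤ (suc k) L λ i → begin
    Σ< (suc k) (λ j → inv (j ℕ.+ i ℕ.* suc k ℕ.+ suc m ℕ.* suc k))
      ≤⟨ Σ<-mono (suc k) (λ j _ → inv-anti (le i j)) ⟩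
    Σ< (suc k) (λ _ → inv (k ℕ.+ (i ℕ.+ m) ℕ.* suc k))
      ≡⟨ Σ<-inv k (i ℕ.+ m) ⟩
    inv (i ℕ.+ m) ∎
    where
    open +-*-Solver
    le : ∀ i j → k ℕ.+ (i ℕ.+ m) ℕ.* suc k ℕ.≤ j ℕ.+ i ℕ.* suc k ℕ.+ suc m ℕ.* suc k
    le i j = ℕ.≤-trans (ℕ.m≤n+m _ (suc j)) (ℕ.≤-reflexive
      (solve 4 (λ i j k m → con 1 :+ j :+ (k :+ (i :+ m) :* (con 1 :+ k))
        := j :+ i :* (con 1 :+ k) :+ (con 1 :+ m) :* (con 1 :+ k)) refl i j k m))

  shift : ∀ m L → Σ< L (λ i → inv (i ℕ.+ m)) ≤ℚ Σ< L (λ i → inv (i ℕ.+ suc m)) +ℚ inv m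
  shift m L = begin
    Σ< L (λ i → inv (i ℕ.+ m))
      ≤⟨ ≤-+ʳ (Σ< L (λ i → inv (i ℕ.+ m))) (ℚ.<⇒≤ (inv-pos (L ℕ.+ m))) ⟩
    Σ< L (λ i → inv (i ℕ.+ m)) +ℚ inv (L ℕ.+ m)
      ≡⟨ Σ<-shift L (λ i → inv (i ℕ.+ m)) ⟩
    inv m +ℚ Σ< L (λ i → inv (suc (i ℕ.+ m)))
      ≡⟨ cong (inv m +ℚ_) (Σ<-cong L (λ i → cong inv (sym (ℕ.+-suc i m)))) ⟩
    inv m +ℚ Σ< L (λ i → inv (i ℕ.+ suc m))
      ≡⟨ ℚ.+-comm (inv m) _ ⟩
    Σ< L (λ i → inv (i ℕ.+ suc m)) +ℚ inv m ∎

  compare : ∀ n m m′ → riemannSum n m ≤ℚ riemannSum n m′ +ℚ inv m′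
  compare n m m′ = begin
    riemannSum n m
      ≤⟨ refine-≥ m m′ (l ℕ.* suc m) ⟩
    Σ< (l ℕ.* suc m ℕ.* suc m′) (λ i → inv (i ℕ.+ suc m ℕ.* suc m′))
      ≡⟨ cong₂ (λ a b → Σ< a (λ i → inv (i ℕ.+ b))) eq (ℕ.*-comm (suc m) (suc m′)) ⟩
    Σ< (l ℕ.* suc m′ ℕ.* suc m) (λ i → inv (i ℕ.+ suc m′ ℕ.* suc m))
      ≤⟨ refine-≤ m′ m (l ℕ.* suc m′) ⟩
    Σ< (l ℕ.* suc m′) (λ i → inv (i ℕ.+ m′))
      ≤⟨ shift m′ (l ℕ.* suc m′) ⟩
    riemannSum n m′ +ℚ inv m′ ∎
    where
    l = n ℕ.∸ 1
    eq : l ℕ.* suc m ℕ.* suc m′ ≡ l ℕ.* suc m′ ℕ.* suc m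
    eq = trans (ℕ.*-assoc l (suc m) (suc m′))
      (trans (cong (l ℕ.*_) (ℕ.*-comm (suc m) (suc m′))) (sym (ℕ.*-assoc l (suc m′) (suc m))))

  log-cauchy : ∀ n → IsCauchy (riemannSum n)
  log-cauchy n = Cauchy.one-sided {riemannSum n} λ 0<ε →
    let N , A = archimedean 0<ε
    in N , λ m m′ _ N≤m′ → ℚ.≤-trans (compare n m m′)
         (ℚ.+-monoʳ-≤ (riemannSum n m′) (ℚ.≤-trans (inv-anti N≤m′) A))

log : ℕ → ℝ
log n = mkℝ (riemannSum n) (Log.log-cauchy n)

record ℂ : Set where
  constructor _+i_
  field
    re im : ℝ

open ℂ

infix  4 _≈ᶜ_
infixl 6 _+ᶜ_
infixl 7 _*ᶜ_

_≈ᶜ_ : ℂ → ℂ → Set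
z ≈ᶜ w = re z ≈ re w × im z ≈ im w

0ℂ 1ℂ : ℂ
0ℂ = 0ℝ +i 0ℝ
1ℂ = 1ℝ +i 0ℝ

_+ᶜ_ _*ᶜ_ : ℂ → ℂ → ℂ
z +ᶜ w = (re z + re w) +i (im z + im w)
z *ᶜ w = (re z * re w + - (im z * im w)) +i (re z * im w + im z * re w)

∣_∣ : ℂ → ℝ
∣ z ∣ = root 2 (re z * re z + im z * im z)

record DirichletCharacter (q : ℕ) : Set where
  field
    χ              : ℤ → ℂ
    periodic       : ∀ a b → + q ℤ.∣ a ℤ.- b → χ a ≈ᶜ χ b
    multiplicative : ∀ a b → χ (a ℤ.* b) ≈ᶜ χ a *ᶜ χ b
    unital         : χ (+ 1) ≈ᶜ 1ℂ
    vanishing      : ∀ a → ¬ ℤ.Coprime a (+ q) → χ a ≈ᶜ 0ℂ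

  IsInducedModulus : ℕ → Set
  IsInducedModulus d =
    d ℕ.∣ q × (∀ a → ℤ.Coprime a (+ q) → + d ℤ.∣ a ℤ.- + 1 → χ a ≈ᶜ 1ℂ)

  IsConductor : ℕ → Set
  IsConductor d = IsInducedModulus d × (∀ {e} → IsInducedModulus e → d ℕ.≤ e)

open DirichletCharacter using (χ; IsConductor)

Primitive : ∀ {q} → DirichletCharacter q → Set
Primitive {q} ψ = IsConductor ψ q

-- ps lists the pairs of positive integers with x y ≤ T, each exactly once. A list is used
-- because order on ℝ is undecidable, so it is not computable from T.

Enumerates : List (ℕ × ℕ) → ℝ → Set
Enumerates ps T = Unique ps ×
  (∀ x y → (x , y) ∈ ps ⇔ (0 ℕ.< x × 0 ℕ.< y × fromℕ (x ℕ.* y) ≤ T))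

∑ : List (ℕ × ℕ) → (ℕ → ℕ → ℂ) → ℂ
∑ ps f = foldr _+ᶜ_ 0ℂ (map (uncurry f) ps)

ν : ℕ → ℕ
ν 2 = 1
ν _ = 0

threshold : (r q₁ q₂ : ℕ) → ℝ
threshold r q₁ q₂ =
    fromℕ q₁ ^[ (r ℕ.+ 1) ℕ.^ 2 / 4 ℕ.* r ]
  * fromℕ q₂ ^[ r ℕ.+ 1 / 4 ℕ.* r ]
  * log q₁ ^ (r ℕ.+ 1)
  * log q₂ ^ (ν r ℕ.* (r ℕ.* (r ℕ.+ 1)) ℕ.+ r ℕ.^ 2 ℕ.+ 1)

-- The region xy ≤ T is cut into rectangles by a dyadic staircase. On a rectangle the double sum is a
-- product of two sums over intervals, each bounded by Burgess. The contributions of the levels of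
-- the staircase decay geometrically, except that for r = 2 they are all equal and cost a logarithm.
-- If T exceeds a large power of q₂ the interval sums are bounded by q₁ and q₂ instead, and for
-- T ≥ T_r the first bound implies the second.
--
-- For Burgess, a sum over an interval is compared with its shifts by products ab; Hölder reduces it
-- to a moment of short sums, which expands into complete sums of χ over polynomial values. Such a sum
-- is the first power sum of an L-function that is a polynomial. Stepanov's method bounds the power
-- sums of even order, and Graeffe's root squaring transfers this to the first one with no reference
-- to the zeros of L.

module Submission where

open import Algebra.Bundles using (CommutativeRing;RawRing;CommutativeSemiring;Semiring)
import Algebra.Definitions.RawSemiring as RawSemiringDefinitions
import Algebra.Properties.AbelianGroup as AbelianGroup
import Algebra.Properties.CommutativeSemiring.Exp as Exp
import Algebra.Properties.Semiring.Exp as Power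
import Algebra.Properties.Semiring.Mult as Mult
open import Algebra.Structures using (IsCommutativeRing)
open import Data.Fin as Fin using (Fin;toℕ)
import Data.Fin.Properties as Fin
open import Data.Integer as Z using (ℤ)
import Data.Integer.Coprimality as Z
import Data.Integer.DivMod as Z
import Data.Integer.Divisibility as Z
import Data.Integer.Properties as Z
open import Data.List as List using (List;[];_∷_;map;length;cartesianProductWith;_++_;upTo;filter;cartesianProduct;replicate;allFin;foldr)
open import Data.List.Membership.Propositional using (_∈_;find;lose)
open import Data.List.Membership.Propositional.Properties using (∈-map⁺;∈-map⁻;∈-lookup;∈-cartesianProductWith⁺;∈-cartesianProductWith⁻;∈-upTo⁺;∈-upTo⁻;∈-filter⁺;∈-filter⁻;∈-++⁺ˡ;∈-++⁺ʳ;∈-++⁻;∈-allFin;∈-cartesianProduct⁺)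
open import Data.List.Membership.Propositional.Properties.WithK using (unique∧set⇒bag)
open import Data.List.Properties using (length-++;length-map;∷-injective;map-upTo;upTo-∷ʳ;≡-dec;length-replicate;length-upTo;++-cancelˡ;length-tabulate)
open import Data.List.Relation.Binary.BagAndSetEquality using (∼bag⇒↭)
open import Data.List.Relation.Binary.Permutation.Propositional using (_↭_)
open import Data.List.Relation.Unary.All as All using (All;[];_∷_)
open import Data.List.Relation.Unary.AllPairs using ([];_∷_;AllPairs)
open import Data.List.Relation.Unary.Any using (here;there;any?;Any)
open import Data.List.Relation.Unary.Any.Properties using (lookup-index)
open import Data.List.Relation.Unary.Unique.Propositional using (Unique)
open import Data.List.Relation.Unary.Unique.Propositional.Properties as Unique using (cartesianProductWith⁺)
open import Data.Maybe using (Maybe;just;nothing)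
open import Data.Nat as N using (ℕ;zero;suc;s≤s;z≤n)
open import Data.Nat.Combinatorics using (nCk≡n!/k![n-k]!;k![n∸k]!∣n!;nCn≡1;nCk≡nC[n∸k])
open import Data.Nat.Coprimality using (coprime-divisor;coprime-/gcd)
open import Data.Nat.DivMod as N using (m/n*n≡m;m/n*n≤m;m*n/n≡m;m*[n/m]≡n;/-monoˡ-≤;/-monoʳ-≤;m%n<n;m<n⇒m%n≡m;%-distribˡ-+;%-distribˡ-*;n%n≡0)
open import Data.Nat.Divisibility as N using (∣⇒≤;m∣m*n;∣1⇒≡1;∣m+n∣m⇒∣n;m%n≡0⇒n∣m;n∣m⇒m%n≡0)
open import Data.Nat.GCD using (gcd;gcd[m,n]∣m;gcd[m,n]∣n;gcd[m,n]≢0)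
open import Data.Nat.Induction as N using (<-rec)
open import Data.Nat.ListAction using (sum)
open import Data.Nat.Primality using (Prime;euclidsLemma;¬prime[0];¬prime[1];prime⇒nonTrivial;prime⇒nonZero)
open import Data.Nat.Properties as N using () renaming (≤-reflexive to ≡⇒≤;≤-trans to ≤-tr)
open import Data.Nat.Tactic.RingSolver using (solve-∀)
open import Data.Product using (_×_;_,_;∃-syntax;Σ-syntax) renaming (proj₁ to fst;proj₂ to snd)
open import Data.Rational as ℚ using (ℚ;0ℚ;1ℚ;½)
import Data.Rational.Properties as ℚ
open import Data.Sum using ([_,_]′;_⊎_) renaming (inj₁ to inl;inj₂ to inr)
import Defs
open Defs using (ν)
open import Function using (_∘_;_⇔_;Equivalence;mk⇔)
open import Induction.WellFounded using (Acc;acc)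
open import Level using (0ℓ)
open import Relation.Binary.Bundles using (Poset)
open import Relation.Binary.Definitions using (DecidableEquality;tri<;tri≈;tri>)
open import Relation.Binary.PropositionalEquality as E using (_≡_;_≢_;subst;cong₂)
import Relation.Binary.Reasoning.PartialOrder
import Relation.Binary.Reasoning.Setoid as Setoid-Reasoning
open import Relation.Binary.Structures using (IsEquivalence)
open import Relation.Nullary using (yes;no;Dec;¬_;contradiction)
open import Relation.Nullary.Decidable using (_×-dec_)

module Identities where
 open import Data.Nat using (_+_;_*_)

 id1 : ∀ c x g -> c * (x + g) + x ≡ c * g + (1 + c) * x
 id1 = solve-∀

 id2 : ∀ x y z -> x + (y + z) ≡ y + (x + z)
 id2 = solve-∀

 id3 : ∀ x y z -> x * 1 + (y + z) ≡ y + (x + z)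
 id3 = solve-∀

 id4 : ∀ k e m -> suc e * (2 + k) * (suc e + 3 * m + 3) ≡ suc (suc (suc ((2 + k) * suc e) * e + suc ((2 + k) * suc e) * m + (suc e + 3 * m + 3))) + (2 + 6 * e + 4 * k + 4 * k * e + 4 * e * m + 2 * k * m + 2 * k * e * m)
 id4 = solve-∀

 id5 : ∀ k e m -> suc e + suc e * suc ((2 + k) * suc e) + (4 * m + 3) * suc ((2 + k) * suc e) ≡ e + (2 + k) * (suc e * m) + (suc e + 3 * m + 3) * suc ((2 + k) * suc e) + (1 + m)
 id5 = solve-∀

 id6 : ∀ a c b d -> a + c + (b + d) ≡ a + b + (c + d)
 id6 = solve-∀

 id7 : ∀ i d -> i + d + (i + d) ≡ i + (i + d + d)
 id7 = solve-∀

 id8 : ∀ i d -> i * i + (i + suc d + suc d) * (i + suc d + suc d) ≡ 2 + ((i + suc d) * (i + suc d) + (i + suc d) * (i + suc d)) + 2 * (d * (2 + d))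
 id8 = solve-∀

 id9 : ∀ k j d -> k + (j + d) ≡ k + d + j
 id9 = solve-∀

 id10 : ∀ i d -> (i + suc d + suc d) * (i + suc d + suc d) + i * i ≡ 2 + ((i + suc d) * (i + suc d) + (i + suc d) * (i + suc d)) + 2 * (d * (2 + d))
 id10 = solve-∀

 id11 : ∀ M -> (2 * suc M) * ((2 * suc M) * 1) ≡ 2 * M + 2 * M + (4 + 4 * M + 4 * (M * M))
 id11 = solve-∀

 id12 : ∀ x n -> x * n + x * n ≡ (x + (x + 0)) * n
 id12 = solve-∀

 id13 : ∀ k c m -> (3 + k) * (c + c * ((2 + k) * c + 1) + (4 * m + 3) * ((2 + k) * c + 1)) + m + 1 + (m * ((2 + k) * c) + 1) ≡ ((2 + k) * (4 * m + 3) + m) * ((2 + k) * c + 1) + (((2 + k) * c + 1) * ((2 + k) * c + 1) + (c + c * ((2 + k) * c + 1) + (4 * m + 3) * ((2 + k) * c + 1))) + 1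
 id13 = solve-∀

 id14 : ∀ q g a -> q * (g * a) ≡ g * (q * a)
 id14 = solve-∀

 id15 : ∀ B p -> B * (p + p) ≡ 2 * (B * p)
 id15 = solve-∀

 id16 : ∀ M a n -> M + a + n ≡ M + n + a
 id16 = solve-∀

 id17 : ∀ A B -> (A + A) * B ≡ 2 * (A * B)
 id17 = solve-∀

 id18 : ∀ A -> A + A + A ≡ 3 * A
 id18 = solve-∀

 id19 : ∀ A N -> (A + A) * N + (A + A) * N ≡ 4 * (A * N)
 id19 = solve-∀

 id20 : ∀ v d u n M -> v * suc d + u * n + u * M ≡ u * (M + n) + v * suc d
 id20 = solve-∀

 id21 : ∀ v d n M -> v * (M + n) + v * suc d ≡ v * (M + (suc d + n))
 id21 = solve-∀

 id22 : ∀ u n M -> u * (M + n) ≡ u * n + u * M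
 id22 = solve-∀

 id23 : ∀ A N l -> A * (l * (A * N)) + N * ((A + A) * (l * (A + A))) ≡ A * (5 * l * (N * A))
 id23 = solve-∀

 id24 : ∀ m n a b -> m * n * (a * b) ≡ m * a * (n * b)
 id24 = solve-∀

 id25 : ∀ r -> 2 * r + 2 * r ≡ 4 * r
 id25 = solve-∀

 id26 : ∀ r -> 4 * r ≡ 2 * r + 2 * r
 id26 = solve-∀

 id27 : ∀ s -> 2 * suc s ≡ s + suc (suc s)
 id27 = solve-∀

 id28 : ∀ b R t -> b * R * (t * b) ≡ b * b * (t * R)
 id28 = solve-∀

 id29 : ∀ s -> suc (suc (s + s)) ≡ 2 * suc s
 id29 = solve-∀

 id30 : ∀ A B L -> 5 * (2 * L) * (64 * (A * (B * L)) * A) ≡ 640 * (A * (A * (B * (L * L))))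
 id30 = solve-∀

 id31 : ∀ B p L -> 2 * B * p * L ≡ 2 * (p * (B * L))
 id31 = solve-∀

 id32 : ∀ A B p L -> 4 * (5 * (2 * L) * (64 * (A * B) * A) * (2 * (B * p))) ≡ A * B * (A * B) * (5120 * (L * p))
 id32 = solve-∀

 id33 : ∀ b A N -> 8 * b * (4 * (A * N)) ≡ A * (32 * b) * N
 id33 = solve-∀

 id34 : ∀ p b -> 8 * (p * b) ≡ 8 * b * p
 id34 = solve-∀

 id36 : ∀ A b -> (A + A) * (32 * b) ≡ 64 * (A * b)
 id36 = solve-∀

 id38 : ∀ A N -> 1 * (32 * A) * N ≡ 8 * (4 * (A * N))
 id38 = solve-∀

 id39 : ∀ A b -> 32 * (A * b) ≡ b * (32 * A)
 id39 = solve-∀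

 id40 : ∀ A b -> (b + b) * (32 * A) ≡ 64 * (A * b)
 id40 = solve-∀

 id41 : ∀ D -> (D + D) * 4 ≡ 8 * D
 id41 = solve-∀

 id42 : ∀ i d b -> i * i * d * b ≡ b * d * (i * i)
 id42 = solve-∀

 id43 : ∀ ℓ v v' q -> ℓ * (v * v') + (v * v' + q * v' * v) ≡ (suc ℓ + q) * v * v'
 id43 = solve-∀

 id44 : ∀ v v' q -> suc q * v' * v ≡ v * v' + q * v' * v
 id44 = solve-∀

 id45 : ∀ n d -> n + (n + d) ≡ d + 2 * n
 id45 = solve-∀

 id46 : ∀ Λ -> 2 * Λ + Λ ≡ 3 * Λ
 id46 = solve-∀

 id47 : ∀ σ I Λ -> 1 + σ * (3 * Λ) + (1 + I * (3 * Λ)) ≡ 2 + 3 * ((σ + I) * Λ)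
 id47 = solve-∀

 id48 : ∀ a b -> 8 * (a * (b * b)) ≡ 2 * a * (2 * b * (2 * b))
 id48 = solve-∀

 id49 : ∀ r -> r * (4 * r) ≡ 4 * (r * (r * 1))
 id49 = solve-∀

 id50 : ∀ L E -> L + (L + L) * E ≡ (2 * E + 1) * L
 id50 = solve-∀

 id51 : ∀ v r -> (1 + (v + 1) * r) * (r + 1) ≡ v * (r * (r + 1)) + r * (r * 1) + 1 + 2 * r
 id51 = solve-∀

 id52 : ∀ s -> suc (suc s * (suc (suc s) + 1)) ≡ suc (suc s) * suc (suc s)
 id52 = solve-∀

open Identities

module IntegerSolver (R : CommutativeRing 0ℓ 0ℓ) where
 open import Algebra.Solver.Ring.AlmostCommutativeRing
 open import Data.Integer using (+_;-[1+_];_⊖_)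
 open CommutativeRing R
 open import Algebra.Properties.Ring ring
 open AbelianGroup +-abelianGroup
 open import Algebra.Properties.Semiring.Mult.TCOptimised semiring renaming (_×_ to _·_)
 open Setoid-Reasoning setoid

 ⟦_⟧ℤ : ℤ -> Carrier
 ⟦ + n ⟧ℤ = n · 1#
 ⟦ -[1+ n ] ⟧ℤ = - (suc n · 1#)

 suc-× : ∀ n -> suc n · 1# ≈ 1# + n · 1#
 suc-× n = 1+× n 1#

 ⊖-homo : ∀ m n -> ⟦ m ⊖ n ⟧ℤ ≈ m · 1# - n · 1#
 ⊖-homo zero zero = sym (-‿inverseʳ 0#)
 ⊖-homo zero (suc n) = sym (+-identityˡ _)
 ⊖-homo (suc m) zero = sym (trans (+-congˡ ε⁻¹≈ε)(+-identityʳ _))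
 ⊖-homo (suc m)(suc n) = begin
  ⟦ suc m ⊖ suc n ⟧ℤ ≡⟨ E.cong ⟦_⟧ℤ (Z.[1+m]⊖[1+n]≡m⊖n m n) ⟩
  ⟦ m ⊖ n ⟧ℤ ≈⟨ ⊖-homo m n ⟩
  m · 1# - n · 1# ≈⟨ +-identityˡ _ ⟨
  0# + (m · 1# - n · 1#) ≈⟨ +-congʳ (-‿inverseʳ 1#) ⟨
  (1# - 1#) + (m · 1# - n · 1#) ≈⟨ +-assoc _ _ _ ⟩
  1# + (- 1# + (m · 1# - n · 1#)) ≈⟨ +-congˡ (+-assoc _ _ _) ⟨
  1# + ((- 1# + m · 1#) - n · 1#) ≈⟨ +-congˡ (+-congʳ (+-comm _ _)) ⟩
  1# + ((m · 1# - 1#) - n · 1#) ≈⟨ +-congˡ (+-assoc _ _ _) ⟩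
  1# + (m · 1# + (- 1# - n · 1#)) ≈⟨ +-assoc _ _ _ ⟨
  (1# + m · 1#) + (- 1# - n · 1#) ≈⟨ +-congˡ (⁻¹-∙-comm 1# (n · 1#)) ⟩
  (1# + m · 1#) - (1# + n · 1#) ≈⟨ +-cong (suc-× m)(-‿cong (suc-× n)) ⟨
  suc m · 1# - suc n · 1# ∎

 +-homo : ∀ i j -> ⟦ i Z.+ j ⟧ℤ ≈ ⟦ i ⟧ℤ + ⟦ j ⟧ℤ
 +-homo (+ m)(+ n) = ×-homo-+ 1# m n
 +-homo (+ m)(-[1+ n ]) = ⊖-homo m (suc n)
 +-homo (-[1+ m ])(+ n) = trans (⊖-homo n (suc m))(+-comm _ _)
 +-homo (-[1+ m ])(-[1+ n ]) = begin
  - (suc (suc (m N.+ n)) · 1#) ≡⟨ E.cong (\k -> - (k · 1#))(E.sym (N.+-suc (suc m) n)) ⟩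
  - ((suc m N.+ suc n) · 1#) ≈⟨ -‿cong (×-homo-+ 1# (suc m)(suc n)) ⟩
  - (suc m · 1# + suc n · 1#) ≈⟨ ⁻¹-∙-comm _ _ ⟨
  - (suc m · 1#) - (suc n · 1#) ∎

 -‿homo : ∀ i -> ⟦ Z.- i ⟧ℤ ≈ - ⟦ i ⟧ℤ
 -‿homo (+ zero) = sym ε⁻¹≈ε
 -‿homo (+ suc n) = refl
 -‿homo -[1+ n ] = sym (⁻¹-involutive _)

 pos-*-homo : ∀ m j -> ⟦ + m Z.* j ⟧ℤ ≈ ⟦ + m ⟧ℤ * ⟦ j ⟧ℤ
 pos-*-homo m (+ n) = trans (reflexive (E.cong ⟦_⟧ℤ (E.sym (Z.pos-* m n))))(×1-homo-* m n)
 pos-*-homo m -[1+ n ] = begin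
  ⟦ + m Z.* -[1+ n ] ⟧ℤ ≡⟨ E.cong ⟦_⟧ℤ (E.sym (Z.neg-distribʳ-* (+ m)(+ suc n))) ⟩
  ⟦ Z.- (+ m Z.* + suc n) ⟧ℤ ≈⟨ -‿homo (+ m Z.* + suc n) ⟩
  - ⟦ + m Z.* + suc n ⟧ℤ ≈⟨ -‿cong (pos-*-homo m (+ suc n)) ⟩
  - (m · 1# * suc n · 1#) ≈⟨ -‿distribʳ-* _ _ ⟩
  m · 1# * - (suc n · 1#) ∎

 *-homo : ∀ i j -> ⟦ i Z.* j ⟧ℤ ≈ ⟦ i ⟧ℤ * ⟦ j ⟧ℤ
 *-homo (+ m) j = pos-*-homo m j
 *-homo -[1+ m ] j = begin
  ⟦ -[1+ m ] Z.* j ⟧ℤ ≡⟨ E.cong ⟦_⟧ℤ (E.sym (Z.neg-distribˡ-* (+ suc m) j)) ⟩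
  ⟦ Z.- (+ suc m Z.* j) ⟧ℤ ≈⟨ -‿homo (+ suc m Z.* j) ⟩
  - ⟦ + suc m Z.* j ⟧ℤ ≈⟨ -‿cong (pos-*-homo (suc m) j) ⟩
  - (suc m · 1# * ⟦ j ⟧ℤ) ≈⟨ -‿distribˡ-* _ _ ⟩
  - (suc m · 1#) * ⟦ j ⟧ℤ ∎

 ℤ-raw : RawRing 0ℓ 0ℓ
 ℤ-raw = record { Carrier = ℤ; _≈_ = _≡_; _+_ = Z._+_; _*_ = Z._*_; -_ = Z.-_
  ; 0# = Z.0ℤ; 1# = Z.1ℤ }

 morphism : ℤ-raw -Raw-AlmostCommutative⟶ fromCommutativeRing R
 morphism = record
  { ⟦_⟧ = ⟦_⟧ℤ
  ; +-homo = +-homo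
  ; *-homo = *-homo
  ; -‿homo = -‿homo
  ; 0-homo = refl
  ; 1-homo = refl
  }

 dec : ∀ i j -> Maybe (⟦ i ⟧ℤ ≈ ⟦ j ⟧ℤ)
 dec i j with i Z.≟ j
 ... | yes i≡j = just (reflexive (E.cong ⟦_⟧ℤ i≡j))
 ... | no _ = nothing

 open import Algebra.Solver.Ring ℤ-raw (fromCommutativeRing R) morphism dec public using (Polynomial;solve;con;_:=_;_:+_;_:*_;_:-_;:-_;_:^_)

 :0 :1 : ∀ {n} -> Polynomial n
 :0 = con Z.0ℤ
 :1 = con Z.1ℤ

module Enumeration where
 open import Data.List using (lookup)
 open import Data.List.Relation.Unary.Any using (index)
 open E

 unique-map : ∀ {A B : Set}{xs : List A}(f : A -> B) -> Unique xs ->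
  (∀ {x y} -> x ∈ xs -> y ∈ xs -> f x ≡ f y -> x ≡ y) -> Unique (map f xs)
 unique-map f [] inj = []
 unique-map {xs = x ∷ xs} f (x∉ ∷ u) inj =
  All.tabulate (\y∈ fx≡y -> case y∈ fx≡y) ∷ unique-map f u (\p q -> inj (there p)(there q))
  where
  case : ∀ {y} -> y ∈ map f xs -> f x ≢ y
  case y∈ fx≡y with ∈-map⁻ f y∈
  ... | z , z∈ , refl = All.lookup x∉ z∈ (inj (here refl)(there z∈) fx≡y)

 unique-↭ : ∀ {A : Set}{xs ys : List A} -> Unique xs -> Unique ys ->
  (∀ {x} -> x ∈ xs -> x ∈ ys) -> (∀ {x} -> x ∈ ys -> x ∈ xs) -> xs ↭ ys
 unique-↭ ux uy f g = ∼bag⇒↭ (unique∧set⇒bag ux uy (mk⇔ f g))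

 bijection-↭ : ∀ {A B : Set}{xs : List A}{ys : List B} -> Unique xs -> Unique ys ->
  (f : A -> B)(g : B -> A) ->
  (∀ {x} -> x ∈ xs -> f x ∈ ys) -> (∀ {y} -> y ∈ ys -> g y ∈ xs) ->
  (∀ {x} -> x ∈ xs -> g (f x) ≡ x) -> (∀ {y} -> y ∈ ys -> f (g y) ≡ y) ->
  map f xs ↭ ys
 bijection-↭ {xs = xs}{ys} ux uy f g f∈ g∈ gf fg = unique-↭ (unique-map f ux inj) uy to from
  where
  inj : ∀ {x y} -> x ∈ xs -> y ∈ xs -> f x ≡ f y -> x ≡ y
  inj p q e = trans (sym (gf p))(trans (cong g e)(gf q))
  to : ∀ {y} -> y ∈ map f xs -> y ∈ ys
  to y∈ with ∈-map⁻ f y∈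
  ... | _ , x∈ , refl = f∈ x∈
  from : ∀ {y} -> y ∈ ys -> y ∈ map f xs
  from y∈ = subst (_∈ map f xs)(fg y∈)(∈-map⁺ f (g∈ y∈))

 length-pairs : ∀ {A B C : Set}(f : A -> B -> C) xs ys ->
  length (cartesianProductWith f xs ys) ≡ length xs N.* length ys
 length-pairs f [] ys = refl
 length-pairs f (x ∷ xs) ys = trans (length-++ (map (f x) ys))
  (cong₂ N._+_ (length-map (f x) ys)(length-pairs f xs ys))

 tuples : ∀ {A : Set} -> List A -> ℕ -> List (List A)
 tuples xs zero = [] ∷ []
 tuples xs (suc n) = cartesianProductWith _∷_ xs (tuples xs n)

 tuples-unique : ∀ {A : Set}{xs : List A} -> Unique xs -> ∀ n -> Unique (tuples xs n)
 tuples-unique u zero = [] ∷ []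
 tuples-unique u (suc n) = cartesianProductWith⁺ _∷_ ∷-injective u (tuples-unique u n)

 ∈-tuples⁺ : ∀ {A : Set}{xs : List A}{w} -> All (_∈ xs) w -> w ∈ tuples xs (length w)
 ∈-tuples⁺ [] = here refl
 ∈-tuples⁺ (p ∷ ps) = ∈-cartesianProductWith⁺ _∷_ p (∈-tuples⁺ ps)

 ∈-tuples⁻ : ∀ {A : Set}(xs : List A) n {w} -> w ∈ tuples xs n -> length w ≡ n × All (_∈ xs) w
 ∈-tuples⁻ xs zero (here refl) = refl , []
 ∈-tuples⁻ xs (suc n) w∈ with ∈-cartesianProductWith⁻ _∷_ xs (tuples xs n) w∈
 ... | _ , _ , x∈ , v∈ , refl with ∈-tuples⁻ xs n v∈
 ... | eq , all = cong suc eq , x∈ ∷ all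

 length-tuples : ∀ {A : Set}(xs : List A) n -> length (tuples xs n) ≡ length xs N.^ n
 length-tuples xs zero = refl
 length-tuples xs (suc n) = trans (length-pairs _∷_ xs (tuples xs n))
  (cong (length xs N.*_)(length-tuples xs n))

 lookup-≢ : ∀ {A : Set}{xs : List A} -> Unique xs -> ∀ {i j} -> i Fin.< j -> lookup xs i ≢ lookup xs j
 lookup-≢ (x∉ ∷ u){Fin.zero}{Fin.suc j} _ = All.lookup x∉ (∈-lookup j)
 lookup-≢ (x∉ ∷ u){Fin.suc i}{Fin.suc j}(N.s≤s lt) = lookup-≢ u lt

 pigeonhole : ∀ {A B : Set}{xs : List A}(ys : List B) -> Unique xs -> length ys N.< length xs ->
  (f : A -> B) -> (∀ {x} -> x ∈ xs -> f x ∈ ys) ->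
  ∃[ x ] ∃[ x' ] x ∈ xs × x' ∈ xs × x ≢ x' × f x ≡ f x'
 pigeonhole {xs = xs} ys u lt f f∈ with Fin.pigeonhole lt (\i -> index (f∈ (∈-lookup i)))
 ... | i , j , i<j , eq = lookup xs i , lookup xs j , ∈-lookup i , ∈-lookup j , lookup-≢ u i<j
  , trans (lookup-index (f∈ (∈-lookup i)))(trans (cong (lookup ys) eq)(sym (lookup-index (f∈ (∈-lookup j)))))

module Summation (S : CommutativeSemiring 0ℓ 0ℓ) where
 open import Data.List.Relation.Binary.Permutation.Propositional using (refl;prep;swap;trans)
 open import Relation.Unary using (Pred;Decidable)
 open CommutativeSemiring S hiding (refl;trans)
 open CommutativeSemiring S using () renaming (refl to ≈-refl;trans to ≈-trans)
 open import Algebra.Properties.CommutativeSemigroup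
  (CommutativeSemiring.+-commutativeSemigroup S) using (interchange; x∙yz≈y∙xz)
 open Mult semiring using () renaming (_×_ to _·_)
 open Setoid-Reasoning setoid

 private variable
  A B : Set

 Σ : List A -> (A -> Carrier) -> Carrier
 Σ [] f = 0#
 Σ (x ∷ xs) f = f x + Σ xs f

 [_] : ∀ {P : Set} -> Dec P -> Carrier
 [ yes _ ] = 1#
 [ no _ ] = 0#

 [_]-yes : ∀ {P : Set}(d : Dec P) -> P -> [ d ] ≈ 1#
 [ yes _ ]-yes _ = ≈-refl
 [ no ¬p ]-yes p = contradiction p ¬p

 [_]-no : ∀ {P : Set}(d : Dec P) -> ¬ P -> [ d ] ≈ 0#
 [ no _ ]-no _ = ≈-refl
 [ yes p ]-no ¬p = contradiction p ¬p

 [_]-⇔ : ∀ {P Q : Set}(d : Dec P)(e : Dec Q) -> (P -> Q) -> (Q -> P) -> [ d ] ≈ [ e ]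
 [ yes p ]-⇔ e to from = sym ([ e ]-yes (to p))
 [ no ¬p ]-⇔ e to from = sym ([ e ]-no (¬p ∘ from))

 Σ-cong∈ : ∀ (xs : List A){f g} -> (∀ {x} -> x ∈ xs -> f x ≈ g x) -> Σ xs f ≈ Σ xs g
 Σ-cong∈ [] h = ≈-refl
 Σ-cong∈ (x ∷ xs) h = +-cong (h (here E.refl))(Σ-cong∈ xs (h ∘ there))

 Σ-cong : ∀ (xs : List A){f g} -> (∀ x -> f x ≈ g x) -> Σ xs f ≈ Σ xs g
 Σ-cong xs h = Σ-cong∈ xs (\{x} _ -> h x)

 Σ-zero : ∀ (xs : List A){f} -> (∀ {x} -> x ∈ xs -> f x ≈ 0#) -> Σ xs f ≈ 0#
 Σ-zero [] h = ≈-refl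
 Σ-zero (x ∷ xs) h = ≈-trans (+-cong (h (here E.refl))(Σ-zero xs (h ∘ there)))(+-identityˡ 0#)

 Σ-+ : ∀ (xs : List A) f g -> Σ xs (\x -> f x + g x) ≈ Σ xs f + Σ xs g
 Σ-+ [] f g = sym (+-identityˡ 0#)
 Σ-+ (x ∷ xs) f g = ≈-trans (+-congˡ (Σ-+ xs f g))(interchange _ _ _ _)

 Σ-*ˡ : ∀ (xs : List A) c f -> Σ xs (\x -> c * f x) ≈ c * Σ xs f
 Σ-*ˡ [] c f = sym (zeroʳ c)
 Σ-*ˡ (x ∷ xs) c f = ≈-trans (+-congˡ (Σ-*ˡ xs c f))(sym (distribˡ _ _ _))

 Σ-*ʳ : ∀ (xs : List A) c f -> Σ xs (\x -> f x * c) ≈ Σ xs f * c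
 Σ-*ʳ xs c f = ≈-trans (Σ-cong xs (\_ -> *-comm _ _))(≈-trans (Σ-*ˡ xs c f)(*-comm _ _))

 Σ-++ : ∀ (xs ys : List A) f -> Σ (xs ++ ys) f ≈ Σ xs f + Σ ys f
 Σ-++ [] ys f = sym (+-identityˡ _)
 Σ-++ (x ∷ xs) ys f = ≈-trans (+-congˡ (Σ-++ xs ys f))(sym (+-assoc _ _ _))

 Σ-map : ∀ (h : A -> B) xs f -> Σ (map h xs) f ≡ Σ xs (f ∘ h)
 Σ-map h [] f = E.refl
 Σ-map h (x ∷ xs) f = E.cong (f (h x) +_)(Σ-map h xs f)

 Σ-pairs : ∀ {C : Set}(h : A -> B -> C) xs ys f ->
  Σ (cartesianProductWith h xs ys) f ≈ Σ xs (\x -> Σ ys (\y -> f (h x y)))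
 Σ-pairs h [] ys f = ≈-refl
 Σ-pairs h (x ∷ xs) ys f = ≈-trans (Σ-++ (map (h x) ys) _ f)
  (+-cong (reflexive (Σ-map (h x) ys f))(Σ-pairs h xs ys f))

 Σ-swap : ∀ (xs : List A)(ys : List B)(f : A -> B -> Carrier) ->
  Σ xs (\x -> Σ ys (f x)) ≈ Σ ys (\y -> Σ xs (\x -> f x y))
 Σ-swap [] ys f = sym (Σ-zero ys (\_ -> ≈-refl))
 Σ-swap (x ∷ xs) ys f = ≈-trans (+-congˡ (Σ-swap xs ys f))(sym (Σ-+ ys (f x) _))

 Σ-↭ : ∀ {xs ys : List A} -> xs ↭ ys -> ∀ f -> Σ xs f ≈ Σ ys f
 Σ-↭ refl f = ≈-refl
 Σ-↭ (prep x p) f = +-congˡ (Σ-↭ p f)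
 Σ-↭ (swap x y p) f = ≈-trans (x∙yz≈y∙xz _ _ _)(+-congˡ (+-congˡ (Σ-↭ p f)))
 Σ-↭ (trans p q) f = ≈-trans (Σ-↭ p f)(Σ-↭ q f)

 Σ-bijection : ∀ {xs : List A}{ys : List B} -> Unique xs -> Unique ys ->
  (f : A -> B)(g : B -> A) ->
  (∀ {x} -> x ∈ xs -> f x ∈ ys) -> (∀ {y} -> y ∈ ys -> g y ∈ xs) ->
  (∀ {x} -> x ∈ xs -> g (f x) ≡ x) -> (∀ {y} -> y ∈ ys -> f (g y) ≡ y) ->
  ∀ h -> Σ ys h ≈ Σ xs (h ∘ f)
 Σ-bijection {xs = xs} ux uy f g f∈ g∈ gf fg h = ≈-trans
  (sym (Σ-↭ (Enumeration.bijection-↭ ux uy f g f∈ g∈ gf fg) h))(reflexive (Σ-map f xs h))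

 Σ-filter : ∀ {P : Pred A 0ℓ}(P? : Decidable P) xs f ->
  Σ (filter P? xs) f ≈ Σ xs (\x -> [ P? x ] * f x)
 Σ-filter P? [] f = ≈-refl
 Σ-filter P? (x ∷ xs) f with P? x
 ... | yes _ = +-cong (sym (*-identityˡ _))(Σ-filter P? xs f)
 ... | no _ = ≈-trans (Σ-filter P? xs f)(≈-trans (sym (+-identityˡ _))(+-congʳ (sym (zeroˡ _))))

 Σ-const : ∀ (xs : List A) c -> Σ xs (\_ -> c) ≈ length xs · c
 Σ-const [] c = ≈-refl
 Σ-const (x ∷ xs) c = +-congˡ (Σ-const xs c)

 Σ-upTo-sucˡ : ∀ n f -> Σ (upTo (suc n)) f ≈ f 0 + Σ (upTo n)(f ∘ suc)
 Σ-upTo-sucˡ n f = +-congˡ (reflexive (E.trans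
  (E.cong (\l -> Σ l f)(E.sym (map-upTo suc n)))(Σ-map suc (upTo n) f)))

 Σ-upTo-sucʳ : ∀ n f -> Σ (upTo (suc n)) f ≈ Σ (upTo n) f + f n
 Σ-upTo-sucʳ n f = ≈-trans (reflexive (E.cong (\l -> Σ l f)(E.sym (upTo-∷ʳ n))))
  (≈-trans (Σ-++ (upTo n)(n ∷ []) f)(+-congˡ (+-identityʳ _)))

 Σ-upTo-+ : ∀ m n f -> Σ (upTo (m N.+ n)) f ≈ Σ (upTo m) f + Σ (upTo n)(\i -> f (m N.+ i))
 Σ-upTo-+ zero n f = sym (+-identityˡ _)
 Σ-upTo-+ (suc m) n f = begin
  Σ (upTo (suc (m N.+ n))) f ≈⟨ Σ-upTo-sucˡ (m N.+ n) f ⟩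
  f 0 + Σ (upTo (m N.+ n))(f ∘ suc) ≈⟨ +-congˡ (Σ-upTo-+ m n (f ∘ suc)) ⟩
  f 0 + (Σ (upTo m)(f ∘ suc) + Σ (upTo n)(\i -> f (suc m N.+ i))) ≈⟨ +-assoc _ _ _ ⟨
  f 0 + Σ (upTo m)(f ∘ suc) + Σ (upTo n)(\i -> f (suc m N.+ i)) ≈⟨ +-congʳ (Σ-upTo-sucˡ m f) ⟨
  Σ (upTo (suc m)) f + Σ (upTo n)(\i -> f (suc m N.+ i)) ∎

 Σ-upTo-extend : ∀ {m n} f -> m N.≤ n -> (∀ i -> m N.≤ i -> f i ≈ 0#) -> Σ (upTo n) f ≈ Σ (upTo m) f
 Σ-upTo-extend {n = n} f N.z≤n h = Σ-zero (upTo n)(\{i} _ -> h i N.z≤n)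
 Σ-upTo-extend {suc m}{suc n} f (N.s≤s m≤n) h = begin
  Σ (upTo (suc n)) f ≈⟨ Σ-upTo-sucˡ n f ⟩
  f 0 + Σ (upTo n)(f ∘ suc) ≈⟨ +-congˡ (Σ-upTo-extend (f ∘ suc) m≤n (\i m≤i -> h (suc i)(N.s≤s m≤i))) ⟩
  f 0 + Σ (upTo m)(f ∘ suc) ≈⟨ Σ-upTo-sucˡ m f ⟨
  Σ (upTo (suc m)) f ∎

 Σ-single : ∀ {xs : List A}{a} -> Unique xs -> a ∈ xs -> ∀ f ->
  (∀ {x} -> x ∈ xs -> x E.≢ a -> f x ≈ 0#) -> Σ xs f ≈ f a
 Σ-single (x∉ ∷ u)(here E.refl) f h =
  ≈-trans (+-congˡ (Σ-zero _ \y∈ -> h (there y∈)(\e -> All.lookup x∉ y∈ (E.sym e))))(+-identityʳ _)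
 Σ-single (x∉ ∷ u)(there a∈) f h =
  ≈-trans (+-cong (h (here E.refl)(All.lookup x∉ a∈))(Σ-single u a∈ f (h ∘ there)))(+-identityˡ _)

module ℕΣ = Summation N.+-*-commutativeSemiring

module PowerSeries (R : CommutativeRing 0ℓ 0ℓ) where
 open CommutativeRing R
 open IntegerSolver R using (solve;_:=_;_:+_;_:*_)
 open import Algebra.Properties.Ring ring using (-‿distribˡ-*)
 open Setoid-Reasoning setoid

 Series : Set
 Series = ℕ -> Carrier

 infix 4 _≋_
 infixl 6 _⊕_
 infixl 7 _⊛_ _•_

 _≋_ : Series -> Series -> Set
 f ≋ g = ∀ n -> f n ≈ g n

 𝟘 𝟙 : Series
 𝟘 _ = 0#
 𝟙 zero = 1#
 𝟙 (suc _) = 0#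

 _⊕_ _⊛_ : Series -> Series -> Series
 (f ⊕ g) n = f n + g n
 (f ⊛ g) zero = f 0 * g 0
 (f ⊛ g)(suc n) = f 0 * g (suc n) + (f ∘ suc ⊛ g) n

 ⊖_ : Series -> Series
 (⊖ f) n = - f n

 _•_ : Carrier -> Series -> Series
 (c • f) n = c * f n

 ⊛-cong : ∀ {f f' g g'} -> f ≋ f' -> g ≋ g' -> f ⊛ g ≋ f' ⊛ g'
 ⊛-cong p q zero = *-cong (p 0)(q 0)
 ⊛-cong p q (suc n) = +-cong (*-cong (p 0)(q (suc n)))(⊛-cong (p ∘ suc) q n)

 ⊛-zeroˡ : ∀ g -> 𝟘 ⊛ g ≋ 𝟘
 ⊛-zeroˡ g zero = zeroˡ _
 ⊛-zeroˡ g (suc n) = trans (+-cong (zeroˡ _)(⊛-zeroˡ g n))(+-identityˡ 0#)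

 ⊛-sucʳ : ∀ f g n -> (f ⊛ g)(suc n) ≈ (f ⊛ g ∘ suc) n + f (suc n) * g 0
 ⊛-sucʳ f g zero = refl
 ⊛-sucʳ f g (suc n) = trans (+-congˡ (⊛-sucʳ (f ∘ suc) g n))(sym (+-assoc _ _ _))

 ⊛-comm : ∀ f g -> f ⊛ g ≋ g ⊛ f
 ⊛-comm f g zero = *-comm _ _
 ⊛-comm f g (suc n) = begin
  f 0 * g (suc n) + (f ∘ suc ⊛ g) n ≈⟨ +-cong (*-comm _ _)(⊛-comm (f ∘ suc) g n) ⟩
  g (suc n) * f 0 + (g ⊛ f ∘ suc) n ≈⟨ +-comm _ _ ⟩
  (g ⊛ f ∘ suc) n + g (suc n) * f 0 ≈⟨ ⊛-sucʳ g f n ⟨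
  (g ⊛ f)(suc n) ∎

 ⊛-distribʳ : ∀ h f g -> (f ⊕ g) ⊛ h ≋ f ⊛ h ⊕ g ⊛ h
 ⊛-distribʳ h f g zero = distribʳ _ _ _
 ⊛-distribʳ h f g (suc n) = begin
  (f 0 + g 0) * h (suc n) + ((f ∘ suc ⊕ g ∘ suc) ⊛ h) n
  ≈⟨ +-congˡ (⊛-distribʳ h (f ∘ suc)(g ∘ suc) n) ⟩
  (f 0 + g 0) * h (suc n) + ((f ∘ suc ⊛ h) n + (g ∘ suc ⊛ h) n)
  ≈⟨ solve 5 (\a b c x y -> (a :+ b) :* c :+ (x :+ y) := a :* c :+ x :+ (b :* c :+ y))
  refl (f 0)(g 0)(h (suc n)) _ _ ⟩
  f 0 * h (suc n) + (f ∘ suc ⊛ h) n + (g 0 * h (suc n) + (g ∘ suc ⊛ h) n) ∎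

 •-⊛ : ∀ c f g -> (c • f) ⊛ g ≋ c • (f ⊛ g)
 •-⊛ c f g zero = *-assoc _ _ _
 •-⊛ c f g (suc n) =
  trans (+-cong (*-assoc _ _ _)(•-⊛ c (f ∘ suc) g n))(sym (distribˡ _ _ _))

 ⊛-assoc : ∀ f g h -> (f ⊛ g) ⊛ h ≋ f ⊛ (g ⊛ h)
 ⊛-assoc f g h zero = *-assoc _ _ _
 ⊛-assoc f g h (suc n) = begin
  f 0 * g 0 * h (suc n) + ((f 0 • (g ∘ suc) ⊕ (f ∘ suc ⊛ g)) ⊛ h) n
  ≈⟨ +-congˡ (⊛-distribʳ h (f 0 • (g ∘ suc))(f ∘ suc ⊛ g) n) ⟩
  f 0 * g 0 * h (suc n) + (((f 0 • (g ∘ suc)) ⊛ h) n + ((f ∘ suc ⊛ g) ⊛ h) n)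
  ≈⟨ +-congˡ (+-cong (•-⊛ (f 0)(g ∘ suc) h n)(⊛-assoc (f ∘ suc) g h n)) ⟩
  f 0 * g 0 * h (suc n) + (f 0 * (g ∘ suc ⊛ h) n + (f ∘ suc ⊛ (g ⊛ h)) n)
  ≈⟨ solve 5 (\a b c x y -> a :* b :* c :+ (a :* x :+ y) := a :* (b :* c :+ x) :+ y)
  refl (f 0)(g 0)(h (suc n)) _ _ ⟩
  f 0 * (g 0 * h (suc n) + (g ∘ suc ⊛ h) n) + (f ∘ suc ⊛ (g ⊛ h)) n ∎

 ⊛-identityˡ : ∀ f -> 𝟙 ⊛ f ≋ f
 ⊛-identityˡ f zero = *-identityˡ _
 ⊛-identityˡ f (suc n) = trans (+-cong (*-identityˡ _)(⊛-zeroˡ f n))(+-identityʳ _)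

 ≋-isEquivalence : IsEquivalence _≋_
 ≋-isEquivalence = record
  { refl = \_ -> refl
  ; sym = \p n -> sym (p n)
  ; trans = \p q n -> trans (p n)(q n)
  }

 seriesRing : CommutativeRing 0ℓ 0ℓ
 seriesRing = record
  { Carrier = Series; _≈_ = _≋_; _+_ = _⊕_; _*_ = _⊛_; -_ = ⊖_; 0# = 𝟘; 1# = 𝟙
  ; isCommutativeRing = record
  { isRing = record
  { +-isAbelianGroup = record
  { isGroup = record
  { isMonoid = record
  { isSemigroup = record
  { isMagma = record
  { isEquivalence = ≋-isEquivalence
  ; ∙-cong = \p q n -> +-cong (p n)(q n) }
  ; assoc = \_ _ _ _ -> +-assoc _ _ _ }
  ; identity = (\_ _ -> +-identityˡ _) , (\_ _ -> +-identityʳ _) }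
  ; inverse = (\_ _ -> -‿inverseˡ _) , (\_ _ -> -‿inverseʳ _)
  ; ⁻¹-cong = \p n -> -‿cong (p n) }
  ; comm = \_ _ _ -> +-comm _ _ }
  ; *-cong = ⊛-cong
  ; *-assoc = ⊛-assoc
  ; *-identity = ⊛-identityˡ , \f n -> trans (⊛-comm f 𝟙 n)(⊛-identityˡ f n)
  ; distrib = (\f g h n -> trans (⊛-comm f _ n)(trans (⊛-distribʳ f g h n)
  (+-cong (⊛-comm g f n)(⊛-comm h f n))))
  , ⊛-distribʳ }
  ; *-comm = ⊛-comm } }

 open Summation commutativeSemiring using (Σ;Σ-upTo-sucˡ)

 ⊛-Σ : ∀ f g n -> (f ⊛ g) n ≈ Σ (upTo (suc n))(\i -> f i * g (n N.∸ i))
 ⊛-Σ f g zero = sym (+-identityʳ _)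
 ⊛-Σ f g (suc n) = trans (+-congˡ (⊛-Σ (f ∘ suc) g n))
  (sym (Σ-upTo-sucˡ (suc n)(\i -> f i * g (suc n N.∸ i))))

module ListPolynomial (R : CommutativeRing 0ℓ 0ℓ) where
 open CommutativeRing R
 open AbelianGroup +-abelianGroup using (ε⁻¹≈ε)
 private module S = PowerSeries R
 private module SR = CommutativeRing S.seriesRing

 Poly : Set
 Poly = List Carrier

 coef : Poly -> S.Series
 coef [] _ = 0#
 coef (c ∷ f) zero = c
 coef (c ∷ f)(suc n) = coef f n

 infix 4 _≈'_
 infixl 6 _+'_
 infixl 7 _*'_ _·'_

 -- Lists with trailing zeros represent the same polynomial.
 record _≈'_ (f g : Poly) : Set where
  constructor coefs
  field at : coef f S.≋ coef g
 open _≈'_ public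

 _+'_ _*'_ : Poly -> Poly -> Poly
 [] +' g = g
 (a ∷ f) +' [] = a ∷ f
 (a ∷ f) +' (b ∷ g) = a + b ∷ f +' g

 _·'_ : Carrier -> Poly -> Poly
 c ·' f = map (c *_) f

 [] *' g = []
 (a ∷ f) *' g = a ·' g +' (0# ∷ f *' g)

 -'_ : Poly -> Poly
 -' f = map -_ f

 coef-+ : ∀ f g -> coef (f +' g) S.≋ coef f S.⊕ coef g
 coef-+ [] g n = sym (+-identityˡ _)
 coef-+ (a ∷ f) [] n = sym (+-identityʳ _)
 coef-+ (a ∷ f)(b ∷ g) zero = refl
 coef-+ (a ∷ f)(b ∷ g)(suc n) = coef-+ f g n

 coef-· : ∀ c f -> coef (c ·' f) S.≋ c S.• coef f
 coef-· c [] n = sym (zeroʳ c)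
 coef-· c (a ∷ f) zero = refl
 coef-· c (a ∷ f)(suc n) = coef-· c f n

 coef-- : ∀ f -> coef (-' f) S.≋ S.⊖ coef f
 coef-- [] n = sym ε⁻¹≈ε
 coef-- (a ∷ f) zero = refl
 coef-- (a ∷ f)(suc n) = coef-- f n

 coef-* : ∀ f g -> coef (f *' g) S.≋ coef f S.⊛ coef g
 coef-* [] g n = sym (S.⊛-zeroˡ (coef g) n)
 coef-* (a ∷ f) g zero = trans (coef-+ (a ·' g) _ 0)
  (trans (+-congʳ (coef-· a g 0))(+-identityʳ _))
 coef-* (a ∷ f) g (suc n) = trans (coef-+ (a ·' g) _ (suc n))
  (+-cong (coef-· a g (suc n))(coef-* f g n))

 const : Carrier -> Poly
 const c = c ∷ []

 X : Poly
 X = 0# ∷ 1# ∷ []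

 coef-1 : coef (const 1#) S.≋ S.𝟙
 coef-1 zero = refl
 coef-1 (suc n) = refl

 polyRing : CommutativeRing 0ℓ 0ℓ
 polyRing = record
  { Carrier = Poly; _≈_ = _≈'_; _+_ = _+'_; _*_ = _*'_; -_ = -'_; 0# = []; 1# = const 1#
  ; isCommutativeRing = record
  { isRing = record
  { +-isAbelianGroup = record
  { isGroup = record
  { isMonoid = record
  { isSemigroup = record
  { isMagma = record
  { isEquivalence = record
  { refl = coefs SR.refl
  ; sym = \p -> coefs (SR.sym (at p))
  ; trans = \p q -> coefs (SR.trans (at p)(at q)) }
  ; ∙-cong = \{f}{f'}{g}{g'} p q -> coefs (SR.trans (coef-+ f g)
  (SR.trans (SR.+-cong {x = coef f}{y = coef f'}{u = coef g}{v = coef g'}(at p)(at q))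
  (SR.sym (coef-+ f' g')))) }
  ; assoc = \f g h -> coefs (\n -> trans (coef-+ (f +' g) h n)
  (trans (+-congʳ (coef-+ f g n))(trans (+-assoc _ _ _)
  (trans (+-congˡ (sym (coef-+ g h n)))(sym (coef-+ f (g +' h) n)))))) }
  ; identity = (\_ -> coefs SR.refl)
  , (\f -> coefs (\n -> trans (coef-+ f [] n)(+-identityʳ _))) }
  ; inverse = (\f -> coefs (\n -> trans (coef-+ (-' f) f n)
  (trans (+-congʳ (coef-- f n))(-‿inverseˡ _))))
  , (\f -> coefs (\n -> trans (coef-+ f (-' f) n)
  (trans (+-congˡ (coef-- f n))(-‿inverseʳ _))))
  ; ⁻¹-cong = \{f}{g} p -> coefs (\n -> trans (coef-- f n)
  (trans (-‿cong (at p n))(sym (coef-- g n)))) }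
  ; comm = \f g -> coefs (\n -> trans (coef-+ f g n)
  (trans (+-comm _ _)(sym (coef-+ g f n)))) }
  ; *-cong = \{f}{f'}{g}{g'} p q -> coefs (\n -> trans (coef-* f g n)
  (trans (S.⊛-cong (at p)(at q) n)(sym (coef-* f' g' n))))
  ; *-assoc = \f g h -> coefs (\n -> trans (coef-* (f *' g) h n)
  (trans (S.⊛-cong (coef-* f g)(\_ -> refl) n)(trans (S.⊛-assoc (coef f)(coef g)(coef h) n)
  (trans (S.⊛-cong {f = coef f}(\_ -> refl)(SR.sym (coef-* g h)) n)
  (sym (coef-* f (g *' h) n))))))
  ; *-identity = identityˡ , \f -> coefs (\n -> trans (at (comm f (const 1#)) n)(at (identityˡ f) n))
  ; distrib = (\f g h -> coefs (\n -> trans (at (comm f (g +' h)) n)(trans (at (distribʳ' f g h) n)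
  (trans (coef-+ (g *' f)(h *' f) n)(trans
  (+-cong (at (comm g f) n)(at (comm h f) n))(sym (coef-+ (f *' g)(f *' h) n)))))))
  , distribʳ' }
  ; *-comm = comm } }
  where
  comm : ∀ f g -> f *' g ≈' g *' f
  comm f g = coefs (\n -> trans (coef-* f g n)
   (trans (S.⊛-comm (coef f)(coef g) n)(sym (coef-* g f n))))
  identityˡ : ∀ f -> const 1# *' f ≈' f
  identityˡ f = coefs (\n -> trans (coef-* (const 1#) f n)
   (trans (S.⊛-cong coef-1 (\_ -> refl) n)(S.⊛-identityˡ (coef f) n)))
  distribʳ' : ∀ h f g -> (f +' g) *' h ≈' f *' h +' g *' h
  distribʳ' h f g = coefs (\n -> trans (coef-* (f +' g) h n)
   (trans (S.⊛-cong (coef-+ f g)(\_ -> refl) n)(trans (S.⊛-distribʳ (coef h)(coef f)(coef g) n)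
   (trans (sym (+-cong (coef-* f h n)(coef-* g h n)))(sym (coef-+ (f *' h)(g *' h) n))))))

module PrimeCharacteristic where
 open import Data.Nat using (_!)
 open import Data.Nat.Combinatorics using (_C_)
 open import Data.Nat.Divisibility using (_∣_;divides)

 ∤-! : ∀ {p} -> Prime p -> ∀ n -> n N.< p -> ¬ p ∣ n !
 ∤-! pr zero _ p∣ = contradiction (subst Prime (∣1⇒≡1 p∣) pr) ¬prime[1]
 ∤-! pr (suc n) n<p p∣ = [ (\h -> N.<⇒≱ n<p (∣⇒≤ h)) , ∤-! pr n (N.<⇒≤ n<p) ]′
  (euclidsLemma (suc n)(n !) pr p∣)

 p∣pCk : ∀ {p k} -> Prime p -> 0 N.< k -> k N.< p -> p ∣ p C k
 p∣pCk {p@(suc p-1)}{k} pr 0<k k<p = [ (\h -> h) , (\h -> contradiction h ∤d) ]′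
  (euclidsLemma (p C k)(k ! N.* (p N.∸ k) !) pr (subst (p ∣_)(E.sym eq)(m∣m*n (p-1 !))))
  where
  instance _ = N._!*_!≢0 k (p N.∸ k)
  eq : (p C k) N.* (k ! N.* (p N.∸ k) !) ≡ p !
  eq = E.trans (E.cong (N._* (k ! N.* (p N.∸ k) !))(nCk≡n!/k![n-k]! (N.<⇒≤ k<p)))
   (m/n*n≡m (k![n∸k]!∣n! (N.<⇒≤ k<p)))
  ∤d : ¬ p ∣ k ! N.* (p N.∸ k) !
  ∤d h = [ ∤-! pr k k<p , ∤-! pr (p N.∸ k)(N.∸-monoʳ-< {p}{k}{0} 0<k (N.<⇒≤ k<p)) ]′
   (euclidsLemma (k !)((p N.∸ k) !) pr h)

 module Of (A : CommutativeRing 0ℓ 0ℓ) where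
  open CommutativeRing A
  open Exp commutativeSemiring
  open import Algebra.Properties.CommutativeSemiring.Binomial commutativeSemiring
  open Mult semiring renaming (_×_ to _·_)
  open import Algebra.Properties.CommutativeMonoid.Sum +-commutativeMonoid renaming (sum to total)
  open import Data.Fin using (fromℕ;inject₁)
  open Setoid-Reasoning setoid

  p∣⇒×≈0 : ∀ {p} -> p · 1# ≈ 0# -> ∀ n x -> p ∣ n -> n · x ≈ 0#
  p∣⇒×≈0 {p} p×1≈0 n x (divides q E.refl) = begin
   (q N.* p) · x ≈⟨ ×-congʳ (q N.* p)(*-identityˡ x) ⟨
   (q N.* p) · (1# * x) ≈⟨ ×-assoc-* (q N.* p) 1# x ⟨
   (q N.* p) · 1# * x ≈⟨ *-congʳ (×1-homo-* q p) ⟩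
   q · 1# * p · 1# * x ≈⟨ *-congʳ (*-congˡ p×1≈0) ⟩
   q · 1# * 0# * x ≈⟨ trans (*-congʳ (zeroʳ _))(zeroˡ x) ⟩
   0# ∎

  frobenius : ∀ {p} -> Prime p -> p · 1# ≈ 0# -> ∀ x y -> (x + y) ^ p ≈ x ^ p + y ^ p
  frobenius {zero} pr _ x y = contradiction pr ¬prime[0]
  frobenius {suc n} pr p×1≈0 x y = begin
   (x + y) ^ suc n ≈⟨ theorem (suc n) x y ⟩
   t Fin.zero + total (\i -> t (Fin.suc i)) ≈⟨ +-cong first (sum-init-last (\i -> t (Fin.suc i))) ⟩
   y ^ suc n + (total (\i -> t (Fin.suc (inject₁ i))) + t (Fin.suc (fromℕ n)))
   ≈⟨ +-congˡ (+-cong (trans (sum-cong-≋ middle)(sum-replicate-zero n)) last) ⟩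
   y ^ suc n + (0# + x ^ suc n) ≈⟨ +-congˡ (+-identityˡ _) ⟩
   y ^ suc n + x ^ suc n ≈⟨ +-comm _ _ ⟩
   x ^ suc n + y ^ suc n ∎
   where
   t = binomialTerm x y (suc n)
   first : t Fin.zero ≈ y ^ suc n
   first = begin
    (suc n C 0) · (1# * y ^ suc n) ≡⟨ E.cong (_· (1# * y ^ suc n))(nCk≡nC[n∸k] {n = suc n} N.z≤n) ⟩
    (suc n C suc n) · (1# * y ^ suc n) ≡⟨ E.cong (_· (1# * y ^ suc n))(nCn≡1 (suc n)) ⟩
    1 · (1# * y ^ suc n) ≈⟨ trans (+-identityʳ _)(*-identityˡ _) ⟩
    y ^ suc n ∎
   last : t (Fin.suc (fromℕ n)) ≈ x ^ suc n
   last = begin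
    t (Fin.suc (fromℕ n))
    ≡⟨ E.cong (\k -> (suc n C suc k) · (x ^ suc k * y ^ (n N.∸ k)))(Fin.toℕ-fromℕ n) ⟩
    (suc n C suc n) · (x ^ suc n * y ^ (n N.∸ n))
    ≡⟨ cong₂ (\c k -> c · (x ^ suc n * y ^ k))(nCn≡1 (suc n))(N.n∸n≡0 n) ⟩
    1 · (x ^ suc n * 1#) ≈⟨ trans (+-identityʳ _)(*-identityʳ _) ⟩
    x ^ suc n ∎
   middle : ∀ i -> t (Fin.suc (inject₁ i)) ≈ 0#
   middle i = p∣⇒×≈0 p×1≈0 (suc n C suc (toℕ (inject₁ i))) _
    (p∣pCk pr (N.s≤s N.z≤n)(N.s≤s (subst (N._< n)(E.sym (Fin.toℕ-inject₁ i))(Fin.toℕ<n i))))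

  module _ {p}(prime : Prime p)(p×1≈0 : p · 1# ≈ 0#) where
   ^-p^suc : ∀ x k -> x ^ (p N.^ suc k) ≈ (x ^ (p N.^ k)) ^ p
   ^-p^suc x k = trans (reflexive (E.cong (x ^_)(N.*-comm p (p N.^ k))))(sym (^-assocʳ x (p N.^ k) p))

   frobenius^ : ∀ k x y -> (x + y) ^ (p N.^ k) ≈ x ^ (p N.^ k) + y ^ (p N.^ k)
   frobenius^ zero x y = trans (*-identityʳ _)(+-cong (sym (*-identityʳ x))(sym (*-identityʳ y)))
   frobenius^ (suc k) x y = begin
    (x + y) ^ (p N.^ suc k) ≈⟨ ^-p^suc (x + y) k ⟩
    ((x + y) ^ (p N.^ k)) ^ p ≈⟨ ^-congˡ p (frobenius^ k x y) ⟩
    (x ^ (p N.^ k) + y ^ (p N.^ k)) ^ p ≈⟨ frobenius prime p×1≈0 _ _ ⟩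
    (x ^ (p N.^ k)) ^ p + (y ^ (p N.^ k)) ^ p ≈⟨ +-cong (^-p^suc x k)(^-p^suc y k) ⟨
    x ^ (p N.^ suc k) + y ^ (p N.^ suc k) ∎

record Homomorphism (R A : CommutativeRing 0ℓ 0ℓ) : Set where
 private
  module R = CommutativeRing R
  module A = CommutativeRing A
 field
  ⟦_⟧ : R.Carrier -> A.Carrier
  cong : ∀ {x y} -> x R.≈ y -> ⟦ x ⟧ A.≈ ⟦ y ⟧
  +-homo : ∀ x y -> ⟦ x R.+ y ⟧ A.≈ ⟦ x ⟧ A.+ ⟦ y ⟧
  *-homo : ∀ x y -> ⟦ x R.* y ⟧ A.≈ ⟦ x ⟧ A.* ⟦ y ⟧
  0-homo : ⟦ R.0# ⟧ A.≈ A.0#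
  1-homo : ⟦ R.1# ⟧ A.≈ A.1#

module Evaluation {R A : CommutativeRing 0ℓ 0ℓ}(h : Homomorphism R A) where
 private module R = CommutativeRing R
 open ListPolynomial R
 open CommutativeRing A
 open Homomorphism h
 open IntegerSolver A using (solve;_:=_;_:+_;_:*_)
 open Setoid-Reasoning setoid

 eval : Poly -> Carrier -> Carrier
 eval [] x = 0#
 eval (c ∷ f) x = ⟦ c ⟧ + x * eval f x

 eval-zero : ∀ f x -> (∀ n -> coef f n R.≈ R.0#) -> eval f x ≈ 0#
 eval-zero [] x f≈0 = refl
 eval-zero (c ∷ f) x f≈0 = trans
  (+-cong (trans (cong (f≈0 0)) 0-homo)(trans (*-congˡ (eval-zero f x (\n -> f≈0 (suc n))))(zeroʳ x)))
  (+-identityˡ 0#)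

 eval-coefs : ∀ f g x -> (∀ n -> coef f n R.≈ coef g n) -> eval f x ≈ eval g x
 eval-coefs [] g x p = sym (eval-zero g x (\n -> R.sym (p n)))
 eval-coefs (c ∷ f) [] x p = eval-zero (c ∷ f) x p
 eval-coefs (c ∷ f)(d ∷ g) x p =
  +-cong (cong (p 0))(*-congˡ (eval-coefs f g x (\n -> p (suc n))))

 eval-cong : ∀ {f g} x -> f ≈' g -> eval f x ≈ eval g x
 eval-cong {f}{g} x p = eval-coefs f g x (at p)

 eval-congʳ : ∀ f {x y} -> x ≈ y -> eval f x ≈ eval f y
 eval-congʳ [] p = refl
 eval-congʳ (c ∷ f) p = +-congˡ (*-cong p (eval-congʳ f p))

 eval-+ : ∀ f g x -> eval (f +' g) x ≈ eval f x + eval g x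
 eval-+ [] g x = sym (+-identityˡ _)
 eval-+ (c ∷ f) [] x = sym (+-identityʳ _)
 eval-+ (c ∷ f)(d ∷ g) x = trans (+-cong (+-homo c d)(*-congˡ (eval-+ f g x)))
  (solve 5 (\c d x f g -> c :+ d :+ x :* (f :+ g) := c :+ x :* f :+ (d :+ x :* g)) refl _ _ _ _ _)

 eval-· : ∀ a f x -> eval (a ·' f) x ≈ ⟦ a ⟧ * eval f x
 eval-· a [] x = sym (zeroʳ _)
 eval-· a (c ∷ f) x = trans (+-cong (*-homo a c)(*-congˡ (eval-· a f x)))
  (solve 4 (\a c x f -> a :* c :+ x :* (a :* f) := a :* (c :+ x :* f)) refl _ _ _ _)

 eval-* : ∀ f g x -> eval (f *' g) x ≈ eval f x * eval g x
 eval-* [] g x = sym (zeroˡ _)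
 eval-* (a ∷ f) g x = begin
  eval (a ·' g +' (R.0# ∷ f *' g)) x
  ≈⟨ eval-+ (a ·' g) _ x ⟩
  eval (a ·' g) x + (⟦ R.0# ⟧ + x * eval (f *' g) x)
  ≈⟨ +-cong (eval-· a g x)(+-cong 0-homo (*-congˡ (eval-* f g x))) ⟩
  ⟦ a ⟧ * eval g x + (0# + x * (eval f x * eval g x))
  ≈⟨ +-congˡ (+-identityˡ _) ⟩
  ⟦ a ⟧ * eval g x + x * (eval f x * eval g x)
  ≈⟨ solve 4 (\a x f g -> a :* g :+ x :* (f :* g) := (a :+ x :* f) :* g) refl _ _ _ _ ⟩
  (⟦ a ⟧ + x * eval f x) * eval g x ∎

 eval-const : ∀ c x -> eval (const c) x ≈ ⟦ c ⟧
 eval-const c x = trans (+-congˡ (zeroʳ x))(+-identityʳ _)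

module Roots (A : CommutativeRing 0ℓ 0ℓ) where
 open CommutativeRing A
 open IntegerSolver A using (solve;_:=_;_:+_;_:*_;_:-_;:1)
 open AbelianGroup +-abelianGroup renaming (x≈y⇒x∙y⁻¹≈ε to x≈y⇒x-y≈0;x∙y⁻¹≈ε⇒x≈y to x-y≈0⇒x≈y) using ()
 open Setoid-Reasoning setoid

 -- horner cs is the monic polynomial of degree length cs with lower coefficients cs.
 horner : List Carrier -> Carrier -> Carrier
 horner [] y = 1#
 horner (c ∷ cs) y = c + y * horner cs y

 ∏-roots : List Carrier -> Carrier -> Carrier
 ∏-roots [] y = 1#
 ∏-roots (r ∷ rs) y = (y - r) * ∏-roots rs y

 add-scaled : ∀ cs r ds -> length ds N.< length cs ->
  ∃[ es ] length es ≡ length cs × (∀ y -> horner es y ≈ horner cs y + r * horner ds y)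
 add-scaled (c ∷ cs) r [] _ = c + r ∷ cs , E.refl , \y ->
  solve 4 (\c r y m -> c :+ r :+ y :* m := c :+ y :* m :+ r :* :1) refl c r y _
 add-scaled (c ∷ cs) r (d ∷ ds)(N.s≤s lt) with add-scaled cs r ds lt
 ... | es , eq , h = c + r * d ∷ es , E.cong suc eq , \y -> trans (+-congˡ (*-congˡ (h y)))
  (solve 6 (\c r d y m n -> c :+ r :* d :+ y :* (m :+ r :* n) := c :+ y :* m :+ r :* (d :+ y :* n))
  refl c r d y _ _)

 factor : ∀ c cs r -> ∃[ ds ] length ds ≡ length cs ×
  (∀ y -> horner (c ∷ cs) y - horner (c ∷ cs) r ≈ (y - r) * horner ds y)
 factor c [] r = [] , E.refl , \y ->
  solve 3 (\c y r -> c :+ y :* :1 :- (c :+ r :* :1) := (y :- r) :* :1) refl c y r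
 factor c (d ∷ cs) r with factor d cs r
 ... | ds , eq , h with add-scaled (d ∷ cs) r ds (≡⇒≤ (E.cong suc eq))
 ... | es , eq' , h' = es , eq' , \y -> begin
  c + y * horner (d ∷ cs) y - (c + r * horner (d ∷ cs) r)
  ≈⟨ solve 5 (\c y r m n -> c :+ y :* m :- (c :+ r :* n) := (y :- r) :* m :+ r :* (m :- n))
  refl c y r _ _ ⟩
  (y - r) * horner (d ∷ cs) y + r * (horner (d ∷ cs) y - horner (d ∷ cs) r)
  ≈⟨ +-congˡ (*-congˡ (h y)) ⟩
  (y - r) * horner (d ∷ cs) y + r * ((y - r) * horner ds y)
  ≈⟨ solve 4 (\z m r n -> z :* m :+ r :* (z :* n) := z :* (m :+ r :* n)) refl (y - r) _ r _ ⟩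
  (y - r) * (horner (d ∷ cs) y + r * horner ds y)
  ≈⟨ *-congˡ (h' y) ⟨
  (y - r) * horner es y ∎

 module _ (1≉0 : ¬ 1# ≈ 0#)(cancel : ∀ x y -> x * y ≈ 0# -> ¬ x ≈ 0# -> y ≈ 0#) where
  Distinct : List Carrier -> Set
  Distinct = AllPairs (\r s -> ¬ r ≈ s)

  horner≈∏-roots : ∀ cs rs -> length rs ≡ length cs -> Distinct rs ->
   All (\r -> horner cs r ≈ 0#) rs -> ∀ y -> horner cs y ≈ ∏-roots rs y
  horner≈∏-roots [] [] _ _ _ y = refl
  horner≈∏-roots (c ∷ cs)(r ∷ rs) eq (≉ ∷ ds)(z ∷ zs) y with factor c cs r
  ... | es , eq' , h = trans (split y)
   (*-congˡ (horner≈∏-roots es rs (E.trans (N.suc-injective eq)(E.sym eq')) ds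
   (All.zipWith (\{ (r≉s , z') -> cancel _ _ (trans (sym (split _)) z')
   (\s-r≈0 -> r≉s (sym (x-y≈0⇒x≈y _ _ s-r≈0))) })(≉ , zs)) y))
   where
   split : ∀ y -> horner (c ∷ cs) y ≈ (y - r) * horner es y
   split y = trans (solve 1 (\m -> m := m :- (:1 :- :1)) refl _)
    (trans (+-congˡ (-‿cong (trans (x≈y⇒x-y≈0 refl)(sym z))))(h y))

  ∏-roots-zero : ∀ rs y -> ∏-roots rs y ≈ 0# -> ¬ All (\r -> ¬ r ≈ y) rs
  ∏-roots-zero [] y e _ = 1≉0 e
  ∏-roots-zero (r ∷ rs) y e (≉ ∷ hs) =
   ∏-roots-zero rs y (cancel _ _ e (\y-r≈0 -> ≉ (sym (x-y≈0⇒x≈y _ _ y-r≈0)))) hs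

  distinct-roots-≤ : ∀ cs rs -> Distinct rs -> All (\r -> horner cs r ≈ 0#) rs -> length rs N.≤ length cs
  distinct-roots-≤ cs [] _ _ = N.z≤n
  distinct-roots-≤ [] (r ∷ rs) _ (z ∷ _) with () ← 1≉0 z
  distinct-roots-≤ (c ∷ cs)(r ∷ rs)(≉ ∷ ds)(z ∷ zs) with factor c cs r
  ... | es , eq' , h = N.s≤s (≤-tr (distinct-roots-≤ es rs ds
   (All.zipWith (\{ (r≉s , z') -> cancel _ _
   (trans (sym (h _))(trans (+-cong z' (-‿cong z))(-‿inverseʳ 0#)))
   (\s-r≈0 -> r≉s (sym (x-y≈0⇒x≈y _ _ s-r≈0))) })(≉ , zs)))(≡⇒≤ eq'))

module QuotientRing (A : CommutativeRing 0ℓ 0ℓ)(m : CommutativeRing.Carrier A) where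
 open CommutativeRing A
 open IntegerSolver A using (solve;_:=_;_:+_;_:*_;_:-_;:-_;:0)

 infix 4 _≡ₘ_

 record _≡ₘ_ (x y : Carrier) : Set where
  constructor multiple
  field
   factor : Carrier
   equation : x - y ≈ factor * m

 ≈⇒≡ₘ : ∀ {x y} -> x ≈ y -> x ≡ₘ y
 ≈⇒≡ₘ {x}{y} x≈y = multiple 0# (trans (+-congʳ x≈y)(trans (-‿inverseʳ y)(sym (zeroˡ m))))

 quotientRing : CommutativeRing 0ℓ 0ℓ
 quotientRing = record
  { Carrier = Carrier; _≈_ = _≡ₘ_; _+_ = _+_; _*_ = _*_; -_ = -_; 0# = 0#; 1# = 1#
  ; isCommutativeRing = record
  { isRing = record
  { +-isAbelianGroup = record
  { isGroup = record
  { isMonoid = record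
  { isSemigroup = record
  { isMagma = record
  { isEquivalence = record
  { refl = ≈⇒≡ₘ refl
  ; sym = \{ {x}{y}(multiple q e) -> multiple (- q)(trans
  (solve 2 (\x y -> y :- x := :- (x :- y)) refl x y)
  (trans (-‿cong e)(solve 2 (\q m -> :- (q :* m) := :- q :* m) refl q m))) }
  ; trans = \{ {x}{y}{z}(multiple q e)(multiple r e') -> multiple (q + r)(trans
  (solve 3 (\x y z -> x :- z := (x :- y) :+ (y :- z)) refl x y z)
  (trans (+-cong e e')(sym (distribʳ m q r)))) } }
  ; ∙-cong = \{ {x}{y}{u}{v}(multiple q e)(multiple r e') -> multiple (q + r)(trans
  (solve 4 (\x y u v -> (x :+ u) :- (y :+ v) := (x :- y) :+ (u :- v)) refl x y u v)
  (trans (+-cong e e')(sym (distribʳ m q r)))) } }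
  ; assoc = \x y z -> ≈⇒≡ₘ (+-assoc x y z) }
  ; identity = (\x -> ≈⇒≡ₘ (+-identityˡ x)) , (\x -> ≈⇒≡ₘ (+-identityʳ x)) }
  ; inverse = (\x -> ≈⇒≡ₘ (-‿inverseˡ x)) , (\x -> ≈⇒≡ₘ (-‿inverseʳ x))
  ; ⁻¹-cong = \{ {x}{y}(multiple q e) -> multiple (- q)(trans
  (solve 2 (\x y -> :- x :- :- y := :- (x :- y)) refl x y)
  (trans (-‿cong e)(solve 2 (\q m -> :- (q :* m) := :- q :* m) refl q m))) } }
  ; comm = \x y -> ≈⇒≡ₘ (+-comm x y) }
  ; *-cong = \{ {x}{y}{u}{v}(multiple q e)(multiple r e') -> multiple (q * u + y * r)(trans
  (solve 4 (\x y u v -> x :* u :- y :* v := (x :- y) :* u :+ y :* (u :- v)) refl x y u v)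
  (trans (+-cong (*-congʳ e)(*-congˡ e'))
  (solve 5 (\q m u y r -> q :* m :* u :+ y :* (r :* m) := (q :* u :+ y :* r) :* m) refl q m u y r))) }
  ; *-assoc = \x y z -> ≈⇒≡ₘ (*-assoc x y z)
  ; *-identity = (\x -> ≈⇒≡ₘ (*-identityˡ x)) , (\x -> ≈⇒≡ₘ (*-identityʳ x))
  ; distrib = (\x y z -> ≈⇒≡ₘ (distribˡ x y z)) , (\x y z -> ≈⇒≡ₘ (distribʳ x y z)) }
  ; *-comm = \x y -> ≈⇒≡ₘ (*-comm x y) } }

record PrimeField (p : ℕ) : Set₁ where
 infixl 6 _+_
 infixl 7 _*_
 infix 8 -_
 infix 4 _≟_
 field
  Carrier : Set
  _+_ _*_ : Carrier -> Carrier -> Carrier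
  -_ : Carrier -> Carrier
  0# 1# : Carrier
  isCommutativeRing : IsCommutativeRing _≡_ _+_ _*_ -_ 0# 1#
  _≟_ : DecidableEquality Carrier
  1≢0 : 1# ≢ 0#
  inverse : ∀ {x} -> x ≢ 0# -> ∃[ y ] x * y ≡ 1#
  prime : Prime p

 ring : CommutativeRing 0ℓ 0ℓ
 ring = record { isCommutativeRing = isCommutativeRing }

 open RawSemiringDefinitions (Semiring.rawSemiring (CommutativeRing.semiring ring)) public using (_^_) renaming (_×_ to _·_)

 field
  elems : List Carrier
  elems-unique : Unique elems
  ∈-elems : ∀ x -> x ∈ elems
  length-elems : length elems ≡ p
  characteristic : p · 1# ≡ 0#
  fermat : ∀ x -> x ^ p ≡ x
  residue : Carrier -> ℕ
  residue-< : ∀ x -> residue x N.< p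
  residue-× : ∀ x -> residue x · 1# ≡ x
  ×-residue : ∀ {n} -> n N.< p -> residue (n · 1#) ≡ n

module FieldPolynomials {p}(F : PrimeField p) where

 module K where
  open PrimeField F public
  open CommutativeRing ring public hiding (Carrier;_+_;_*_;-_;0#;1#;isCommutativeRing;ring)

  *-cancel : ∀ {x y} -> x * y ≡ 0# -> x ≢ 0# -> y ≡ 0#
  *-cancel {x}{y} xy≡0 x≢0 with inverse x≢0
  ... | z , xz≡1 = E.trans (E.sym (*-identityˡ y))(E.trans (E.cong (_* y)(E.trans (E.sym xz≡1)(*-comm x z)))
   (E.trans (*-assoc z x y)(E.trans (E.cong (z *_) xy≡0)(zeroʳ z))))

 open K using (0#;1#) renaming (Carrier to 𝕂;_+_ to _+ᴷ_;_*_ to _*ᴷ_;-_ to -ᴷ_) public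
 open ListPolynomial K.ring public
 private module S = PowerSeries K.ring
 module P = CommutativeRing polyRing
 open P using (_-_)
 module PS = IntegerSolver polyRing
 module KS = IntegerSolver K.ring

 Bounded : ℕ -> Poly -> Set
 Bounded n f = ∀ k -> n N.≤ k -> coef f k ≡ 0#

 record Monic (n : ℕ)(f : Poly) : Set where
  constructor monic
  field
   leading : coef f n ≡ 1#
   bounded : Bounded (suc n) f
 open Monic public

 Bounded-cong : ∀ {n f g} -> f ≈' g -> Bounded n f -> Bounded n g
 Bounded-cong f≈g b k n≤k = E.trans (E.sym (at f≈g k))(b k n≤k)

 Bounded-length : ∀ f -> Bounded (length f) f
 Bounded-length [] k _ = E.refl
 Bounded-length (c ∷ f)(suc k)(N.s≤s le) = Bounded-length f k le

 Bounded-+ : ∀ {n} f g -> Bounded n f -> Bounded n g -> Bounded n (f +' g)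
 Bounded-+ f g bf bg k le = E.trans (coef-+ f g k)
  (E.trans (cong₂ _+ᴷ_ (bf k le)(bg k le))(K.+-identityˡ 0#))

 Bounded-mono : ∀ {m n} f -> m N.≤ n -> Bounded m f -> Bounded n f
 Bounded-mono f m≤n b k le = b k (≤-tr m≤n le)

 series-leading : ∀ m n (f g : S.Series) -> (∀ k -> m N.< k -> f k ≡ 0#) -> (∀ k -> n N.< k -> g k ≡ 0#) ->
  (f S.⊛ g)(m N.+ n) ≡ f m *ᴷ g n × (∀ k -> m N.+ n N.< k -> (f S.⊛ g) k ≡ 0#)
 series-leading zero n f g bf bg = top n , above
  where
  single : ∀ k -> (f S.⊛ g) k ≡ f 0 *ᴷ g k
  single zero = E.refl
  single (suc k) = E.trans (E.cong (f 0 *ᴷ g (suc k) +ᴷ_)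
   (E.trans (S.⊛-cong {g = g}(\i -> bf (suc i)(N.s≤s N.z≤n))(\_ -> E.refl) k)(S.⊛-zeroˡ g k)))
   (K.+-identityʳ _)
  top : ∀ k -> (f S.⊛ g) k ≡ f 0 *ᴷ g k
  top = single
  above : ∀ k -> n N.< k -> (f S.⊛ g) k ≡ 0#
  above k n<k = E.trans (single k)(E.trans (E.cong (f 0 *ᴷ_)(bg k n<k))(K.zeroʳ _))
 series-leading (suc m) n f g bf bg with series-leading m n (\k -> f (suc k)) g
  (\k m<k -> bf (suc k)(N.s≤s m<k)) bg
 ... | top , above = E.trans (vanish (suc (m N.+ n)) _ (N.s≤s (N.m≤n+m n m))) top , above'
  where
  vanish : ∀ k x -> n N.< k -> f 0 *ᴷ g k +ᴷ x ≡ x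
  vanish k x n<k = E.trans (E.cong (_+ᴷ x)(E.trans (E.cong (f 0 *ᴷ_)(bg k n<k))(K.zeroʳ _)))(K.+-identityˡ x)
  above' : ∀ k -> suc m N.+ n N.< k -> (f S.⊛ g) k ≡ 0#
  above' (suc k)(N.s≤s lt) =
   E.trans (vanish (suc k) _ (≤-tr (N.s≤s (N.m≤n+m n m))(N.m≤n⇒m≤1+n lt)))(above k lt)

 leading-* : ∀ {m n} f g -> Bounded (suc m) f -> Bounded (suc n) g ->
  coef (f *' g)(m N.+ n) ≡ coef f m *ᴷ coef g n
 leading-* {m}{n} f g bf bg = E.trans (coef-* f g (m N.+ n))(fst (series-leading m n (coef f)(coef g) bf bg))

 Bounded-* : ∀ {m n} f g -> Bounded (suc m) f -> Bounded (suc n) g -> Bounded (suc (m N.+ n))(f *' g)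
 Bounded-* {m}{n} f g bf bg k le =
  E.trans (coef-* f g k)(snd (series-leading m n (coef f)(coef g) bf bg) k le)

 Monic-* : ∀ {m n f g} -> Monic m f -> Monic n g -> Monic (m N.+ n)(f *' g)
 Monic-* {f = f}{g}(monic lf bf)(monic lg bg) = monic
  (E.trans (leading-* f g bf bg)(E.trans (cong₂ _*ᴷ_ lf lg)(K.*-identityˡ 1#)))(Bounded-* f g bf bg)

 Monic-cong : ∀ {n f g} -> f ≈' g -> Monic n f -> Monic n g
 Monic-cong {n} f≈g (monic l b) = monic (E.trans (E.sym (at f≈g n)) l)(Bounded-cong f≈g b)

 Monic-1 : Monic 0 (const 1#)
 Monic-1 = monic E.refl \{ (suc k) _ -> E.refl }

 Bounded-· : ∀ {n} c f -> Bounded n f -> Bounded n (c ·' f)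
 Bounded-· c f b k le = E.trans (coef-· c f k)(E.trans (E.cong (c *ᴷ_)(b k le))(K.zeroʳ c))

 tail : Poly -> Poly
 tail [] = []
 tail (_ ∷ f) = f

 coef-tail : ∀ f n -> coef (tail f) n ≡ coef f (suc n)
 coef-tail [] n = E.refl
 coef-tail (c ∷ f) n = E.refl

 low : ℕ -> Poly -> Poly
 low zero f = []
 low (suc n) f = coef f 0 ∷ low n (tail f)

 length-low : ∀ n f -> length (low n f) ≡ n
 length-low zero f = E.refl
 length-low (suc n) f = E.cong suc (length-low n (tail f))

 tail-cong : ∀ {f g} -> f ≈' g -> tail f ≈' tail g
 tail-cong {f}{g} p = coefs \n -> E.trans (coef-tail f n)(E.trans (at p (suc n))(E.sym (coef-tail g n)))

 low-cong : ∀ n {f g} -> f ≈' g -> low n f ≡ low n g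
 low-cong zero p = E.refl
 low-cong (suc n) p = cong₂ _∷_ (at p 0)(low-cong n (tail-cong p))

 low-length : ∀ f -> low (length f) f ≡ f
 low-length [] = E.refl
 low-length (c ∷ f) = E.cong (c ∷_)(low-length f)

 Bounded⇒≈low : ∀ n f -> Bounded n f -> f ≈' low n f
 Bounded⇒≈low n f b = coefs (go n f b)
  where
  go : ∀ n f -> Bounded n f -> ∀ k -> coef f k ≡ coef (low n f) k
  go zero f b k = b k N.z≤n
  go (suc n) f b zero = E.refl
  go (suc n) f b (suc k) = E.trans (E.sym (coef-tail f k))
   (go n (tail f)(\i le -> E.trans (coef-tail f i)(b (suc i)(N.s≤s le))) k)

 mon : List 𝕂 -> Poly
 mon cs = cs ++ 1# ∷ []

 mon-monic : ∀ cs -> Monic (length cs)(mon cs)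
 mon-monic [] = Monic-1
 mon-monic (c ∷ cs) with mon-monic cs
 ... | monic l b = monic l \{ (suc k)(N.s≤s le) -> b k le }

 Monic⇒≈mon : ∀ n f -> Monic n f -> f ≈' mon (low n f)
 Monic⇒≈mon n f m = coefs (go n f m)
  where
  go : ∀ n f -> Monic n f -> ∀ k -> coef f k ≡ coef (mon (low n f)) k
  go zero f (monic l b) zero = l
  go zero f (monic l b)(suc k) = b (suc k)(N.s≤s N.z≤n)
  go (suc n) f m zero = E.refl
  go (suc n) f (monic l b)(suc k) = E.trans (E.sym (coef-tail f k))
   (go n (tail f)(monic (E.trans (coef-tail f n) l)
   (\i le -> E.trans (coef-tail f i)(b (suc i)(N.s≤s le)))) k)

 low-mon : ∀ cs -> low (length cs)(mon cs) ≡ cs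
 low-mon [] = E.refl
 low-mon (c ∷ cs) = E.cong (c ∷_)(low-mon cs)

 data DegreeView (f : Poly) : Set where
  null : f ≈' [] -> DegreeView f
  degree : ∀ n -> coef f n ≢ 0# -> Bounded (suc n) f -> DegreeView f

 degreeView : ∀ f -> DegreeView f
 degreeView [] = null P.refl
 degreeView (c ∷ f) with degreeView f
 ... | degree n l b = degree (suc n) l \{ (suc k)(N.s≤s le) -> b k le }
 ... | null f≈0 with c K.≟ 0#
 ... | yes c≡0 = null (coefs \{ zero -> c≡0; (suc k) -> at f≈0 k })
 ... | no c≢0 = degree 0 c≢0 \{ (suc k) _ -> at f≈0 k }

 *-nonzero : ∀ f g -> f *' g ≈' [] -> ¬ f ≈' [] -> g ≈' []
 *-nonzero f g fg≈0 f≉0 with degreeView f | degreeView g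
 ... | null f≈0 | _ = contradiction f≈0 f≉0
 ... | degree _ _ _ | null g≈0 = g≈0
 ... | degree m l b | degree n l' b' = contradiction
  (K.*-cancel (E.trans (E.sym (leading-* f g b b'))(at fg≈0 (m N.+ n))) l) l'

 Bounded-0 : ∀ {f} -> Bounded 0 f -> f ≈' []
 Bounded-0 b = coefs \k -> b k N.z≤n

 Monic-multiple : ∀ {d g} -> Monic d g -> ∀ h -> Bounded d (h *' g) -> h ≈' []
 Monic-multiple {d}{g}(monic l b) h hb with degreeView h
 ... | null h≈0 = h≈0
 ... | degree n l' b' = contradiction (E.trans (E.sym (E.trans (leading-* h g b' b)
  (E.trans (E.cong (coef h n *ᴷ_) l)(K.*-identityʳ _))))(hb (n N.+ d)(N.m≤n+m d n))) l'

 infix 4 _∣'_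

 record _∣'_ (g f : Poly) : Set where
  constructor factors
  field
   quotient : Poly
   equality : f ≈' quotient *' g

 record Division (f g : Poly)(d : ℕ) : Set where
  constructor division
  field
   quot rem : Poly
   decompose : f ≈' quot *' g +' rem
   small : Bounded d rem

 shift-≈ : ∀ c f -> c ∷ f ≈' const c +' X *' f
 shift-≈ c f = coefs \
  { zero -> E.sym (E.trans (coef-+ (const c)(X *' f) 0)(E.trans (E.cong (c +ᴷ_)
  (E.trans (coef-* X f 0)(K.zeroˡ _)))(K.+-identityʳ c)))
  ; (suc k) -> E.sym (E.trans (coef-+ (const c)(X *' f)(suc k))(E.trans (K.+-identityˡ _)
  (E.trans (coef-* X f (suc k))(E.trans (cong₂ _+ᴷ_ (K.zeroˡ (coef f (suc k)))
  (E.trans (S.⊛-cong coef-1 (\_ -> E.refl) k)(S.⊛-identityˡ (coef f) k)))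
  (K.+-identityˡ _))))) }

 ·≈const* : ∀ c f -> c ·' f ≈' const c *' f
 ·≈const* c f = coefs \n -> E.sym (E.trans (coef-+ (c ·' f)(0# ∷ []) n)
  (E.trans (E.cong (coef (c ·' f) n +ᴷ_)(zeros n))(K.+-identityʳ _)))
  where
  zeros : ∀ n -> coef (0# ∷ []) n ≡ 0#
  zeros zero = E.refl
  zeros (suc n) = E.refl

 divide : ∀ {d g} -> Monic d g -> ∀ f -> Division f g d
 divide m [] = division [] [] P.refl (\_ _ -> E.refl)
 divide {d}{g} m@(monic l b)(c ∷ f) with divide m f
 ... | division q r e s = division (const t +' X *' q)((c ∷ r) - t ·' g) eq small'
  where
  t = coef (c ∷ r) d
  eq : c ∷ f ≈' (const t +' X *' q) *' g +' ((c ∷ r) - t ·' g)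
  eq = P.trans (shift-≈ c f)(P.trans (P.+-congˡ {const c}(P.*-congˡ {X} e))
   (P.trans (PS.solve 6 (\c x q g r t -> c PS.:+ x PS.:* (q PS.:* g PS.:+ r)
   PS.:= (t PS.:+ x PS.:* q) PS.:* g PS.:+ ((c PS.:+ x PS.:* r) PS.:- t PS.:* g))
   P.refl (const c) X q g r (const t))
   (P.+-congˡ {(const t +' X *' q) *' g}(P.+-cong (P.sym (shift-≈ c r))(P.-‿cong (P.sym (·≈const* t g)))))))
  small' : Bounded d ((c ∷ r) - t ·' g)
  small' k d≤k = E.trans (coef-+ (c ∷ r)(-' (t ·' g)) k)
   (E.trans (E.cong (coef (c ∷ r) k +ᴷ_)(E.trans (coef-- (t ·' g) k)(E.cong -ᴷ_ (coef-· t g k))))(rest k d≤k))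
   where
   rest : ∀ k -> d N.≤ k -> coef (c ∷ r) k +ᴷ (-ᴷ (t *ᴷ coef g k)) ≡ 0#
   rest k d≤k with N.m≤n⇒m<n∨m≡n d≤k
   ... | inr E.refl = E.trans (E.cong (\x -> t +ᴷ (-ᴷ (t *ᴷ x))) l)
    (E.trans (E.cong (\x -> t +ᴷ (-ᴷ x))(K.*-identityʳ t))(K.-‿inverseʳ t))
   rest (suc k) _ | inl (N.s≤s d≤k) =
    E.trans (cong₂ (\x y -> x +ᴷ (-ᴷ (t *ᴷ y)))(s k d≤k)(b (suc k)(N.s≤s d≤k)))
    (KS.solve 1 (\t -> KS.:0 KS.:- t KS.:* KS.:0 KS.:= KS.:0) E.refl t)

 null? : ∀ f -> Dec (f ≈' [])
 null? f with degreeView f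
 ... | null f≈0 = yes f≈0
 ... | degree n l _ = no \f≈0 -> l (at f≈0 n)

 rem-zero : ∀ {d g} -> Monic d g -> ∀ q r -> Bounded d r -> g ∣' q *' g +' r -> r ≈' []
 rem-zero {d}{g} m q r s (factors q' e) = P.trans r≈ (P.trans (P.*-congʳ {g} h≈0) P.refl)
  where
  r≈ : r ≈' (q' - q) *' g
  r≈ = P.trans (PS.solve 3 (\q g r -> r PS.:= (q PS.:* g PS.:+ r) PS.:- q PS.:* g) P.refl q g r)
   (P.trans (P.+-congʳ { -' (q *' g)} e)
   (PS.solve 3 (\q' q g -> q' PS.:* g PS.:- q PS.:* g PS.:= (q' PS.:- q) PS.:* g) P.refl q' q g))
  h≈0 : q' - q ≈' []
  h≈0 = Monic-multiple m (q' - q)(Bounded-cong r≈ s)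

 ∣'-cong : ∀ {g f f'} -> f ≈' f' -> g ∣' f -> g ∣' f'
 ∣'-cong p (factors q e) = factors q (P.trans (P.sym p) e)

 abstract
  divides? : ∀ {d g} -> Monic d g -> ∀ f -> Dec (g ∣' f)
  divides? {g = g} m f with divide m f
  ... | division q r e s with null? r
  ... | yes r≈0 = yes (factors q (P.trans e (P.trans (P.+-congˡ {q *' g} r≈0)(P.+-identityʳ _))))
  ... | no r≉0 = no \g∣f -> r≉0 (rem-zero m q r s (∣'-cong e g∣f))

 open Enumeration using (tuples;tuples-unique;∈-tuples⁺;∈-tuples⁻;length-tuples)

 ∣'-congˡ : ∀ {g g' f} -> g ≈' g' -> g ∣' f -> g' ∣' f
 ∣'-congˡ p (factors q e) = factors q (P.trans e (P.*-congˡ {q} p))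

 ∣'-trans : ∀ {f g h} -> f ∣' g -> g ∣' h -> f ∣' h
 ∣'-trans {f}(factors q e)(factors r e') =
  factors (r *' q)(P.trans e' (P.trans (P.*-congˡ {r} e)(P.sym (P.*-assoc r q f))))

 ∣'-refl : ∀ {f} -> f ∣' f
 ∣'-refl = factors (const 1#)(P.sym (P.*-identityˡ _))

 ∣'-*ˡ : ∀ {f g} h -> f ∣' g -> f ∣' h *' g
 ∣'-*ˡ {f} h (factors q e) = factors (h *' q)(P.trans (P.*-congˡ {h} e)(P.sym (P.*-assoc h q f)))

 ∣'-+ : ∀ {f g h} -> f ∣' g -> f ∣' h -> f ∣' g +' h
 ∣'-+ {f}(factors q e)(factors r e') =
  factors (q +' r)(P.trans (P.+-cong e e')(P.sym (P.distribʳ f q r)))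

 ∣'-0 : ∀ {f} -> f ∣' []
 ∣'-0 = factors [] P.refl

 record Irreducible (n : ℕ)(f : Poly) : Set where
  constructor irreducible
  field
   positive : 0 N.< n
   isMonic : Monic n f
   noFactor : ∀ {d g} -> 0 N.< d -> d N.< n -> Monic d g -> ¬ g ∣' f
 open Irreducible public

 degree-< : ∀ {k n f} -> coef f k ≢ 0# -> Bounded n f -> k N.< n
 degree-< {k}{n} l b with k N.<? n
 ... | yes k<n = k<n
 ... | no k≮n = contradiction (b k (N.≮⇒≥ k≮n)) l

 normalise : ∀ {k f} -> coef f k ≢ 0# -> Bounded (suc k) f -> ∃[ c ] Monic k (const c *' f)
 normalise {k}{f} l b with K.inverse l
 ... | c , lc≡1 = c , Monic-cong (·≈const* c f)
  (monic (E.trans (coef-· c f k)(E.trans (K.*-comm c _) lc≡1))(Bounded-· c f b))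

 Monic-0 : ∀ {f} -> Monic 0 f -> f ≈' const 1#
 Monic-0 {f} m = Monic⇒≈mon 0 f m

 bezout : ∀ {s P} -> Irreducible s P -> ∀ n f -> Bounded n f -> n N.≤ s -> ¬ P ∣' f ->
  ∃[ u ] ∃[ v ] u *' P +' v *' f ≈' const 1#
 bezout irr zero f b _ P∤f = contradiction (∣'-cong (P.sym (Bounded-0 b)) ∣'-0) P∤f
 bezout {s}{Q} irr (suc n) f b n<s P∤f with degreeView f
 ... | null f≈0 = contradiction (∣'-cong (P.sym f≈0) ∣'-0) P∤f
 ... | degree k l b' with normalise {k}{f} l b'
 ... | c , m with k in k≡
 ... | zero = [] , const c , Monic-0 m
 ... | suc k' with divide m Q
 ... | division q r e small = result (bezout irr n r (Bounded-mono r k≤n small)(N.<⇒≤ n<s) P∤r)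
  where
  k≤n : suc k' N.≤ n
  k≤n = N.s≤s⁻¹ (degree-< {f = f} l b)
  g = const c *' f
  P∤r : ¬ Q ∣' r
  P∤r (factors h e') = noFactor irr (s≤s z≤n)(N.≤-<-trans k≤n n<s) m
   (factors q (P.trans e (P.trans (P.+-congˡ {q *' g} r≈0)(P.+-identityʳ _))))
   where
   r≈0 : r ≈' []
   r≈0 = P.trans e' (P.*-congʳ {Q}(Monic-multiple (isMonic irr) h
    (Bounded-cong e' (Bounded-mono r (≤-tr k≤n (N.<⇒≤ n<s)) small))))
  result : ∃[ u ] ∃[ v ] u *' Q +' v *' r ≈' const 1# -> ∃[ u ] ∃[ v ] u *' Q +' v *' f ≈' const 1#
  result (u , v , h) = u +' v , -' (v *' q *' const c) , P.trans
   (PS.solve 6 (\u v Q q c f -> (u PS.:+ v) PS.:* Q PS.:+ (PS.:- (v PS.:* q PS.:* c)) PS.:* f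
   PS.:= u PS.:* Q PS.:+ v PS.:* (Q PS.:- q PS.:* (c PS.:* f))) P.refl u v Q q (const c) f)
   (P.trans (P.+-congˡ {u *' Q}(P.*-congˡ {v}(P.trans (P.+-congʳ { -' (q *' g)} e)
   (PS.solve 2 (\x r -> x PS.:+ r PS.:- x PS.:= r) P.refl (q *' g) r)))) h)

 euclid : ∀ {s P} -> Irreducible s P -> ∀ f g -> P ∣' f *' g -> ¬ P ∣' f -> P ∣' g
 euclid {s}{Q} irr f g Q∣fg Q∤f with divide (isMonic irr) f
 ... | division q r e small with bezout irr s r small N.≤-refl
  (\Q∣r -> Q∤f (∣'-cong (P.sym e)(∣'-+ (∣'-*ˡ q ∣'-refl) Q∣r)))
 ... | u , v , h = ∣'-cong (P.trans (P.sym eq)(P.trans (P.*-congʳ {g} h)(P.*-identityˡ g)))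
  (∣'-+ (∣'-*ˡ ((u - v *' q) *' g) ∣'-refl)(∣'-*ˡ v Q∣fg))
  where
  eq : (u *' Q +' v *' r) *' g ≈' (u - v *' q) *' g *' Q +' v *' (f *' g)
  eq = P.trans (PS.solve 6 (\u Q v r g q -> (u PS.:* Q PS.:+ v PS.:* r) PS.:* g PS.:=
   (u PS.:- v PS.:* q) PS.:* g PS.:* Q PS.:+ v PS.:* ((q PS.:* Q PS.:+ r) PS.:* g)) P.refl u Q v r g q)
   (P.+-congˡ {(u - v *' q) *' g *' Q}(P.*-congˡ {v}(P.*-congʳ {g}(P.sym e))))

 words : ℕ -> List (List 𝕂)
 words = tuples K.elems

 words-unique : ∀ n -> Unique (words n)
 words-unique = tuples-unique K.elems-unique

 ∈-words : ∀ cs -> cs ∈ words (length cs)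
 ∈-words cs = ∈-tuples⁺ (All.tabulate (\{c} _ -> K.∈-elems c))

 ∈-words-length : ∀ n {cs} -> length cs ≡ n -> cs ∈ words n
 ∈-words-length n {cs} e = subst (\k -> cs ∈ words k) e (∈-words cs)

 length-∈-words : ∀ n {cs} -> cs ∈ words n -> length cs ≡ n
 length-∈-words n cs∈ = fst (∈-tuples⁻ K.elems n cs∈)

 length-words : ∀ n -> length (words n) ≡ p N.^ n
 length-words n = E.trans (length-tuples K.elems n)(E.cong (N._^ n) K.length-elems)

 Reducible : ℕ -> Poly -> Set
 Reducible n f = ∃[ d ] ∃[ g ] 0 N.< d × d N.< n × Monic d g × g ∣' f

 mon-Monic : ∀ n {w} -> length w ≡ n -> Monic n (mon w)
 mon-Monic n {w} e = subst (\k -> Monic k (mon w)) e (mon-monic w)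

 irreducible-or-factor : ∀ {n f} -> 0 N.< n -> Monic n f -> Irreducible n f ⊎ Reducible n f
 irreducible-or-factor {n}{f} 0<n m
  with any? (\d -> any? (\w -> (0 N.<? d) ×-dec divides? (mon-monic w) f)(words d))(upTo n)
 ... | yes h with find h
 ... | d , d∈ , h' with find h'
 ... | w , w∈ , 0<d , w∣f =
  inr (d , mon w , 0<d , ∈-upTo⁻ d∈ , mon-Monic d (length-∈-words d w∈) , w∣f)
 irreducible-or-factor {n}{f} 0<n m | no h = inl (irreducible 0<n m \{d}{g} 0<d d<n mg g∣f ->
  h (lose (∈-upTo⁺ d<n)(lose (∈-words-length d (length-low d g))
  (0<d , ∣'-congˡ (Monic⇒≈mon d g mg) g∣f))))

 abstract
  irreducible? : ∀ w -> Dec (Irreducible (length w)(mon w))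
  irreducible? w with 0 N.<? length w
  ... | no n≯0 = no \irr -> n≯0 (positive irr)
  ... | yes 0<n with irreducible-or-factor 0<n (mon-monic w)
  ... | inl irr = yes irr
  ... | inr (d , g , 0<d , d<n , m , g∣f) = no \irr -> noFactor irr 0<d d<n m g∣f

 irreducible-divisor : ∀ {n f} -> 0 N.< n -> Monic n f -> ∃[ s ] ∃[ g ] Irreducible s g × g ∣' f
 irreducible-divisor {n} = go (N.<-wellFounded n)
  where
  go : ∀ {n f} -> Acc N._<_ n -> 0 N.< n -> Monic n f -> ∃[ s ] ∃[ g ] Irreducible s g × g ∣' f
  go {n}{f}(acc rec) 0<n m with irreducible-or-factor 0<n m
  ... | inl irr = n , f , irr , ∣'-refl
  ... | inr (d , g , 0<d , d<n , m' , g∣f) with go (rec d<n) 0<d m'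
  ... | s , h , irr , h∣g = s , h , irr , ∣'-trans h∣g g∣f

 quotient-degree : ∀ {d N g f} -> Monic d g -> ∀ q -> f ≈' q *' g -> ¬ f ≈' [] -> Bounded (suc N) f ->
  ∃[ k ] coef q k ≢ 0# × Bounded (suc k) q × k N.+ d N.≤ N × coef f (k N.+ d) ≡ coef q k
 quotient-degree {d}{N}{g}{f}(monic l b) q e f≉0 bf with degreeView q
 ... | null q≈0 = contradiction (P.trans e (P.*-congʳ {g} q≈0)) f≉0
 ... | degree k l' b' = k , l' , b' , N.s≤s⁻¹ (degree-< {f = f}(\z -> l' (E.trans (E.sym top) z)) bf) , top
  where
  top : coef f (k N.+ d) ≡ coef q k
  top = E.trans (at e (k N.+ d))(E.trans (leading-* q g b' b)(E.trans (E.cong (coef q k K.*_) l)(K.*-identityʳ _)))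

 Monic-nonzero : ∀ {n f} -> Monic n f -> ¬ f ≈' []
 Monic-nonzero {n} m f≈0 = K.1≢0 (E.trans (E.sym (leading m))(at f≈0 n))

 Monic-quotient : ∀ {n d g f} -> Monic n f -> Monic d g -> ∀ q -> f ≈' q *' g -> ∃[ k ] k N.+ d ≡ n × Monic k q
 Monic-quotient {n}{d}{g}{f} mf mg q e
  with quotient-degree mg q e (Monic-nonzero mf)(bounded mf)
 ... | k , l' , b' , k+d≤n , top with N.m≤n⇒m<n∨m≡n k+d≤n
 ... | inr E.refl = k , E.refl , monic (E.trans (E.sym top)(leading mf)) b'
 ... | inl lt = contradiction (E.trans (E.sym (leading mf))(E.trans (at e n)
  (Bounded-* q g b' (bounded mg) n lt))) K.1≢0

 irreducible-∣⇒≈ : ∀ {s t P Q} -> Irreducible s P -> Irreducible t Q -> P ∣' Q -> P ≈' Q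
 irreducible-∣⇒≈ {s}{t}{A}{B} iA iB A∣B@(factors q e)
  with Monic-quotient (isMonic iB)(isMonic iA) q e
 ... | zero , E.refl , mq = P.sym (P.trans e (P.trans (P.*-congʳ {A}(Monic-0 mq))(P.*-identityˡ A)))
 ... | suc k , E.refl , mq = contradiction A∣B
  (noFactor iB (positive iA)(N.m<n+m s (s≤s z≤n))(isMonic iA))

 mon-injective : ∀ v w -> Monic (length v)(mon w) -> mon v ≈' mon w -> v ≡ w
 mon-injective v w m e with N.<-cmp (length v)(length w)
 ... | tri≈ _ eq _ = E.trans (E.sym (low-mon v))(E.trans (low-cong (length v) e)
  (E.trans (E.cong (\n -> low n (mon w)) eq)(low-mon w)))
 ... | tri< lt _ _ = contradiction (E.trans (E.sym (leading (mon-monic w)))(bounded m (length w) lt)) K.1≢0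
 ... | tri> _ _ gt = contradiction (E.trans (E.sym (leading m))(bounded (mon-monic w)(length v) gt)) K.1≢0

 IrreducibleWord : List 𝕂 -> Set
 IrreducibleWord w = Irreducible (length w)(mon w)

 irreducible-word-∣⇒≡ : ∀ {v w} -> IrreducibleWord v -> IrreducibleWord w -> mon v ∣' mon w -> v ≡ w
 irreducible-word-∣⇒≡ {v}{w} iv iw v∣w = mon-injective v w (Monic-cong e (isMonic iv)) e
  where e = irreducible-∣⇒≈ iv iw v∣w

 Σ-degree-≤ : ∀ {N f} ws -> Unique ws -> All IrreducibleWord ws -> All (\w -> mon w ∣' f) ws ->
  ¬ f ≈' [] -> Bounded (suc N) f -> sum (map length ws) N.≤ N
 Σ-degree-≤ [] _ _ _ _ _ = z≤n
 Σ-degree-≤ {N}{f}(w ∷ ws)(w∉ ∷ u)(iw ∷ is)(factors q e ∷ ds) f≉0 b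
  with quotient-degree (isMonic iw) q e f≉0 b
 ... | k , l' , b' , k+d≤N , top = ≤-tr (N.+-monoʳ-≤ (length w)
  (Σ-degree-≤ {k}{q} ws u is (All.tabulate dq)(\q≈0 -> l' (at q≈0 k)) b'))
  (subst (N._≤ N)(N.+-comm k (length w)) k+d≤N)
  where
  dq : ∀ {v} -> v ∈ ws -> mon v ∣' q
  dq {v} v∈ = euclid (All.lookup is v∈)(mon w) q
   (∣'-cong (P.trans e (P.*-comm q (mon w)))(All.lookup ds v∈))
   (\v∣w -> All.lookup w∉ v∈ (E.sym (irreducible-word-∣⇒≡ (All.lookup is v∈) iw v∣w)))

 open Exp P.commutativeSemiring public using () renaming (_^_ to _^'_;^-homo-* to ^'-homo-*;^-congˡ to ^'-congˡ;^-distrib-* to ^'-distrib-*;^-assocʳ to ^'-assocʳ)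

 Monic-^ : ∀ {n f} -> Monic n f -> ∀ i -> Monic (i N.* n)(f ^' i)
 Monic-^ m zero = Monic-1
 Monic-^ m (suc i) = Monic-* m (Monic-^ m i)

 abstract
  _≟ʷ_ : (v w : List 𝕂) -> Dec (v ≡ w)
  _≟ʷ_ = ≡-dec K._≟_

 allWords : ℕ -> List (List 𝕂)
 allWords zero = []
 allWords (suc N) = words N ++ allWords N

 ∈-allWords⁻ : ∀ N {w} -> w ∈ allWords N -> length w N.< N
 ∈-allWords⁻ (suc N) w∈ with ∈-++⁻ (words N) w∈
 ... | inl h = s≤s (≡⇒≤ (length-∈-words N h))
 ... | inr h = N.m<n⇒m<1+n (∈-allWords⁻ N h)

 ∈-allWords⁺ : ∀ N {w} -> length w N.< N -> w ∈ allWords N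
 ∈-allWords⁺ (suc N)(s≤s le) with N.m≤n⇒m<n∨m≡n le
 ... | inl lt = ∈-++⁺ʳ (words N)(∈-allWords⁺ N lt)
 ... | inr eq = ∈-++⁺ˡ (∈-words-length N eq)

 allWords-unique : ∀ N -> Unique (allWords N)
 allWords-unique zero = []
 allWords-unique (suc N) = Unique.++⁺ (words-unique N)(allWords-unique N)
  \{ (a , b) -> N.<-irrefl (length-∈-words N a)(∈-allWords⁻ N b) }

 irreds : ℕ -> List (List 𝕂)
 irreds N = filter irreducible? (allWords N)

 irreds-unique : ∀ N -> Unique (irreds N)
 irreds-unique N = Unique.filter⁺ irreducible? (allWords-unique N)

 ∈-irreds⁻ : ∀ N {w} -> w ∈ irreds N -> length w N.< N × IrreducibleWord w
 ∈-irreds⁻ N w∈ with ∈-filter⁻ irreducible? {xs = allWords N} w∈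
 ... | a , b = ∈-allWords⁻ N a , b

 ∈-irreds⁺ : ∀ N {w} -> length w N.< N -> IrreducibleWord w -> w ∈ irreds N
 ∈-irreds⁺ N lt irr = ∈-filter⁺ irreducible? (∈-allWords⁺ N lt) irr

 abstract
  power∣? : ∀ w i f -> Dec (mon w ^' suc i ∣' f)
  power∣? w i f = divides? (Monic-^ (mon-monic w)(suc i)) f

 -- multiplicity N w f is the exponent of mon w in f, provided that f has degree below N.
 multiplicity : ℕ -> List 𝕂 -> Poly -> ℕ
 multiplicity N w f = ℕΣ.Σ (upTo N)(\i -> ℕΣ.[ power∣? w i f ])

 *'-cancelˡ : ∀ {n f g h} -> Monic n f -> f *' g ≈' f *' h -> g ≈' h
 *'-cancelˡ {f = f}{g}{h} m e = x-y≈0⇒x≈y g h (*-nonzero f (g P.- h)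
  (P.trans (PS.solve 3 (\f g h -> f PS.:* (g PS.:- h) PS.:= f PS.:* g PS.:- f PS.:* h) P.refl f g h)
  (x≈y⇒x-y≈0 e))(Monic-nonzero m))
  where
  open AbelianGroup P.+-abelianGroup renaming (x≈y⇒x∙y⁻¹≈ε to x≈y⇒x-y≈0;x∙y⁻¹≈ε⇒x≈y to x-y≈0⇒x≈y) using ()

 ∣'-cancel : ∀ {n f} -> Monic n f -> ∀ {g h} -> f *' g ∣' f *' h -> g ∣' h
 ∣'-cancel {f = f} m {g}{h}(factors q e) = factors q (*'-cancelˡ {g = h}{q *' g} m
  (P.trans e (PS.solve 3 (\f q g -> q PS.:* (f PS.:* g) PS.:= f PS.:* (q PS.:* g)) P.refl f q g)))

 ∣'-*-mono : ∀ f {g h} -> g ∣' h -> f *' g ∣' f *' h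
 ∣'-*-mono f {g}(factors q e) = factors q (P.trans (P.*-congˡ {f} e)
  (PS.solve 3 (\f q g -> f PS.:* (q PS.:* g) PS.:= q PS.:* (f PS.:* g)) P.refl f q g))

 ∣'-degree : ∀ {d n g f} -> Monic d g -> Monic n f -> g ∣' f -> d N.≤ n
 ∣'-degree mg mf (factors q e) with Monic-quotient mf mg q e
 ... | k , E.refl , _ = N.m≤n+m _ k

 irreducible-∤1 : ∀ {w} -> IrreducibleWord w -> ∀ {f} -> f ≈' const 1# -> ¬ mon w ∣' f
 irreducible-∤1 irr f≈1 w∣f = N.<⇒≱ (positive irr)(∣'-degree (isMonic irr)(Monic-cong (P.sym f≈1) Monic-1) w∣f)

 power-coprime : ∀ {v w} -> IrreducibleWord v -> IrreducibleWord w -> v ≢ w -> ∀ i q ->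
  mon v ^' i ∣' mon w *' q -> mon v ^' i ∣' q
 power-coprime {v}{w} iv iw v≢w zero q _ = factors q (P.sym (P.*-identityʳ q))
 power-coprime {v}{w} iv iw v≢w (suc i) q h = step (euclid iv (mon w) q (∣'-trans {g = mon v ^' suc i} v∣ h)
  (\d -> v≢w (irreducible-word-∣⇒≡ iv iw d)))
  where
  v∣ : mon v ∣' mon v ^' suc i
  v∣ = factors (mon v ^' i)(P.*-comm (mon v)(mon v ^' i))
  step : mon v ∣' q -> mon v ^' suc i ∣' q
  step (factors r e) = ∣'-cong {f = mon v *' r}{q}(P.trans (P.*-comm (mon v) r)(P.sym e))
   (∣'-*-mono (mon v)(power-coprime iv iw v≢w i r
   (∣'-cancel (mon-monic v){mon v ^' i}{mon w *' r}(∣'-cong {f = mon w *' q} rearrange h))))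
   where
   rearrange : mon w *' q ≈' mon v *' (mon w *' r)
   rearrange = P.trans (P.*-congˡ {mon w} e)
    (PS.solve 3 (\w r v -> w PS.:* (r PS.:* v) PS.:= v PS.:* (w PS.:* r)) P.refl (mon w) r (mon v))

 multiplicity-* : ∀ N {v w q n} -> IrreducibleWord v -> IrreducibleWord w -> Monic n q -> n N.< N ->
  multiplicity N v (mon w *' q) ≡ multiplicity N v q N.+ ℕΣ.[ v ≟ʷ w ]
 multiplicity-* N {v}{w}{q} iv iw mq n<N with v ≟ʷ w
 ... | no v≢w = E.trans (ℕΣ.Σ-cong (upTo N)(\i -> ℕΣ.[ power∣? v i (mon w *' q) ]-⇔ (power∣? v i q)
  (power-coprime iv iw v≢w (suc i) q)(∣'-*ˡ {g = q}(mon w))))(E.sym (N.+-identityʳ _))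
 multiplicity-* (suc N){v}{.v}{q}{n} iv iw mq (s≤s n≤N) | yes E.refl = begin
  ℕΣ.Σ (upTo (suc N))(\i -> ℕΣ.[ power∣? v i (mon v *' q) ])
  ≡⟨ ℕΣ.Σ-upTo-sucˡ N _ ⟩
  ℕΣ.[ power∣? v 0 (mon v *' q) ] N.+ ℕΣ.Σ (upTo N)(\i -> ℕΣ.[ power∣? v (suc i)(mon v *' q) ])
  ≡⟨ cong₂ N._+_ (ℕΣ.[ power∣? v 0 (mon v *' q) ]-yes
  (factors q (P.trans (P.*-comm (mon v) q)(P.*-congˡ {q}(P.sym (P.*-identityʳ (mon v)))))))
  (ℕΣ.Σ-cong (upTo N)(\i -> ℕΣ.[ power∣? v (suc i)(mon v *' q) ]-⇔ (power∣? v i q)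
  (∣'-cancel (mon-monic v){mon v ^' suc i}{q})(∣'-*-mono (mon v){mon v ^' suc i}{q}))) ⟩
  1 N.+ ℕΣ.Σ (upTo N)(\i -> ℕΣ.[ power∣? v i q ])
  ≡⟨ N.+-comm 1 _ ⟩
  ℕΣ.Σ (upTo N)(\i -> ℕΣ.[ power∣? v i q ]) N.+ 1
  ≡⟨ E.cong (N._+ 1)(E.sym (E.trans (ℕΣ.Σ-upTo-sucʳ N _)
  (E.trans (E.cong (ℕΣ.Σ (upTo N) _ N.+_)(ℕΣ.[ power∣? v N q ]-no too-big))(N.+-identityʳ _)))) ⟩
  ℕΣ.Σ (upTo (suc N))(\i -> ℕΣ.[ power∣? v i q ]) N.+ 1 ∎
  where
  open E.≡-Reasoning
  too-big : ¬ mon v ^' suc N ∣' q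
  too-big h = N.<⇒≱ (s≤s n≤N)(≤-tr (N.m≤m*n (suc N)(length v){{N.>-nonZero (positive iv)}})
   (∣'-degree (Monic-^ (mon-monic v)(suc N)) mq h))

 multiplicity-cong : ∀ N w {f g} -> f ≈' g -> multiplicity N w f ≡ multiplicity N w g
 multiplicity-cong N w {f}{g} p = ℕΣ.Σ-cong (upTo N) \i ->
  ℕΣ.[ power∣? w i f ]-⇔ (power∣? w i g)(∣'-cong p)(∣'-cong (P.sym p))

 Σ-multiplicity : ∀ N {n f} -> Monic n f -> n N.< N ->
  ℕΣ.Σ (irreds N)(\w -> multiplicity N w f N.* length w) ≡ n
 Σ-multiplicity N {n} = go (N.<-wellFounded n)
  where
  open E.≡-Reasoning
  go : ∀ {n f} -> Acc N._<_ n -> Monic n f -> n N.< N ->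
   ℕΣ.Σ (irreds N)(\w -> multiplicity N w f N.* length w) ≡ n
  go {zero}{f} _ m _ = ℕΣ.Σ-zero (irreds N) \{w} w∈ -> E.cong (N._* length w)
   (ℕΣ.Σ-zero (upTo N) \{i} _ -> ℕΣ.[ power∣? w i f ]-no
   (\d -> irreducible-∤1 (snd (∈-irreds⁻ N w∈))(Monic-0 m)
   (∣'-trans {g = mon w ^' suc i}(factors (mon w ^' i)(P.*-comm (mon w)(mon w ^' i))) d)))
  go {suc n-1}{f}(acc rec) m n<N with irreducible-divisor (s≤s z≤n) m
  ... | s , g , irr , factors q e with Monic-quotient m (isMonic irr) q e
  ... | k , k+s≡n , mq = begin
   ℕΣ.Σ (irreds N)(\v -> multiplicity N v f N.* length v)
   ≡⟨ ℕΣ.Σ-cong∈ (irreds N)(\{v} v∈ -> E.trans (E.cong (N._* length v)(E.trans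
   (multiplicity-cong N v (P.trans e (P.trans (P.*-congˡ {q} g≈)(P.*-comm q (mon w)))))
   (multiplicity-* N (snd (∈-irreds⁻ N v∈)) iw mq k<N)))
   (N.*-distribʳ-+ (length v)(multiplicity N v q) _)) ⟩
   ℕΣ.Σ (irreds N)(\v -> multiplicity N v q N.* length v N.+ ℕΣ.[ v ≟ʷ w ] N.* length v)
   ≡⟨ ℕΣ.Σ-+ (irreds N) _ _ ⟩
   ℕΣ.Σ (irreds N)(\v -> multiplicity N v q N.* length v)
   N.+ ℕΣ.Σ (irreds N)(\v -> ℕΣ.[ v ≟ʷ w ] N.* length v)
   ≡⟨ cong₂ N._+_ (go (rec k<n) mq k<N)
   (ℕΣ.Σ-single (irreds-unique N)(∈-irreds⁺ N |w|<N iw) _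
   (\{v} _ v≢w -> E.cong (N._* length v)(ℕΣ.[ v ≟ʷ w ]-no v≢w))) ⟩
   k N.+ ℕΣ.[ w ≟ʷ w ] N.* length w
   ≡⟨ E.cong (k N.+_)(E.trans (E.cong (N._* length w)(ℕΣ.[ w ≟ʷ w ]-yes E.refl))(N.*-identityˡ _)) ⟩
   k N.+ length w
   ≡⟨ E.cong (k N.+_) |w|≡s ⟩
   k N.+ s
   ≡⟨ k+s≡n ⟩
   suc n-1 ∎
   where
   w = low s g
   |w|≡s = length-low s g
   g≈ : g ≈' mon w
   g≈ = Monic⇒≈mon s g (isMonic irr)
   iw : IrreducibleWord w
   iw = irreducible (subst (0 N.<_)(E.sym |w|≡s)(positive irr))(mon-monic w)
    (\ 0<d d<n mg d∣ -> noFactor irr 0<d (subst (_ N.<_) |w|≡s d<n) mg (∣'-cong (P.sym g≈) d∣))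
   k<n : k N.< suc n-1
   k<n = subst (k N.<_) k+s≡n (N.m<m+n k (positive irr))
   k<N = N.<-trans k<n n<N
   |w|<N : length w N.< N
   |w|<N = N.≤-<-trans (subst (N._≤ suc n-1)(E.sym |w|≡s)(subst (s N.≤_) k+s≡n (N.m≤n+m s k))) n<N

-- A completely multiplicative weight on polynomials, zero values allowed.
record Weight {p}(F : PrimeField p)(S : CommutativeSemiring 0ℓ 0ℓ) : Set where
 open FieldPolynomials F using (Poly;_≈'_;_*'_;const;module K)
 open CommutativeSemiring S
 field
  weight : Poly -> Carrier
  cong : ∀ {f g} -> f ≈' g -> weight f ≈ weight g
  *-homo : ∀ f g -> weight (f *' g) ≈ weight f * weight g
  1-homo : weight (const K.1#) ≈ 1#

module NewtonIdentity {p}(F : PrimeField p)(S : CommutativeSemiring 0ℓ 0ℓ)(W : Weight F S) where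
 open FieldPolynomials F public hiding (0#;1#)
 open CommutativeSemiring S
 open Mult semiring using (×-congʳ;×-homo-+;×-assocˡ;×-assoc-*;×-comm-*) renaming (_×_ to _×ˢ_)
 open Power semiring using (_^_)
 open Setoid-Reasoning setoid
 open Weight W renaming (cong to weight-cong;*-homo to weight-*;1-homo to weight-1)
 open Summation S

 weight-^ : ∀ f i -> weight (f ^' i) ≈ weight f ^ i
 weight-^ f zero = weight-1
 weight-^ f (suc i) = trans (weight-* f (f ^' i))(*-congˡ (weight-^ f i))

 coeff : ℕ -> Carrier
 coeff n = Σ (words n)(weight ∘ mon)

 primePowerSum : ℕ -> ℕ -> Carrier
 primePowerSum N k = Σ (irreds N) \w -> Σ (upTo N) \i ->
  [ suc i N.* length w N.≟ k ] * (length w ×ˢ weight (mon w) ^ suc i)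

 Σ-multiples : ∀ {e u} -> Monic e u -> ∀ {n} -> e N.≤ n -> (d? : ∀ g -> Dec (u ∣' mon g)) ->
  Σ (words n)(\g -> [ d? g ] * weight (mon g)) ≈ weight u * coeff (n N.∸ e)
 Σ-multiples {e}{u} mu {n} e≤n d? = begin
  Σ (words n)(\g -> [ d? g ] * weight (mon g)) ≈⟨ Σ-filter d? (words n)(weight ∘ mon) ⟨
  Σ (filter d? (words n))(weight ∘ mon) ≈⟨ Σ-bijection (words-unique k)(Unique.filter⁺ d? (words-unique n))
  up down up∈ down∈ down-up up-down (weight ∘ mon) ⟩
  Σ (words k)(weight ∘ mon ∘ up) ≈⟨ Σ-cong∈ (words k)(\{h} h∈ ->
  trans (weight-cong (P.sym (up≈ h∈)))(weight-* u (mon h))) ⟩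
  Σ (words k)(\h -> weight u * weight (mon h)) ≈⟨ Σ-*ˡ (words k)(weight u)(weight ∘ mon) ⟩
  weight u * coeff k ∎
  where
  k = n N.∸ e
  e+k≡n = N.m+[n∸m]≡n e≤n
  quot : ∀ g -> Dec (u ∣' mon g) -> Poly
  quot g (yes (factors q _)) = q
  quot g (no _) = []
  up down : List 𝕂 -> List 𝕂
  up h = low n (u *' mon h)
  down g = low k (quot g (d? g))
  monic-up : ∀ {h} -> h ∈ words k -> Monic n (u *' mon h)
  monic-up {h} h∈ = subst (\j -> Monic j (u *' mon h)) e+k≡n (Monic-* mu (mon-Monic k (length-∈-words k h∈)))
  up≈ : ∀ {h} -> h ∈ words k -> u *' mon h ≈' mon (up h)
  up≈ h∈ = Monic⇒≈mon n _ (monic-up h∈)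
  up∈ : ∀ {h} -> h ∈ words k -> up h ∈ filter d? (words n)
  up∈ {h} h∈ = ∈-filter⁺ d? (∈-words-length n (length-low n (u *' mon h)))
   (factors (mon h)(P.trans (P.sym (up≈ h∈))(P.*-comm u (mon h))))
  down∈ : ∀ {g} -> g ∈ filter d? (words n) -> down g ∈ words k
  down∈ {g} _ = ∈-words-length k (length-low k (quot g (d? g)))
  quot-monic : ∀ {g} -> g ∈ words n -> (d : Dec (u ∣' mon g)) -> u ∣' mon g ->
   Monic k (quot g d) × mon g ≈' u *' quot g d
  quot-monic g∈ (no ¬d) d = contradiction d ¬d
  quot-monic {g} g∈ (yes (factors q eq)) _ with Monic-quotient (mon-Monic n (length-∈-words n g∈)) mu q eq
  ... | j , j+e≡n , mq = subst (\i -> Monic i q)(E.trans (E.sym (N.m+n∸n≡m j e))(E.cong (N._∸ e) j+e≡n)) mq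
   , P.trans eq (P.*-comm q u)
  down-up : ∀ {h} -> h ∈ words k -> down (up h) ≡ h
  down-up {h} h∈ with quot-monic (fst (∈-filter⁻ d? {xs = words n}(up∈ h∈)))(d? (up h))
   (snd (∈-filter⁻ d? {xs = words n}(up∈ h∈)))
  ... | mq , eq = E.trans (low-cong k (*'-cancelˡ {g = quot (up h)(d? (up h))}{mon h} mu
   (P.trans (P.sym eq)(P.sym (up≈ h∈)))))
   (E.trans (E.cong (\j -> low j (mon h))(E.sym (length-∈-words k h∈)))(low-mon h))
  up-down : ∀ {g} -> g ∈ filter d? (words n) -> up (down g) ≡ g
  up-down {g} g∈ with ∈-filter⁻ d? {xs = words n} g∈
  ... | g∈w , u∣g with quot-monic g∈w (d? g) u∣g
  ... | mq , eq = E.trans (low-cong n (P.trans (P.*-congˡ {u}(P.sym (Monic⇒≈mon k _ mq)))(P.sym eq)))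
   (E.trans (E.cong (\j -> low j (mon g))(E.sym (length-∈-words n g∈w)))(low-mon g))

 Σ-no-multiples : ∀ {e u} -> Monic e u -> ∀ {n} -> n N.< e -> (d? : ∀ g -> Dec (u ∣' mon g)) ->
  Σ (words n)(\g -> [ d? g ] * weight (mon g)) ≈ 0#
 Σ-no-multiples mu {n} n<e d? = Σ-zero (words n) \{g} g∈ -> trans (*-congʳ ([ d? g ]-no \u∣g ->
  N.<⇒≱ n<e (∣'-degree mu (mon-Monic n (length-∈-words n g∈)) u∣g)))(zeroˡ _)

 ×-Σ : ∀ {A : Set}(xs : List A)(f : A -> ℕ) x -> ℕΣ.Σ xs f ×ˢ x ≈ Σ xs (\a -> f a ×ˢ x)
 ×-Σ [] f x = refl
 ×-Σ (a ∷ xs) f x = trans (×-homo-+ x (f a)(ℕΣ.Σ xs f))(+-congˡ (×-Σ xs f x))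

 Σ-× : ∀ {A : Set} n (xs : List A) f -> n ×ˢ Σ xs f ≈ Σ xs (\a -> n ×ˢ f a)
 Σ-× zero xs f = sym (Σ-zero xs (\_ -> refl))
 Σ-× (suc n) xs f = trans (+-congˡ (Σ-× n xs f))(sym (Σ-+ xs f _))

 indicator-× : ∀ {Q : Set}(d : Dec Q) l x -> (ℕΣ.[ d ] N.* l) ×ˢ x ≈ [ d ] * (l ×ˢ x)
 indicator-× (yes _) l x = trans (reflexive (E.cong (_×ˢ x)(N.+-identityʳ l)))(sym (*-identityˡ _))
 indicator-× (no _) l x = sym (zeroˡ _)

 expand-degree : ∀ N n g -> g ∈ words n -> n N.< N -> ∀ x ->
  n ×ˢ x ≈ Σ (irreds N) \w -> Σ (upTo N) \i -> [ power∣? w i (mon g) ] * (length w ×ˢ x)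
 expand-degree N n g g∈ n<N x = begin
  n ×ˢ x
  ≡⟨ E.cong (_×ˢ x)(E.sym (Σ-multiplicity N (mon-Monic n (length-∈-words n g∈)) n<N)) ⟩
  ℕΣ.Σ (irreds N)(\w -> multiplicity N w (mon g) N.* length w) ×ˢ x
  ≈⟨ ×-Σ (irreds N) _ x ⟩
  Σ (irreds N)(\w -> (multiplicity N w (mon g) N.* length w) ×ˢ x)
  ≈⟨ Σ-cong (irreds N)(\w -> trans (reflexive (E.cong (_×ˢ x)
  (E.sym (ℕΣ.Σ-*ʳ (upTo N)(length w)(\i -> ℕΣ.[ power∣? w i (mon g) ])))))
  (trans (×-Σ (upTo N) _ x)(Σ-cong (upTo N)(\i -> indicator-× (power∣? w i (mon g))(length w) x)))) ⟩
  Σ (irreds N)(\w -> Σ (upTo N) \i -> [ power∣? w i (mon g) ] * (length w ×ˢ x)) ∎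

 newton : ∀ N n -> n N.< N ->
  n ×ˢ coeff n ≈ Σ (upTo n)(\k -> primePowerSum N (suc k) * coeff (n N.∸ suc k))
 newton N n n<N = begin
  n ×ˢ coeff n
  ≈⟨ Σ-× n (words n) _ ⟩
  Σ (words n)(\g -> n ×ˢ weight (mon g))
  ≈⟨ Σ-cong∈ (words n)(\{g} g∈ -> expand-degree N n g g∈ n<N _) ⟩
  Σ (words n)(\g -> Σ (irreds N) \w -> Σ (upTo N) \i ->
  [ power∣? w i (mon g) ] * (length w ×ˢ weight (mon g)))
  ≈⟨ Σ-swap (words n)(irreds N) _ ⟩
  Σ (irreds N)(\w -> Σ (words n) \g -> Σ (upTo N) \i ->
  [ power∣? w i (mon g) ] * (length w ×ˢ weight (mon g)))
  ≈⟨ Σ-cong (irreds N)(\w -> Σ-swap (words n)(upTo N) _) ⟩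
  Σ (irreds N)(\w -> Σ (upTo N) \i -> Σ (words n) \g ->
  [ power∣? w i (mon g) ] * (length w ×ˢ weight (mon g)))
  ≈⟨ Σ-cong∈ (irreds N)(\{w} w∈ -> Σ-cong (upTo N)(\i ->
  term w (snd (∈-irreds⁻ N w∈)) i)) ⟩
  Σ (irreds N)(\w -> Σ (upTo N) \i -> Σ (upTo n) \k -> T w i k)
  ≈⟨ Σ-cong (irreds N)(\w -> Σ-swap (upTo N)(upTo n) _) ⟩
  Σ (irreds N)(\w -> Σ (upTo n) \k -> Σ (upTo N) \i -> T w i k)
  ≈⟨ Σ-swap (irreds N)(upTo n) _ ⟩
  Σ (upTo n)(\k -> Σ (irreds N) \w -> Σ (upTo N) \i -> T w i k)
  ≈⟨ Σ-cong (upTo n)(\k -> trans (Σ-cong (irreds N)(\w -> Σ-*ʳ (upTo N) _ _))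
  (Σ-*ʳ (irreds N) _ _)) ⟩
  Σ (upTo n)(\k -> primePowerSum N (suc k) * coeff (n N.∸ suc k)) ∎
  where
  T : List 𝕂 -> ℕ -> ℕ -> Carrier
  T w i k = [ suc i N.* length w N.≟ suc k ] * (length w ×ˢ weight (mon w) ^ suc i) * coeff (n N.∸ suc k)
  pull : ∀ w i -> Σ (words n)(\g -> [ power∣? w i (mon g) ] * (length w ×ˢ weight (mon g)))
   ≈ length w ×ˢ Σ (words n)(\g -> [ power∣? w i (mon g) ] * weight (mon g))
  pull w i = trans (Σ-cong (words n)(\g -> ×-comm-* (length w) _ _))(sym (Σ-× (length w)(words n) _))
  term : ∀ w -> IrreducibleWord w -> ∀ i ->
   Σ (words n)(\g -> [ power∣? w i (mon g) ] * (length w ×ˢ weight (mon g))) ≈ Σ (upTo n)(T w i)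
  term w irr i with suc i N.* length w N.≤? n
  ... | no e≰n = trans (pull w i)(trans (×-congʳ (length w)
   (trans (Σ-no-multiples (Monic-^ (mon-monic w)(suc i))(N.≰⇒> e≰n)(\g -> power∣? w i (mon g)))(sym (zeroˡ 0#))))
   (trans (sym (×-assoc-* (length w) 0# 0#))(trans (zeroʳ _)(sym (Σ-zero (upTo n)(\{k} k∈ ->
   trans (*-congʳ (trans (*-congʳ ([ suc i N.* length w N.≟ suc k ]-no
   (\eq -> e≰n (subst (N._≤ n)(E.sym eq)(∈-upTo⁻ k∈)))))(zeroˡ _)))(zeroˡ _)))))))
  ... | yes e≤n = begin
   Σ (words n)(\g -> [ power∣? w i (mon g) ] * (length w ×ˢ weight (mon g)))
   ≈⟨ pull w i ⟩
   length w ×ˢ Σ (words n)(\g -> [ power∣? w i (mon g) ] * weight (mon g))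
   ≈⟨ ×-congʳ (length w)(Σ-multiples (Monic-^ (mon-monic w)(suc i)) e≤n (\g -> power∣? w i (mon g))) ⟩
   length w ×ˢ (weight (mon w ^' suc i) * coeff (n N.∸ e))
   ≈⟨ ×-assoc-* (length w) _ _ ⟨
   length w ×ˢ weight (mon w ^' suc i) * coeff (n N.∸ e)
   ≈⟨ *-congʳ (×-congʳ (length w)(weight-^ (mon w)(suc i))) ⟩
   length w ×ˢ weight (mon w) ^ suc i * coeff (n N.∸ e)
   ≈⟨ *-congʳ (trans (*-congʳ ([ e N.≟ suc k0 ]-yes e≡))(*-identityˡ _)) ⟨
   [ e N.≟ suc k0 ] * (length w ×ˢ weight (mon w) ^ suc i) * coeff (n N.∸ e)
   ≡⟨ E.cong (\j -> [ e N.≟ suc k0 ] * (length w ×ˢ weight (mon w) ^ suc i) * coeff (n N.∸ j)) e≡ ⟩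
   T w i k0
   ≈⟨ Σ-single (Unique.upTo⁺ n)(∈-upTo⁺ (subst (N._≤ n) e≡ e≤n))(T w i)(\{k} _ k≢k0 ->
   trans (*-congʳ (trans (*-congʳ ([ e N.≟ suc k ]-no
   (\eq -> k≢k0 (N.suc-injective (E.trans (E.sym eq) e≡)))))(zeroˡ _)))(zeroˡ _)) ⟨
   Σ (upTo n)(T w i) ∎
   where
   e = suc i N.* length w
   k0 = N.pred e
   e≡ : e ≡ suc k0
   e≡ = E.sym (N.suc-pred e {{N.>-nonZero (≤-tr (positive irr)(N.m≤n*m (length w)(suc i)))}})

-- geom b i n is b^i + b^(i+1) + ... + b^(i+n-1).
geom : ℕ -> ℕ -> ℕ -> ℕ
geom b i zero = 0
geom b i (suc n) = b N.^ i N.+ geom b (suc i) n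

module GeometricSums (b : ℕ) where
 open E

 geom-+ : ∀ i m n -> geom b i (m N.+ n) ≡ geom b i m N.+ geom b (i N.+ m) n
 geom-+ i zero n = cong (\j -> geom b j n)(sym (N.+-identityʳ i))
 geom-+ i (suc m) n = trans (cong (b N.^ i N.+_)(trans (geom-+ (suc i) m n)
  (cong (\j -> geom b (suc i) m N.+ geom b j n)(sym (N.+-suc i m)))))
  (sym (N.+-assoc (b N.^ i) _ _))

 geom-shift : ∀ i j n -> geom b (i N.+ j) n ≡ b N.^ i N.* geom b j n
 geom-shift i j zero = sym (N.*-zeroʳ (b N.^ i))
 geom-shift i j (suc n) = trans (cong₂ N._+_ (N.^-distribˡ-+-* b i j)
  (trans (cong (\k -> geom b k n)(sym (N.+-suc i j)))(geom-shift i (suc j) n)))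
  (sym (N.*-distribˡ-+ (b N.^ i) _ _))

 geom-sum : ∀ c -> b ≡ suc c -> ∀ i n -> c N.* geom b i n N.+ b N.^ i ≡ b N.^ (i N.+ n)
 geom-sum c refl i zero = cong₂ N._+_ (N.*-zeroʳ c)(cong (b N.^_)(sym (N.+-identityʳ i)))
 geom-sum c refl i (suc n) = trans (id1 c (b N.^ i)(geom b (suc i) n))
  (trans (geom-sum c refl (suc i) n)(cong (b N.^_)(sym (N.+-suc i n))))

module Values {p}(F : PrimeField p) where
 open FieldPolynomials F using (Poly;𝕂;module K)
 open E using (refl)

 identity : Homomorphism K.ring K.ring
 identity = record { ⟦_⟧ = \x -> x; cong = \e -> e; +-homo = \_ _ -> refl; *-homo = \_ _ -> refl
  ; 0-homo = refl; 1-homo = refl }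

 open Evaluation identity public using ()
  renaming (eval to value; eval-cong to value-cong; eval-* to value-*; eval-+ to value-+; eval-const to value-const)

module Reciprocity {p}(F : PrimeField p)(w : List.List (PrimeField.Carrier F))
 (irr : FieldPolynomials.IrreducibleWord F w) where
 open FieldPolynomials F
 open Values F
 open QuotientRing polyRing (mon w) public
 module A = CommutativeRing quotientRing
 open A using (_-_)
 open Exp A.commutativeSemiring
 open AbelianGroup A.+-abelianGroup renaming (x≈y⇒x∙y⁻¹≈ε to x≈y⇒x-y≈0;x∙y⁻¹≈ε⇒x≈y to x-y≈0⇒x≈y) using ()
 open Mult A.semiring using () renaming (_×_ to _×ᴬ_)
 open Setoid-Reasoning A.setoid
 open Roots quotientRing
 private
  module AS = IntegerSolver quotientRing
  s = length w

 instance _ = prime⇒nonTrivial K.prime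

 ^'≡^ : ∀ x n -> x ^' n ≡ x ^ n
 ^'≡^ x zero = E.refl
 ^'≡^ x (suc n) = E.cong (x *'_)(^'≡^ x n)

 ∣⇒≡ₘ0 : ∀ {x} -> mon w ∣' x -> x ≡ₘ []
 ∣⇒≡ₘ0 (factors q e) = multiple q (P.trans (P.+-identityʳ _) e)

 ∣⇒≡ₘ : ∀ {x y} -> mon w ∣' x - y -> x ≡ₘ y
 ∣⇒≡ₘ (factors q e) = multiple q e

 ≡ₘ⇒∣ : ∀ {x y} -> x ≡ₘ y -> mon w ∣' x - y
 ≡ₘ⇒∣ (multiple q e) = factors q e

 ≡ₘ0⇒∣ : ∀ {x} -> x ≡ₘ [] -> mon w ∣' x
 ≡ₘ0⇒∣ (multiple q e) = factors q (P.trans (P.sym (P.+-identityʳ _)) e)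

 1≉0 : ¬ const K.1# ≡ₘ []
 1≉0 e = irreducible-∤1 irr P.refl (≡ₘ0⇒∣ e)

 cancel : ∀ x y -> x *' y ≡ₘ [] -> ¬ x ≡ₘ [] -> y ≡ₘ []
 cancel x y e x≉0 = ∣⇒≡ₘ0 (euclid irr x y (≡ₘ0⇒∣ e)(\d -> x≉0 (∣⇒≡ₘ0 d)))

 _≡ₘ?_ : ∀ x y -> Dec (x ≡ₘ y)
 x ≡ₘ? y with divides? (mon-monic w)(x - y)
 ... | yes (factors q e) = yes (multiple q e)
 ... | no ∤ = no \{ (multiple q e) -> ∤ (factors q e) }

 ^-zero : ∀ x n -> x ^ n ≡ₘ [] -> x ≡ₘ []
 ^-zero x zero e = contradiction e 1≉0
 ^-zero x (suc n) e with x ≡ₘ? []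
 ... | yes x≈0 = x≈0
 ... | no x≉0 = ^-zero x n (cancel x (x ^ n) e x≉0)

 embedding : Homomorphism K.ring quotientRing
 embedding = record
  { ⟦_⟧ = const
  ; cong = \{ E.refl -> A.refl }
  ; +-homo = \x y -> A.refl
  ; *-homo = \x y -> ≈⇒≡ₘ (·≈const* x (const y))
  ; 0-homo = ≈⇒≡ₘ (coefs \{ zero -> E.refl; (suc n) -> E.refl })
  ; 1-homo = A.refl
  }
 open Evaluation embedding
 open Homomorphism embedding using (*-homo;0-homo)

 const-^ : ∀ c n -> const c ^ n ≡ₘ const (c K.^ n)
 const-^ c zero = A.refl
 const-^ c (suc n) = A.trans (A.*-congˡ {const c}(const-^ c n))(A.sym (*-homo c (c K.^ n)))

 p×1≈0 : p ×ᴬ const K.1# ≡ₘ []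
 p×1≈0 = A.trans (go p)(A.trans (A.reflexive (E.cong const K.characteristic)) 0-homo)
  where
  go : ∀ n -> n ×ᴬ const K.1# ≡ₘ const (n K.· K.1#)
  go zero = A.sym 0-homo
  go (suc n) = A.+-congˡ (go n)

 fermat^ : ∀ c k -> c K.^ (p N.^ k) ≡ c
 fermat^ c zero = K.*-identityʳ c
 fermat^ c (suc k) = E.trans (E.sym (^-assocʳ' c p (p N.^ k)))
  (E.trans (E.cong (K._^ (p N.^ k))(K.fermat c))(fermat^ c k))
  where open Power K.semiring using () renaming (^-assocʳ to ^-assocʳ')

 private
  q : ℕ -> ℕ
  q k = p N.^ k

 frobenius : ∀ k x y -> (x +' y) ^ q k ≡ₘ x ^ q k +' y ^ q k
 frobenius = PrimeCharacteristic.Of.frobenius^ quotientRing K.prime p×1≈0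

 frobenius-sub : ∀ k x y -> (x - y) ^ q k ≡ₘ x ^ q k - y ^ q k
 frobenius-sub k x y = begin
  (x - y) ^ q k
  ≈⟨ AS.solve 2 (\a b -> a AS.:= (a AS.:+ b) AS.:- b) A.refl _ (y ^ q k) ⟩
  ((x - y) ^ q k +' y ^ q k) - y ^ q k
  ≈⟨ A.+-congʳ (frobenius k (x - y) y) ⟨
  (x - y +' y) ^ q k - y ^ q k
  ≈⟨ A.+-congʳ (^-congˡ (q k)(AS.solve 2 (\a b -> a AS.:- b AS.:+ b AS.:= a) A.refl x y)) ⟩
  x ^ q k - y ^ q k ∎

 frobenius-injective : ∀ k x y -> x ^ q k ≡ₘ y ^ q k -> x ≡ₘ y
 frobenius-injective k x y e = x-y≈0⇒x≈y x y (^-zero (x - y)(q k)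
  (A.trans (frobenius-sub k x y)(x≈y⇒x-y≈0 e)))

 frobenius-eval : ∀ k f y -> eval f y ^ q k ≡ₘ eval f (y ^ q k)
 frobenius-eval k [] y = zero-^ (q k)(N.m^n>0 p {{N.nonTrivial⇒nonZero p}} k)
  where
  zero-^ : ∀ n -> 0 N.< n -> [] ^ n ≡ₘ []
  zero-^ (suc n) _ = A.refl
 frobenius-eval k (c ∷ f) y = begin
  (const c +' y *' eval f y) ^ q k
  ≈⟨ frobenius k (const c)(y *' eval f y) ⟩
  const c ^ q k +' (y *' eval f y) ^ q k
  ≈⟨ A.+-cong (A.trans (const-^ c (q k))(A.reflexive (E.cong const (fermat^ c k))))
  (A.trans (^-distrib-* y (eval f y)(q k))(A.*-congˡ {y ^ q k}(frobenius-eval k f y))) ⟩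
  const c +' y ^ q k *' eval f (y ^ q k) ∎

 eval-X : ∀ f -> eval f X ≡ₘ f
 eval-X [] = A.refl
 eval-X (c ∷ f) = A.trans (A.+-congˡ {const c}(A.*-congˡ {X}(eval-X f)))(A.sym (≈⇒≡ₘ (shift-≈ c f)))

 horner-replicate : ∀ n y -> horner (replicate n []) y ≡ₘ y ^ n
 horner-replicate zero y = A.refl
 horner-replicate (suc n) y = A.*-congˡ {y}(horner-replicate n y)

 distinct : ∀ {B : Set}{R : B -> B -> Set}{xs : List B} -> Unique xs ->
  (∀ {x y} -> x ∈ xs -> y ∈ xs -> x ≢ y -> R x y) -> AllPairs R xs
 distinct [] h = []
 distinct (x∉ ∷ u) h = All.tabulate (\y∈ -> h (here E.refl)(there y∈)(All.lookup x∉ y∈))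
  ∷ distinct u (\x∈ y∈ -> h (there x∈)(there y∈))

 residues-distinct : AllPairs (\u v -> ¬ u ≡ₘ v)(words s)
 residues-distinct = distinct (words-unique s) \{u}{v} u∈ v∈ u≢v u≡v -> u≢v
  (E.trans (low-word u∈)(E.trans (low-cong s (u≈v u∈ v∈ u≡v))(E.sym (low-word v∈))))
  where
  bounded-word : ∀ {u} -> u ∈ words s -> Bounded s u
  bounded-word {u} u∈ = subst (\n -> Bounded n u)(length-∈-words s u∈)(Bounded-length u)
  low-word : ∀ {u} -> u ∈ words s -> u ≡ low s u
  low-word {u} u∈ = E.trans (E.sym (low-length u))(E.cong (\n -> low n u)(length-∈-words s u∈))
  u≈v : ∀ {u v} -> u ∈ words s -> v ∈ words s -> u ≡ₘ v -> u ≈' v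
  u≈v {u}{v} u∈ v∈ (multiple h e) = Pu-v≈0⇒u≈v u v (P.trans e (P.*-congʳ {mon w}(Monic-multiple (isMonic irr) h
   (Bounded-cong e (Bounded-+ u (-' v)(bounded-word u∈)
   (\k le -> E.trans (coef-- v k)(E.trans (E.cong K.-_ (bounded-word v∈ k le)) ε⁻¹≈ε)))))))
   where
   open AbelianGroup P.+-abelianGroup renaming (x∙y⁻¹≈ε⇒x≈y to Pu-v≈0⇒u≈v) using ()
   open AbelianGroup K.+-abelianGroup using (ε⁻¹≈ε)

 q≥2 : ∀ k -> 2 N.≤ q (suc k)
 q≥2 k = ≤-tr (N.nonTrivial⇒n>1 p)(N.m≤m*n p (q k){{N.>-nonZero (N.m^n>0 p {{N.nonTrivial⇒nonZero p}} k)}})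

 fixed⇒degree-≤ : ∀ k -> X ^ q (suc k) ≡ₘ X -> s N.≤ suc k
 fixed⇒degree-≤ k fix = N.≮⇒≥ \k<s -> N.<⇒≱ (N.^-monoʳ-< p (N.nonTrivial⇒n>1 p) k<s)
  (subst (N._≤ q (suc k))(length-words s)(≤-tr
  (distinct-roots-≤ 1≉0 cancel cs (words s) residues-distinct (All.tabulate (\{u} _ -> root u)))
  (≡⇒≤ length-cs)))
  where
  m = q (suc k) N.∸ 2
  q≡ : 2 N.+ m ≡ q (suc k)
  q≡ = N.m+[n∸m]≡n (q≥2 k)
  cs : List Poly
  cs = [] ∷ (-' const K.1#) ∷ replicate m []
  length-cs : length cs ≡ q (suc k)
  length-cs = E.trans (E.cong (2 N.+_)(length-replicate m)) q≡
  root : ∀ u -> horner cs u ≡ₘ []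
  root u = begin
   u *' (-' const K.1# +' u *' horner (replicate m []) u) ≈⟨ A.*-congˡ {u}(A.+-congˡ { -' const K.1#}(A.*-congˡ {u}(horner-replicate m u))) ⟩
   u *' (-' const K.1# +' u *' u ^ m)
   ≈⟨ AS.solve 2 (\u x -> u AS.:* (AS.:- AS.:1 AS.:+ u AS.:* x) AS.:= u AS.:* (u AS.:* x) AS.:- u) A.refl u (u ^ m) ⟩
   u ^ (2 N.+ m) - u ≡⟨ E.cong (\n -> u ^ n - u) q≡ ⟩
   u ^ q (suc k) - u ≈⟨ x≈y⇒x-y≈0 (begin
   u ^ q (suc k) ≈⟨ ^-congˡ (q (suc k))(eval-X u) ⟨
   eval u X ^ q (suc k) ≈⟨ frobenius-eval (suc k) u X ⟩
   eval u (X ^ q (suc k)) ≈⟨ eval-congʳ u fix ⟩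
   eval u X ≈⟨ eval-X u ⟩
   u ∎) ⟩
   [] ∎

 X^-≡⇒fixed : ∀ i j -> X ^ q (i N.+ j) ≡ₘ X ^ q i -> X ^ q j ≡ₘ X
 X^-≡⇒fixed i j e = frobenius-injective i (X ^ q j) X (A.trans (A.trans (^-assocʳ X (q j)(q i))
  (A.reflexive (E.cong (X ^_)(E.trans (N.*-comm (q j)(q i))(E.sym (N.^-distribˡ-+-* p i j)))))) e)

 conjugates : ℕ -> ℕ -> List Poly
 conjugates i zero = []
 conjugates i (suc n) = X ^ q i ∷ conjugates (suc i) n

 length-conjugates : ∀ i n -> length (conjugates i n) ≡ n
 length-conjugates i zero = E.refl
 length-conjugates i (suc n) = E.cong suc (length-conjugates (suc i) n)

 All-conjugates : ∀ {R : Poly -> Set} i n -> (∀ j -> i N.≤ j -> j N.< i N.+ n -> R (X ^ q j)) ->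
  All R (conjugates i n)
 All-conjugates i zero h = []
 All-conjugates i (suc n) h = h i N.≤-refl (N.m<m+n i (s≤s z≤n))
  ∷ All-conjugates (suc i) n (\j i<j lt -> h j (N.<⇒≤ i<j)(subst (j N.<_)(E.sym (N.+-suc i n)) lt))

 conjugate-≢ : ∀ i j -> i N.< j -> j N.< i N.+ s -> ¬ X ^ q i ≡ₘ X ^ q j
 conjugate-≢ i j i<j j<i+s e = N.<⇒≱ j<i+s (subst (i N.+ s N.≤_) i+k≡j (N.+-monoʳ-≤ i (fixed⇒degree-≤ k
  (X^-≡⇒fixed i (suc k)(A.sym (subst (\n -> X ^ q i ≡ₘ X ^ q n)(E.sym i+k≡j) e))))))
  where
  k = j N.∸ suc i
  i+k≡j : i N.+ suc k ≡ j
  i+k≡j = E.trans (N.+-suc i k)(N.m+[n∸m]≡n i<j)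

 conjugates-distinct : ∀ i n -> i N.+ n N.≤ s -> Distinct 1≉0 cancel (conjugates i n)
 conjugates-distinct i zero le = []
 conjugates-distinct i (suc n) le = All-conjugates (suc i) n (\j i<j lt -> conjugate-≢ i j i<j
  (N.<-≤-trans lt (≤-tr (subst (N._≤ s)(N.+-suc i n) le)(N.m≤n+m s i))))
  ∷ conjugates-distinct (suc i) n (subst (N._≤ s)(N.+-suc i n) le)

 eval-mon : ∀ cs y -> horner (map const cs) y ≡ₘ eval (mon cs) y
 eval-mon [] y = A.sym (A.trans (A.+-congˡ {const K.1#}(A.zeroʳ y))(A.+-identityʳ _))
 eval-mon (c ∷ cs) y = A.+-congˡ {const c}(A.*-congˡ {y}(eval-mon cs y))

 root-conjugate : ∀ k -> horner (map const w)(X ^ q k) ≡ₘ []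
 root-conjugate k = begin
  horner (map const w)(X ^ q k) ≈⟨ eval-mon w (X ^ q k) ⟩
  eval (mon w)(X ^ q k) ≈⟨ frobenius-eval k (mon w) X ⟨
  eval (mon w) X ^ q k ≈⟨ ^-congˡ (q k)(A.trans (eval-X (mon w))(∣⇒≡ₘ0 ∣'-refl)) ⟩
  [] ^ q k ≈⟨ frobenius-eval k [] X ⟩
  [] ∎

 horner≈∏ : ∀ y -> horner (map const w) y ≡ₘ ∏-roots (conjugates 0 s) y
 horner≈∏ = horner≈∏-roots 1≉0 cancel (map const w)(conjugates 0 s)
  (E.trans (length-conjugates 0 s)(E.sym (length-map const w)))
  (conjugates-distinct 0 s N.≤-refl)(All-conjugates 0 s (\j _ _ -> root-conjugate j))

 X^qˢ≡X : X ^ q s ≡ₘ X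
 X^qˢ≡X with (X ^ q s) ≡ₘ? X
 ... | yes e = e
 ... | no ≢X = contradiction (All-conjugates 0 s different)
  (∏-roots-zero 1≉0 cancel (conjugates 0 s)(X ^ q s)(A.trans (A.sym (horner≈∏ (X ^ q s)))(root-conjugate s)))
  where
  different : ∀ j -> 0 N.≤ j -> j N.< s -> ¬ X ^ q j ≡ₘ X ^ q s
  different zero _ _ e = ≢X (A.trans (A.sym e)(A.*-identityʳ X))
  different (suc j) _ j<s e = conjugate-≢ (suc j) s j<s (N.m<n+m s (s≤s z≤n)) e

 open GeometricSums p

 eval-const-point : ∀ f a -> eval f (const a) ≡ₘ const (value f a)
 eval-const-point [] a = A.sym 0-homo
 eval-const-point (c ∷ f) a = A.+-congˡ {const c}(A.trans (A.*-congˡ {const a}(eval-const-point f a))(A.sym (*-homo a (value f a))))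

 ∏-conjugates : ∀ a i n -> ∏-roots (conjugates i n)(const a) ≡ₘ (const a - X) ^ geom p i n
 ∏-conjugates a i zero = A.refl
 ∏-conjugates a i (suc n) = begin
  (const a - X ^ q i) *' ∏-roots (conjugates (suc i) n)(const a)
  ≈⟨ A.*-cong (A.sym (A.trans (frobenius-sub i (const a) X)
  (A.+-congʳ (A.trans (const-^ a (q i))(A.reflexive (E.cong const (fermat^ a i)))))))
  (∏-conjugates a (suc i) n) ⟩
  (const a - X) ^ q i *' (const a - X) ^ geom p (suc i) n
  ≈⟨ ^-homo-* (const a - X)(q i)(geom p (suc i) n) ⟨
  (const a - X) ^ geom p i (suc n) ∎

 norm : ∀ a -> (const a - X) ^ geom p 0 s ≡ₘ const (value (mon w) a)
 norm a = A.trans (A.sym (∏-conjugates a 0 s))(A.trans (A.sym (horner≈∏ (const a)))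
  (A.trans (eval-mon w (const a))(eval-const-point (mon w) a)))

 frobenius-fixed : ∀ i -> X ^ q (i N.* s) ≡ₘ X
 frobenius-fixed zero = A.*-identityʳ X
 frobenius-fixed (suc i) = begin
  X ^ q (s N.+ i N.* s) ≡⟨ E.cong (X ^_)(N.^-distribˡ-+-* p s (i N.* s)) ⟩
  X ^ (q s N.* q (i N.* s)) ≈⟨ ^-assocʳ X (q s)(q (i N.* s)) ⟨
  (X ^ q s) ^ q (i N.* s) ≈⟨ ^-congˡ (q (i N.* s)) X^qˢ≡X ⟩
  X ^ q (i N.* s) ≈⟨ frobenius-fixed i ⟩
  X ∎

 reciprocity : ∀ a i -> (const a - X) ^ geom p 0 (i N.* s) ≡ₘ const (value (mon w) a K.^ i)
 reciprocity a zero = A.refl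
 reciprocity a (suc i) = begin
  (const a - X) ^ geom p 0 (s N.+ i N.* s)
  ≡⟨ E.cong ((const a - X) ^_)(E.trans (geom-+ 0 s (i N.* s))(E.cong (geom p 0 s N.+_)
  (E.trans (E.cong (\j -> geom p j (i N.* s))(E.sym (N.+-identityʳ s)))(E.trans (geom-shift s 0 (i N.* s))
  (N.*-comm (q s) _))))) ⟩
  (const a - X) ^ (geom p 0 s N.+ geom p 0 (i N.* s) N.* q s)
  ≈⟨ ^-homo-* (const a - X)(geom p 0 s) _ ⟩
  (const a - X) ^ geom p 0 s *' (const a - X) ^ (geom p 0 (i N.* s) N.* q s)
  ≈⟨ A.*-cong (norm a)(A.trans (A.sym (^-assocʳ (const a - X)(geom p 0 (i N.* s))(q s)))
  (A.trans (^-congˡ (q s)(reciprocity a i))(A.trans (const-^ _ (q s))(A.reflexive (E.cong const (fermat^ _ s)))))) ⟩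
  const (value (mon w) a) *' const (value (mon w) a K.^ i)
  ≈⟨ *-homo _ _ ⟨
  const (value (mon w) a K.^ suc i) ∎

module AuxiliaryPolynomial {p}(F : PrimeField p) where
 open FieldPolynomials F

 coef-*-0 : ∀ f g -> coef (f *' g) 0 ≡ coef f 0 K.* coef g 0
 coef-*-0 f g = coef-* f g 0

 coef-^-0 : ∀ f -> coef f 0 ≢ 0# -> ∀ n -> coef (f ^' n) 0 ≢ 0#
 coef-^-0 f f0≢0 zero = K.1≢0
 coef-^-0 f f0≢0 (suc n) e =
  coef-^-0 f f0≢0 n (K.*-cancel (E.trans (E.sym (coef-*-0 f (f ^' n))) e) f0≢0)

 coef-X*-0 : ∀ f g -> coef (X *' f *' g) 0 ≡ 0#
 coef-X*-0 f g = E.trans (coef-*-0 (X *' f) g)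
  (E.trans (E.cong (K._* coef g 0)(E.trans (coef-*-0 X f)(K.zeroˡ _)))(K.zeroˡ _))

 Monic-X : Monic 1 X
 Monic-X = monic E.refl \{ (suc (suc k)) _ -> E.refl; (suc zero)(s≤s ()) }

 +-cancelˡ : ∀ x {y z} -> x +' y ≈' x +' z -> y ≈' z
 +-cancelˡ x {y}{z} e = ∙-cancelˡ x y z e
  where open AbelianGroup P.+-abelianGroup using (∙-cancelˡ)

 -- The valuation at 0 of X ^ n * Z is at least n, so the n coefficients of b can be read off.
 separate : ∀ n b b' H Z Z' -> length b ≡ n -> length b' ≡ n -> coef H 0 ≢ 0# ->
  H *' b +' X ^' n *' Z ≈' H *' b' +' X ^' n *' Z' -> b ≡ b' × Z ≈' Z'
 separate zero [] [] H Z Z' _ _ H0 e = E.refl , P.trans (simplify Z)(P.trans e (P.sym (simplify Z')))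
  where
  simplify : ∀ Z -> Z ≈' H *' [] +' const K.1# *' Z
  simplify Z = P.sym (P.trans (P.+-congʳ {const K.1# *' Z}(P.zeroʳ H))(P.*-identityˡ Z))
 separate (suc n)(β ∷ b)(β' ∷ b') H Z Z' l l' H0 e = cong₂ _∷_ β≡β' (fst IH) , snd IH
  where
  at-0 : ∀ β b Z -> coef (H *' (β ∷ b) +' X ^' suc n *' Z) 0 ≡ coef H 0 K.* β
  at-0 β b Z = E.trans (coef-+ (H *' (β ∷ b))(X ^' suc n *' Z) 0)
   (E.trans (cong₂ K._+_ (coef-*-0 H (β ∷ b))(coef-X*-0 (X ^' n) Z))(K.+-identityʳ _))
  β≡β' : β ≡ β'
  β≡β' = x∙y⁻¹≈ε⇒x≈y β β' (K.*-cancel {coef H 0}{β K.+ (K.- β')}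
   (E.trans (KS.solve 3 (\h x y -> h KS.:* (x KS.:- y) KS.:= h KS.:* x KS.:- h KS.:* y) E.refl (coef H 0) β β')
   (x≈y⇒x∙y⁻¹≈ε (E.trans (E.sym (at-0 β b Z))(E.trans (at e 0)(at-0 β' b' Z'))))) H0)
   where
   open AbelianGroup K.+-abelianGroup using (x≈y⇒x∙y⁻¹≈ε;x∙y⁻¹≈ε⇒x≈y)
  split : ∀ β b Z -> H *' (β ∷ b) +' X ^' suc n *' Z ≈' H *' const β +' X *' (H *' b +' X ^' n *' Z)
  split β b Z = P.trans (P.+-congʳ {X ^' suc n *' Z}(P.*-congˡ {H}(shift-≈ β b)))
   (PS.solve 6 (\H c x b y Z -> H PS.:* (c PS.:+ x PS.:* b) PS.:+ x PS.:* y PS.:* Z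
   PS.:= H PS.:* c PS.:+ x PS.:* (H PS.:* b PS.:+ y PS.:* Z)) P.refl H (const β) X b (X ^' n) Z)
  IH : b ≡ b' × Z ≈' Z'
  IH = separate n b b' H Z Z' (N.suc-injective l)(N.suc-injective l') H0
   (*'-cancelˡ {g = H *' b +' X ^' n *' Z}{H *' b' +' X ^' n *' Z'} Monic-X
   (+-cancelˡ (H *' const β)(P.trans (P.sym (split β b Z))(P.trans e (P.trans (split β' b' Z')
   (P.reflexive (E.cong (\ γ -> H *' const γ +' X *' (H *' b' +' X ^' n *' Z'))(E.sym β≡β'))))))))

 Bounded-^ : ∀ {m} f -> Bounded (suc m) f -> ∀ n -> Bounded (suc (n N.* m))(f ^' n)
 Bounded-^ f b zero = bounded Monic-1
 Bounded-^ f b (suc n) = Bounded-* f (f ^' n) b (Bounded-^ f b n)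

 -- b is the size of a block, and f vanishes to order exactly 1 at the origin.
 module Blocks (f G : Poly)(f≈XG : f ≈' X *' G)(G0≢0 : coef G 0 ≢ 0#)(e : ℕ) where
  private
   b = suc e

  rowValue : List Poly -> Poly
  rowValue [] = []
  rowValue (r ∷ rs) = r +' f ^' b *' rowValue rs

  arrayValue : ℕ -> List (List Poly) -> Poly
  arrayValue Q [] = []
  arrayValue Q (rs ∷ rss) = rowValue rs +' X ^' Q *' arrayValue Q rss

  row-separate : ∀ n rs rs' t H Y Y' -> length rs ≡ n -> length rs' ≡ n ->
   All (\r -> length r ≡ b) rs -> All (\r -> length r ≡ b) rs' ->
   n N.* b N.≤ t -> coef H 0 ≢ 0# ->
   H *' rowValue rs +' X ^' t *' Y ≈' H *' rowValue rs' +' X ^' t *' Y' ->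
   rs ≡ rs' × Y ≈' Y'
  row-separate zero [] [] t H Y Y' _ _ _ _ _ _ eq = E.refl
   , *'-cancelˡ {g = Y}{Y'}(Monic-^ Monic-X t)
   (P.trans (simplify Y)(P.trans eq (P.sym (simplify Y'))))
   where
   simplify : ∀ Y -> X ^' t *' Y ≈' H *' [] +' X ^' t *' Y
   simplify Y = P.sym (P.+-congʳ {X ^' t *' Y}(P.zeroʳ H))
  row-separate (suc n)(r ∷ rs)(r' ∷ rs') t H Y Y' l l' (a ∷ as)(a' ∷ as') le H0 eq =
   cong₂ _∷_ (fst first)(fst second) , snd second
   where
   t' = t N.∸ b
   t≡ : b N.+ t' ≡ t
   t≡ = N.m+[n∸m]≡n (≤-tr (N.m≤m+n b (n N.* b)) le)
   rest : List Poly -> Poly -> Poly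
   rest rs Y = H *' G ^' b *' rowValue rs +' X ^' t' *' Y
   expand : ∀ r x g R x' Y -> H *' (r +' x *' g *' R) +' x *' x' *' Y
    ≈' H *' r +' x *' (H *' g *' R +' x' *' Y)
   expand = PS.solve 7 (\H r x g R x' Y -> H PS.:* (r PS.:+ x PS.:* g PS.:* R) PS.:+ x PS.:* x' PS.:* Y
    PS.:= H PS.:* r PS.:+ x PS.:* (H PS.:* g PS.:* R PS.:+ x' PS.:* Y)) P.refl H
   split : ∀ r rs Y -> H *' (r +' f ^' b *' rowValue rs) +' X ^' t *' Y
    ≈' H *' r +' X ^' b *' rest rs Y
   split r rs Y = P.trans (P.+-cong
    (P.*-congˡ {H}(P.+-congˡ {r}(P.*-congʳ {rowValue rs}
    (P.trans (^'-congˡ b f≈XG)(^'-distrib-* X G b)))))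
    (P.*-congʳ {Y}(P.trans (P.reflexive (E.cong (X ^'_)(E.sym t≡)))(^'-homo-* X b t'))))
    (expand r (X ^' b)(G ^' b)(rowValue rs)(X ^' t') Y)
   first : r ≡ r' × rest rs Y ≈' rest rs' Y'
   first = separate b r r' H (rest rs Y)(rest rs' Y') a a' H0
    (P.trans (P.sym (split r rs Y))(P.trans eq (split r' rs' Y')))
   second : rs ≡ rs' × Y ≈' Y'
   second = row-separate n rs rs' t' (H *' G ^' b) Y Y' (N.suc-injective l)(N.suc-injective l') as as'
    (≤-tr (≡⇒≤ (E.sym (N.m+n∸m≡n b (n N.* b))))(N.∸-monoˡ-≤ b le))
    (\z -> coef-^-0 G G0≢0 b (K.*-cancel (E.trans (E.sym (coef-*-0 H (G ^' b))) z) H0))(snd first)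

  Row : ℕ -> List Poly -> Set
  Row d rs = length rs ≡ d × All (\r -> length r ≡ b) rs

  array-injective : ∀ d Q -> d N.* b N.≤ Q -> ∀ n rss rss' -> length rss ≡ n -> length rss' ≡ n ->
   All (Row d) rss -> All (Row d) rss' ->
   arrayValue Q rss ≈' arrayValue Q rss' -> rss ≡ rss'
  array-injective d Q le zero [] [] _ _ _ _ _ = E.refl
  array-injective d Q le (suc n)(rs ∷ rss)(rs' ∷ rss') l l' ((k , a) ∷ as)((k' , a') ∷ as') eq =
   cong₂ _∷_ (fst first)
   (array-injective d Q le n rss rss' (N.suc-injective l)(N.suc-injective l') as as' (snd first))
   where
   unit : ∀ rs rss -> const K.1# *' rowValue rs +' X ^' Q *' arrayValue Q rss ≈' arrayValue Q (rs ∷ rss)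
   unit rs rss = P.+-congʳ {X ^' Q *' arrayValue Q rss}(P.*-identityˡ (rowValue rs))
   first : rs ≡ rs' × arrayValue Q rss ≈' arrayValue Q rss'
   first = row-separate d rs rs' Q (const K.1#)(arrayValue Q rss)(arrayValue Q rss') k k' a a' le K.1≢0
    (P.trans (unit rs rss)(P.trans eq (P.sym (unit rs' rss'))))

  module _ {m}(f-bounded : Bounded (suc m) f) where
   row-bounded : ∀ n rs -> length rs ≡ n -> All (\r -> length r ≡ b) rs ->
    Bounded (suc (e N.+ n N.* (b N.* m)))(rowValue rs)
   row-bounded zero [] _ _ k _ = E.refl
   row-bounded (suc n)(r ∷ rs) l (a ∷ as) = Bounded-+ r (f ^' b *' rowValue rs)
    (Bounded-mono r (s≤s (N.m≤m+n e _))(subst (\i -> Bounded i r) a (Bounded-length r)))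
    (subst (\i -> Bounded (suc i)(f ^' b *' rowValue rs))(id2 (b N.* m) e (n N.* (b N.* m)))
    (Bounded-* (f ^' b)(rowValue rs)(Bounded-^ f f-bounded b)(row-bounded n rs (N.suc-injective l) as)))

   array-bounded : ∀ d Q n rss -> length rss ≡ n -> All (Row d) rss ->
    Bounded (suc (e N.+ d N.* (b N.* m) N.+ n N.* Q))(arrayValue Q rss)
   array-bounded d Q zero [] _ _ k _ = E.refl
   array-bounded d Q (suc n)(rs ∷ rss) l ((k , a) ∷ as) = Bounded-+ (rowValue rs)(X ^' Q *' arrayValue Q rss)
    (Bounded-mono (rowValue rs)(s≤s (N.m≤m+n _ _))(row-bounded d rs k a))
    (subst (\i -> Bounded (suc i)(X ^' Q *' arrayValue Q rss))(id3 Q (e N.+ d N.* (b N.* m))(n N.* Q))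
    (Bounded-* (X ^' Q)(arrayValue Q rss)(Bounded-^ X (bounded Monic-X) Q)(array-bounded d Q n rss (N.suc-injective l) as)))

  -- Modulo an irreducible P with X ^ (Q * Q) ≡ X and f ^ (b + b * Q) ≡ u, the Q-th power of
  -- f * arrayValue is congruent to arrayReduced, which has much smaller degree.
  rowReduced : ℕ -> ℕ -> 𝕂 -> 𝕂 -> List Poly -> Poly
  rowReduced Q i u v [] = []
  rowReduced Q i u v (r ∷ rs) = const v *' (r ^' Q *' f ^' i) +' rowReduced Q (i N.∸ b) u (v K.* u) rs

  arrayReduced : ℕ -> 𝕂 -> List (List Poly) -> Poly
  arrayReduced Q u [] = []
  arrayReduced Q u (rs ∷ rss) = rowReduced Q Q u K.1# rs +' X *' arrayReduced Q u rss

  module _ {m}(f-bounded : Bounded (suc m) f) where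
   rowReduced-bounded : ∀ Q i u v rs -> i N.≤ Q -> All (\r -> length r ≡ b) rs ->
    Bounded (suc (Q N.* e N.+ Q N.* m))(rowReduced Q i u v rs)
   rowReduced-bounded Q i u v [] le _ k _ = E.refl
   rowReduced-bounded Q i u v (r ∷ rs) le (a ∷ as) =
    Bounded-+ (const v *' (r ^' Q *' f ^' i))(rowReduced Q (i N.∸ b) u (v K.* u) rs)
    (Bounded-* {0}(const v)(r ^' Q *' f ^' i)(\{ (suc k) _ -> E.refl })
    (Bounded-* (r ^' Q)(f ^' i)(Bounded-^ r (subst (\j -> Bounded j r) a (Bounded-length r)) Q)
    (Bounded-mono (f ^' i)(s≤s (N.*-monoˡ-≤ m le))(Bounded-^ f f-bounded i))))
    (rowReduced-bounded Q (i N.∸ b) u (v K.* u) rs (≤-tr (N.m∸n≤m i b) le) as)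

   arrayReduced-bounded : ∀ d Q u n rss -> length rss ≡ n -> All (Row d) rss ->
    Bounded (suc (Q N.* e N.+ Q N.* m N.+ n))(arrayReduced Q u rss)
   arrayReduced-bounded d Q u zero [] _ _ k _ = E.refl
   arrayReduced-bounded d Q u (suc n)(rs ∷ rss) l ((_ , a) ∷ as) =
    Bounded-+ (rowReduced Q Q u K.1# rs)(X *' arrayReduced Q u rss)
    (Bounded-mono (rowReduced Q Q u K.1# rs)(s≤s (N.m≤m+n _ _))(rowReduced-bounded Q Q u K.1# rs N.≤-refl a))
    (subst (\i -> Bounded i (X *' arrayReduced Q u rss))(E.cong suc (E.sym (N.+-suc _ n)))
    (Bounded-* X (arrayReduced Q u rss)(bounded Monic-X)
    (arrayReduced-bounded d Q u n rss (N.suc-injective l) as)))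

module StepanovReduction {p}(F : PrimeField p)(w : List.List (PrimeField.Carrier F))
 (irr : FieldPolynomials.IrreducibleWord F w) where
 open FieldPolynomials F
 open Reciprocity F w irr
 open AuxiliaryPolynomial F
 open Exp A.commutativeSemiring
 open Setoid-Reasoning A.setoid
 private module AS = IntegerSolver quotientRing

 module _ (f G : Poly)(f≈XG : f ≈' X *' G)(G0≢0 : coef G 0 ≢ 0#)(e μ : ℕ) where
  private
   Q = p N.^ μ
   b = suc e
  open Blocks f G f≈XG G0≢0 e

  module _ {u}(f-power : f ^ (b N.+ b N.* Q) ≡ₘ const u) where
   row-reduction : ∀ i v rs -> length rs N.* b N.≤ i ->
    f ^ i *' rowValue rs ^ Q *' const v ≡ₘ rowReduced Q i u v rs
   row-reduction i v [] _ = begin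
    f ^ i *' [] ^ Q *' const v ≈⟨ A.*-cong {f ^ i *' [] ^ Q}(A.*-cong {f ^ i} A.refl (frobenius-eval μ [] X)) A.refl ⟩
    f ^ i *' [] *' const v ≈⟨ AS.solve 2 (\x y -> x AS.:* AS.:0 AS.:* y AS.:= AS.:0) A.refl (f ^ i)(const v) ⟩
    [] ∎
   row-reduction i v (r ∷ rs) le = begin
    f ^ i *' (r +' f ^' b *' R) ^ Q *' const v
    ≈⟨ A.*-cong {f ^ i *' (r +' f ^' b *' R) ^ Q}(A.*-cong {f ^ i} A.refl (A.trans (frobenius μ r (f ^' b *' R))
    (A.+-cong {r ^ Q} A.refl (A.trans (^-distrib-* (f ^' b) R Q)
    (A.*-cong {(f ^' b) ^ Q}(A.trans (A.reflexive (E.cong (_^ Q)(^'≡^ f b)))(^-assocʳ f b Q)) A.refl))))) A.refl ⟩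
    f ^ i *' (r ^ Q +' f ^ (b N.* Q) *' R ^ Q) *' const v
    ≈⟨ A.*-cong {f ^ i *' (r ^ Q +' f ^ (b N.* Q) *' R ^ Q)}(A.*-cong {f ^ i} f^i A.refl) A.refl ⟩
    f ^ b *' f ^ j *' (r ^ Q +' f ^ (b N.* Q) *' R ^ Q) *' const v
    ≈⟨ regroup (f ^ b)(f ^ j)(r ^ Q)(f ^ (b N.* Q))(R ^ Q)(const v) ⟩
    const v *' (r ^ Q *' (f ^ b *' f ^ j)) +' f ^ j *' R ^ Q *' (const v *' (f ^ b *' f ^ (b N.* Q)))
    ≈⟨ A.+-cong {const v *' (r ^ Q *' (f ^ b *' f ^ j))}(A.*-cong {const v} A.refl (A.*-cong {r ^ Q} A.refl (A.sym f^i)))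
    (A.*-cong {f ^ j *' R ^ Q} A.refl (A.trans (A.*-cong {const v} A.refl
    (A.trans (A.sym (^-homo-* f b (b N.* Q))) f-power))(A.sym (*-homo v u)))) ⟩
    const v *' (r ^ Q *' f ^ i) +' f ^ j *' R ^ Q *' const (v K.* u)
    ≈⟨ A.+-cong {const v *' (r ^ Q *' f ^ i)}
    (A.reflexive (cong₂ (\x y -> const v *' (x *' y))(E.sym (^'≡^ r Q))(E.sym (^'≡^ f i))))
    (row-reduction j (v K.* u) rs le') ⟩
    const v *' (r ^' Q *' f ^' i) +' rowReduced Q j u (v K.* u) rs ∎
    where
    open Homomorphism embedding using (*-homo)
    R = rowValue rs
    j = i N.∸ b
    f^i : f ^ i ≡ₘ f ^ b *' f ^ j
    f^i = A.trans (A.reflexive (E.cong (f ^_)(E.sym (N.m+[n∸m]≡n (≤-tr (N.m≤m+n b _) le)))))(^-homo-* f b j)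
    le' : length rs N.* b N.≤ j
    le' = ≤-tr (≡⇒≤ (E.sym (N.m+n∸m≡n b (length rs N.* b))))(N.∸-monoˡ-≤ b le)
    regroup : ∀ fb fj rQ fbQ RQ v -> fb *' fj *' (rQ +' fbQ *' RQ) *' v
     ≡ₘ v *' (rQ *' (fb *' fj)) +' fj *' RQ *' (v *' (fb *' fbQ))
    regroup = AS.solve 6 (\fb fj rQ fbQ RQ v -> fb AS.:* fj AS.:* (rQ AS.:+ fbQ AS.:* RQ) AS.:* v
     AS.:= v AS.:* (rQ AS.:* (fb AS.:* fj)) AS.:+ fj AS.:* RQ AS.:* (v AS.:* (fb AS.:* fbQ))) A.refl

   array-reduction : X ^ (Q N.* Q) ≡ₘ X -> ∀ rss -> All (\rs -> length rs N.* b N.≤ Q) rss ->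
    f ^ Q *' arrayValue Q rss ^ Q ≡ₘ arrayReduced Q u rss
   array-reduction X-fixed [] _ = A.trans (A.*-cong {f ^ Q} A.refl (frobenius-eval μ [] X))(A.zeroʳ (f ^ Q))
   array-reduction X-fixed (rs ∷ rss)(le ∷ les) = begin
    f ^ Q *' (R +' X ^' Q *' S) ^ Q
    ≈⟨ A.*-cong {f ^ Q} A.refl (A.trans (frobenius μ R (X ^' Q *' S))
    (A.+-cong {R ^ Q} A.refl (A.trans (^-distrib-* (X ^' Q) S Q)
    (A.*-cong {(X ^' Q) ^ Q}(A.trans (A.reflexive (E.cong (_^ Q)(^'≡^ X Q)))
    (A.trans (^-assocʳ X Q Q) X-fixed)) A.refl)))) ⟩
    f ^ Q *' (R ^ Q +' X *' S ^ Q)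
    ≈⟨ regroup (f ^ Q)(R ^ Q) X (S ^ Q) ⟩
    f ^ Q *' R ^ Q *' const K.1# +' X *' (f ^ Q *' S ^ Q)
    ≈⟨ A.+-cong {f ^ Q *' R ^ Q *' const K.1#}(row-reduction Q K.1# rs le)
    (A.*-cong {X} A.refl (array-reduction X-fixed rss les)) ⟩
    rowReduced Q Q u K.1# rs +' X *' arrayReduced Q u rss ∎
    where
    R = rowValue rs
    S = arrayValue Q rss
    regroup : ∀ f R x S -> f *' (R +' x *' S) ≡ₘ f *' R *' const K.1# +' x *' (f *' S)
    regroup = AS.solve 4 (\f R x S -> f AS.:* (R AS.:+ x AS.:* S) AS.:= f AS.:* R AS.:* AS.:1 AS.:+ x AS.:* (f AS.:* S)) A.refl

module Stepanov {p}(F : PrimeField p) where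
 open Enumeration using (tuples;tuples-unique;∈-tuples⁻;length-tuples;pigeonhole)
 open FieldPolynomials F
 open AuxiliaryPolynomial F
 open P using (_-_)

 record Point (f : Poly)(u : 𝕂)(μ : ℕ)(w : List 𝕂) : Set where
  field
   irr : IrreducibleWord w
   fixed : mon w ∣' X ^' (p N.^ μ N.* p N.^ μ) - X
   power : mon w ∣' f ^' (geom p 0 μ N.+ geom p 0 μ N.* p N.^ μ) - const u

 parameter-count : ∀ k e m Q -> Q ≡ suc ((2 N.+ k) N.* suc e) ->
  suc (Q N.* e N.+ Q N.* m N.+ (suc e N.+ 3 N.* m N.+ 3))
  N.< suc e N.* (2 N.+ k) N.* (suc e N.+ 3 N.* m N.+ 3)
 parameter-count k e m Q E.refl = N.m+n≤o⇒m≤o _ (≡⇒≤ (E.sym (id4 k e m)))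

 degree-count : ∀ k e m Q -> Q ≡ suc ((2 N.+ k) N.* suc e) ->
  e N.+ (2 N.+ k) N.* (suc e N.* m) N.+ (suc e N.+ 3 N.* m N.+ 3) N.* Q
  N.≤ suc e N.+ suc e N.* Q N.+ (4 N.* m N.+ 3) N.* Q
 degree-count k e m Q E.refl = N.m+n≤o⇒m≤o _ (≡⇒≤ (E.sym (id5 k e m)))

 module _ (f G : Poly)(f≈XG : f ≈' X *' G)(G0≢0 : coef G 0 ≢ 0#){m}(f-bounded : Bounded (suc m) f) where
  stepanov : ∀ k -> p ≡ 3 N.+ k -> ∀ μ {u} -> u ≢ 0# -> ∀ ws -> Unique ws -> All (Point f u (suc μ)) ws ->
   sum (map length ws) N.≤ geom p 0 (suc μ) N.+ geom p 0 (suc μ) N.* p N.^ suc μ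
   N.+ (4 N.* m N.+ 3) N.* p N.^ suc μ
  stepanov k p≡ μ {u} u≢0 ws unique points = conclude
   (pigeonhole (words W)(tuples-unique (tuples-unique (words-unique b) d) K') count reduced reduced∈)
   where
   d = 2 N.+ k
   e = geom p 1 μ
   b = suc e
   Q = p N.^ suc μ
   K' = suc e N.+ 3 N.* m N.+ 3
   W = suc (Q N.* e N.+ Q N.* m N.+ K')
   arrays = tuples (tuples (words b) d) K'
   open Blocks f G f≈XG G0≢0 e
   Q≡ : Q ≡ suc (d N.* b)
   Q≡ = E.trans (E.sym (GeometricSums.geom-sum p d p≡ 0 (suc μ)))(N.+-comm (d N.* b) 1)
   instance _ = prime⇒nonTrivial K.prime
   count : length (words W) N.< length arrays
   count = E.subst₂ N._<_ (E.sym (length-words W))(E.sym (E.trans (length-tuples (tuples (words b) d) K')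
    (E.trans (E.cong (N._^ K')(E.trans (length-tuples (words b) d)(E.cong (N._^ d)(length-words b))))
    (E.trans (E.cong (N._^ K')(N.^-*-assoc p b d))(N.^-*-assoc p (b N.* d) K')))))
    (N.^-monoʳ-< p (N.nonTrivial⇒n>1 p)(parameter-count k e m Q Q≡))
   rows : ∀ {rss} -> rss ∈ arrays -> length rss ≡ K' × All (Row d) rss
   rows rss∈ with ∈-tuples⁻ (tuples (words b) d) K' rss∈
   ... | l , all = l , All.map (\rs∈ -> let (l' , all') = ∈-tuples⁻ (words b) d rs∈ in l' , All.map (length-∈-words b) all') all
   reduced : List (List Poly) -> List 𝕂
   reduced rss = low W (arrayReduced Q u rss)
   reduced∈ : ∀ {rss} -> rss ∈ arrays -> reduced rss ∈ words W
   reduced∈ {rss} _ = ∈-words-length W (length-low W (arrayReduced Q u rss))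
   short-rows : ∀ {rss} -> All (Row d) rss -> All (\rs -> length rs N.* b N.≤ Q) rss
   short-rows = All.map \{ {rs}(l , _) -> subst (\n -> n N.* b N.≤ Q)(E.sym l)(subst (d N.* b N.≤_)(E.sym Q≡)(N.n≤1+n _)) }
   conclude : ∃[ rss ] ∃[ rss' ] rss ∈ arrays × rss' ∈ arrays × rss ≢ rss' × reduced rss ≡ reduced rss' -> _
   conclude (rss , rss' , rss∈ , rss'∈ , rss≢rss' , red≡) =
    ≤-tr (Σ-degree-≤ ws unique (All.map Point.irr points)(All.map divides points) Ψ≉0
    (Bounded-+ Ψ1 (-' Ψ2)(array-bounded f-bounded d Q K' rss (fst R1)(snd R1))
    (\i le -> E.trans (coef-- Ψ2 i)(E.trans (E.cong K.-_ (array-bounded f-bounded d Q K' rss' (fst R2)(snd R2) i le)) ε⁻¹≈ε))))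
    (degree-count k e m Q Q≡)
    where
    open AbelianGroup K.+-abelianGroup using (ε⁻¹≈ε)
    open AbelianGroup P.+-abelianGroup using (x∙y⁻¹≈ε⇒x≈y)
    Ψ1 = arrayValue Q rss
    Ψ2 = arrayValue Q rss'
    R1 = rows rss∈
    R2 = rows rss'∈
    Ψ≉0 : ¬ Ψ1 - Ψ2 ≈' []
    Ψ≉0 z = rss≢rss' (array-injective d Q (subst (d N.* b N.≤_)(E.sym Q≡)(N.n≤1+n _)) K' rss rss'
     (fst R1)(fst R2)(snd R1)(snd R2)(x∙y⁻¹≈ε⇒x≈y Ψ1 Ψ2 z))
    reduced≈ : arrayReduced Q u rss ≈' arrayReduced Q u rss'
    reduced≈ = P.trans (Bounded⇒≈low W _ (arrayReduced-bounded f-bounded d Q u K' rss (fst R1)(snd R1)))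
     (P.trans (P.reflexive red≡)(P.sym (Bounded⇒≈low W _ (arrayReduced-bounded f-bounded d Q u K' rss' (fst R2)(snd R2)))))
    divides : ∀ {w} -> Point f u (suc μ) w -> mon w ∣' Ψ1 - Ψ2
    divides {w} point = ≡ₘ⇒∣ (frobenius-injective (suc μ) Ψ1 Ψ2 (y-z≈0⇒y≈z (Ψ1 ^ Q)(Ψ2 ^ Q)
     (cancel (f ^ Q)(Ψ1 ^ Q - Ψ2 ^ Q) difference f^Q≉0)))
     where
     open Point point
     open Reciprocity F w irr
     open StepanovReduction F w irr
     open Exp A.commutativeSemiring
     open AbelianGroup A.+-abelianGroup renaming (x≈y⇒x∙y⁻¹≈ε to y≈z⇒y-z≈0;x∙y⁻¹≈ε⇒x≈y to y-z≈0⇒y≈z) using ()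
     module AS = IntegerSolver quotientRing
     fixed' : X ^ (Q N.* Q) ≡ₘ X
     fixed' = A.trans (A.reflexive (E.sym (^'≡^ X (Q N.* Q))))(∣⇒≡ₘ fixed)
     power' : f ^ (b N.+ b N.* Q) ≡ₘ const u
     power' = A.trans (A.reflexive (E.sym (^'≡^ f (b N.+ b N.* Q))))(∣⇒≡ₘ power)
     equal : f ^ Q *' Ψ1 ^ Q ≡ₘ f ^ Q *' Ψ2 ^ Q
     equal = A.trans (array-reduction f G f≈XG G0≢0 e (suc μ) power' fixed' rss (short-rows (snd R1)))
      (A.trans (≈⇒≡ₘ reduced≈)(A.sym
      (array-reduction f G f≈XG G0≢0 e (suc μ) power' fixed' rss' (short-rows (snd R2)))))
     difference : f ^ Q *' (Ψ1 ^ Q - Ψ2 ^ Q) ≡ₘ []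
     difference = A.trans (AS.solve 3 (\f x y -> f AS.:* (x AS.:- y) AS.:= f AS.:* x AS.:- f AS.:* y) A.refl
      (f ^ Q)(Ψ1 ^ Q)(Ψ2 ^ Q))(y≈z⇒y-z≈0 equal)
     const-≉0 : ∀ {c} -> c ≢ 0# -> ¬ const c ≡ₘ []
     const-≉0 {c} c≢0 c≈0 with K.inverse c≢0
     ... | c⁻¹ , cc⁻¹≡1 = 1≉0 (A.trans (A.reflexive (E.cong const (E.sym cc⁻¹≡1)))
      (A.trans (Homomorphism.*-homo embedding c c⁻¹)(A.*-cong {const c}{[]}{const c⁻¹} c≈0 A.refl)))
     f^Q≉0 : ¬ f ^ Q ≡ₘ []
     f^Q≉0 z = const-≉0 u≢0 (A.trans (A.sym power')(A.*-cong {f}{[]}(^-zero f Q z) A.refl))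

-- An ordered field with roots of nonnegative elements in which the order is classical only up
-- to double negation; since _≤_ is stable, this suffices for proving inequalities.
record RealField : Set₁ where
 field
  ring : CommutativeRing 0ℓ 0ℓ
 open CommutativeRing ring public hiding (ring)
 open RawSemiringDefinitions (Semiring.rawSemiring semiring) public using (_^_) renaming (_×_ to _·_)
 infix 4 _≤_
 field
  _≤_ : Carrier -> Carrier -> Set
  ≤-reflexive : ∀ {x y} -> x ≈ y -> x ≤ y
  ≤-trans : ∀ {x y z} -> x ≤ y -> y ≤ z -> x ≤ z
  ≤-antisym : ∀ {x y} -> x ≤ y -> y ≤ x -> x ≈ y
  +-mono-≤ : ∀ {x y u v} -> x ≤ y -> u ≤ v -> x + u ≤ y + v
  *-nonneg : ∀ {x y} -> 0# ≤ x -> 0# ≤ y -> 0# ≤ x * y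
  1≰0 : ¬ 1# ≤ 0#
  stable : ∀ {x y} -> ¬ ¬ x ≤ y -> x ≤ y
  total : ∀ x y -> ¬ ¬ (x ≤ y ⊎ y ≤ x)
  inverse : ∀ {x} -> ¬ x ≤ 0# -> ¬ ¬ (∃[ y ] 0# ≤ y × y * x ≈ 1#)
  root : ℕ -> Carrier -> Carrier
  root-nonneg : ∀ k x -> 0# ≤ root (suc k) x
  root-power : ∀ k {x} -> 0# ≤ x -> root (suc k) x ^ suc k ≈ x

module RealProperties (ℝ : RealField) where
 open RealField ℝ public
 open Exp commutativeSemiring public using (^-congˡ;^-homo-*;^-assocʳ;^-distrib-*)
 open Mult semiring public using (×-homo-+;×-assoc-*;×-comm-*;×1-homo-*;×-congʳ)
 private module RS = IntegerSolver ring
 open RS using (solve;_:=_;_:+_;_:*_;_:-_;:-_;:0;:1) public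

 ≡-cong : ∀ {A : Set}(f : A -> Carrier){x y} -> x ≡ y -> f x ≈ f y
 ≡-cong f e = reflexive (E.cong f e)

 poset : Poset 0ℓ 0ℓ 0ℓ
 poset = record
  { Carrier = Carrier; _≈_ = _≈_; _≤_ = _≤_
  ; isPartialOrder = record
  { isPreorder = record { isEquivalence = isEquivalence; reflexive = ≤-reflexive; trans = ≤-trans }
  ; antisym = ≤-antisym } }

 module ≤-Reasoning = Relation.Binary.Reasoning.PartialOrder poset

 ≤-refl : ∀ {x} -> x ≤ x
 ≤-refl = ≤-reflexive refl

 ≤-respˡ : ∀ {x y z} -> x ≈ y -> y ≤ z -> x ≤ z
 ≤-respˡ e h = ≤-trans (≤-reflexive e) h

 ≤-respʳ : ∀ {x y z} -> y ≈ z -> x ≤ y -> x ≤ z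
 ≤-respʳ e h = ≤-trans h (≤-reflexive e)

 -- Any inequality may be proved by cases on the order of two elements.
 by-total : ∀ x y {u v} -> (x ≤ y -> u ≤ v) -> (y ≤ x -> u ≤ v) -> u ≤ v
 by-total x y f g = stable \ ¬uv -> total x y \{ (inl h) -> ¬uv (f h); (inr h) -> ¬uv (g h) }

 x≤y⇒0≤y-x : ∀ {x y} -> x ≤ y -> 0# ≤ y - x
 x≤y⇒0≤y-x {x} h = ≤-respˡ (sym (-‿inverseʳ x))(+-mono-≤ h ≤-refl)

 0≤y-x⇒x≤y : ∀ {x y} -> 0# ≤ y - x -> x ≤ y
 0≤y-x⇒x≤y {x}{y} h = ≤-respˡ (sym (+-identityˡ x))
  (≤-respʳ (solve 2 (\x y -> y :- x :+ x := y) refl x y)(+-mono-≤ h (≤-refl {x})))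

 *-monoˡ : ∀ {c x y} -> 0# ≤ c -> x ≤ y -> c * x ≤ c * y
 *-monoˡ {c}{x}{y} 0≤c x≤y = 0≤y-x⇒x≤y (≤-respʳ
  (solve 3 (\c x y -> c :* (y :- x) := c :* y :- c :* x) refl c x y)(*-nonneg 0≤c (x≤y⇒0≤y-x x≤y)))

 *-monoʳ : ∀ {c x y} -> 0# ≤ c -> x ≤ y -> x * c ≤ y * c
 *-monoʳ 0≤c x≤y = ≤-respˡ (*-comm _ _)(≤-respʳ (*-comm _ _)(*-monoˡ 0≤c x≤y))

 *-mono : ∀ {x y u v} -> 0# ≤ x -> 0# ≤ v -> x ≤ y -> u ≤ v -> x * u ≤ y * v
 *-mono 0≤x 0≤v x≤y u≤v = ≤-trans (*-monoˡ 0≤x u≤v)(*-monoʳ 0≤v x≤y)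

 square-nonneg : ∀ x -> 0# ≤ x * x
 square-nonneg x = by-total 0# x (\h -> *-nonneg h h) \h ->
  ≤-respʳ (solve 1 (\x -> (:0 :- x) :* (:0 :- x) := x :* x) refl x)
  (*-nonneg (x≤y⇒0≤y-x h)(x≤y⇒0≤y-x h))

 0≤1 : 0# ≤ 1#
 0≤1 = ≤-respʳ (*-identityˡ 1#)(square-nonneg 1#)

 +-nonneg : ∀ {x y} -> 0# ≤ x -> 0# ≤ y -> 0# ≤ x + y
 +-nonneg h k = ≤-respˡ (sym (+-identityˡ 0#))(+-mono-≤ h k)

 x≤x+y : ∀ {x y} -> 0# ≤ y -> x ≤ x + y
 x≤x+y {x} h = ≤-respˡ (sym (+-identityʳ x))(+-mono-≤ ≤-refl h)

 x≤y+x : ∀ {x y} -> 0# ≤ y -> x ≤ y + x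
 x≤y+x {x} h = ≤-respˡ (sym (+-identityˡ x))(+-mono-≤ h ≤-refl)

 +-cancelʳ-≤ : ∀ {x y} z -> x + z ≤ y + z -> x ≤ y
 +-cancelʳ-≤ {x}{y} z h = 0≤y-x⇒x≤y (≤-respʳ
  (solve 3 (\x y z -> y :+ z :- (x :+ z) := y :- x) refl x y z)(x≤y⇒0≤y-x h))

 *-cancelˡ-≤ : ∀ {c x y} -> ¬ c ≤ 0# -> c * x ≤ c * y -> x ≤ y
 *-cancelˡ-≤ {c}{x}{y} c≰0 h = stable \x≰y -> inverse c≰0 \{ (d , 0≤d , dc≈1) ->
  x≰y (≤-respˡ (sym (undo dc≈1 x))(≤-respʳ (undo dc≈1 y)(*-monoˡ 0≤d h))) }
  where
  undo : ∀ {d} -> d * c ≈ 1# -> ∀ z -> d * (c * z) ≈ z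
  undo e z = trans (sym (*-assoc _ _ _))(trans (*-congʳ e)(*-identityˡ z))

 *-positive : ∀ {x y} -> ¬ x ≤ 0# -> ¬ y ≤ 0# -> ¬ x * y ≤ 0#
 *-positive {x} x≰0 y≰0 h = y≰0 (*-cancelˡ-≤ x≰0 (≤-respʳ (sym (zeroʳ x)) h))

 ^-nonneg : ∀ {x} n -> 0# ≤ x -> 0# ≤ x ^ n
 ^-nonneg zero h = 0≤1
 ^-nonneg (suc n) h = *-nonneg h (^-nonneg n h)

 ^-positive : ∀ {x} n -> ¬ x ≤ 0# -> ¬ x ^ n ≤ 0#
 ^-positive zero h = 1≰0
 ^-positive (suc n) h = *-positive h (^-positive n h)

 ^-mono : ∀ {x y} n -> 0# ≤ x -> x ≤ y -> x ^ n ≤ y ^ n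
 ^-mono zero 0≤x h = ≤-refl
 ^-mono (suc n) 0≤x h = *-mono 0≤x (^-nonneg n (≤-trans 0≤x h)) h (^-mono n 0≤x h)

 ≰⇒≥ : ∀ {x y} -> ¬ x ≤ y -> y ≤ x
 ≰⇒≥ {x}{y} h = by-total y x (\p -> p)(\p -> contradiction p h)

 ^-cancel-≤ : ∀ {x y} n -> 0# ≤ y -> x ^ suc n ≤ y ^ suc n -> x ≤ y
 ^-cancel-≤ {x}{y} n 0≤y h = stable \x≰y ->
  let y≤x = ≰⇒≥ x≰y
      x≰0 = \x≤0 -> x≰y (≤-trans x≤0 0≤y)
  in x≰y (*-cancelˡ-≤ (^-positive n x≰0)(begin
  x ^ n * x ≈⟨ *-comm _ _ ⟩
  x * x ^ n ≤⟨ h ⟩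
  y * y ^ n ≤⟨ *-monoˡ 0≤y (^-mono n 0≤y y≤x) ⟩
  y * x ^ n ≈⟨ *-comm _ _ ⟩
  x ^ n * y ∎))
  where open ≤-Reasoning

 ^-injective : ∀ {x y} n -> 0# ≤ x -> 0# ≤ y -> x ^ suc n ≈ y ^ suc n -> x ≈ y
 ^-injective n 0≤x 0≤y e = ≤-antisym (^-cancel-≤ n 0≤y (≤-reflexive e))(^-cancel-≤ n 0≤x (≤-reflexive (sym e)))

 # : ℕ -> Carrier
 # n = n · 1#

 #-+ : ∀ m n -> # (m N.+ n) ≈ # m + # n
 #-+ = ×-homo-+ 1#

 #-* : ∀ m n -> # (m N.* n) ≈ # m * # n
 #-* = ×1-homo-*

 #1 : # 1 ≈ 1#
 #1 = +-identityʳ 1#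

 #-^ : ∀ m n -> # (m N.^ n) ≈ # m ^ n
 #-^ m zero = #1
 #-^ m (suc n) = trans (#-* m (m N.^ n))(*-congˡ (#-^ m n))

 0≤# : ∀ n -> 0# ≤ # n
 0≤# zero = ≤-refl
 0≤# (suc n) = +-nonneg 0≤1 (0≤# n)

 #-mono : ∀ {m n} -> m N.≤ n -> # m ≤ # n
 #-mono {n = n} N.z≤n = 0≤# n
 #-mono (N.s≤s h) = +-mono-≤ ≤-refl (#-mono h)

 1≤#suc : ∀ n -> 1# ≤ # (suc n)
 1≤#suc n = x≤x+y (0≤# n)

 #suc≰0 : ∀ n -> ¬ # (suc n) ≤ 0#
 #suc≰0 n h = 1≰0 (≤-trans (1≤#suc n) h)

 #-reflect : ∀ {m n} -> # m ≤ # n -> m N.≤ n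
 #-reflect {m}{n} h = N.≮⇒≥ \n<m -> 1≰0 (+-cancelʳ-≤ (# n)(≤-respʳ (sym (+-identityˡ _))(≤-trans (#-mono n<m) h)))

 1≤^ : ∀ {x} n -> 1# ≤ x -> 1# ≤ x ^ n
 1≤^ zero h = ≤-refl
 1≤^ (suc n) h = ≤-respˡ (sym (*-identityˡ 1#))(*-mono 0≤1 (≤-trans 0≤1 (1≤^ n h)) h (1≤^ n h))

 double : ∀ x j -> x ^ (2 N.* j) ≈ x ^ j * x ^ j
 double x j = trans (≡-cong (\m -> x ^ (j N.+ m))(N.+-identityʳ j))(^-homo-* x j j)

 root-unique : ∀ k {x y} -> 0# ≤ x -> 0# ≤ y -> y ^ suc k ≈ x -> root (suc k) x ≈ y
 root-unique k {x} 0≤x 0≤y e = ^-injective k (root-nonneg k x) 0≤y (trans (root-power k 0≤x)(sym e))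

 root-cong : ∀ k {x y} -> 0# ≤ x -> x ≈ y -> root (suc k) x ≈ root (suc k) y
 root-cong k {x}{y} 0≤x e = root-unique k 0≤x (root-nonneg k y)(trans (root-power k (≤-respʳ e 0≤x))(sym e))

 1^ : ∀ n -> 1# ^ n ≈ 1#
 1^ zero = refl
 1^ (suc n) = trans (*-identityˡ _)(1^ n)

 1≤root : ∀ k {x} -> 1# ≤ x -> 1# ≤ root (suc k) x
 1≤root k {x} h = ^-cancel-≤ k (root-nonneg k x)(≤-respʳ (sym (root-power k (≤-trans 0≤1 h)))(≤-respˡ (1^ (suc k)) h))

 ·≈* : ∀ n x -> n · x ≈ # n * x
 ·≈* n x = trans (×-congʳ n (sym (*-identityˡ x)))(sym (×-assoc-* n 1# x))

 open Summation commutativeSemiring public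

 Σ-mono : ∀ {A : Set}(xs : List A){f g} -> (∀ {x} -> x ∈ xs -> f x ≤ g x) -> Σ xs f ≤ Σ xs g
 Σ-mono [] h = ≤-refl
 Σ-mono (x ∷ xs) h = +-mono-≤ (h (here E.refl))(Σ-mono xs (h ∘ there))

 Σ-nonneg : ∀ {A : Set}(xs : List A){f} -> (∀ {x} -> x ∈ xs -> 0# ≤ f x) -> 0# ≤ Σ xs f
 Σ-nonneg [] h = ≤-refl
 Σ-nonneg (x ∷ xs) h = +-nonneg (h (here E.refl))(Σ-nonneg xs (h ∘ there))

 Σ-bound : ∀ {A : Set}(xs : List A){f c} -> (∀ {x} -> x ∈ xs -> f x ≤ c) -> Σ xs f ≤ # (length xs) * c
 Σ-bound xs {c = c} h = ≤-trans (Σ-mono xs h)(≤-reflexive (trans (Σ-const xs c)(·≈* (length xs) c)))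

-- The complex numbers over a real field; ι is the inclusion of the reals.
record NormedRing (ℝ : RealField) : Set₁ where
 private module R = RealField ℝ
 field
  ring : CommutativeRing 0ℓ 0ℓ
 open CommutativeRing ring public hiding (ring)
 field
  ∣_∣ : Carrier -> R.Carrier
  ∣∣-cong : ∀ {x y} -> x ≈ y -> ∣ x ∣ R.≈ ∣ y ∣
  ∣∣-nonneg : ∀ x -> R.0# R.≤ ∣ x ∣
  ∣∣-* : ∀ x y -> ∣ x * y ∣ R.≈ ∣ x ∣ R.* ∣ y ∣
  ∣∣-+ : ∀ x y -> ∣ x + y ∣ R.≤ ∣ x ∣ R.+ ∣ y ∣
  ∣∣-0 : ∀ {x} -> ∣ x ∣ R.≤ R.0# -> x ≈ 0#
  ι : R.Carrier -> Carrier
  ι-cong : ∀ {x y} -> x R.≈ y -> ι x ≈ ι y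
  ι-+ : ∀ x y -> ι (x R.+ y) ≈ ι x + ι y
  ι-0 : ι R.0# ≈ 0#
  ι-1 : ι R.1# ≈ 1#
  ∣ι∣ : ∀ {x} -> R.0# R.≤ x -> ∣ ι x ∣ R.≈ x
  conj : Carrier -> Carrier
  conj-cong : ∀ {x y} -> x ≈ y -> conj x ≈ conj y
  conj-+ : ∀ x y -> conj (x + y) ≈ conj x + conj y
  conj-* : ∀ x y -> conj (x * y) ≈ conj x * conj y
  conj-0 : conj 0# ≈ 0#
  conj-conj : ∀ x -> conj (conj x) ≈ x
  *-conj : ∀ x -> x * conj x ≈ ι (∣ x ∣ R.* ∣ x ∣)
  ∣conj∣ : ∀ x -> ∣ conj x ∣ R.≈ ∣ x ∣

module NormedProperties {ℝ}(ℂ : NormedRing ℝ) where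
 private module R = RealProperties ℝ
 open NormedRing ℂ public
 open Power semiring public using (_^_)
 open Mult semiring public using () renaming (_×_ to _·_)
 open Summation commutativeSemiring public
 open IntegerSolver ring public using (solve;_:=_;_:+_;_:*_;_:-_;:-_;:0;:1)

 ∣0∣ : ∣ 0# ∣ R.≈ R.0#
 ∣0∣ = R.trans (∣∣-cong (sym ι-0))(∣ι∣ R.≤-refl)

 ∣1∣ : ∣ 1# ∣ R.≈ R.1#
 ∣1∣ = R.trans (∣∣-cong (sym ι-1))(∣ι∣ R.0≤1)

 ∣-∣ : ∀ x -> ∣ - x ∣ R.≈ ∣ x ∣
 ∣-∣ x = R.^-injective 1 (∣∣-nonneg _)(∣∣-nonneg _)(R.trans (square (- x))
  (R.trans (∣∣-cong (solve 1 (\x -> :- x :* :- x := x :* x) refl x))(R.sym (square x))))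
  where
  square : ∀ x -> ∣ x ∣ R.^ 2 R.≈ ∣ x * x ∣
  square x = R.trans (R.*-congˡ (R.*-identityʳ _))(R.sym (∣∣-* x x))

 ∣^∣ : ∀ x n -> ∣ x ^ n ∣ R.≈ ∣ x ∣ R.^ n
 ∣^∣ x zero = ∣1∣
 ∣^∣ x (suc n) = R.trans (∣∣-* x (x ^ n))(R.*-congˡ (∣^∣ x n))

 ∣Σ∣ : ∀ {A : Set}(xs : List A) f -> ∣ Σ xs f ∣ R.≤ R.Σ xs (∣_∣ ∘ f)
 ∣Σ∣ [] f = R.≤-reflexive ∣0∣
 ∣Σ∣ (x ∷ xs) f = R.≤-trans (∣∣-+ _ _)(R.+-mono-≤ R.≤-refl (∣Σ∣ xs f))

 ι-Σ : ∀ {A : Set}(xs : List A) f -> ι (R.Σ xs f) ≈ Σ xs (ι ∘ f)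
 ι-Σ [] f = ι-0
 ι-Σ (x ∷ xs) f = trans (ι-+ _ _)(+-congˡ (ι-Σ xs f))

 conj-Σ : ∀ {A : Set}(xs : List A) f -> conj (Σ xs f) ≈ Σ xs (conj ∘ f)
 conj-Σ [] f = conj-0
 conj-Σ (x ∷ xs) f = trans (conj-+ _ _)(+-congˡ (conj-Σ xs f))

 ι-· : ∀ n -> ι (R.# n) ≈ n · 1#
 ι-· zero = ι-0
 ι-· (suc n) = trans (ι-+ _ _)(+-cong ι-1 (ι-· n))

 ∣·∣ : ∀ n x -> ∣ n · x ∣ R.≈ R.# n R.* ∣ x ∣
 ∣·∣ n x = R.trans (∣∣-cong (trans (×-congʳ n (sym (*-identityˡ x)))(sym (×-assoc-* n 1# x))))
  (R.trans (∣∣-* _ x)(R.*-congʳ (R.trans (∣∣-cong (sym (ι-· n)))(∣ι∣ (R.0≤# n)))))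
  where open Mult semiring using (×-congʳ; ×-assoc-*)

 ∣x-y∣≤ : ∀ x y -> ∣ x - y ∣ R.≤ ∣ x ∣ R.+ ∣ y ∣
 ∣x-y∣≤ x y = R.≤-trans (∣∣-+ x (- y))(R.+-mono-≤ R.≤-refl (R.≤-reflexive (∣-∣ y)))

module Graeffe {ℝ}(ℂ : NormedRing ℝ) where
 private module R = RealProperties ℝ
 open NormedProperties ℂ
 open PowerSeries ring
 open Mult semiring using (×-homo-+;×-congʳ;×-assoc-*;×-comm-*;×-assocˡ;×-congˡ)
 open import Algebra.Properties.Ring (CommutativeRing.ring ring) using (-‿distribˡ-*)
 open AbelianGroup +-abelianGroup using (x∙y⁻¹≈ε⇒x≈y;x≈y⇒x∙y⁻¹≈ε)
 private module 𝕊 = CommutativeRing seriesRing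
 open Setoid-Reasoning setoid

 Newton : Series -> Series -> Set
 Newton L S = ∀ n -> n · L n ≈ Σ (upTo n)(\k -> S (suc k) * L (n N.∸ suc k))

 θ : Series -> Series
 θ f n = n · f n

 θ-⊛ : ∀ f g -> θ (f ⊛ g) ≋ θ f ⊛ g ⊕ f ⊛ θ g
 θ-⊛ f g n = begin
  n · (f ⊛ g) n
  ≈⟨ ×-congʳ n (⊛-Σ f g n) ⟩
  n · Σ (upTo (suc n))(\i -> f i * g (n N.∸ i))
  ≈⟨ Σ-· n (upTo (suc n)) _ ⟩
  Σ (upTo (suc n))(\i -> n · (f i * g (n N.∸ i)))
  ≈⟨ Σ-cong∈ (upTo (suc n))(\{i} i∈ -> trans
  (×-congˡ (E.sym (N.m+[n∸m]≡n (N.s≤s⁻¹ (∈-upTo⁻ i∈)))))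
  (trans (×-homo-+ _ i (n N.∸ i))(+-cong (sym (×-assoc-* i _ _))(sym (×-comm-* (n N.∸ i) _ _))))) ⟩
  Σ (upTo (suc n))(\i -> θ f i * g (n N.∸ i) + f i * θ g (n N.∸ i))
  ≈⟨ Σ-+ (upTo (suc n)) _ _ ⟩
  Σ (upTo (suc n))(\i -> θ f i * g (n N.∸ i)) + Σ (upTo (suc n))(\i -> f i * θ g (n N.∸ i))
  ≈⟨ +-cong (⊛-Σ (θ f) g n)(⊛-Σ f (θ g) n) ⟨
  (θ f ⊛ g ⊕ f ⊛ θ g) n ∎
  where
  Σ-· : ∀ {A : Set} n (xs : List A) f -> n · Σ xs f ≈ Σ xs (\a -> n · f a)
  Σ-· zero xs f = sym (Σ-zero xs (\_ -> refl))
  Σ-· (suc n) xs f = trans (+-congˡ (Σ-· n xs f))(sym (Σ-+ xs f _))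

 sign : ℕ -> Carrier
 sign zero = 1#
 sign (suc n) = - sign n

 sign-+ : ∀ m n -> sign (m N.+ n) ≈ sign m * sign n
 sign-+ zero n = sym (*-identityˡ _)
 sign-+ (suc m) n = trans (-‿cong (sign-+ m n))(-‿distribˡ-* _ _)

 sign-double : ∀ n -> sign (n N.+ n) ≈ 1#
 sign-double zero = refl
 sign-double (suc n) = trans (-‿cong (reflexive (E.cong sign (N.+-suc n n))))
  (trans (solve 1 (\x -> :- (:- x) := x) refl (sign (n N.+ n)))(sign-double n))

 ∣sign∣ : ∀ n -> ∣ sign n ∣ R.≈ R.1#
 ∣sign∣ zero = ∣1∣
 ∣sign∣ (suc n) = R.trans (∣-∣ (sign n))(∣sign∣ n)

 twist : Series -> Series
 twist f n = sign n * f n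

 twist-⊛ : ∀ f g -> twist (f ⊛ g) ≋ twist f ⊛ twist g
 twist-⊛ f g n = begin
  sign n * (f ⊛ g) n ≈⟨ *-congˡ (⊛-Σ f g n) ⟩
  sign n * Σ (upTo (suc n))(\i -> f i * g (n N.∸ i)) ≈⟨ Σ-*ˡ (upTo (suc n))(sign n) _ ⟨
  Σ (upTo (suc n))(\i -> sign n * (f i * g (n N.∸ i))) ≈⟨ Σ-cong∈ (upTo (suc n))(\{i} i∈ -> trans
  (*-congʳ (trans (reflexive (E.cong sign (E.sym (N.m+[n∸m]≡n (N.s≤s⁻¹ (∈-upTo⁻ i∈))))))(sign-+ i (n N.∸ i))))
  (solve 4 (\a b x y -> a :* b :* (x :* y) := a :* x :* (b :* y)) refl (sign i)(sign (n N.∸ i))(f i) _)) ⟩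
  Σ (upTo (suc n))(\i -> twist f i * twist g (n N.∸ i)) ≈⟨ ⊛-Σ (twist f)(twist g) n ⟨
  (twist f ⊛ twist g) n ∎

 θ-twist : ∀ f -> θ (twist f) ≋ twist (θ f)
 θ-twist f n = sym (×-comm-* n _ _)

 -- L(t) L(-t), as a series in t².
 graeffe : Series -> Series
 graeffe L n = (L ⊛ twist L)(n N.+ n)

 shift-sum : Series -> Series
 shift-sum S zero = 0#
 shift-sum S (suc n) = S (suc n)

 newton⇒θ : ∀ {L S} -> Newton L S -> θ L ≋ shift-sum S ⊛ L
 newton⇒θ {L}{S} h n = begin
  n · L n ≈⟨ h n ⟩
  Σ (upTo n)(\k -> S (suc k) * L (n N.∸ suc k)) ≈⟨ +-identityˡ _ ⟨
  0# + Σ (upTo n)(\k -> S (suc k) * L (n N.∸ suc k)) ≈⟨ +-congʳ (zeroˡ _) ⟨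
  0# * L n + Σ (upTo n)(\k -> S (suc k) * L (n N.∸ suc k)) ≈⟨ Σ-upTo-sucˡ n (\i -> shift-sum S i * L (n N.∸ i)) ⟨
  Σ (upTo (suc n))(\i -> shift-sum S i * L (n N.∸ i)) ≈⟨ ⊛-Σ (shift-sum S) L n ⟨
  (shift-sum S ⊛ L) n ∎

 two-cancel : ∀ {x y} -> x + x ≈ y + y -> x ≈ y
 two-cancel {x}{y} e = x∙y⁻¹≈ε⇒x≈y x y (∣∣-0 (R.*-cancelˡ-≤ (R.#suc≰0 1)
  (R.≤-respˡ (R.trans (R.sym (∣·∣ 2 (x - y)))(R.trans (∣∣-cong vanish) ∣0∣))(R.≤-reflexive (R.sym (R.zeroʳ _))))))
  where
  vanish : 2 · (x - y) ≈ 0#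
  vanish = trans (solve 2 (\x y -> x :- y :+ (x :- y :+ :0) := x :+ x :- (y :+ y)) refl x y)(x≈y⇒x∙y⁻¹≈ε e)

 Σ-even : ∀ n h -> (∀ j -> h (suc (j N.+ j)) ≈ 0#) ->
  Σ (upTo (suc (n N.+ n))) h ≈ Σ (upTo (suc n))(\j -> h (j N.+ j))
 Σ-even zero h odd = refl
 Σ-even (suc n) h odd = begin
  Σ (upTo (suc (suc n N.+ suc n))) h
  ≡⟨ E.cong (\m -> Σ (upTo (suc (suc m))) h)(N.+-suc n n) ⟩
  Σ (upTo (suc (suc (suc (n N.+ n))))) h
  ≈⟨ Σ-upTo-sucʳ (suc (suc (n N.+ n))) h ⟩
  Σ (upTo (suc (suc (n N.+ n)))) h + h (suc (suc (n N.+ n)))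
  ≈⟨ +-cong (trans (Σ-upTo-sucʳ (suc (n N.+ n)) h)(trans (+-congˡ (odd n))(+-identityʳ _)))
  (reflexive (E.cong (h ∘ suc)(E.sym (N.+-suc n n)))) ⟩
  Σ (upTo (suc (n N.+ n))) h + h (suc n N.+ suc n)
  ≈⟨ +-congʳ (Σ-even n h odd) ⟩
  Σ (upTo (suc n))(\j -> h (j N.+ j)) + h (suc n N.+ suc n)
  ≈⟨ Σ-upTo-sucʳ (suc n)(\j -> h (j N.+ j)) ⟨
  Σ (upTo (suc (suc n)))(\j -> h (j N.+ j)) ∎

 double-∸ : ∀ n j -> n N.+ n N.∸ (j N.+ j) ≡ (n N.∸ j) N.+ (n N.∸ j)
 double-∸ n zero = E.refl
 double-∸ zero (suc j) = E.refl
 double-∸ (suc n)(suc j) = E.trans (cong₂ N._∸_ (N.+-suc n n)(N.+-suc j j))(double-∸ n j)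

 graeffe-newton : ∀ {L S} -> Newton L S -> Newton (graeffe L)(\n -> S (n N.+ n))
 graeffe-newton {L}{S} newton n = two-cancel (begin
  n · graeffe L n + n · graeffe L n
  ≈⟨ ×-homo-+ _ n n ⟨
  (n N.+ n) · (L ⊛ twist L)(n N.+ n)
  ≈⟨ θG (n N.+ n) ⟩
  ((S0 ⊕ twist S0) ⊛ G)(n N.+ n)
  ≈⟨ ⊛-Σ (S0 ⊕ twist S0) G (n N.+ n) ⟩
  Σ (upTo (suc (n N.+ n)))(\i -> (S0 i + sign i * S0 i) * G (n N.+ n N.∸ i))
  ≈⟨ Σ-even n _ (\j -> trans (*-congʳ (trans (+-congˡ (*-congʳ (-‿cong (sign-double j))))
  (trans (solve 1 (\x -> x :+ (:- :1) :* x := :0) refl _) refl)))(zeroˡ _)) ⟩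
  Σ (upTo (suc n))(\j -> (S0 (j N.+ j) + sign (j N.+ j) * S0 (j N.+ j)) * G (n N.+ n N.∸ (j N.+ j)))
  ≈⟨ Σ-cong (upTo (suc n))(\j -> trans (*-cong (+-congˡ (trans (*-congʳ (sign-double j))(*-identityˡ _)))
  (reflexive (E.cong G (double-∸ n j))))(distribʳ _ _ _)) ⟩
  Σ (upTo (suc n))(\j -> S0 (j N.+ j) * graeffe L (n N.∸ j) + S0 (j N.+ j) * graeffe L (n N.∸ j))
  ≈⟨ Σ-+ (upTo (suc n)) _ _ ⟩
  T + T
  ≈⟨ +-cong T≈ T≈ ⟩
  _ ∎)
  where
  S0 = shift-sum S
  G = L ⊛ twist L
  T = Σ (upTo (suc n))(\j -> S0 (j N.+ j) * graeffe L (n N.∸ j))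
  T≈ : T ≈ Σ (upTo n)(\k -> S (suc k N.+ suc k) * graeffe L (n N.∸ suc k))
  T≈ = trans (Σ-upTo-sucˡ n _)(trans (+-congʳ (zeroˡ _))(+-identityˡ _))
  θG : θ G ≋ (S0 ⊕ twist S0) ⊛ G
  θG = 𝕊.trans (θ-⊛ L (twist L))(𝕊.trans (𝕊.+-cong
   (⊛-cong (newton⇒θ newton)(\_ -> refl))
   (⊛-cong {L}(\_ -> refl)(𝕊.trans (θ-twist L)(𝕊.trans (\m -> *-congˡ (newton⇒θ newton m))(twist-⊛ S0 L)))))
   (SS.solve 4 (\s l t m -> s SS.:* l SS.:* m SS.:+ l SS.:* (t SS.:* m) SS.:= (s SS.:+ t) SS.:* (l SS.:* m))
   𝕊.refl S0 L (twist S0)(twist L)))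
   where module SS = IntegerSolver seriesRing

 Vanishing : ℕ -> Series -> Set
 Vanishing M L = ∀ n -> M N.< n -> L n ≈ 0#

 graeffe-vanishing : ∀ {M L} -> Vanishing M L -> Vanishing M (graeffe L)
 graeffe-vanishing {M}{L} v n M<n = trans (⊛-Σ L (twist L)(n N.+ n))(Σ-zero (upTo (suc (n N.+ n))) term)
  where
  term : ∀ {i} -> i ∈ upTo (suc (n N.+ n)) -> L i * twist L (n N.+ n N.∸ i) ≈ 0#
  term {i} i∈ with M N.<? i
  ... | yes M<i = trans (*-congʳ (v i M<i))(zeroˡ _)
  ... | no M≮i = trans (*-congˡ (trans (*-congˡ (v _ (N.<-≤-trans M<n
   (≤-tr (≡⇒≤ (E.sym (N.m+n∸n≡m n n)))(N.∸-monoʳ-≤ (n N.+ n)(≤-tr (N.≮⇒≥ M≮i)(N.<⇒≤ M<n)))))))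
   (zeroʳ _)))(zeroʳ _)

 graeffe-0 : ∀ {L} -> L 0 ≈ 1# -> graeffe L 0 ≈ 1#
 graeffe-0 e = trans (*-cong e (trans (*-identityˡ _) e))(*-identityˡ 1#)

 -- Only the middle term of the convolution is a square.
 square-bound : ∀ L k -> ∣ L k ∣ R.* ∣ L k ∣ R.≤ ∣ graeffe L k ∣ R.+
  (R.Σ (upTo k)(\i -> ∣ L i ∣ R.* ∣ L (k N.+ k N.∸ i) ∣)
  R.+ R.Σ (upTo k)(\j -> ∣ L (suc (k N.+ j)) ∣ R.* ∣ L (k N.+ k N.∸ suc (k N.+ j)) ∣))
 square-bound L k = R.≤-respˡ (R.trans (R.sym (R.trans (∣∣-* (L k)(twist L k))(R.*-congˡ
  (R.trans (∣∣-* _ _)(R.trans (R.*-congʳ (∣sign∣ k))(R.*-identityˡ _))))))(∣∣-cong middle))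
  (R.≤-trans (∣x-y∣≤ _ _)(R.+-mono-≤ R.≤-refl (R.≤-trans (∣∣-+ _ _)(R.+-mono-≤
  (R.≤-trans (∣Σ∣ (upTo k) t)(R.Σ-mono (upTo k)(\_ -> norm _)))
  (R.≤-trans (∣Σ∣ (upTo k) _)(R.Σ-mono (upTo k)(\_ -> norm _)))))))
  where
  t : ℕ -> Carrier
  t i = L i * twist L (k N.+ k N.∸ i)
  norm : ∀ i -> ∣ t i ∣ R.≤ ∣ L i ∣ R.* ∣ L (k N.+ k N.∸ i) ∣
  norm i = R.≤-reflexive (R.trans (∣∣-* _ _)(R.*-congˡ (R.trans (∣∣-* _ _)
   (R.trans (R.*-congʳ (∣sign∣ (k N.+ k N.∸ i)))(R.*-identityˡ _)))))
  middle : L k * twist L k ≈ graeffe L k - (Σ (upTo k) t + Σ (upTo k)(\j -> t (suc (k N.+ j))))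
  middle = begin
   L k * twist L k
   ≡⟨ E.cong (\m -> L k * twist L m)(E.sym (N.m+n∸m≡n k k)) ⟩
   t k
   ≡⟨ E.cong t (E.sym (N.+-identityʳ k)) ⟩
   t (k N.+ 0)
   ≈⟨ solve 3 (\a x b -> x := a :+ (x :+ b) :- (a :+ b)) refl A (t (k N.+ 0)) B' ⟩
   A + (t (k N.+ 0) + B') - (A + B')
   ≈⟨ +-cong (trans (trans (+-congˡ (sym (Σ-upTo-sucˡ k (\j -> t (k N.+ j)))))(sym (Σ-upTo-+ k (suc k) t)))
   (trans (reflexive (E.cong (\m -> Σ (upTo m) t)(N.+-suc k k)))(sym (⊛-Σ L (twist L)(k N.+ k)))))
   (-‿cong (+-congˡ (Σ-cong (upTo k)(\j -> reflexive (E.cong t (N.+-suc k j)))))) ⟩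
   graeffe L k - (A + Σ (upTo k)(\j -> t (suc (k N.+ j)))) ∎
   where
   A = Σ (upTo k) t
   B' = Σ (upTo k)(\j -> t (k N.+ suc j))

module GraeffeBound {ℝ}(ℂ : NormedRing ℝ) where
 open RealProperties ℝ
 private
  module C = NormedProperties ℂ
 open NormedRing ℂ using (∣_∣;∣∣-nonneg;∣∣-cong;∣∣-*)
 open Graeffe ℂ
 open PowerSeries C.ring using (Series)
 open ≤-Reasoning

 ¬¬-max : ∀ n (f : ℕ -> Carrier) -> ¬ ¬ (∃[ k ] k N.≤ n × (∀ j -> j N.≤ n -> f j ≤ f k))
 ¬¬-max zero f h = h (0 , z≤n , \{ zero _ -> ≤-refl })
 ¬¬-max (suc n) f h = ¬¬-max n f \{ (k , k≤n , max) -> total (f k)(f (suc n)) \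
  { (inl le) -> h (suc n , N.≤-refl , \j j≤ -> split j j≤ (\q -> ≤-trans (max j q) le)(\{ E.refl -> ≤-refl }))
  ; (inr ge) -> h (k , N.m≤n⇒m≤1+n k≤n , \j j≤ -> split j j≤ (max j)(\{ E.refl -> ge })) } }
  where
  split : ∀ {A : Set} j -> j N.≤ suc n -> (j N.≤ n -> A) -> (j ≡ suc n -> A) -> A
  split j j≤ a b with N.m≤n⇒m<n∨m≡n j≤
  ... | inl lt = a (N.s≤s⁻¹ lt)
  ... | inr eq = b eq

 Σ-upTo-bound : ∀ n {f c} -> (∀ i -> i N.< n -> f i ≤ c) -> Σ (upTo n) f ≤ # n * c
 Σ-upTo-bound n h = ≤-respʳ (*-congʳ (≡-cong # (length-upTo n)))
  (Σ-bound (upTo n)(\i∈ -> h _ (∈-upTo⁻ i∈)))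

 module _ (M : ℕ) where
  β : ℕ
  β = 2 N.* suc M

  wt : ℕ -> Carrier
  wt k = # (β N.^ (k N.* k))

  κ : Carrier
  κ = # (2 N.* β N.^ (M N.* M))

  -- Weights making the coefficients of L strongly log-concave.
  CoefficientBound : Series -> Carrier -> Carrier -> Set
  CoefficientBound L G R = ∀ k -> ∣ L k ∣ * wt k ≤ G * R ^ k

  wt-nonneg : ∀ k -> 0# ≤ wt k
  wt-nonneg k = 0≤# (β N.^ (k N.* k))

  κ-nonneg : 0# ≤ κ
  κ-nonneg = 0≤# (2 N.* β N.^ (M N.* M))

  module Descent (L : Series)(vanishing : Vanishing M L){R g : Carrier}
   (0≤R : 0# ≤ R)(R≰0 : ¬ R ≤ 0#)(0≤g : 0# ≤ g)
   (bound : CoefficientBound (graeffe L)(κ * (g * g))(R * R)) where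
   y : ℕ -> Carrier
   y k = ∣ L k ∣ * wt k * R ^ (M N.∸ k)

   y-nonneg : ∀ k -> 0# ≤ y k
   y-nonneg k = *-nonneg (*-nonneg (∣∣-nonneg (L k))(wt-nonneg k))(^-nonneg (M N.∸ k) 0≤R)

   module At (k : ℕ)(k≤M : k N.≤ M)(max : ∀ j -> j N.≤ M -> y j ≤ y k) where
    scale : Carrier
    scale = wt k * wt k * (R ^ (M N.∸ k) * R ^ (M N.∸ k))

    scale-nonneg : 0# ≤ scale
    scale-nonneg = *-nonneg (square-nonneg _)(square-nonneg _)

    pair : ∀ i j -> i N.+ j ≡ k N.+ k -> i ≢ k -> # (2 N.* M N.+ 2 N.* M) * (∣ L i ∣ * ∣ L j ∣ * scale) ≤ y k * y k
    pair i j i+j≡2k i≢k with i N.≤? M | j N.≤? M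
    ... | no i≰M | _ = zero-case (trans (*-congʳ (trans (∣∣-cong (vanishing i (N.≰⇒> i≰M))) C.∣0∣))(zeroˡ _))
     where
     zero-case : ∣ L i ∣ * ∣ L j ∣ ≈ 0# -> # (2 N.* M N.+ 2 N.* M) * (∣ L i ∣ * ∣ L j ∣ * scale) ≤ y k * y k
     zero-case e = ≤-respˡ (trans (*-congˡ (trans (*-congʳ e)(zeroˡ _)))(zeroʳ _))(square-nonneg _)
    ... | yes _ | no j≰M = ≤-respˡ (trans (*-congˡ (trans (*-congʳ (trans (*-congˡ (trans (∣∣-cong (vanishing j (N.≰⇒> j≰M))) C.∣0∣))
     (zeroʳ _)))(zeroˡ _)))(zeroʳ _))(square-nonneg _)
    ... | yes i≤M | yes j≤M = begin
     # (2 N.* M N.+ 2 N.* M) * (∣ L i ∣ * ∣ L j ∣ * scale)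
     ≈⟨ solve 5 (\c a b w r -> c :* (a :* b :* (w :* w :* r)) := c :* (w :* w) :* (a :* b :* r)) refl _ _ _ _ _ ⟩
     # (2 N.* M N.+ 2 N.* M) * (wt k * wt k) * (∣ L i ∣ * ∣ L j ∣ * (R ^ (M N.∸ k) * R ^ (M N.∸ k)))
     ≤⟨ *-monoʳ (*-nonneg (*-nonneg (∣∣-nonneg _)(∣∣-nonneg _))(square-nonneg _)) weights ⟩
     wt i * wt j * (∣ L i ∣ * ∣ L j ∣ * (R ^ (M N.∸ k) * R ^ (M N.∸ k)))
     ≈⟨ *-congˡ (*-congˡ (trans (sym (^-homo-* R (M N.∸ k)(M N.∸ k)))
     (trans (≡-cong (R ^_) exponents)(^-homo-* R (M N.∸ i)(M N.∸ j))))) ⟩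
     wt i * wt j * (∣ L i ∣ * ∣ L j ∣ * (R ^ (M N.∸ i) * R ^ (M N.∸ j)))
     ≈⟨ solve 6 (\u v a b r s -> u :* v :* (a :* b :* (r :* s)) := a :* u :* r :* (b :* v :* s)) refl _ _ _ _ _ _ ⟩
     y i * y j
     ≤⟨ *-mono (y-nonneg i)(y-nonneg k)(max i i≤M)(max j j≤M) ⟩
     y k * y k ∎
     where
     exponents : (M N.∸ k) N.+ (M N.∸ k) ≡ (M N.∸ i) N.+ (M N.∸ j)
     exponents = N.+-cancelʳ-≡ (k N.+ k) _ _ (E.trans (collect (M N.∸ k) k (M N.∸ k) k (N.m∸n+n≡m k≤M)(N.m∸n+n≡m k≤M))
      (E.sym (E.trans (E.cong ((M N.∸ i) N.+ (M N.∸ j) N.+_)(E.sym i+j≡2k))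
      (collect (M N.∸ i) i (M N.∸ j) j (N.m∸n+n≡m i≤M)(N.m∸n+n≡m j≤M)))))
      where
      collect : ∀ a b c d -> a N.+ b ≡ M -> c N.+ d ≡ M -> a N.+ c N.+ (b N.+ d) ≡ M N.+ M
      collect a b c d e f = E.trans (id6 a c b d)(cong₂ N._+_ e f)
     squares : 2 N.+ (k N.* k N.+ k N.* k) N.≤ i N.* i N.+ j N.* j
     squares with N.<-cmp i k
     ... | tri≈ _ i≡k _ = contradiction i≡k i≢k
     ... | tri< i<k _ _ = subst (N._≤ i N.* i N.+ j N.* j)(E.cong (\k -> 2 N.+ (k N.* k N.+ k N.* k)) k≡)
      (subst (\j -> 2 N.+ ((i N.+ suc d) N.* (i N.+ suc d) N.+ (i N.+ suc d) N.* (i N.+ suc d)) N.≤ i N.* i N.+ j N.* j)(E.sym j≡)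
      (N.m+n≤o⇒m≤o _ (≡⇒≤ (E.sym (id8 i d)))))
      where
      d = k N.∸ suc i
      k≡ : i N.+ suc d ≡ k
      k≡ = E.trans (N.+-suc i d)(N.m+[n∸m]≡n i<k)
      j≡ : j ≡ i N.+ suc d N.+ suc d
      j≡ = N.+-cancelˡ-≡ i _ _ (E.trans i+j≡2k (E.trans (E.cong (\k -> k N.+ k)(E.sym k≡))(id7 i (suc d))))
     ... | tri> _ _ k<i = subst (\i -> 2 N.+ (k N.* k N.+ k N.* k) N.≤ i N.* i N.+ j N.* j) i≡
      (subst (\k -> 2 N.+ (k N.* k N.+ k N.* k) N.≤ (k N.+ suc d) N.* (k N.+ suc d) N.+ j N.* j) k≡
      (N.m+n≤o⇒m≤o _ (≡⇒≤ (E.sym (id10 j d)))))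
      where
      d = i N.∸ suc k
      i≡ : k N.+ suc d ≡ i
      i≡ = E.trans (N.+-suc k d)(N.m+[n∸m]≡n k<i)
      k≡ : j N.+ suc d ≡ k
      k≡ = N.+-cancelˡ-≡ k _ _ (E.trans (id9 k j (suc d))(E.trans (E.cong (N._+ j) i≡) i+j≡2k))
     4M≤β² : 2 N.* M N.+ 2 N.* M N.≤ β N.^ 2
     4M≤β² = N.m+n≤o⇒m≤o _ (≡⇒≤ (E.sym (id11 M)))
     weights : # (2 N.* M N.+ 2 N.* M) * (wt k * wt k) ≤ wt i * wt j
     weights = ≤-respˡ (trans (*-congˡ (sym (#-* u u)))(sym (#-* (2 N.* M N.+ 2 N.* M)(u N.* u))))
      (≤-respʳ (#-* (β N.^ (i N.* i))(β N.^ (j N.* j)))(#-mono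
      (≤-tr (N.*-monoˡ-≤ (u N.* u) 4M≤β²)(≤-tr
      (≡⇒≤ (E.trans (E.cong (β N.^ 2 N.*_)(E.sym (N.^-distribˡ-+-* β (k N.* k)(k N.* k))))
      (E.sym (N.^-distribˡ-+-* β 2 (k N.* k N.+ k N.* k)))))
      (≤-tr (N.^-monoʳ-≤ β squares)(≡⇒≤ (N.^-distribˡ-+-* β (i N.* i)(j N.* j))))))))
      where u = β N.^ (k N.* k)

    half-sum : ∀ (f h : ℕ -> ℕ) -> (∀ i -> i N.< k -> f i N.+ h i ≡ k N.+ k × f i ≢ k) ->
     # (2 N.* M N.+ 2 N.* M) * (Σ (upTo k)(\i -> ∣ L (f i) ∣ * ∣ L (h i) ∣) * scale) ≤ # M * (y k * y k)
    half-sum f h pairs = begin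
     # (2 N.* M N.+ 2 N.* M) * (Σ (upTo k)(\i -> ∣ L (f i) ∣ * ∣ L (h i) ∣) * scale)
     ≈⟨ *-congˡ (Σ-*ʳ (upTo k) scale _) ⟨
     # (2 N.* M N.+ 2 N.* M) * Σ (upTo k)(\i -> ∣ L (f i) ∣ * ∣ L (h i) ∣ * scale)
     ≈⟨ Σ-*ˡ (upTo k) _ _ ⟨
     Σ (upTo k)(\i -> # (2 N.* M N.+ 2 N.* M) * (∣ L (f i) ∣ * ∣ L (h i) ∣ * scale))
     ≤⟨ Σ-upTo-bound k (\i i<k -> pair (f i)(h i)(fst (pairs i i<k))(snd (pairs i i<k))) ⟩
     # k * (y k * y k)
     ≤⟨ *-monoʳ (square-nonneg _)(#-mono k≤M) ⟩
     # M * (y k * y k) ∎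

    private
     A = Σ (upTo k)(\i -> ∣ L i ∣ * ∣ L (k N.+ k N.∸ i) ∣)
     B = Σ (upTo k)(\j -> ∣ L (suc (k N.+ j)) ∣ * ∣ L (k N.+ k N.∸ suc (k N.+ j)) ∣)
     m = # M

    -- c = 4 M cancels the 2 k ≤ 2 M cross terms down to half of the square.
    y²-bound : 0 N.< M -> y k * y k ≤ # 2 * (∣ graeffe L k ∣ * scale)
    y²-bound 0<M = +-cancelʳ-≤ Y (*-cancelˡ-≤ m≰0 (begin
     m * (Y + Y) ≈⟨ solve 2 (\m y -> m :* (y :+ y) := (m :+ (m :+ :0)) :* y) refl m Y ⟩
     (m + (m + 0#)) * Y ≈⟨ *-congʳ 2M ⟨
     # (2 N.* M) * Y ≤⟨ *-monoˡ (0≤# (2 N.* M)) expand ⟩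
     # (2 N.* M) * (Γ + (A * scale + B * scale))
     ≈⟨ *-congʳ 2M ⟩
     (m + (m + 0#)) * (Γ + (A * scale + B * scale))
     ≈⟨ solve 4 (\m Γ a b -> (m :+ (m :+ :0)) :* (Γ :+ (a :+ b)) := m :* ((:1 :+ (:1 :+ :0)) :* Γ) :+ ((m :+ (m :+ :0)) :* a :+ (m :+ (m :+ :0)) :* b))
     refl m Γ (A * scale)(B * scale) ⟩
     m * (# 2 * Γ) + ((m + (m + 0#)) * (A * scale) + (m + (m + 0#)) * (B * scale))
     ≤⟨ +-mono-≤ ≤-refl (*-cancelˡ-≤ (#suc≰0 1) doubled) ⟩
     m * (# 2 * Γ) + m * Y ≈⟨ distribˡ _ _ _ ⟨
     m * (# 2 * Γ + Y) ∎))
     where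
     Y = y k * y k
     Γ = ∣ graeffe L k ∣ * scale
     m≰0 : ¬ m ≤ 0#
     m≰0 h = 1≰0 (≤-trans (≤-respˡ (sym #1)(#-mono 0<M)) h)
     2M : # (2 N.* M) ≈ m + (m + 0#)
     2M = trans (#-+ M (M N.+ 0))(+-congˡ (#-+ M 0))
     expand : Y ≤ Γ + (A * scale + B * scale)
     expand = begin
      Y ≈⟨ solve 3 (\a w r -> a :* w :* r :* (a :* w :* r) := a :* a :* (w :* w :* (r :* r))) refl _ _ _ ⟩
      ∣ L k ∣ * ∣ L k ∣ * scale ≤⟨ *-monoʳ scale-nonneg (square-bound L k) ⟩
      (∣ graeffe L k ∣ + (A + B)) * scale ≈⟨ solve 4 (\g a b s -> (g :+ (a :+ b)) :* s := g :* s :+ (a :* s :+ b :* s)) refl _ _ _ _ ⟩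
      Γ + (A * scale + B * scale) ∎
     lower-pairs : ∀ i -> i N.< k -> i N.+ (k N.+ k N.∸ i) ≡ k N.+ k × i ≢ k
     lower-pairs i i<k = N.m+[n∸m]≡n (≤-tr (N.<⇒≤ i<k)(N.m≤m+n k k)) , N.<⇒≢ i<k
     upper-pairs : ∀ j -> j N.< k -> suc (k N.+ j) N.+ (k N.+ k N.∸ suc (k N.+ j)) ≡ k N.+ k × suc (k N.+ j) ≢ k
     upper-pairs j j<k = N.m+[n∸m]≡n (subst (N._≤ k N.+ k)(N.+-suc k j)(N.+-monoʳ-≤ k j<k))
      , \e -> N.<⇒≢ (s≤s (N.m≤m+n k j))(E.sym e)
     4M : # (2 N.* M N.+ 2 N.* M) ≈ # 2 * (m + (m + 0#))
     4M = trans (#-+ (2 N.* M)(2 N.* M))(trans (+-cong 2M 2M)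
      (solve 1 (\m -> m :+ (m :+ :0) :+ (m :+ (m :+ :0)) := (:1 :+ (:1 :+ :0)) :* (m :+ (m :+ :0))) refl m))
     doubled : # 2 * ((m + (m + 0#)) * (A * scale) + (m + (m + 0#)) * (B * scale)) ≤ # 2 * (m * Y)
     doubled = begin
      # 2 * ((m + (m + 0#)) * (A * scale) + (m + (m + 0#)) * (B * scale))
      ≈⟨ solve 4 (\t n a b -> t :* (n :* a :+ n :* b) := t :* n :* a :+ t :* n :* b) refl (# 2)(m + (m + 0#)) _ _ ⟩
      # 2 * (m + (m + 0#)) * (A * scale) + # 2 * (m + (m + 0#)) * (B * scale)
      ≈⟨ +-cong (*-congʳ 4M)(*-congʳ 4M) ⟨
      # (2 N.* M N.+ 2 N.* M) * (A * scale) + # (2 N.* M N.+ 2 N.* M) * (B * scale)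
      ≤⟨ +-mono-≤ (half-sum (\i -> i)(\i -> k N.+ k N.∸ i) lower-pairs)
      (half-sum (\j -> suc (k N.+ j))(\j -> k N.+ k N.∸ suc (k N.+ j)) upper-pairs) ⟩
      m * Y + m * Y ≈⟨ solve 1 (\x -> x :+ x := (:1 :+ (:1 :+ :0)) :* x) refl (m * Y) ⟩
      # 2 * (m * Y) ∎

 module _ (M : ℕ)(0<M : 0 N.< M) where
  κ≥ : ∀ {k} -> k N.≤ M -> # 2 * wt M k ≤ κ M
  κ≥ {k} k≤M = ≤-respˡ (sym (#-* 2 (β M N.^ (k N.* k))))(#-mono (N.*-monoʳ-≤ 2 (N.^-monoʳ-≤ (β M)(N.*-mono-≤ k≤M k≤M))))

  module _ (L : Series)(vanishing : Vanishing M L){R g : Carrier}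
   (0≤R : 0# ≤ R)(R≰0 : ¬ R ≤ 0#)(0≤g : 0# ≤ g)
   (bound : CoefficientBound M (graeffe L)(κ M * (g * g))(R * R)) where
   open Descent M L vanishing 0≤R R≰0 0≤g bound

   max-bound : ∀ k -> k N.≤ M -> (∀ j -> j N.≤ M -> y j ≤ y k) -> y k ≤ κ M * g * R ^ M
   max-bound k k≤M max = ^-cancel-≤ 1 (*-nonneg (*-nonneg (κ-nonneg M) 0≤g)(^-nonneg M 0≤R))(begin
    y k ^ 2 ≈⟨ *-congˡ (*-identityʳ _) ⟩
    y k * y k ≤⟨ y²-bound 0<M ⟩
    # 2 * (∣ graeffe L k ∣ * scale)
    ≈⟨ solve 4 (\t a w r -> t :* (a :* (w :* w :* r)) := t :* w :* (a :* w :* r)) refl (# 2) _ (wt M k) _ ⟩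
    # 2 * wt M k * (∣ graeffe L k ∣ * wt M k * (R ^ (M N.∸ k) * R ^ (M N.∸ k)))
    ≤⟨ *-mono (*-nonneg (0≤# 2)(wt-nonneg M k))(*-nonneg (*-nonneg (*-nonneg (κ-nonneg M)(*-nonneg 0≤g 0≤g))(^-nonneg k (*-nonneg 0≤R 0≤R)))(square-nonneg _))
    (κ≥ k≤M)(*-monoʳ (square-nonneg _)(bound k)) ⟩
    κ M * (κ M * (g * g) * (R * R) ^ k * (R ^ (M N.∸ k) * R ^ (M N.∸ k)))
    ≈⟨ *-congˡ (*-congʳ (*-congˡ (^-distrib-* R R k))) ⟩
    κ M * (κ M * (g * g) * (R ^ k * R ^ k) * (R ^ (M N.∸ k) * R ^ (M N.∸ k)))
    ≈⟨ solve 4 (\ κ g a b -> κ :* (κ :* (g :* g) :* (a :* a) :* (b :* b)) := κ :* g :* (a :* b) :* (κ :* g :* (a :* b) :* :1)) refl (κ M) g (R ^ k)(R ^ (M N.∸ k)) ⟩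
    (κ M * g * (R ^ k * R ^ (M N.∸ k))) ^ 2
    ≈⟨ ^-congˡ 2 (*-congˡ (trans (sym (^-homo-* R k (M N.∸ k)))(≡-cong (R ^_)(N.m+[n∸m]≡n k≤M)))) ⟩
    (κ M * g * R ^ M) ^ 2 ∎)
    where open At k k≤M max

   descent : CoefficientBound M L (κ M * g) R
   descent k with k N.≤? M
   ... | no k≰M = ≤-respˡ (trans (*-congʳ (trans (∣∣-cong (vanishing k (N.≰⇒> k≰M))) C.∣0∣))(zeroˡ _))
    (*-nonneg (*-nonneg (κ-nonneg M) 0≤g)(^-nonneg k 0≤R))
   ... | yes k≤M = *-cancelˡ-≤ (^-positive (M N.∸ k) R≰0)(begin
    R ^ (M N.∸ k) * (∣ L k ∣ * wt M k) ≈⟨ *-comm _ _ ⟩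
    y k ≤⟨ stable (\h -> ¬¬-max M y (\{ (k0 , k0≤M , max) -> h (≤-trans (max k k≤M)(max-bound k0 k0≤M max)) })) ⟩
    κ M * g * R ^ M ≈⟨ *-congˡ (trans (≡-cong (R ^_)(E.sym (N.m∸n+n≡m k≤M)))(^-homo-* R (M N.∸ k) k)) ⟩
    κ M * g * (R ^ (M N.∸ k) * R ^ k) ≈⟨ solve 3 (\a b c -> a :* (b :* c) := b :* (a :* c)) refl (κ M * g) _ _ ⟩
    R ^ (M N.∸ k) * (κ M * g * R ^ k) ∎)

  graeffe^ : ℕ -> Series -> Series
  graeffe^ zero L = L
  graeffe^ (suc J) L = graeffe^ J (graeffe L)

  squares : ℕ -> Carrier -> Carrier
  squares zero x = x
  squares (suc J) x = squares J (x * x)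

  squares-^ : ∀ J x -> squares J x ≈ x ^ (2 N.^ J)
  squares-^ zero x = sym (*-identityʳ x)
  squares-^ (suc J) x = trans (squares-^ J (x * x))(trans (^-congˡ (2 N.^ J)(*-congˡ (sym (*-identityʳ x))))
   (^-assocʳ x 2 (2 N.^ J)))

  iterated-descent : ∀ J L -> Vanishing M L -> ∀ {R g} -> 0# ≤ R -> ¬ R ≤ 0# -> 0# ≤ g ->
   CoefficientBound M (graeffe^ J L)(κ M * squares J g)(squares J R) -> CoefficientBound M L (κ M * g) R
  iterated-descent zero L v 0≤R R≰0 0≤g b = b
  iterated-descent (suc J) L v 0≤R R≰0 0≤g b = descent L v 0≤R R≰0 0≤g
   (iterated-descent J (graeffe L)(graeffe-vanishing v)(*-nonneg 0≤R 0≤R)(*-positive R≰0 R≰0)(*-nonneg 0≤g 0≤g) b)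

 newton-bound : ∀ {L S} -> Newton L S -> L 0 C.≈ C.1# -> ∀ M {D B} -> 0# ≤ D -> 0# ≤ B ->
  (∀ k -> 0 N.< k -> k N.≤ M -> ∣ S k ∣ ≤ D * B ^ k) ->
  ∀ n -> n N.≤ M -> ∣ L n ∣ ≤ (1# + D) ^ n * B ^ n
 newton-bound {L}{S} newton L0 M {D}{B} 0≤D 0≤B h n = go n (N.<-wellFounded n)
  where
  E = 1# + D
  0≤E = +-nonneg 0≤1 0≤D
  1≤E : 1# ≤ E
  1≤E = x≤x+y 0≤D
  1≤E^ : ∀ n -> 1# ≤ E ^ n
  1≤E^ zero = ≤-refl
  1≤E^ (suc n) = ≤-respˡ (sym (*-identityˡ 1#))(*-mono 0≤1 (^-nonneg n 0≤E) 1≤E (1≤E^ n))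
  E^-mono : ∀ {m n} -> m N.≤ n -> E ^ m ≤ E ^ n
  E^-mono {n = n} z≤n = 1≤E^ n
  E^-mono (s≤s le) = *-monoˡ 0≤E (E^-mono le)
  go : ∀ n -> Acc N._<_ n -> n N.≤ M -> ∣ L n ∣ ≤ E ^ n * B ^ n
  go zero _ _ = ≤-reflexive (trans (trans (∣∣-cong L0) C.∣1∣)(sym (*-identityˡ 1#)))
  go (suc n)(acc rec) n≤M = *-cancelˡ-≤ (#suc≰0 n)(begin
   # (suc n) * ∣ L (suc n) ∣
   ≈⟨ trans (∣∣-cong (C.sym (newton (suc n))))(C.∣·∣ (suc n)(L (suc n))) ⟨
   ∣ C.Σ (upTo (suc n))(\k -> S (suc k) C.* L (n N.∸ k)) ∣
   ≤⟨ C.∣Σ∣ (upTo (suc n)) _ ⟩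
   Σ (upTo (suc n))(\k -> ∣ S (suc k) C.* L (n N.∸ k) ∣)
   ≤⟨ Σ-upTo-bound (suc n) term ⟩
   # (suc n) * (E ^ suc n * B ^ suc n) ∎)
   where
   term : ∀ k -> k N.< suc n -> ∣ S (suc k) C.* L (n N.∸ k) ∣ ≤ E ^ suc n * B ^ suc n
   term k (s≤s k≤n) = begin
    ∣ S (suc k) C.* L (n N.∸ k) ∣ ≈⟨ ∣∣-* _ _ ⟩
    ∣ S (suc k) ∣ * ∣ L (n N.∸ k) ∣ ≤⟨ *-mono (∣∣-nonneg _)(*-nonneg (^-nonneg (n N.∸ k) 0≤E)(^-nonneg (n N.∸ k) 0≤B))
    (h (suc k)(s≤s z≤n)(≤-tr (s≤s k≤n) n≤M))
    (go (n N.∸ k)(rec (s≤s (N.m∸n≤m n k)))(≤-tr (N.m∸n≤m n k)(≤-tr (N.n≤1+n n) n≤M))) ⟩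
    D * B ^ suc k * (E ^ (n N.∸ k) * B ^ (n N.∸ k)) ≈⟨ solve 4 (\d b e c -> d :* b :* (e :* c) := d :* e :* (b :* c)) refl D _ _ _ ⟩
    D * E ^ (n N.∸ k) * (B ^ suc k * B ^ (n N.∸ k))
    ≈⟨ *-congˡ (trans (sym (^-homo-* B (suc k)(n N.∸ k)))(≡-cong (\m -> B ^ suc m)(N.m+[n∸m]≡n k≤n))) ⟩
    D * E ^ (n N.∸ k) * B ^ suc n ≤⟨ *-monoʳ (^-nonneg (suc n) 0≤B)(*-mono 0≤D (^-nonneg n 0≤E)(x≤y+x 0≤1)(E^-mono (N.m∸n≤m n k))) ⟩
    E ^ suc n * B ^ suc n ∎

 doubled : ℕ -> Series -> Series
 doubled zero S = S
 doubled (suc J) S = doubled J (\n -> S (n N.+ n))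

 doubled≡ : ∀ J S n -> doubled J S n ≡ S (2 N.^ J N.* n)
 doubled≡ zero S n = E.cong S (E.sym (N.+-identityʳ n))
 doubled≡ (suc J) S n = E.trans (doubled≡ J (\n -> S (n N.+ n)) n)(E.cong S (id12 (2 N.^ J) n))

 n<2^n : ∀ n -> n N.< 2 N.^ n
 n<2^n zero = s≤s z≤n
 n<2^n (suc n) = ≤-tr (N.+-mono-≤ (N.m^n>0 2 n)(n<2^n n))(N.+-monoʳ-≤ (2 N.^ n)(N.m≤m+n _ 0))

 -- Bounds on the power sums of even order suffice: after many Graeffe steps all power sums have
 -- even order, and descending replaces any constant D by its 2^J-th root.
 riemann-hypothesis : ∀ M (0<M : 0 N.< M){L S} -> Newton L S -> L 0 C.≈ C.1# -> Vanishing M L ->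
  ∀ D p -> 0 N.< p -> (∀ μ -> 0 N.< μ -> ∣ S (2 N.* μ) ∣ ≤ # D * # p ^ μ) ->
  ∣ L 1 ∣ ≤ κ M * # 2 * root 2 (# p)
 riemann-hypothesis M 0<M {L}{S} newton L0 v D p 0<p power-sums = begin
  ∣ L 1 ∣ ≤⟨ ≤-respˡ (sym (*-identityʳ _))(*-monoˡ (∣∣-nonneg (L 1))(≤-respˡ (sym #1)(#-mono (N.m^n>0 (β M) 1)))) ⟩
  ∣ L 1 ∣ * wt M 1 ≤⟨ iterated-descent M 0<M J L v 0≤R R≰0 (0≤# 2) top 1 ⟩
  κ M * # 2 * R ^ 1 ≈⟨ *-congˡ (*-identityʳ R) ⟩
  κ M * # 2 * R ∎
  where
  R = root 2 (# p)
  0≤R = root-nonneg 1 (# p)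
  R² : R * R ≈ # p
  R² = trans (*-congˡ (sym (*-identityʳ R)))(root-power 1 (0≤# p))
  p≰0 : ¬ # p ≤ 0#
  p≰0 h = 1≰0 (≤-trans (≤-respˡ (sym #1)(#-mono 0<p)) h)
  R≰0 : ¬ R ≤ 0#
  R≰0 h = p≰0 (≤-respˡ (sym R²)(≤-respʳ (zeroˡ R)(*-monoʳ 0≤R h)))
  E = (1 N.+ D) N.^ M N.* β M N.^ (M N.* M)
  J = suc E
  B = # p ^ (2 N.^ E)
  0≤B = ^-nonneg (2 N.^ E)(0≤# p)
  B≈ : squares M 0<M J R ≈ B
  B≈ = trans (squares-^ M 0<M E (R * R))(^-congˡ (2 N.^ E) R²)
  newton^ : ∀ J {L S} -> Newton L S -> Newton (graeffe^ M 0<M J L)(doubled J S)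
  newton^ zero h = h
  newton^ (suc J){L}{S} h = newton^ J {graeffe L}(graeffe-newton {L}{S} h)
  one^ : ∀ J {L} -> L 0 C.≈ C.1# -> graeffe^ M 0<M J L 0 C.≈ C.1#
  one^ zero e = e
  one^ (suc J){L} e = one^ J (graeffe-0 {L} e)
  vanishing^ : ∀ J {L} -> Vanishing M L -> Vanishing M (graeffe^ M 0<M J L)
  vanishing^ zero e = e
  vanishing^ (suc J){L} e = vanishing^ J (graeffe-vanishing {M}{L} e)
  sums : ∀ k -> 0 N.< k -> k N.≤ M -> ∣ doubled J S k ∣ ≤ # D * B ^ k
  sums k 0<k _ = begin
   ∣ doubled J S k ∣ ≡⟨ E.cong ∣_∣ (E.trans (doubled≡ J S k)(E.cong S (N.*-assoc 2 (2 N.^ E) k))) ⟩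
   ∣ S (2 N.* (2 N.^ E N.* k)) ∣ ≤⟨ power-sums (2 N.^ E N.* k)(N.*-mono-≤ (N.m^n>0 2 E) 0<k) ⟩
   # D * # p ^ (2 N.^ E N.* k) ≈⟨ *-congˡ (^-assocʳ (# p)(2 N.^ E) k) ⟨
   # D * B ^ k ∎
  top : CoefficientBound M (graeffe^ M 0<M J L)(κ M * squares M 0<M J (# 2))(squares M 0<M J R)
  top k with k N.≤? M
  ... | no k≰M = ≤-respˡ (trans (*-congʳ (trans (∣∣-cong (vanishing^ J {L} v k (N.≰⇒> k≰M))) C.∣0∣))(zeroˡ _))
   (*-nonneg (*-nonneg (κ-nonneg M)(≤-respʳ (sym (squares-^ M 0<M J (# 2)))(^-nonneg (2 N.^ J)(0≤# 2))))
   (≤-respʳ (^-congˡ k (sym B≈))(^-nonneg k 0≤B)))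
  ... | yes k≤M = begin
   ∣ graeffe^ M 0<M J L k ∣ * wt M k
   ≤⟨ *-monoʳ (wt-nonneg M k)(newton-bound {S = doubled J S}(newton^ J {L}{S} newton)(one^ J {L} L0) M (0≤# D) 0≤B sums k k≤M) ⟩
   # (1 N.+ D) ^ k * B ^ k * wt M k
   ≈⟨ solve 3 (\a b c -> a :* b :* c := a :* c :* b) refl _ _ _ ⟩
   # (1 N.+ D) ^ k * wt M k * B ^ k
   ≈⟨ *-congʳ (trans (#-* ((1 N.+ D) N.^ k)(β M N.^ (k N.* k)))(*-congʳ (#-^ (1 N.+ D) k))) ⟨
   # ((1 N.+ D) N.^ k N.* β M N.^ (k N.* k)) * B ^ k
   ≤⟨ *-monoʳ (^-nonneg k 0≤B)(#-mono constant) ⟩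
   # (2 N.* β M N.^ (M N.* M) N.* 2 N.^ (2 N.^ J)) * B ^ k
   ≈⟨ *-cong (trans (#-* (2 N.* β M N.^ (M N.* M))(2 N.^ (2 N.^ J)))
   (*-congˡ (trans (#-^ 2 (2 N.^ J))(sym (squares-^ M 0<M J (# 2))))))(^-congˡ k (sym B≈)) ⟩
   κ M * squares M 0<M J (# 2) * squares M 0<M J R ^ k ∎
   where
   constant : (1 N.+ D) N.^ k N.* β M N.^ (k N.* k) N.≤ 2 N.* β M N.^ (M N.* M) N.* 2 N.^ (2 N.^ J)
   constant = ≤-tr (N.*-mono-≤ (N.^-monoʳ-≤ (1 N.+ D) k≤M)(N.^-monoʳ-≤ (β M)(N.*-mono-≤ k≤M k≤M)))
    (≤-tr (N.<⇒≤ (n<2^n E))(≤-tr (N.^-monoʳ-≤ 2 (N.<⇒≤ (N.<-trans (N.n<1+n E)(n<2^n J))))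
    (N.m≤n*m (2 N.^ (2 N.^ J))(2 N.* β M N.^ (M N.* M))
    {{N.>-nonZero (N.*-mono-≤ (s≤s (z≤n {1}))(N.m^n>0 (β M)(M N.* M)))}})))

record Character {p}(F : PrimeField p){ℝ}(ℂ : NormedRing ℝ) : Set where
 open PrimeField F using (Carrier;_*_;0#;1#)
 private module C = NormedRing ℂ
 field
  χ : Carrier -> C.Carrier
  χ-* : ∀ x y -> χ (x * y) C.≈ χ x C.* χ y
  χ-0 : χ 0# C.≈ C.0#
  χ-1 : χ 1# C.≈ C.1#
  nontrivial : ¬ (∀ x -> x ≢ 0# -> χ x C.≈ C.1#)

module Characters {p}{F : PrimeField p}{ℝ}{ℂ : NormedRing ℝ}(ψ : Character F ℂ) where
 open Character ψ
 private
  module K = FieldPolynomials.K F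
  module R = RealProperties ℝ
  module KS = IntegerSolver K.ring
 open NormedProperties ℂ
 open Setoid-Reasoning setoid

 χ-^ : ∀ x n -> χ (x K.^ n) ≈ χ x ^ n
 χ-^ x zero = χ-1
 χ-^ x (suc n) = trans (χ-* x _)(*-congˡ (χ-^ x n))

 ∣χ∣≈1 : ∀ {x} -> x ≢ K.0# -> ∣ χ x ∣ R.≈ R.1#
 ∣χ∣≈1 {x} x≢0 = unit p (prime⇒nonTrivial K.prime)(R.trans (R.sym (∣^∣ (χ x) p))
  (∣∣-cong (trans (sym (χ-^ x p))(reflexive (E.cong χ (K.fermat x))))))
  where
  ∣χx∣≰0 : ¬ ∣ χ x ∣ R.≤ R.0#
  ∣χx∣≰0 h with K.inverse x≢0
  ... | y , xy≡1 = R.1≰0 (R.≤-respˡ (R.trans (R.sym ∣1∣)(R.trans (∣∣-cong (trans (sym χ-1)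
   (trans (reflexive (E.cong χ (E.sym xy≡1)))(χ-* x y))))(∣∣-* _ _)))
   (R.≤-respʳ (R.zeroˡ _)(R.*-monoʳ (∣∣-nonneg _) h)))
  unit : ∀ p -> N.NonTrivial p -> ∣ χ x ∣ R.^ p R.≈ ∣ χ x ∣ -> ∣ χ x ∣ R.≈ R.1#
  unit (suc (suc n)) _ e = R.^-injective n (∣∣-nonneg _) R.0≤1 (R.trans root-of-unity (R.sym (one^ (suc n))))
   where
   one^ : ∀ n -> R.1# R.^ n R.≈ R.1#
   one^ zero = R.refl
   one^ (suc n) = R.trans (R.*-identityˡ _)(one^ n)
   root-of-unity : ∣ χ x ∣ R.^ suc n R.≈ R.1#
   root-of-unity = R.≤-antisym (R.*-cancelˡ-≤ ∣χx∣≰0 (R.≤-reflexive e'))(R.*-cancelˡ-≤ ∣χx∣≰0 (R.≤-reflexive (R.sym e')))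
    where
    e' : ∣ χ x ∣ R.* ∣ χ x ∣ R.^ suc n R.≈ ∣ χ x ∣ R.* R.1#
    e' = R.trans e (R.sym (R.*-identityʳ _))

 ∣χ∣≤1 : ∀ x -> ∣ χ x ∣ R.≤ R.1#
 ∣χ∣≤1 x with x K.≟ K.0#
 ... | yes E.refl = R.≤-respˡ (R.trans (∣∣-cong χ-0) ∣0∣) R.0≤1
 ... | no x≢0 = R.≤-reflexive (∣χ∣≈1 x≢0)

 Σ-affine : ∀ a b -> b ≢ K.0# -> ∀ f -> Σ K.elems (\c -> f (a K.+ c K.* b)) ≈ Σ K.elems f
 Σ-affine a b b≢0 f with K.inverse b≢0
 ... | b⁻¹ , bb⁻¹≡1 = sym (Σ-bijection K.elems-unique K.elems-unique
  (\c -> a K.+ c K.* b)(\d -> (d K.+ (K.- a)) K.* b⁻¹)(\_ -> K.∈-elems _)(\_ -> K.∈-elems _)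
  (\{c} _ -> E.trans (KS.solve 4 (\a b c d -> (a KS.:+ c KS.:* b KS.:- a) KS.:* d KS.:= c KS.:* (b KS.:* d)) E.refl a b c b⁻¹)
  (E.trans (E.cong (c K.*_) bb⁻¹≡1)(K.*-identityʳ c)))
  (\{d} _ -> E.trans (KS.solve 4 (\a b d e -> a KS.:+ (d KS.:- a) KS.:* e KS.:* b KS.:= a KS.:+ (d KS.:- a) KS.:* (b KS.:* e)) E.refl a b d b⁻¹)
  (E.trans (E.cong (\z -> a K.+ (d K.+ (K.- a)) K.* z) bb⁻¹≡1)(KS.solve 2 (\a d -> a KS.:+ (d KS.:- a) KS.:* KS.:1 KS.:= d) E.refl a d))) f)

 Σχ≈0 : Σ K.elems χ ≈ 0#
 Σχ≈0 = ∣∣-0 (R.stable \S≰0 -> nontrivial \x x≢0 -> x-y≈0⇒x≈y (χ x) 1# (∣∣-0 (R.*-cancelˡ-≤ S≰0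
  (R.≤-reflexive (R.trans (R.sym (∣∣-* _ _))(R.trans (∣∣-cong (fixed x x≢0))(R.trans ∣0∣ (R.sym (R.zeroʳ _)))))))))
  where
  open AbelianGroup +-abelianGroup using () renaming (x∙y⁻¹≈ε⇒x≈y to x-y≈0⇒x≈y)
  S = Σ K.elems χ
  fixed : ∀ x -> x ≢ K.0# -> S * (χ x - 1#) ≈ 0#
  fixed x x≢0 = begin
   S * (χ x - 1#) ≈⟨ solve 2 (\s c -> s :* (c :- :1) := s :* c :- s) refl S (χ x) ⟩
   S * χ x - S ≈⟨ +-congʳ (trans (sym (Σ-*ʳ K.elems (χ x) χ))(trans (Σ-cong K.elems (\c ->
   trans (sym (χ-* c x))(reflexive (E.cong χ (E.sym (K.+-identityˡ (c K.* x)))))))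
   (Σ-affine K.0# x x≢0 χ))) ⟩
   S - S ≈⟨ -‿inverseʳ S ⟩
   0# ∎

 Σχ-affine : ∀ a b -> b ≢ K.0# -> Σ K.elems (\c -> χ (a K.+ c K.* b)) ≈ 0#
 Σχ-affine a b b≢0 = trans (Σ-affine a b b≢0 χ) Σχ≈0

module CharacterWeights {p}{F : PrimeField p}{ℝ}{ℂ : NormedRing ℝ}(ψ : Character F ℂ)
 (points : List.List (PrimeField.Carrier F × ℕ)) where
 open Character ψ
 open Characters ψ
 private
  module R = RealProperties ℝ
  module C = NormedProperties ℂ
 open Values F
 open FieldPolynomials F hiding (0#;1#)

 valueAt : List (𝕂 × ℕ) -> Poly -> 𝕂
 valueAt [] f = K.1#
 valueAt ((a , e) ∷ as) f = value f a K.^ e K.* valueAt as f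

 -- The value at f of the character of the function field attached to the points.
 ρ : Poly -> 𝕂
 ρ f = value f K.0# K.* valueAt points f

 open Exp K.commutativeSemiring using (^-distrib-*)

 valueAt-cong : ∀ as {f g} -> f ≈' g -> valueAt as f ≡ valueAt as g
 valueAt-cong [] p = E.refl
 valueAt-cong ((a , e) ∷ as) p = cong₂ (\x y -> x K.^ e K.* y)(value-cong a p)(valueAt-cong as p)

 valueAt-* : ∀ as f g -> valueAt as (f *' g) ≡ valueAt as f K.* valueAt as g
 valueAt-* [] f g = E.sym (K.*-identityˡ K.1#)
 valueAt-* ((a , e) ∷ as) f g = E.trans (cong₂ (\x y -> x K.^ e K.* y)(value-* f g a)(valueAt-* as f g))
  (E.trans (E.cong (K._* (valueAt as f K.* valueAt as g))(^-distrib-* (value f a)(value g a) e))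
  (KS.solve 4 (\a b c d -> a KS.:* b KS.:* (c KS.:* d) KS.:= a KS.:* c KS.:* (b KS.:* d)) E.refl _ _ _ _))

 one^ : ∀ e -> K.1# K.^ e ≡ K.1#
 one^ zero = E.refl
 one^ (suc e) = E.trans (K.*-identityˡ _)(one^ e)

 valueAt-1 : ∀ as -> valueAt as (const K.1#) ≡ K.1#
 valueAt-1 [] = E.refl
 valueAt-1 ((a , e) ∷ as) = E.trans (cong₂ K._*_ (E.trans (E.cong (K._^ e)(value-const K.1# a))(one^ e))(valueAt-1 as))(K.*-identityˡ K.1#)

 ρ-* : ∀ f g -> ρ (f *' g) ≡ ρ f K.* ρ g
 ρ-* f g = E.trans (cong₂ K._*_ (value-* f g K.0#)(valueAt-* points f g))
  (KS.solve 4 (\a b c d -> a KS.:* b KS.:* (c KS.:* d) KS.:= a KS.:* c KS.:* (b KS.:* d)) E.refl _ _ _ _)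

 characterWeight : Weight F C.commutativeSemiring
 characterWeight = record
  { weight = χ ∘ ρ
  ; cong = \p -> C.reflexive (E.cong χ (cong₂ K._*_ (value-cong K.0# p)(valueAt-cong points p)))
  ; *-homo = \f g -> C.trans (C.reflexive (E.cong χ (ρ-* f g)))(χ-* _ _)
  ; 1-homo = C.trans (C.reflexive (E.cong χ (E.trans (cong₂ K._*_ (value-const K.1# K.0#)(valueAt-1 points))(K.*-identityˡ K.1#)))) χ-1
  }
 open NewtonIdentity F C.commutativeSemiring characterWeight public
  using (coeff; primePowerSum; newton; weight-^)

 vanishingPoly : List (𝕂 × ℕ) -> Poly
 vanishingPoly [] = const K.1#
 vanishingPoly ((a , _) ∷ as) = ((K.- a) ∷ K.1# ∷ []) *' vanishingPoly as

 linear-monic : ∀ a -> Monic 1 ((K.- a) ∷ K.1# ∷ [])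
 linear-monic a = monic E.refl \{ (suc (suc k)) _ -> E.refl; (suc zero)(s≤s ()) }

 vanishing-monic : ∀ as -> Monic (length as)(vanishingPoly as)
 vanishing-monic [] = Monic-1
 vanishing-monic ((a , _) ∷ as) = Monic-* (linear-monic a)(vanishing-monic as)

 value-linear : ∀ a x -> value ((K.- a) ∷ K.1# ∷ []) x ≡ x K.+ (K.- a)
 value-linear a x = KS.solve 2 (\a x -> KS.:- a KS.:+ x KS.:* (KS.:1 KS.:+ x KS.:* KS.:0) KS.:= x KS.:- a) E.refl a x

 value-vanishing : ∀ as {b} -> b ∈ List.map fst as -> value (vanishingPoly as) b ≡ K.0#
 value-vanishing ((a , _) ∷ as){b} b∈ = E.trans (value-* ((K.- a) ∷ K.1# ∷ [])(vanishingPoly as) b)(zero-factor b∈)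
  where
  zero-factor : b ∈ (a ∷ List.map fst as) -> value ((K.- a) ∷ K.1# ∷ []) b K.* value (vanishingPoly as) b ≡ K.0#
  zero-factor (here E.refl) = E.trans (E.cong (K._* value (vanishingPoly as) a)(E.trans (value-linear a a)(K.-‿inverseʳ a)))(K.zeroˡ _)
  zero-factor (there b∈) = E.trans (E.cong (value ((K.- a) ∷ K.1# ∷ []) b K.*_)(value-vanishing as b∈))(K.zeroʳ _)

 value-vanishing-0 : ∀ as -> All (\x -> fst x ≢ K.0#) as -> value (vanishingPoly as) K.0# ≢ K.0#
 value-vanishing-0 [] _ e = K.1≢0 (E.trans (E.sym (value-const K.1# K.0#)) e)
 value-vanishing-0 ((a , _) ∷ as)(h ∷ hs) e = value-vanishing-0 as hs (K.*-cancel (E.trans (E.sym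
  (value-* ((K.- a) ∷ K.1# ∷ [])(vanishingPoly as) K.0#)) e) linear≢0)
  where
  linear≢0 : value ((K.- a) ∷ K.1# ∷ []) K.0# ≢ K.0#
  linear≢0 z = h (E.trans (KS.solve 1 (\a -> a KS.:= KS.:- (KS.:0 KS.:- a)) E.refl a)
   (E.trans (E.cong K.-_ (E.trans (E.sym (value-linear a K.0#)) z))(KS.solve 0 (KS.:- KS.:0 KS.:= KS.:0) E.refl)))

 module _ (nonzero : All (\x -> fst x ≢ K.0#) points) where
  private
   V = vanishingPoly points

  shifted : 𝕂 -> Poly -> Poly
  shifted c f = f +' const c *' V

  valueAt-shifted : ∀ as -> (∀ {b} -> b ∈ List.map fst as -> value V b ≡ K.0#) ->
   ∀ c f -> valueAt as (shifted c f) ≡ valueAt as f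
  valueAt-shifted [] z c f = E.refl
  valueAt-shifted ((a , e) ∷ as) z c f = cong₂ (\x y -> x K.^ e K.* y)
   (E.trans (value-+ f (const c *' V) a)(E.trans (E.cong (value f a K.+_)(E.trans (value-* (const c) V a)
   (E.trans (E.cong (value (const c) a K.*_)(z (here E.refl)))(K.zeroʳ _))))(K.+-identityʳ _)))
   (valueAt-shifted as (\b∈ -> z (there b∈)) c f)
   where open import Data.List.Relation.Unary.Any using (here; there)

  ρ-shifted : ∀ c f -> ρ (shifted c f) ≡ (value f K.0# K.+ c K.* value V K.0#) K.* valueAt points f
  ρ-shifted c f = cong₂ K._*_ (E.trans (value-+ f (const c *' V) K.0#)(E.cong (value f K.0# K.+_)
   (E.trans (value-* (const c) V K.0#)(E.cong (K._* value V K.0#)(value-const c K.0#)))))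
   (valueAt-shifted points (value-vanishing points) c f)

  shifted-inverse : ∀ c f -> shifted (K.- c)(shifted c f) ≈' f
  shifted-inverse c f = P.trans (PS.solve 4 (\f c d v -> f PS.:+ c PS.:* v PS.:+ d PS.:* v PS.:= f PS.:+ (c PS.:+ d) PS.:* v) P.refl f (const c)(const (K.- c)) V)
   (P.trans (P.+-congˡ {f}(P.*-congʳ {V}{const c +' const (K.- c)}{[]}(coefs \{ zero -> K.-‿inverseʳ c; (suc n) -> E.refl })))
   (P.+-identityʳ f))

  shifted-monic : ∀ {n} -> length points N.< n -> ∀ c {f} -> Monic n f -> Monic n (shifted c f)
  shifted-monic {n} M<n c {f}(monic l b) = monic
   (E.trans (coef-+ f (const c *' V) n)(E.trans (cong₂ K._+_ l (small n M<n))(K.+-identityʳ _)))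
   (\k n<k -> E.trans (coef-+ f (const c *' V) k)(E.trans (cong₂ K._+_ (b k n<k)
   (small k (N.<-trans M<n n<k)))(K.+-identityʳ _)))
   where
   small : Bounded (suc (length points))(const c *' V)
   small = Bounded-* {0}(const c) V (\{ (suc k) _ -> E.refl })(bounded (vanishing-monic points))

  coeff-shift : ∀ n -> length points N.< n -> ∀ c ->
   coeff n C.≈ C.Σ (words n)(\g -> χ (ρ (shifted c (mon g))))
  coeff-shift n M<n c = C.trans
   (C.Σ-bijection (words-unique n)(words-unique n)(move c)(move (K.- c))(move∈ c)(move∈ (K.- c))
   (\{g} g∈ -> inverse c g∈)
   (\{g} g∈ -> subst (\d -> move d (move (K.- c) g) ≡ g)(KS.solve 1 (\c -> KS.:- (KS.:- c) KS.:= c) E.refl c)(inverse (K.- c) g∈))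
   (χ ∘ ρ ∘ mon))
   (C.Σ-cong∈ (words n)(\{g} g∈ -> Weight.cong characterWeight
   (P.sym (Monic⇒≈mon n (shifted c (mon g))(shifted-monic M<n c {mon g}(mon-Monic n {g}(length-∈-words n g∈)))))))
   where
   move : 𝕂 -> List 𝕂 -> List 𝕂
   move c g = low n (shifted c (mon g))
   move∈ : ∀ c {g} -> g ∈ words n -> move c g ∈ words n
   move∈ c {g} _ = ∈-words-length n (length-low n (shifted c (mon g)))
   inverse : ∀ c {g} -> g ∈ words n -> move (K.- c)(move c g) ≡ g
   inverse c {g} g∈ = E.trans (low-cong n (P.trans (P.+-congʳ {const (K.- c) *' V}
    (P.sym (Monic⇒≈mon n (shifted c (mon g))(shifted-monic M<n c {mon g}(mon-Monic n {g}(length-∈-words n g∈))))))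
    (shifted-inverse c (mon g))))
    (E.trans (E.cong (\k -> low k (mon g))(E.sym (length-∈-words n g∈)))(low-mon g))

  coeff-vanishes : ∀ n -> length points N.< n -> coeff n C.≈ C.0#
  coeff-vanishes n M<n = C.∣∣-0 (R.*-cancelˡ-≤ p≰0 (R.≤-reflexive (R.trans (R.sym (C.∣·∣ p _))
   (R.trans (C.∣∣-cong p-fold)(R.trans C.∣0∣ (R.sym (R.zeroʳ _)))))))
   where
   open Setoid-Reasoning C.setoid
   p≰0 : ¬ R.# p R.≤ R.0#
   p≰0 h = R.1≰0 (R.≤-trans (R.≤-respˡ (R.sym R.#1)(R.#-mono
    (N.<⇒≤ (N.nonTrivial⇒n>1 p {{prime⇒nonTrivial K.prime}})))) h)
   β = value V K.0#
   p-fold : p C.· coeff n C.≈ C.0#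
   p-fold = begin
    p C.· coeff n
    ≡⟨ E.cong (C._· coeff n)(E.sym K.length-elems) ⟩
    length K.elems C.· coeff n
    ≈⟨ C.Σ-const K.elems _ ⟨
    C.Σ K.elems (\_ -> coeff n)
    ≈⟨ C.Σ-cong K.elems (coeff-shift n M<n) ⟩
    C.Σ K.elems (\c -> C.Σ (words n)(\g -> χ (ρ (shifted c (mon g)))))
    ≈⟨ C.Σ-swap K.elems (words n) _ ⟩
    C.Σ (words n)(\g -> C.Σ K.elems (\c -> χ (ρ (shifted c (mon g)))))
    ≈⟨ C.Σ-zero (words n)(\{g} _ -> C.trans (C.Σ-cong K.elems (\c ->
    C.trans (C.reflexive (E.cong χ (ρ-shifted c (mon g))))(χ-* _ _)))
    (C.trans (C.Σ-*ʳ K.elems _ _)(C.trans (C.*-congʳ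
    (Σχ-affine (value (mon g) K.0#) β (value-vanishing-0 points nonzero)))(C.zeroˡ _)))) ⟩
    C.0# ∎

module TrivialWeight {p}(F : PrimeField p) where
 open E
 open FieldPolynomials F using (words;length-words)

 trivialWeight : Weight F N.+-*-commutativeSemiring
 trivialWeight = record { weight = \_ -> 1; cong = \_ -> refl; *-homo = \_ _ -> refl; 1-homo = refl }

 open NewtonIdentity F N.+-*-commutativeSemiring trivialWeight using (coeff;primePowerSum;newton) public
 open Summation N.+-*-commutativeSemiring
 open Mult (CommutativeSemiring.semiring N.+-*-commutativeSemiring) using () renaming (_×_ to _·_)
 open ≡-Reasoning

 ×≡* : ∀ n x -> n · x ≡ n N.* x
 ×≡* zero x = refl
 ×≡* (suc n) x = cong (x N.+_)(×≡* n x)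

 coeff≡ : ∀ n -> coeff n ≡ p N.^ n
 coeff≡ n = trans (Σ-const (words n) 1)(trans (×≡* (length (words n)) 1)(trans (N.*-identityʳ _)(length-words n)))

 primePowerSum≡ : ∀ N m -> suc m N.< N -> primePowerSum N (suc m) ≡ p N.^ suc m
 primePowerSum≡ N m = go m (N.<-wellFounded m)
  where
  go : ∀ m -> Acc N._<_ m -> suc m N.< N -> primePowerSum N (suc m) ≡ p N.^ suc m
  go m (acc rec) m<N = N.+-cancelˡ-≡ (m N.* p N.^ suc m) _ _ (begin
   m N.* p N.^ suc m N.+ primePowerSum N (suc m)
   ≡⟨ cong₂ N._+_ (sym (trans (Σ-const (upTo m) _)(trans (×≡* (length (upTo m))(p N.^ suc m))(cong (N._* p N.^ suc m)(length-upTo m)))))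
   (sym (trans (cong (primePowerSum N (suc m) N.*_)(trans (cong coeff (N.n∸n≡0 m))(coeff≡ 0)))(N.*-identityʳ _))) ⟩
   Σ (upTo m)(\_ -> p N.^ suc m) N.+ primePowerSum N (suc m) N.* coeff (m N.∸ m)
   ≡⟨ cong (N._+ primePowerSum N (suc m) N.* coeff (m N.∸ m))(Σ-cong∈ (upTo m)(\{k} k∈ -> sym (term k (∈-upTo⁻ k∈)))) ⟩
   Σ (upTo m)(\k -> primePowerSum N (suc k) N.* coeff (m N.∸ k)) N.+ primePowerSum N (suc m) N.* coeff (m N.∸ m)
   ≡⟨ sym (Σ-upTo-sucʳ m _) ⟩
   Σ (upTo (suc m))(\k -> primePowerSum N (suc k) N.* coeff (m N.∸ k))
   ≡⟨ sym (newton N (suc m) m<N) ⟩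
   suc m · coeff (suc m)
   ≡⟨ trans (×≡* (suc m) _)(cong (suc m N.*_)(coeff≡ (suc m))) ⟩
   p N.^ suc m N.+ m N.* p N.^ suc m
   ≡⟨ N.+-comm (p N.^ suc m) _ ⟩
   m N.* p N.^ suc m N.+ p N.^ suc m ∎)
   where
   term : ∀ k -> k N.< m -> primePowerSum N (suc k) N.* coeff (m N.∸ k) ≡ p N.^ suc m
   term k k<m = trans (cong₂ N._*_ (go k (rec k<m)(N.<-trans (s≤s k<m) m<N))(coeff≡ (m N.∸ k)))
    (trans (sym (N.^-distribˡ-+-* p (suc k)(m N.∸ k)))(cong (\j -> p N.^ suc j)(N.m+[n∸m]≡n (N.<⇒≤ k<m))))

module PowerSumIndependence {p}(F : PrimeField p)(R : CommutativeRing 0ℓ 0ℓ)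
 (W : Weight F (CommutativeRing.commutativeSemiring R)) where
 open CommutativeRing R
 open NewtonIdentity F commutativeSemiring W using (coeff;primePowerSum;newton)
 open Weight W
 open Summation commutativeSemiring
 open AbelianGroup +-abelianGroup using (∙-cancelˡ)
 open Mult semiring using () renaming (_×_ to _·_)
 open Setoid-Reasoning setoid

 coeff-0 : coeff 0 ≈ 1#
 coeff-0 = trans (+-identityʳ _) 1-homo

 last-term : ∀ N m -> suc m N.< N -> Σ (upTo m)(\k -> primePowerSum N (suc k) * coeff (m N.∸ k)) + primePowerSum N (suc m)
  ≈ suc m · coeff (suc m)
 last-term N m m<N = begin
  Σ (upTo m)(\k -> primePowerSum N (suc k) * coeff (m N.∸ k)) + primePowerSum N (suc m)
  ≈⟨ +-congˡ (trans (*-congˡ (trans (reflexive (E.cong coeff (N.n∸n≡0 m))) coeff-0))(*-identityʳ _)) ⟨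
  Σ (upTo m)(\k -> primePowerSum N (suc k) * coeff (m N.∸ k)) + primePowerSum N (suc m) * coeff (m N.∸ m)
  ≈⟨ Σ-upTo-sucʳ m _ ⟨
  Σ (upTo (suc m))(\k -> primePowerSum N (suc k) * coeff (m N.∸ k))
  ≈⟨ newton N (suc m) m<N ⟨
  suc m · coeff (suc m) ∎

 primePowerSum-independent : ∀ N N' m -> suc m N.< N -> suc m N.< N' -> primePowerSum N (suc m) ≈ primePowerSum N' (suc m)
 primePowerSum-independent N N' m = go m (N.<-wellFounded m)
  where
  go : ∀ m -> Acc N._<_ m -> suc m N.< N -> suc m N.< N' -> primePowerSum N (suc m) ≈ primePowerSum N' (suc m)
  go m (acc rec) m<N m<N' = ∙-cancelˡ _ _ _ (trans (last-term N m m<N)(trans (sym (last-term N' m m<N'))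
   (+-congʳ (Σ-cong∈ (upTo m)(\{k} k∈ -> *-congʳ (sym
   (go k (rec (∈-upTo⁻ k∈))(N.<-trans (s≤s (∈-upTo⁻ k∈)) m<N)(N.<-trans (s≤s (∈-upTo⁻ k∈)) m<N'))))))))

 powerSum : ℕ -> Carrier
 powerSum k = primePowerSum (suc k) k

 powerSum-newton : ∀ n -> n · coeff n ≈ Σ (upTo n)(\k -> powerSum (suc k) * coeff (n N.∸ suc k))
 powerSum-newton n = trans (newton (suc n) n N.≤-refl)(Σ-cong∈ (upTo n)(\{k} k∈ -> *-congʳ
  (primePowerSum-independent (suc n)(suc (suc k)) k (s≤s (∈-upTo⁻ k∈)) N.≤-refl)))

module LevelSets {p}{F : PrimeField p}{ℝ}{ℂ : NormedRing ℝ}(ψ : Character F ℂ)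
 (points : List.List (PrimeField.Carrier F × ℕ))
 (nonzero : All (\x -> fst x ≢ PrimeField.0# F) points) where
 open Character ψ
 open Characters ψ
 open CharacterWeights ψ points
 open Values F
 open FieldPolynomials F hiding (0#;1#)
 open AuxiliaryPolynomial F
 open Stepanov F
 open P using (_-_)

 factorAt : List (𝕂 × ℕ) -> Poly
 factorAt [] = const K.1#
 factorAt ((a , e) ∷ as) = (const a - X) ^' e *' factorAt as

 f0 G0 : Poly
 f0 = (const K.0# - X) *' factorAt points
 G0 = (-' const K.1#) *' factorAt points

 f0≈XG0 : f0 ≈' X *' G0
 f0≈XG0 = P.trans (P.*-congʳ {factorAt points}(P.+-congʳ { -' X}{const K.0#}{[]}(coefs \{ zero -> E.refl; (suc n) -> E.refl })))
  (PS.solve 2 (\x r -> (PS.:0 PS.:- x) PS.:* r PS.:= x PS.:* (PS.:- PS.:1 PS.:* r)) P.refl X (factorAt points))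

 factorAt-0 : ∀ as -> All (\x -> fst x ≢ K.0#) as -> coef (factorAt as) 0 ≢ K.0#
 factorAt-0 [] _ = K.1≢0
 factorAt-0 ((a , e) ∷ as)(h ∷ hs) z = factorAt-0 as hs (K.*-cancel
  (E.trans (E.sym (coef-*-0 ((const a - X) ^' e)(factorAt as))) z)(coef-^-0 (const a - X) a≢0 e))
  where
  a≢0 : a K.+ (K.- K.0#) ≢ K.0#
  a≢0 z = h (E.trans (KS.solve 1 (\a -> a KS.:= a KS.:- KS.:0) E.refl a) z)

 G0-0 : coef G0 0 ≢ K.0#
 G0-0 z = factorAt-0 points nonzero (K.*-cancel (E.trans (E.sym (coef-*-0 (-' const K.1#)(factorAt points))) z)
  (\e -> K.1≢0 (E.trans (KS.solve 0 (KS.:1 KS.:= KS.:- (KS.:- KS.:1)) E.refl)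
  (E.trans (E.cong K.-_ e)(KS.solve 0 (KS.:- KS.:0 KS.:= KS.:0) E.refl)))))

 m : ℕ
 m = length f0

 f0-bounded : Bounded (suc m) f0
 f0-bounded = Bounded-mono f0 (N.n≤1+n m)(Bounded-length f0)

 module _ {w}(irr : IrreducibleWord w)(i : ℕ) where
  private module Q = Reciprocity F w irr
  open Q using (_≡ₘ_;module A)
  open Exp A.commutativeSemiring
  private
   c = geom p 0 (i N.* length w)

  factorAt-power : ∀ as -> factorAt as ^ c ≡ₘ const (valueAt as (mon w) K.^ i)
  factorAt-power [] = A.trans (Q.const-^ K.1# c)(A.reflexive (E.cong const (E.trans (one^ c)(E.sym (one^ i)))))
  factorAt-power ((a , e) ∷ as) = A.trans (^-distrib-* ((const a - X) ^' e)(factorAt as) c)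
   (A.trans (A.*-cong {((const a - X) ^' e) ^ c}{const ((value (mon w) a K.^ e) K.^ i)} power (factorAt-power as))
   (A.trans (A.sym (Homomorphism.*-homo Q.embedding _ _))
   (A.reflexive (E.cong const (E.sym (K^.^-distrib-* (value (mon w) a K.^ e)(valueAt as (mon w)) i))))))
   where
   module K^ where
    open Exp K.commutativeSemiring public
   power : ((const a - X) ^' e) ^ c ≡ₘ const ((value (mon w) a K.^ e) K.^ i)
   power = A.trans (A.reflexive (E.cong (_^ c)(Q.^'≡^ (const a - X) e)))
    (A.trans (^-assocʳ (const a - X) e c)(A.trans (A.reflexive (E.cong ((const a - X) ^_)(N.*-comm e c)))
    (A.trans (A.sym (^-assocʳ (const a - X) c e))(A.trans (^-congˡ e (Q.reciprocity a i))
    (A.trans (Q.const-^ _ e)(A.reflexive (E.cong const (E.trans (K^.^-assocʳ (value (mon w) a) i e)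
    (E.trans (E.cong (value (mon w) a K.^_)(N.*-comm i e))(E.sym (K^.^-assocʳ (value (mon w) a) e i)))))))))))

  f0-power : f0 ^ c ≡ₘ const (ρ (mon w) K.^ i)
  f0-power = A.trans (^-distrib-* (const K.0# - X)(factorAt points) c)
   (A.trans (A.*-cong {(const K.0# - X) ^ c}{const (value (mon w) K.0# K.^ i)}(Q.reciprocity K.0# i)(factorAt-power points))
   (A.trans (A.sym (Homomorphism.*-homo Q.embedding _ _))
   (A.reflexive (E.cong const (E.sym (^-distrib-*ᴷ (value (mon w) K.0#)(valueAt points (mon w)) i))))))
   where open Exp K.commutativeSemiring using () renaming (^-distrib-* to ^-distrib-*ᴷ)

  point : ∀ μ {u} -> i N.* length w ≡ μ N.+ μ -> ρ (mon w) K.^ i ≡ u -> Point f0 u μ w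
  point μ {u} i*s≡ ρ≡ = record
   { irr = irr
   ; fixed = Q.≡ₘ⇒∣ (A.trans (A.reflexive (E.trans (Q.^'≡^ X (p N.^ μ N.* p N.^ μ))(E.cong (X ^_)(E.trans (E.sym (N.^-distribˡ-+-* p μ μ))
   (E.cong (p N.^_)(E.sym i*s≡))))))(Q.frobenius-fixed i))
   ; power = Q.≡ₘ⇒∣ (A.trans (A.reflexive (E.trans (Q.^'≡^ f0 (geom p 0 μ N.+ geom p 0 μ N.* p N.^ μ))(E.cong (f0 ^_)(E.trans exponent
   (E.cong (geom p 0)(E.sym i*s≡))))))(A.trans f0-power (A.reflexive (E.cong const ρ≡))))
   }
   where
   exponent : geom p 0 μ N.+ geom p 0 μ N.* p N.^ μ ≡ geom p 0 (μ N.+ μ)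
   exponent = E.sym (E.trans (GeometricSums.geom-+ p 0 μ μ)(E.cong (geom p 0 μ N.+_)
    (E.trans (E.cong (\j -> geom p j μ)(E.sym (N.+-identityʳ μ)))
    (E.trans (GeometricSums.geom-shift p μ 0 μ)(N.*-comm (p N.^ μ) _)))))

 module Counting (N n : ℕ) where
  Level : 𝕂 -> List 𝕂 -> ℕ -> Set
  Level u w i = suc i N.* length w ≡ n × ρ (mon w) K.^ suc i ≡ u

  level? : ∀ u w i -> Dec (Level u w i)
  level? u w i = (suc i N.* length w N.≟ n) ×-dec (ρ (mon w) K.^ suc i K.≟ u)

  inLevel? : ∀ u w -> Dec (∃[ i ] i N.< N × Level u w i)
  inLevel? u w with any? (level? u w)(upTo N)
  ... | yes h = let (i , i∈ , l) = find h in yes (i , ∈-upTo⁻ i∈ , l)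
  ... | no ¬h = no \{ (i , i<N , l) -> ¬h (lose (∈-upTo⁺ i<N) l) }

  levelWords : 𝕂 -> List (List 𝕂)
  levelWords u = filter (inLevel? u)(irreds N)

  mass : 𝕂 -> ℕ
  mass u = ℕΣ.Σ (irreds N) \w -> ℕΣ.Σ (upTo N) \i ->
   ℕΣ.[ suc i N.* length w N.≟ n ] N.* (ℕΣ.[ ρ (mon w) K.^ suc i K.≟ u ] N.* length w)

  sum≡Σ : ∀ {A : Set}(g : A -> ℕ) xs -> sum (map g xs) ≡ ℕΣ.Σ xs g
  sum≡Σ g [] = E.refl
  sum≡Σ g (x ∷ xs) = E.cong (g x N.+_)(sum≡Σ g xs)

  Σ-mono-≤ : ∀ {A : Set}(xs : List A){f g : A -> ℕ} -> (∀ {x} -> x ∈ xs -> f x N.≤ g x) -> ℕΣ.Σ xs f N.≤ ℕΣ.Σ xs g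
  Σ-mono-≤ [] h = z≤n
  Σ-mono-≤ (x ∷ xs) h = N.+-mono-≤ (h (here E.refl))(Σ-mono-≤ xs (\x∈ -> h (there x∈)))
   where open import Data.List.Relation.Unary.Any using (here; there)

  mass≤ : ∀ u -> mass u N.≤ sum (map length (levelWords u))
  mass≤ u = ≤-tr (Σ-mono-≤ (irreds N)(\{w} w∈ -> per-word w (snd (∈-irreds⁻ N w∈))(inLevel? u w)))
   (≡⇒≤ (E.trans (E.sym (ℕΣ.Σ-filter (inLevel? u)(irreds N) length))(E.sym (sum≡Σ length (levelWords u)))))
   where
   term : List 𝕂 -> ℕ -> ℕ
   term w i = ℕΣ.[ suc i N.* length w N.≟ n ] N.* (ℕΣ.[ ρ (mon w) K.^ suc i K.≟ u ] N.* length w)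
   term-zero : ∀ w i -> ¬ Level u w i -> term w i ≡ 0
   term-zero w i ¬l with suc i N.* length w N.≟ n | ρ (mon w) K.^ suc i K.≟ u
   ... | no _ | _ = E.refl
   ... | yes _ | no _ = E.refl
   ... | yes a | yes b = contradiction (a , b) ¬l
   term≤ : ∀ w i -> term w i N.≤ length w
   term≤ w i with suc i N.* length w N.≟ n | ρ (mon w) K.^ suc i K.≟ u
   ... | no _ | _ = z≤n
   ... | yes _ | no _ = z≤n
   ... | yes _ | yes _ = ≡⇒≤ (E.trans (N.*-identityˡ _)(N.*-identityˡ _))
   per-word : ∀ w -> IrreducibleWord w -> (d : Dec (∃[ i ] i N.< N × Level u w i)) ->
    ℕΣ.Σ (upTo N)(term w) N.≤ ℕΣ.[ d ] N.* length w
   per-word w irr (no ¬d) = ≡⇒≤ (ℕΣ.Σ-zero (upTo N) \{i} i∈ -> term-zero w i \l -> ¬d (i , ∈-upTo⁻ i∈ , l))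
   per-word w irr (yes (i , i<N , l)) = ≤-tr (≡⇒≤
    (ℕΣ.Σ-single (Unique.upTo⁺ N)(∈-upTo⁺ i<N)(term w) \{j} _ j≢i -> term-zero w j \l' ->
    j≢i (N.suc-injective (N.*-cancelʳ-≡ (suc j)(suc i)(length w){{N.>-nonZero (positive irr)}}
    (E.trans (fst l')(E.sym (fst l)))))))
    (≤-tr (term≤ w i)(≡⇒≤ (E.sym (N.*-identityˡ _))))

  all-level : ∀ u -> All (\w -> IrreducibleWord w × ∃[ i ] i N.< N × Level u w i)(levelWords u)
  all-level u = All.tabulate \w∈ -> let (w∈' , l) = ∈-filter⁻ (inLevel? u){xs = irreds N} w∈
   in snd (∈-irreds⁻ N w∈') , l

  total-mass : ℕΣ.Σ K.elems mass ≡ TrivialWeight.primePowerSum F N n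
  total-mass = E.trans (ℕΣ.Σ-swap K.elems (irreds N) _)(ℕΣ.Σ-cong (irreds N) \w ->
   E.trans (ℕΣ.Σ-swap K.elems (upTo N) _)(ℕΣ.Σ-cong (upTo N) \i ->
   E.trans (ℕΣ.Σ-*ˡ K.elems ℕΣ.[ suc i N.* length w N.≟ n ] (\u -> ℕΣ.[ ρ (mon w) K.^ suc i K.≟ u ] N.* length w))(E.cong (ℕΣ.[ suc i N.* length w N.≟ n ] N.*_)(inner w i))))
   where
   open Mult (CommutativeSemiring.semiring N.+-*-commutativeSemiring) using () renaming (_×_ to _×ℕ_)
   open Power (CommutativeSemiring.semiring N.+-*-commutativeSemiring) using (_^_)
   1^ : ∀ i -> 1 ^ i ≡ 1
   1^ zero = E.refl
   1^ (suc i) = E.trans (N.*-identityˡ _)(1^ i)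
   inner : ∀ w i -> ℕΣ.Σ K.elems (\u -> ℕΣ.[ ρ (mon w) K.^ suc i K.≟ u ] N.* length w) ≡ length w ×ℕ (1 ^ suc i)
   inner w i = E.trans (ℕΣ.Σ-single K.elems-unique (K.∈-elems (ρ (mon w) K.^ suc i)) _
    (\{u} _ u≢ -> E.cong (N._* length w)(ℕΣ.[ ρ (mon w) K.^ suc i K.≟ u ]-no (\e -> u≢ (E.sym e)))))
    (E.trans (E.cong (N._* length w)(ℕΣ.[ ρ (mon w) K.^ suc i K.≟ ρ (mon w) K.^ suc i ]-yes E.refl))
    (E.trans (N.*-identityˡ _)(E.sym (E.trans (TrivialWeight.×≡* F (length w)(1 ^ suc i))
    (E.trans (E.cong (length w N.*_)(1^ (suc i)))(N.*-identityʳ _))))))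

  private
   module C = NormedProperties ℂ
  open NewtonIdentity F C.commutativeSemiring characterWeight using (×-Σ;indicator-×)

  power-sum : primePowerSum N n C.≈ C.Σ K.elems (\u -> mass u C.· χ u)
  power-sum = begin
   primePowerSum N n
   ≈⟨ C.Σ-cong (irreds N)(\w -> C.Σ-cong (upTo N)(\i -> C.*-congˡ (inner w i))) ⟩
   C.Σ (irreds N)(\w -> C.Σ (upTo N) \i -> C.[ suc i N.* length w N.≟ n ] C.*
   C.Σ K.elems (\u -> C.[ ρ (mon w) K.^ suc i K.≟ u ] C.* (length w C.· χ u)))
   ≈⟨ C.Σ-cong (irreds N)(\w -> C.Σ-cong (upTo N)(\i -> C.sym (C.Σ-*ˡ K.elems _ _))) ⟩
   C.Σ (irreds N)(\w -> C.Σ (upTo N) \i -> C.Σ K.elems \u -> T u w i)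
   ≈⟨ C.Σ-cong (irreds N)(\w -> C.Σ-swap (upTo N) K.elems _) ⟩
   C.Σ (irreds N)(\w -> C.Σ K.elems \u -> C.Σ (upTo N) \i -> T u w i)
   ≈⟨ C.Σ-swap (irreds N) K.elems _ ⟩
   C.Σ K.elems (\u -> C.Σ (irreds N) \w -> C.Σ (upTo N) \i -> T u w i)
   ≈⟨ C.Σ-cong K.elems (\u -> C.trans (×-Σ (irreds N) _ (χ u))(C.Σ-cong (irreds N)(\w ->
   C.trans (×-Σ (upTo N) _ (χ u))(C.Σ-cong (upTo N)(\i -> C.trans (indicator-× (suc i N.* length w N.≟ n) _ (χ u))
   (C.*-congˡ (indicator-× (ρ (mon w) K.^ suc i K.≟ u)(length w)(χ u)))))))) ⟨
   C.Σ K.elems (\u -> mass u C.· χ u) ∎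
   where
   open Setoid-Reasoning C.setoid
   open Mult C.semiring using (×-congʳ)
   T : 𝕂 -> List 𝕂 -> ℕ -> C.Carrier
   T u w i = C.[ suc i N.* length w N.≟ n ] C.* (C.[ ρ (mon w) K.^ suc i K.≟ u ] C.* (length w C.· χ u))
   inner : ∀ w i -> length w C.· (χ (ρ (mon w)) C.^ suc i)
    C.≈ C.Σ K.elems (\u -> C.[ ρ (mon w) K.^ suc i K.≟ u ] C.* (length w C.· χ u))
   inner w i = C.trans (×-congʳ (length w)(C.sym (χ-^ (ρ (mon w))(suc i))))(C.sym (C.trans
    (C.Σ-single K.elems-unique (K.∈-elems (ρ (mon w) K.^ suc i)) _
    (\{u} _ u≢ -> C.trans (C.*-congʳ (C.[ ρ (mon w) K.^ suc i K.≟ u ]-no (\e -> u≢ (E.sym e))))(C.zeroˡ _)))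
    (C.trans (C.*-congʳ (C.[ ρ (mon w) K.^ suc i K.≟ ρ (mon w) K.^ suc i ]-yes E.refl))(C.*-identityˡ _))))

module Weil {p}{F : PrimeField p}{ℝ}{ℂ : NormedRing ℝ}(ψ : Character F ℂ)
 (points : List.List (PrimeField.Carrier F × ℕ))
 (nonzero : All (\x -> fst x ≢ PrimeField.0# F) points)
 (0<M : 0 N.< List.length points)(k : ℕ)(p≡ : p ≡ 3 N.+ k) where
 open Character ψ
 open Characters ψ
 open CharacterWeights ψ points
 open LevelSets ψ points nonzero
 open FieldPolynomials F hiding (0#;1#)
 open AuxiliaryPolynomial F using (coef-*-0;Monic-X)
 open Stepanov F using (Point;stepanov)
 open PowerSumIndependence F (NormedRing.ring ℂ) characterWeight
 private
  module R = RealProperties ℝ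
  module C = NormedProperties ℂ

 f0≉0 : ¬ f0 ≈' []
 f0≉0 z = G0-0 (at (*-nonzero X G0 (P.trans (P.sym f0≈XG0) z)(Monic-nonzero Monic-X)) 0)

 module _ (μ-1 : ℕ) where
  private
   μ = suc μ-1
   n = 2 N.* μ
   N = suc n
   Q = p N.^ μ
   n≡ : n ≡ μ N.+ μ
   n≡ = E.cong (μ N.+_)(N.+-identityʳ μ)
  open Counting N n

  A : ℕ
  A = geom p 0 μ N.+ geom p 0 μ N.* Q N.+ (4 N.* m N.+ 3) N.* Q

  levelWords-unique : ∀ u -> Unique (levelWords u)
  levelWords-unique u = Unique.filter⁺ (inLevel? u)(irreds-unique N)

  mass-nonzero : ∀ u -> u ≢ K.0# -> mass u N.≤ A
  mass-nonzero u u≢0 = ≤-tr (mass≤ u)(stepanov f0 G0 f0≈XG0 G0-0 f0-bounded k p≡ μ-1 u≢0 (levelWords u)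
   (levelWords-unique u)
   (All.map (\{ (irr , i , _ , l , e) -> point irr (suc i) μ (E.trans l n≡) e })(all-level u)))

  mass-zero : mass K.0# N.≤ m
  mass-zero = ≤-tr (mass≤ K.0#)(Σ-degree-≤ (levelWords K.0#)(levelWords-unique K.0#)
   (All.map fst (all-level K.0#))(All.map divides (all-level K.0#)) f0≉0 f0-bounded)
   where
   divides : ∀ {w} -> IrreducibleWord w × (∃[ i ] i N.< N × Level K.0# w i) -> mon w ∣' f0
   divides {w}(irr , i , _ , l , e) = Q'.≡ₘ0⇒∣ (Q'.^-zero f0 (geom p 0 (suc i N.* length w))
    (Q'.A.trans (f0-power irr (suc i))(Q'.A.trans (Q'.A.reflexive (E.cong const e))(Homomorphism.0-homo Q'.embedding))))
    where module Q' = Reciprocity F w irr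

  deficit : 𝕂 -> ℕ
  deficit u with u K.≟ K.0#
  ... | yes _ = 0
  ... | no _ = A N.∸ mass u

  deficit-+ : ∀ u -> deficit u N.+ mass u N.+ ℕΣ.[ u K.≟ K.0# ] N.* A N.≤ A N.+ ℕΣ.[ u K.≟ K.0# ] N.* m
  deficit-+ u with u K.≟ K.0#
  ... | yes E.refl = ≤-tr (≡⇒≤ (E.cong (mass K.0# N.+_)(N.+-identityʳ A)))
   (≤-tr (≡⇒≤ (N.+-comm (mass K.0#) A))(N.+-monoʳ-≤ A
   (≤-tr mass-zero (≡⇒≤ (E.sym (N.+-identityʳ m))))))
  ... | no u≢0 = ≡⇒≤ (E.cong (N._+ 0)(N.m∸n+n≡m (mass-nonzero u u≢0)))

  total-deficit : ℕΣ.Σ K.elems deficit N.+ p N.^ n N.+ A N.≤ p N.* A N.+ m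
  total-deficit = subst₂ N._≤_ lhs rhs (Σ-mono-≤ K.elems (\{u} _ -> deficit-+ u))
   where
   open E using (subst₂)
   at-zero : ∀ x -> ℕΣ.Σ K.elems (\u -> ℕΣ.[ u K.≟ K.0# ] N.* x) ≡ x
   at-zero x = E.trans (ℕΣ.Σ-single K.elems-unique (K.∈-elems K.0#) _
    (\{u} _ u≢0 -> E.cong (N._* x)(ℕΣ.[ u K.≟ K.0# ]-no u≢0)))
    (E.trans (E.cong (N._* x)(ℕΣ.[ K.0# K.≟ K.0# ]-yes E.refl))(N.*-identityˡ x))
   lhs : ℕΣ.Σ K.elems (\u -> deficit u N.+ mass u N.+ ℕΣ.[ u K.≟ K.0# ] N.* A) ≡ ℕΣ.Σ K.elems deficit N.+ p N.^ n N.+ A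
   lhs = E.trans (ℕΣ.Σ-+ K.elems _ _)(cong₂ N._+_ (E.trans (ℕΣ.Σ-+ K.elems deficit mass)
    (E.cong (ℕΣ.Σ K.elems deficit N.+_)(E.trans total-mass (TrivialWeight.primePowerSum≡ F N (N.pred n) N.≤-refl))))(at-zero A))
   rhs : ℕΣ.Σ K.elems (\u -> A N.+ ℕΣ.[ u K.≟ K.0# ] N.* m) ≡ p N.* A N.+ m
   rhs = E.trans (ℕΣ.Σ-+ K.elems _ _)(cong₂ N._+_ (E.trans (ℕΣ.Σ-const K.elems A)
    (E.trans (TrivialWeight.×≡* F (length K.elems) A)(E.cong (N._* A) K.length-elems)))(at-zero m))

  D : ℕ
  D = (2 N.+ k) N.* (4 N.* m N.+ 3) N.+ m

  deficit-bound : ℕΣ.Σ K.elems deficit N.≤ D N.* Q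
  deficit-bound = N.+-cancelʳ-≤ (Q N.* Q N.+ A) _ _ (≤-tr
   (≡⇒≤ (E.trans (E.sym (N.+-assoc _ (Q N.* Q) A))(E.cong (\x -> ℕΣ.Σ K.elems deficit N.+ x N.+ A)
   (E.trans (E.sym (N.^-distribˡ-+-* p μ μ))(E.cong (p N.^_)(E.sym n≡))))))
   (≤-tr total-deficit (N.+-cancelʳ-≤ 1 _ _ (≤-tr (≡⇒≤ (E.cong (\x -> x N.* A N.+ m N.+ 1) p≡))
   (subst (\q -> (3 N.+ k) N.* (c' N.+ c' N.* q N.+ (4 N.* m N.+ 3) N.* q) N.+ m N.+ 1
   N.≤ D N.* q N.+ (q N.* q N.+ (c' N.+ c' N.* q N.+ (4 N.* m N.+ 3) N.* q)) N.+ 1)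
   Q≡ (N.m+n≤o⇒m≤o _ (≡⇒≤ (id13 k c' m))))))))
   where
   c' = geom p 0 μ
   Q≡ : (2 N.+ k) N.* c' N.+ 1 ≡ Q
   Q≡ = GeometricSums.geom-sum p (2 N.+ k) p≡ 0 μ

  -- Since the values of χ sum to 0, each level set may be compared with its maximal mass A.
  powerSum-bound : C.∣ powerSum n ∣ R.≤ R.# D R.* R.# p R.^ μ
  powerSum-bound = begin
   C.∣ powerSum n ∣
   ≈⟨ R.trans (C.∣∣-cong split)(C.∣-∣ _) ⟩
   C.∣ C.Σ K.elems (\u -> deficit u C.· χ u) ∣
   ≤⟨ C.∣Σ∣ K.elems _ ⟩
   R.Σ K.elems (\u -> C.∣ deficit u C.· χ u ∣)
   ≤⟨ R.Σ-mono K.elems (\{u} _ -> R.≤-respˡ (C.∣·∣ (deficit u)(χ u))(R.≤-respʳ (R.*-identityʳ _)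
   (R.*-monoˡ (R.0≤# (deficit u))(∣χ∣≤1 u)))) ⟩
   R.Σ K.elems (\u -> R.# (deficit u))
   ≈⟨ cast K.elems ⟨
   R.# (ℕΣ.Σ K.elems deficit)
   ≤⟨ R.#-mono deficit-bound ⟩
   R.# (D N.* Q)
   ≈⟨ R.trans (R.#-* D Q)(R.*-congˡ (R.#-^ p μ)) ⟩
   R.# D R.* R.# p R.^ μ ∎
   where
   open R.≤-Reasoning
   cast : ∀ xs -> R.# (ℕΣ.Σ xs deficit) R.≈ R.Σ xs (\u -> R.# (deficit u))
   cast [] = R.refl
   cast (x ∷ xs) = R.trans (R.#-+ (deficit x) _)(R.+-congˡ (cast xs))
   open Mult C.semiring using (×-homo-+;×-congʳ;×-congˡ;×-assoc-*)
   complement : ∀ u -> mass u C.· χ u C.+ deficit u C.· χ u C.≈ A C.· χ u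
   complement u with u K.≟ K.0#
   ... | yes E.refl = C.trans (C.+-cong (zero· (mass K.0#)) C.refl)(C.trans (C.+-identityʳ _)(C.sym (zero· A)))
    where
    zero· : ∀ n -> n C.· χ K.0# C.≈ C.0#
    zero· zero = C.refl
    zero· (suc n) = C.trans (C.+-cong χ-0 (zero· n))(C.+-identityˡ _)
   ... | no u≢0 = C.trans (C.sym (×-homo-+ (χ u)(mass u)(A N.∸ mass u)))(×-congˡ (N.m+[n∸m]≡n (mass-nonzero u u≢0)))
   split : powerSum n C.≈ C.- C.Σ K.elems (\u -> deficit u C.· χ u)
   split = C.trans power-sum (inverseˡ-unique _ _ (C.trans (C.sym (C.Σ-+ K.elems _ _))
    (C.trans (C.Σ-cong K.elems complement)(C.trans (C.Σ-cong K.elems (\u ->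
    C.trans (×-congʳ A (C.sym (C.*-identityˡ _)))(C.sym (×-assoc-* A C.1# (χ u)))))
    (C.trans (C.Σ-*ˡ K.elems _ χ)(C.trans (C.*-congˡ Σχ≈0)(C.zeroʳ _)))))))
    where open AbelianGroup C.+-abelianGroup using (inverseˡ-unique)

 open GraeffeBound ℂ using (κ)

 weil-coeff : C.∣ coeff 1 ∣ R.≤ κ (length points) R.* R.# 2 R.* R.root 2 (R.# p)
 weil-coeff = GraeffeBound.riemann-hypothesis ℂ (length points) 0<M {coeff}{powerSum}
  powerSum-newton coeff-0 (coeff-vanishes nonzero)(D 0) p
  (N.<⇒≤ (N.nonTrivial⇒n>1 p {{prime⇒nonTrivial K.prime}})) \{ (suc μ) _ -> powerSum-bound μ }

module Singletons where
 open E
 open Enumeration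

 unique-⊆-length : ∀ {A : Set}{xs ys : List A} -> Unique xs -> (∀ {x} -> x ∈ xs -> x ∈ ys) -> length xs N.≤ length ys
 unique-⊆-length {xs = xs}{ys} u sub = N.≮⇒≥ \lt ->
  let (x , x' , _ , _ , x≢x' , x≡x') = pigeonhole ys u lt (\x -> x) sub in x≢x' x≡x'

 count : ℕ -> List ℕ -> ℕ
 count c [] = 0
 count c (b ∷ bs) with b N.≟ c
 ... | yes _ = suc (count c bs)
 ... | no _ = count c bs

 others : ℕ -> List ℕ -> List ℕ
 others c [] = []
 others c (b ∷ bs) with b N.≟ c
 ... | yes _ = others c bs
 ... | no _ = b ∷ others c bs

 ∈-others⁻ : ∀ c xs {x} -> x ∈ others c xs -> x ∈ xs
 ∈-others⁻ c (b ∷ xs) x∈ with b N.≟ c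
 ∈-others⁻ c (b ∷ xs) x∈ | yes _ = there (∈-others⁻ c xs x∈)
 ∈-others⁻ c (b ∷ xs)(here e) | no _ = here e
 ∈-others⁻ c (b ∷ xs)(there x∈) | no _ = there (∈-others⁻ c xs x∈)

 ∈-others⁺ : ∀ c xs {x} -> x ∈ xs -> x ≢ c -> x ∈ others c xs
 ∈-others⁺ c (b ∷ xs) x∈ x≢c with b N.≟ c
 ∈-others⁺ c (b ∷ xs)(here refl) x≢c | yes b≡c = contradiction b≡c x≢c
 ∈-others⁺ c (b ∷ xs)(there x∈) x≢c | yes _ = ∈-others⁺ c xs x∈ x≢c
 ∈-others⁺ c (b ∷ xs)(here refl) x≢c | no _ = here refl
 ∈-others⁺ c (b ∷ xs)(there x∈) x≢c | no _ = there (∈-others⁺ c xs x∈ x≢c)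

 count-++ : ∀ c xs ys -> count c (xs ++ ys) ≡ count c xs N.+ count c ys
 count-++ c [] ys = refl
 count-++ c (b ∷ xs) ys with b N.≟ c
 ... | yes _ = cong suc (count-++ c xs ys)
 ... | no _ = count-++ c xs ys

 length-others : ∀ c xs -> length (others c xs) N.+ count c xs ≡ length xs
 length-others c [] = refl
 length-others c (b ∷ xs) with b N.≟ c
 ... | yes _ = trans (N.+-suc _ _)(cong suc (length-others c xs))
 ... | no _ = cong suc (length-others c xs)

 count-others : ∀ {b c} -> c ≢ b -> ∀ xs -> count c (others b xs) ≡ count c xs
 count-others c≢b [] = refl
 count-others {b}{c} c≢b (x ∷ xs) with x N.≟ b
 ... | yes refl with x N.≟ c
 ... | yes refl = contradiction refl c≢b
 ... | no _ = count-others c≢b xs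
 count-others {b}{c} c≢b (x ∷ xs) | no _ with x N.≟ c
 ... | yes _ = cong suc (count-others c≢b xs)
 ... | no _ = count-others c≢b xs

 count-zero : ∀ c xs -> count c xs ≡ 0 -> others c xs ≡ xs
 count-zero c [] e = refl
 count-zero c (b ∷ xs) e with b N.≟ c
 ... | no _ = cong (b ∷_)(count-zero c xs e)

 others-≢ : ∀ c xs -> All (_≢ c)(others c xs)
 others-≢ c [] = []
 others-≢ c (b ∷ xs) with b N.≟ c
 ... | yes _ = others-≢ c xs
 ... | no b≢c = b≢c ∷ others-≢ c xs

 count-∉ : ∀ c xs -> count c (others c xs) ≡ 0
 count-∉ c [] = refl
 count-∉ c (b ∷ xs) with b N.≟ c
 ... | yes _ = count-∉ c xs
 ... | no b≢c with b N.≟ c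
 ... | yes b≡c = contradiction b≡c b≢c
 ... | no _ = count-∉ c xs

 -- Either some value occurs exactly once, or at most half as many values as entries occur.
 singleton-or-few : ∀ n xs -> length xs N.≤ 2 N.* n ⊎ length xs N.≤ suc (2 N.* n) ->
  (∃[ c ] count c xs ≡ 1) ⊎ (∃[ vs ] length vs N.≤ n × All (_∈ vs) xs × All (_∈ xs) vs)
 singleton-or-few n [] _ = inr ([] , z≤n , [] , [])
 singleton-or-few n (b ∷ xs) h with count b xs in eq
 ... | zero = inl (b , once)
  where
  once : count b (b ∷ xs) ≡ 1
  once with b N.≟ b
  ... | yes _ = cong suc eq
  ... | no b≢b = contradiction refl b≢b
 singleton-or-few zero (b ∷ []) h | suc j with () ← eq
 singleton-or-few zero (b ∷ c ∷ xs)(inl ()) | suc j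
 singleton-or-few zero (b ∷ c ∷ xs)(inr (s≤s ())) | suc j
 singleton-or-few (suc n)(b ∷ xs) h | suc j with singleton-or-few n (others b xs) shorter
  where
  drop : suc (length (others b xs)) N.≤ length xs
  drop = subst (suc (length (others b xs)) N.≤_)(trans (cong (length (others b xs) N.+_)(sym eq))(length-others b xs))
   (≤-tr (s≤s (N.m≤m+n _ j))(≡⇒≤ (sym (N.+-suc _ j))))
  two : 2 N.* suc n ≡ suc (suc (2 N.* n))
  two = cong suc (N.+-suc n (n N.+ 0))
  shorten : suc (length xs) N.≤ 2 N.* suc n ⊎ suc (length xs) N.≤ suc (2 N.* suc n) ->
   length (others b xs) N.≤ 2 N.* n ⊎ length (others b xs) N.≤ suc (2 N.* n)
  shorten (inl le) = inl (N.s≤s⁻¹ (≤-tr drop (N.s≤s⁻¹ (subst (suc (length xs) N.≤_) two le))))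
  shorten (inr le) = inr (N.s≤s⁻¹ (≤-tr drop (N.s≤s⁻¹ (subst (\k -> suc (length xs) N.≤ suc k) two le))))
  shorter = shorten h
 ... | inl (c , e) with c N.≟ b
 ... | yes refl = contradiction (trans (sym (count-∉ b xs)) e)(\())
 ... | no c≢b = inl (c , trans skip (trans (sym (count-others c≢b xs)) e))
  where
  skip : count c (b ∷ xs) ≡ count c xs
  skip with b N.≟ c
  ... | yes b≡c = contradiction (sym b≡c) c≢b
  ... | no _ = refl
 singleton-or-few (suc n)(b ∷ xs) h | suc j | inr (vs , le , all , back) =
  inr (b ∷ vs , s≤s le , here refl ∷ All.tabulate cover
  , here refl ∷ All.map (\v∈ -> there (∈-others⁻ b xs v∈)) back)
  where
  cover : ∀ {x} -> x ∈ xs -> x ∈ b ∷ vs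
  cover {x} x∈ with x N.≟ b
  ... | yes refl = here refl
  ... | no x≢b = there (All.lookup all (∈-others⁺ b xs x∈ x≢b))

 at : ℕ -> List ℕ -> ℕ -> ℕ
 at d [] i = d
 at d (v ∷ vs) zero = v
 at d (v ∷ vs)(suc i) = at d vs i

 at-∈ : ∀ d {v vs} -> v ∈ vs -> ∃[ i ] i N.< length vs × at d vs i ≡ v
 at-∈ d (here refl) = 0 , s≤s z≤n , refl
 at-∈ d (there v∈) with at-∈ d v∈
 ... | i , lt , e = suc i , s≤s lt , e

 -- Lists of length 2n over [0, B) without singletons are parametrised by n values and a choice of a
 -- value at each position.
 decodings : ℕ -> ℕ -> ℕ -> List (List ℕ)
 decodings B n l = cartesianProductWith (\vs is -> map (at 0 vs) is)(tuples (upTo B) n)(tuples (upTo n) l)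

 length-decodings : ∀ B n l -> length (decodings B n l) ≡ B N.^ n N.* n N.^ l
 length-decodings B n l = trans (length-pairs _ (tuples (upTo B) n)(tuples (upTo n) l))
  (cong₂ N._*_ (trans (length-tuples (upTo B) n)(cong (N._^ n)(length-upTo B)))
  (trans (length-tuples (upTo n) l)(cong (N._^ l)(length-upTo n))))

 singleton-or-decoding : ∀ B n xs -> 0 N.< B -> length xs ≡ 2 N.* n -> All (_∈ upTo B) xs ->
  (∃[ c ] count c xs ≡ 1) ⊎ xs ∈ decodings B n (2 N.* n)
 singleton-or-decoding B n xs 0<B len all with singleton-or-few n xs (inl (≡⇒≤ len))
 ... | inl single = inl single
 ... | inr (vs , le , cover , back) = inr (subst (_∈ decodings B n (2 N.* n)) decoded
  (∈-cartesianProductWith⁺ _ padded∈ indices∈))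
  where
  padded = vs ++ replicate (n N.∸ length vs) 0
  length-padded : length padded ≡ n
  length-padded = trans (length-++ vs)(trans (cong (length vs N.+_)(length-replicate (n N.∸ length vs)))(N.m+[n∸m]≡n le))
  All-++ : ∀ {xs ys : List ℕ} -> All (_∈ upTo B) xs -> All (_∈ upTo B) ys -> All (_∈ upTo B)(xs ++ ys)
  All-++ [] qs = qs
  All-++ (p ∷ ps) qs = p ∷ All-++ ps qs
  zeros : ∀ k -> All (_∈ upTo B)(replicate k 0)
  zeros zero = []
  zeros (suc k) = ∈-upTo⁺ 0<B ∷ zeros k
  padded∈ : padded ∈ tuples (upTo B) n
  padded∈ = subst (\k -> padded ∈ tuples (upTo B) k) length-padded
   (∈-tuples⁺ (All-++ (All.map (All.lookup all) back)(zeros _)))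
  position : ∀ {x} -> x ∈ vs -> ∃[ i ] i N.< n × at 0 padded i ≡ x
  position x∈ with at-∈ 0 (∈-++⁺ˡ {ys = replicate (n N.∸ length vs) 0} x∈)
  ... | i , lt , e = i , subst (i N.<_) length-padded lt , e
  encode : ∀ {ys} -> All (_∈ vs) ys -> ∃[ is ] ((length is ≡ length ys) × (All (_∈ upTo n) is × (map (at 0 padded) is ≡ ys)))
  encode [] = [] , refl , [] , refl
  encode (p ∷ ps) with position p | encode ps
  ... | i , lt , e | is , l , a , e' = i ∷ is , cong suc l , ∈-upTo⁺ lt ∷ a , cong₂ _∷_ e e'
  indices = encode cover
  indices∈ : fst indices ∈ tuples (upTo n)(2 N.* n)
  indices∈ = subst (\k -> fst indices ∈ tuples (upTo n) k)(trans (fst (snd indices)) len)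
   (∈-tuples⁺ (fst (snd (snd indices))))
  decoded : map (at 0 padded)(fst indices) ≡ xs
  decoded = snd (snd (snd indices))

module Inequalities (ℝ : RealField) where
 open RealProperties ℝ
 open ≤-Reasoning

 Σ-product : ∀ {A B : Set}(xs : List A)(ys : List B)(f : A -> Carrier)(g : B -> Carrier) ->
  Σ xs (\x -> Σ ys (\y -> f x * g y)) ≈ Σ xs f * Σ ys g
 Σ-product xs ys f g = trans (Σ-cong xs (\x -> Σ-*ˡ ys (f x) g))(Σ-*ʳ xs (Σ ys g) f)

 Σ-- : ∀ {A : Set}(xs : List A) f -> Σ xs (\x -> - f x) ≈ - Σ xs f
 Σ-- xs f = trans (Σ-cong xs (\x -> solve 1 (\a -> :- a := :- :1 :* a) refl (f x)))
  (trans (Σ-*ˡ xs (- 1#) f)(solve 1 (\a -> :- :1 :* a := :- a) refl (Σ xs f)))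

 halve : ∀ {x y} -> 0# ≤ (x - y) + (x - y) -> y ≤ x
 halve {x}{y} h = *-cancelˡ-≤ (#suc≰0 1)(0≤y-x⇒x≤y (≤-respʳ
  (solve 2 (\x y -> (x :- y) :+ (x :- y) := (:1 :+ (:1 :+ :0)) :* x :- (:1 :+ (:1 :+ :0)) :* y) refl x y) h))

 cauchy-schwarz : ∀ {A : Set}(xs : List A)(u v : A -> Carrier) ->
  Σ xs (\x -> u x * v x) * Σ xs (\x -> u x * v x) ≤ Σ xs (\x -> u x * u x) * Σ xs (\x -> v x * v x)
 cauchy-schwarz xs u v = halve (≤-respʳ expand (Σ-nonneg xs (\{x} _ -> Σ-nonneg xs (\{y} _ -> square-nonneg (u x * v y - u y * v x)))))
  where
  S = Σ xs (\x -> u x * v x)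
  U = Σ xs (\x -> u x * u x)
  V = Σ xs (\x -> v x * v x)
  expand : Σ xs (\x -> Σ xs (\y -> (u x * v y - u y * v x) * (u x * v y - u y * v x))) ≈ (U * V - S * S) + (U * V - S * S)
  expand = trans (Σ-cong xs (\x -> trans (Σ-cong xs (\y ->
   solve 4 (\a b c d -> (a :* d :- c :* b) :* (a :* d :- c :* b) := a :* a :* (d :* d) :+ b :* b :* (c :* c) :+ (:- (a :* b :* (c :* d)) :+ :- (a :* b :* (c :* d))))
   refl (u x)(v x)(u y)(v y)))
   (trans (Σ-+ xs _ _)(+-cong (Σ-+ xs _ _)(Σ-+ xs _ _)))))
   (trans (Σ-+ xs _ _)(trans (+-cong (Σ-+ xs _ _)(Σ-+ xs _ _))
   (trans (+-cong (+-cong (Σ-product xs xs _ _)(Σ-product xs xs _ _))(+-cong cross cross))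
   (solve 3 (\u v s -> u :* v :+ v :* u :+ (:- (s :* s) :+ :- (s :* s)) := (u :* v :- s :* s) :+ (u :* v :- s :* s)) refl U V S))))
   where
   cross : Σ xs (\x -> Σ xs (\y -> - (u x * v x * (u y * v y)))) ≈ - (S * S)
   cross = trans (Σ-cong xs (\x -> Σ-- xs _))(trans (Σ-- xs _)(-‿cong (Σ-product xs xs _ _)))

 module _ {A : Set}(xs : List A)(s : A -> Carrier)(s-nonneg : ∀ x -> 0# ≤ s x) where
  private
   n = # (length xs)
   S : ℕ -> Carrier
   S k = Σ xs (\x -> s x ^ k)

  chebyshev : ∀ k -> S 1 * S k ≤ n * S (suc k)
  chebyshev k = halve (≤-respʳ expand (Σ-nonneg xs (\{x} _ -> Σ-nonneg xs (\{y} _ -> same-sign (s x)(s y)(s-nonneg x)(s-nonneg y)))))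
   where
   same-sign : ∀ a b -> 0# ≤ a -> 0# ≤ b -> 0# ≤ (a ^ 1 - b ^ 1) * (a ^ k - b ^ k)
   same-sign a b 0≤a 0≤b = by-total a b
    (\a≤b -> ≤-respʳ (solve 4 (\a b c d -> (b :- a) :* (d :- c) := (a :- b) :* (c :- d)) refl (a ^ 1)(b ^ 1)(a ^ k)(b ^ k))
    (*-nonneg (x≤y⇒0≤y-x (^-mono 1 0≤a a≤b))(x≤y⇒0≤y-x (^-mono k 0≤a a≤b))))
    (\b≤a -> *-nonneg (x≤y⇒0≤y-x (^-mono 1 0≤b b≤a))(x≤y⇒0≤y-x (^-mono k 0≤b b≤a)))
   one : Σ xs (\_ -> 1#) ≈ n
   one = trans (Σ-const xs 1#) refl
   expand : Σ xs (\x -> Σ xs (\y -> (s x ^ 1 - s y ^ 1) * (s x ^ k - s y ^ k))) ≈ (n * S (suc k) - S 1 * S k) + (n * S (suc k) - S 1 * S k)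
   expand = trans (Σ-cong xs (\x -> trans (Σ-cong xs (\y ->
    solve 4 (\a b c d -> (a :* :1 :- b :* :1) :* (c :- d) := :1 :* (a :* c) :+ (a :* c) :* :1 :+ (b :* d :- a :* c) :+ (:- ((a :* :1) :* d) :+ :- (c :* (b :* :1))))
    refl (s x)(s y)(s x ^ k)(s y ^ k)))
    (trans (Σ-+ xs _ _)(+-cong (trans (Σ-+ xs _ _)(+-cong (Σ-+ xs _ _)(Σ-+ xs _ _)))(Σ-+ xs _ _)))))
    (trans (Σ-+ xs _ _)(trans (+-cong (trans (Σ-+ xs _ _)(+-cong (Σ-+ xs _ _)(Σ-+ xs _ _)))(Σ-+ xs _ _))
    (trans (+-cong (+-cong (+-cong one-left one-right)(+-cong left right))(+-cong cross cross'))
    (solve 3 (\n a b -> n :* a :+ a :* n :+ (n :* a :- a :* n) :+ (:- b :+ :- b) := (n :* a :- b) :+ (n :* a :- b)) refl n (S (suc k))(S 1 * S k)))))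
    where
    one-left : Σ xs (\x -> Σ xs (\y -> 1# * (s x * s x ^ k))) ≈ n * S (suc k)
    one-left = trans (Σ-swap xs xs _)(trans (Σ-product xs xs (\_ -> 1#)(\x -> s x ^ suc k))(*-congʳ one))
    one-right : Σ xs (\x -> Σ xs (\y -> s x * s x ^ k * 1#)) ≈ S (suc k) * n
    one-right = trans (Σ-product xs xs (\x -> s x ^ suc k)(\_ -> 1#))(*-congˡ one)
    left : Σ xs (\x -> Σ xs (\y -> s y * s y ^ k)) ≈ n * S (suc k)
    left = trans (Σ-cong xs (\x -> sym (*-identityˡ _)))(trans (Σ-*ʳ xs _ (\_ -> 1#))(*-congʳ one))
    right : Σ xs (\x -> Σ xs (\y -> - (s x * s x ^ k))) ≈ - (S (suc k) * n)
    right = trans (Σ-cong xs (\x -> trans (Σ-- xs _)(-‿cong (trans (Σ-cong xs (\_ -> sym (*-identityʳ _)))(trans (Σ-*ˡ xs _ (\_ -> 1#))(*-congˡ one))))))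
     (trans (Σ-- xs _)(-‿cong (Σ-*ʳ xs n _)))
    cross : Σ xs (\x -> Σ xs (\y -> - (s x * 1# * s y ^ k))) ≈ - (S 1 * S k)
    cross = trans (Σ-cong xs (\x -> Σ-- xs _))(trans (Σ-- xs _)(-‿cong (Σ-product xs xs _ _)))
    cross' : Σ xs (\x -> Σ xs (\y -> - (s x ^ k * (s y * 1#)))) ≈ - (S 1 * S k)
    cross' = trans (Σ-cong xs (\x -> Σ-- xs _))(trans (Σ-- xs _)(-‿cong (trans (Σ-product xs xs _ _)(*-comm _ _))))

  power-mean : ∀ k -> Σ xs s ^ suc k ≤ n ^ k * S (suc k)
  power-mean zero = ≤-reflexive (trans (*-identityʳ _)(trans (Σ-cong xs (\x -> sym (*-identityʳ _)))(sym (*-identityˡ _))))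
  power-mean (suc k) = begin
   Σ xs s * Σ xs s ^ suc k ≤⟨ *-monoˡ (Σ-nonneg xs (\_ -> s-nonneg _))(power-mean k) ⟩
   Σ xs s * (n ^ k * S (suc k)) ≈⟨ solve 3 (\a b c -> a :* (b :* c) := b :* (a :* c)) refl _ _ _ ⟩
   n ^ k * (Σ xs s * S (suc k)) ≈⟨ *-congˡ (*-congʳ (Σ-cong xs (\x -> sym (*-identityʳ _)))) ⟩
   n ^ k * (S 1 * S (suc k)) ≤⟨ *-monoˡ (^-nonneg k (0≤# (length xs)))(chebyshev (suc k)) ⟩
   n ^ k * (n * S (suc (suc k))) ≈⟨ solve 3 (\a b c -> a :* (b :* c) := b :* a :* c) refl _ _ _ ⟩
   n ^ suc k * S (suc (suc k)) ∎

 -- Hölder's inequality for the sum of t over a family of points, with fibres of size fibre.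
 module Hölder {X I : Set}(_≟_ : (x y : X) -> Dec (x ≡ y))
  (xs : List X)(unique : Unique xs)(complete : ∀ x -> x ∈ xs)
  (is : List I)(g : I -> X)(t : X -> Carrier)(t-nonneg : ∀ x -> 0# ≤ t x) where
  fibre : X -> Carrier
  fibre x = Σ is (\i -> [ g i ≟ x ])

  Σ-fibre : ∀ (f : X -> Carrier) -> Σ is (\i -> f (g i)) ≈ Σ xs (\x -> fibre x * f x)
  Σ-fibre f = trans (Σ-cong is (\i -> sym (trans (Σ-single unique (complete (g i))(\x -> [ g i ≟ x ] * f x)
   (\{x} _ x≢ -> trans (*-congʳ ([ g i ≟ x ]-no (\e -> x≢ (E.sym e))))(zeroˡ _)))
   (trans (*-congʳ ([ g i ≟ g i ]-yes E.refl))(*-identityˡ _)))))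
   (trans (Σ-swap is xs _)(Σ-cong xs (\x -> Σ-*ʳ is (f x) _)))

  hölder : ∀ k -> Σ is (\i -> t (g i)) ^ (2 N.* suc k)
   ≤ # (length is) ^ (2 N.* k) * (Σ xs (\x -> fibre x * fibre x) * Σ xs (\x -> t x ^ (2 N.* suc k)))
  hölder k = begin
   S ^ (2 N.* suc k) ≈⟨ double S (suc k) ⟩
   S ^ suc k * S ^ suc k ≤⟨ *-mono (^-nonneg (suc k) 0≤S) 0≤B bound bound ⟩
   n ^ k * T * (n ^ k * T) ≈⟨ solve 2 (\a b -> a :* b :* (a :* b) := a :* a :* (b :* b)) refl (n ^ k) T ⟩
   n ^ k * n ^ k * (T * T) ≤⟨ *-monoˡ (square-nonneg _)(cauchy-schwarz xs fibre (\x -> t x ^ suc k)) ⟩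
   n ^ k * n ^ k * (Σ xs (\x -> fibre x * fibre x) * Σ xs (\x -> t x ^ suc k * t x ^ suc k))
   ≈⟨ *-cong (double n k)(*-congˡ (Σ-cong xs (\x -> double (t x)(suc k)))) ⟨
   n ^ (2 N.* k) * (Σ xs (\x -> fibre x * fibre x) * Σ xs (\x -> t x ^ (2 N.* suc k))) ∎
   where
   S = Σ is (\i -> t (g i))
   0≤S = Σ-nonneg is (\{i} _ -> t-nonneg (g i))
   n = # (length is)
   T = Σ xs (\x -> fibre x * t x ^ suc k)
   bound : S ^ suc k ≤ n ^ k * T
   bound = ≤-respʳ (*-congˡ (Σ-fibre (\x -> t x ^ suc k)))(power-mean is (\i -> t (g i))(\i -> t-nonneg (g i)) k)
   0≤B = ≤-trans (^-nonneg (suc k) 0≤S) bound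

module DivisorSums where
 open import Data.Nat as N
 open import Data.Nat.Divisibility using (_∣_;_∣?_;divides)
 open import Data.Nat.DivMod using (_/_)
 open import Data.Nat.Properties
 open E hiding ([_])
 open Summation +-*-commutativeSemiring

 Σ-mono-≤ : ∀ {A : Set}(xs : List A){f g : A -> ℕ} -> (∀ {x} -> x ∈ xs -> f x ≤ g x) -> Σ xs f ≤ Σ xs g
 Σ-mono-≤ [] h = z≤n
 Σ-mono-≤ (x ∷ xs) h = +-mono-≤ (h (here refl))(Σ-mono-≤ xs (\x∈ -> h (there x∈)))

 Σ-upTo-≤ : ∀ n {f} c -> (∀ i -> i < n -> f i ≤ c) -> Σ (upTo n) f ≤ n * c
 Σ-upTo-≤ zero c h = z≤n
 Σ-upTo-≤ (suc n){f} c h = ≤-trans (≤-reflexive (Σ-upTo-sucˡ n f))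
  (+-mono-≤ (h 0 (s≤s z≤n))(Σ-upTo-≤ n c (\i i<n -> h (suc i)(s≤s i<n))))

 Σ-upTo-const : ∀ n c -> Σ (upTo n)(\_ -> c) ≡ n * c
 Σ-upTo-const zero c = refl
 Σ-upTo-const (suc n) c = trans (Σ-upTo-sucˡ n (\_ -> c))(cong (c +_)(Σ-upTo-const n c))

 -- Measuring from the first element of P, the other elements are counted by their distances.
 gap : ∀ N {P Q : ℕ -> Set}(P? : ∀ n -> Dec (P n))(Q? : ∀ n -> Dec (Q n)) ->
  (∀ n d -> suc d + n < N -> P n -> P (suc d + n) -> Q (suc d)) ->
  Σ (upTo N)(\n -> [ P? n ]) ≤ 1 + Σ (upTo N)(\d -> [ Q? (suc d) ])
 gap zero P? Q? h = z≤n
 gap (suc N){P}{Q} P? Q? h = ≤-trans (≤-reflexive (Σ-upTo-sucˡ N (\n -> [ P? n ])))(split (P? 0))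
  where
  tail-≤ : Σ (upTo N)(\d -> [ Q? (suc d) ]) ≤ Σ (upTo (suc N))(\d -> [ Q? (suc d) ])
  tail-≤ = ≤-trans (m≤m+n _ _)(≤-reflexive (sym (Σ-upTo-sucʳ N (\d -> [ Q? (suc d) ]))))
  indicator-mono : ∀ {A B : Set}(d : Dec A)(e : Dec B) -> (A -> B) -> [ d ] ≤ [ e ]
  indicator-mono (no _) e f = z≤n
  indicator-mono (yes a)(yes _) f = ≤-refl
  indicator-mono (yes a)(no ¬b) f = contradiction (f a) ¬b
  split : (d : Dec (P 0)) -> [ d ] + Σ (upTo N)(\n -> [ P? (suc n) ]) ≤ 1 + Σ (upTo (suc N))(\d -> [ Q? (suc d) ])
  split (yes p) = s≤s (≤-trans (Σ-mono-≤ (upTo N)(\{n} n∈ -> indicator-mono (P? (suc n))(Q? (suc n))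
   (\q -> h 0 n (s≤s (subst (_< N)(sym (+-identityʳ n))(∈-upTo⁻ n∈))) p (subst P (cong suc (sym (+-identityʳ n))) q)))) tail-≤)
  split (no _) = ≤-trans (gap N (\n -> P? (suc n)) Q? (\n d lt p q ->
   h (suc n) d (subst (_< suc N)(cong suc (sym (+-suc d n)))(s≤s lt)) p (subst P (cong suc (sym (+-suc d n))) q)))(s≤s tail-≤)

 multiples-≤ : ∀ k .{{_ : NonZero k}} N -> k * Σ (upTo N)(\d -> [ k ∣? suc d ]) ≤ N
 multiples-≤ k zero = ≤-reflexive (*-zeroʳ k)
 multiples-≤ k@(suc j)(suc N) with k ∣? suc N in eq
 ... | no ∤ = ≤-trans (≤-reflexive (cong (k *_)(trans (Σ-upTo-sucʳ N (\d -> [ k ∣? suc d ]))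
  (trans (cong (\d -> Σ (upTo N)(\d -> [ k ∣? suc d ]) + [ d ]) eq)(+-identityʳ _)))))
  (≤-trans (multiples-≤ k N)(n≤1+n N))
 ... | yes (divides q e) = ≤-trans (≤-reflexive (cong (k *_)(trans (Σ-upTo-sucʳ N (\d -> [ k ∣? suc d ]))
  (trans (cong (\d -> Σ (upTo N)(\d -> [ k ∣? suc d ]) + [ d ]) eq)(+-comm _ 1)))))
  (≤-trans (*-monoʳ-≤ k count<q)(≤-reflexive (trans (*-comm k q)(sym e))))
  where
  C = Σ (upTo N)(\d -> [ k ∣? suc d ])
  count<q : suc C ≤ q
  count<q = ≮⇒≥ \q<sC -> <-irrefl refl (<-≤-trans (s≤s (≤-trans (*-monoʳ-≤ k (s≤s⁻¹ q<sC))(multiples-≤ k N)))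
   (≤-reflexive (trans e (*-comm q k))))

 multiples-gcd : ∀ a .{{_ : NonZero a}} b N -> a * Σ (upTo N)(\d -> [ a ∣? b * suc d ]) ≤ N * gcd a b
 multiples-gcd a b N = begin
  a * Σ (upTo N)(\d -> [ a ∣? b * suc d ]) ≤⟨ *-monoʳ-≤ a (Σ-mono-≤ (upTo N)(\{d} _ -> step d)) ⟩
  a * Σ (upTo N)(\d -> [ a' ∣? suc d ]) ≡⟨ cong (_* Σ (upTo N)(\d -> [ a' ∣? suc d ]))(sym (m*[n/m]≡n (gcd[m,n]∣m a b))) ⟩
  g * a' * Σ (upTo N)(\d -> [ a' ∣? suc d ]) ≡⟨ *-assoc g a' _ ⟩
  g * (a' * Σ (upTo N)(\d -> [ a' ∣? suc d ])) ≤⟨ *-monoʳ-≤ g (multiples-≤ a' N) ⟩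
  g * N ≡⟨ *-comm g N ⟩
  N * g ∎
  where
  open ≤-Reasoning
  g = gcd a b
  instance
   _ : NonZero g
   _ = ≢-nonZero (gcd[m,n]≢0 a b (inl (≢-nonZero⁻¹ a)))
  a' = a / g
  instance
   _ : NonZero a'
   _ = ≢-nonZero \z -> ≢-nonZero⁻¹ a (trans (sym (m*[n/m]≡n (gcd[m,n]∣m a b)))(trans (cong (g *_) z)(*-zeroʳ g)))
  step : ∀ d -> [ a ∣? b * suc d ] ≤ [ a' ∣? suc d ]
  step d with a ∣? b * suc d
  ... | no _ = z≤n
  ... | yes (divides q e) = ≤-reflexive (sym ([ a' ∣? suc d ]-yes (coprime-divisor (coprime-/gcd a b)(divides q
   (*-cancelˡ-≡ _ _ g (trans (sym (*-assoc g (b / g)(suc d)))(trans (cong (_* suc d)(m*[n/m]≡n (gcd[m,n]∣n a b)))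
   (trans e (trans (cong (q *_)(sym (m*[n/m]≡n (gcd[m,n]∣m a b))))(id14 q g a'))))))))))

 harmonic : ∀ l X -> Σ (upTo (2 ^ l ∸ 1))(\g -> X / suc g) ≤ l * X
 harmonic zero X = z≤n
 harmonic (suc l) X = begin
  Σ (upTo (2 ^ suc l ∸ 1))(\g -> X / suc g)
  ≡⟨ cong (\n -> Σ (upTo n)(\g -> X / suc g)) split ⟩
  Σ (upTo ((2 ^ l ∸ 1) + 2 ^ l))(\g -> X / suc g)
  ≡⟨ Σ-upTo-+ (2 ^ l ∸ 1)(2 ^ l) _ ⟩
  Σ (upTo (2 ^ l ∸ 1))(\g -> X / suc g) + Σ (upTo (2 ^ l))(\i -> X / suc (2 ^ l ∸ 1 + i))
  ≤⟨ +-mono-≤ (harmonic l X)(≤-trans (Σ-upTo-≤ (2 ^ l)(X / 2 ^ l)(\i _ -> /-monoʳ-≤ X (≤-trans (≤-reflexive (sym 1+))(s≤s (m≤m+n _ i)))))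
  (≤-trans (≤-reflexive (*-comm (2 ^ l) _))(m/n*n≤m X (2 ^ l)))) ⟩
  l * X + X
  ≡⟨ +-comm (l * X) X ⟩
  suc l * X ∎
  where
  open ≤-Reasoning
  instance
   _ : NonZero (2 ^ l)
   _ = m^n≢0 2 l
  1+ : suc (2 ^ l ∸ 1) ≡ 2 ^ l
  1+ = m+[n∸m]≡n (m^n>0 2 l)
  split : 2 ^ suc l ∸ 1 ≡ (2 ^ l ∸ 1) + 2 ^ l
  split = cong pred (trans (cong (2 ^ l +_)(+-identityʳ (2 ^ l)))(cong (_+ 2 ^ l)(sym 1+)))

 harmonic' : ∀ l X n -> n < 2 ^ l -> Σ (upTo n)(\g -> X / suc g) ≤ l * X
 harmonic' l X n n<2^l = ≤-trans (prefix n (2 ^ l ∸ 1)(s≤s⁻¹ (subst (suc n ≤_)(sym (m+[n∸m]≡n (m^n>0 2 l))) n<2^l)))(harmonic l X)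
  where
  prefix : ∀ m n -> m ≤ n -> Σ (upTo m)(\g -> X / suc g) ≤ Σ (upTo n)(\g -> X / suc g)
  prefix m n m≤n = ≤-trans (m≤m+n _ _)(≤-reflexive (trans (sym (Σ-upTo-+ m (n ∸ m) _))(cong (\k -> Σ (upTo k)(\g -> X / suc g))(m+[n∸m]≡n m≤n))))

 module _ (A : ℕ) where
  private
   X = A + A
   a : ℕ -> ℕ
   a i = suc (A + i)

  multiples-in-block : ∀ g -> suc g * Σ (upTo A)(\i -> [ suc g ∣? a i ]) ≤ X
  multiples-in-block g = ≤-trans (*-monoʳ-≤ (suc g)(≤-trans (m≤n+m _ _)(≤-reflexive (sym (Σ-upTo-+ A A (\d -> [ suc g ∣? suc d ]))))))
   (multiples-≤ (suc g) X)

  gcd-≤ : ∀ i j -> i < A -> gcd (a i)(a j) ≤ Σ (upTo X)(\g -> suc g * ([ suc g ∣? a i ] * [ suc g ∣? a j ]))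
  gcd-≤ i j i<A = ≤-trans (≤-reflexive (sym at-gcd))(term-≤ (upTo X)(∈-upTo⁺ g<X))
   where
   term : ℕ -> ℕ
   term g = suc g * ([ suc g ∣? a i ] * [ suc g ∣? a j ])
   term-≤ : ∀ xs {x} -> x ∈ xs -> term x ≤ Σ xs term
   term-≤ (y ∷ xs)(here refl) = m≤m+n _ _
   term-≤ (y ∷ xs)(there x∈) = ≤-trans (term-≤ xs x∈)(m≤n+m _ _)
   G = gcd (a i)(a j)
   g = pred G
   G≡ : suc g ≡ G
   G≡ = suc-pred G {{≢-nonZero (gcd[m,n]≢0 (a i)(a j)(inl \()))}}
   g<X : g < X
   g<X = ≤-trans (≤-reflexive G≡)(≤-trans (∣⇒≤ (gcd[m,n]∣m (a i)(a j)))(+-monoʳ-< A i<A))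
   at-gcd : term g ≡ G
   at-gcd = trans (cong (suc g *_)(cong₂ _*_ ([ suc g ∣? a i ]-yes (subst (_∣ a i)(sym G≡)(gcd[m,n]∣m (a i)(a j))))
    ([ suc g ∣? a j ]-yes (subst (_∣ a j)(sym G≡)(gcd[m,n]∣n (a i)(a j))))))(trans (*-identityʳ (suc g)) G≡)

  Σ-gcd : ∀ l -> X < 2 ^ l -> Σ (upTo A)(\i -> Σ (upTo A)(\j -> gcd (a i)(a j))) ≤ X * (l * X)
  Σ-gcd l X<2^l = begin
   Σ (upTo A)(\i -> Σ (upTo A)(\j -> gcd (a i)(a j)))
   ≤⟨ Σ-mono-≤ (upTo A)(\{i} i∈ -> Σ-mono-≤ (upTo A)(\{j} _ -> gcd-≤ i j (∈-upTo⁻ i∈))) ⟩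
   Σ (upTo A)(\i -> Σ (upTo A)(\j -> Σ (upTo X)(\g -> suc g * ([ suc g ∣? a i ] * [ suc g ∣? a j ]))))
   ≡⟨ Σ-cong (upTo A)(\i -> Σ-swap (upTo A)(upTo X) _) ⟩
   Σ (upTo A)(\i -> Σ (upTo X)(\g -> Σ (upTo A)(\j -> suc g * ([ suc g ∣? a i ] * [ suc g ∣? a j ]))))
   ≡⟨ Σ-swap (upTo A)(upTo X) _ ⟩
   Σ (upTo X)(\g -> Σ (upTo A)(\i -> Σ (upTo A)(\j -> suc g * ([ suc g ∣? a i ] * [ suc g ∣? a j ]))))
   ≡⟨ Σ-cong (upTo X)(\g -> trans (Σ-cong (upTo A)(\i -> Σ-*ˡ (upTo A)(suc g)(\j -> [ suc g ∣? a i ] * [ suc g ∣? a j ])))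
   (trans (Σ-*ˡ (upTo A)(suc g)(\i -> Σ (upTo A)(\j -> [ suc g ∣? a i ] * [ suc g ∣? a j ])))
   (cong (suc g *_)(trans (Σ-cong (upTo A)(\i -> Σ-*ˡ (upTo A) [ suc g ∣? a i ] (\j -> [ suc g ∣? a j ])))
   (Σ-*ʳ (upTo A)(C g)(\i -> [ suc g ∣? a i ])))))) ⟩
   Σ (upTo X)(\g -> suc g * (C g * C g))
   ≤⟨ Σ-mono-≤ (upTo X)(\{g} _ -> term g) ⟩
   Σ (upTo X)(\g -> X * (X / suc g))
   ≡⟨ Σ-*ˡ (upTo X) X (\g -> X / suc g) ⟩
   X * Σ (upTo X)(\g -> X / suc g)
   ≤⟨ *-monoʳ-≤ X (harmonic' l X X X<2^l) ⟩
   X * (l * X) ∎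
   where
   open ≤-Reasoning
   C : ℕ -> ℕ
   C g = Σ (upTo A)(\i -> [ suc g ∣? a i ])
   term : ∀ g -> suc g * (C g * C g) ≤ X * (X / suc g)
   term g = ≤-trans (≤-reflexive (sym (*-assoc (suc g)(C g)(C g))))(*-mono-≤ (multiples-in-block g)
    (≤-trans (≤-reflexive (sym (m*n/n≡m (C g)(suc g))))(/-monoˡ-≤ (suc g)(≤-trans (≤-reflexive (*-comm (C g)(suc g)))(multiples-in-block g)))))

module ShiftedSums {p}{F : PrimeField p}{ℝ}{ℂ : NormedRing ℝ}(ψ : Character F ℂ)
 (k : ℕ)(p≡ : p ≡ 3 N.+ k) where
 open Character ψ
 open Characters ψ
 open Singletons
 open Enumeration using (tuples;∈-tuples⁻;length-tuples;tuples-unique)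
 open import Data.Nat.Divisibility using (_∣_;_∣?_)
 private
  module R = RealProperties ℝ
  module K = FieldPolynomials.K F
  module KS = IntegerSolver K.ring
 open NormedProperties ℂ
 open GraeffeBound ℂ using (κ;κ-nonneg)
 open Mult K.semiring using () renaming (×-homo-+ to ×ᴷ-homo-+;×1-homo-* to ×ᴷ-homo-*)
 open Exp K.commutativeSemiring using () renaming (^-distrib-* to ^ᴷ-distrib-*)
 open Exp commutativeSemiring using (^-congˡ;^-homo-*)
 open AbelianGroup K.+-abelianGroup using () renaming (∙-cancelʳ to +ᴷ-cancelʳ)

 embed : ℕ -> K.Carrier
 embed n = n K.· K.1#

 embed-injective : ∀ {m n} -> m N.< p -> n N.< p -> embed m ≡ embed n -> m ≡ n
 embed-injective m<p n<p e = E.trans (E.sym (K.×-residue m<p))(E.trans (E.cong K.residue e)(K.×-residue n<p))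

 product : List ℕ -> K.Carrier -> K.Carrier
 product [] x = K.1#
 product (b ∷ v) x = (x K.+ embed b) K.* product v x

 product-single : ∀ c v x -> count c v ≡ 1 -> product v x ≡ (x K.+ embed c) K.* product (others c v) x
 product-single c (b ∷ v) x e with b N.≟ c
 ... | yes E.refl = E.cong (\u -> (x K.+ embed b) K.* product u x)(E.sym (count-zero b v (N.suc-injective e)))
 ... | no _ = E.trans (E.cong ((x K.+ embed b) K.*_)(product-single c v x e))
  (KS.solve 3 (\a b c -> a KS.:* (b KS.:* c) KS.:= b KS.:* (a KS.:* c)) E.refl _ _ _)

 inverse-power : ∀ {y} -> y ≢ K.0# -> y K.* y K.^ suc k ≡ K.1#
 inverse-power {y} y≢0 = x∙y⁻¹≈ε⇒x≈y _ _ (K.*-cancel (E.trans (KS.solve 2 (\y z -> y KS.:* (y KS.:* z KS.:- KS.:1) KS.:= y KS.:* (y KS.:* z) KS.:- y) E.refl y (y K.^ suc k))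
  (x≈y⇒x∙y⁻¹≈ε (E.trans (E.cong (y K.^_)(E.sym p≡))(K.fermat y)))) y≢0)
  where open AbelianGroup K.+-abelianGroup using (x≈y⇒x∙y⁻¹≈ε; x∙y⁻¹≈ε⇒x≈y)

 conj-χ : ∀ y -> conj (χ y) ≈ χ (y K.^ suc k)
 conj-χ y with y K.≟ K.0#
 ... | yes E.refl = trans (conj-cong χ-0)(trans conj-0 (sym (trans (reflexive (E.cong χ (K.zeroˡ _))) χ-0)))
 ... | no y≢0 = begin
  conj (χ y) ≈⟨ *-identityʳ _ ⟨
  conj (χ y) * 1# ≈⟨ *-congˡ (trans (sym χ-1)(trans (reflexive (E.cong χ (E.sym (inverse-power y≢0))))(χ-* y _))) ⟩
  conj (χ y) * (χ y * χ (y K.^ suc k)) ≈⟨ solve 3 (\a b c -> a :* (b :* c) := b :* a :* c) refl _ _ _ ⟩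
  χ y * conj (χ y) * χ (y K.^ suc k) ≈⟨ *-congʳ (trans (*-conj (χ y))(trans (ι-cong (R.trans (R.*-cong (∣χ∣≈1 y≢0)(∣χ∣≈1 y≢0))(R.*-identityˡ _))) ι-1)) ⟩
  1# * χ (y K.^ suc k) ≈⟨ *-identityˡ _ ⟩
  χ (y K.^ suc k) ∎
  where open Setoid-Reasoning setoid

 term : List ℕ -> List ℕ -> K.Carrier -> Carrier
 term v w x = χ (product v x) * conj (χ (product w x))

 completeSum : List ℕ -> List ℕ -> Carrier
 completeSum v w = Σ K.elems (term v w)

 ∣term∣≤1 : ∀ v w x -> ∣ term v w x ∣ R.≤ R.1#
 ∣term∣≤1 v w x = R.≤-respˡ (∣∣-* _ _)(R.≤-respʳ (R.*-identityˡ _)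
  (R.*-mono (∣∣-nonneg _) R.0≤1 (∣χ∣≤1 _)(R.≤-respˡ (∣conj∣ _)(∣χ∣≤1 _))))

 completeSum-trivial : ∀ v w -> ∣ completeSum v w ∣ R.≤ R.# p
 completeSum-trivial v w = R.≤-trans (∣Σ∣ K.elems _)(R.≤-trans (R.Σ-bound K.elems (\_ -> ∣term∣≤1 v w _))
  (R.≤-reflexive (R.trans (R.*-identityʳ _)(R.≡-cong R.# K.length-elems))))

 completeSum-swap : ∀ v w -> ∣ completeSum v w ∣ R.≈ ∣ completeSum w v ∣
 completeSum-swap v w = R.trans (R.sym (∣conj∣ _))(∣∣-cong (trans (conj-Σ K.elems _)(Σ-cong K.elems (\x ->
  trans (conj-* _ _)(trans (*-congˡ (conj-conj _))(*-comm _ _))))))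

 weilConstant : ℕ -> R.Carrier
 weilConstant M = κ M R.* R.# 2 R.* R.root 2 (R.# p)

 weilConstant-nonneg : ∀ M -> R.0# R.≤ weilConstant M
 weilConstant-nonneg M = R.*-nonneg (R.*-nonneg (κ-nonneg M)(R.0≤# 2))(R.root-nonneg 1 _)

 module _ (c : ℕ)(c<p : c N.< p) where
  shiftedPoints : ℕ -> List ℕ -> List (K.Carrier × ℕ)
  shiftedPoints e = map (\b -> embed b K.+ (K.- embed c) , e)

  shifted-nonzero : ∀ e v -> All (N._< p) v -> All (_≢ c) v -> All (\x -> fst x ≢ K.0#)(shiftedPoints e v)
  shifted-nonzero e [] _ _ = []
  shifted-nonzero e (b ∷ v)(l ∷ ls)(h ∷ hs) =
   (\z -> h (embed-injective l c<p (x∙y⁻¹≈ε⇒x≈y _ _ z))) ∷ shifted-nonzero e v ls hs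
   where open AbelianGroup K.+-abelianGroup using (x∙y⁻¹≈ε⇒x≈y)

  module _ (v w : List ℕ) where
   private
    points = shiftedPoints 1 (others c v) ++ shiftedPoints (suc k) w
    module CW = CharacterWeights ψ points
    mon = FieldPolynomials.mon F
    value = Values.value F

   value-mon : ∀ d a -> value (mon (d ∷ [])) a ≡ a K.+ d
   value-mon d a = KS.solve 2 (\d a -> d KS.:+ a KS.:* (KS.:1 KS.:+ a KS.:* KS.:0) KS.:= a KS.:+ d) E.refl d a

   valueAt-++ : ∀ xs ys f -> CW.valueAt (xs ++ ys) f ≡ CW.valueAt xs f K.* CW.valueAt ys f
   valueAt-++ [] ys f = E.sym (K.*-identityˡ _)
   valueAt-++ ((a , e) ∷ xs) ys f = E.trans (E.cong (value f a K.^ e K.*_)(valueAt-++ xs ys f))(E.sym (K.*-assoc _ _ _))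

   valueAt-shifted : ∀ e u x -> CW.valueAt (shiftedPoints e u)(mon (x K.+ embed c ∷ [])) ≡ product u x K.^ e
   valueAt-shifted e [] x = E.sym (CW.one^ e)
   valueAt-shifted e (b ∷ u) x = E.trans (cong₂ (\y z -> y K.^ e K.* z)
    (E.trans (value-mon (x K.+ embed c)(embed b K.+ (K.- embed c)))
    (KS.solve 3 (\x b c -> b KS.:- c KS.:+ (x KS.:+ c) KS.:= x KS.:+ b) E.refl x (embed b)(embed c)))
    (valueAt-shifted e u x))
    (E.sym (^ᴷ-distrib-* (x K.+ embed b)(product u x) e))

   term≈weight : count c v ≡ 1 -> ∀ x -> term v w x ≈ χ (CW.ρ (mon (x K.+ embed c ∷ [])))
   term≈weight e x = trans (*-congˡ (conj-χ (product w x)))(trans (sym (χ-* _ _))(reflexive (E.cong χ (E.trans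
    (E.cong (K._* product w x K.^ suc k)(product-single c v x e))
    (E.trans (K.*-assoc _ _ _)(cong₂ K._*_ (E.sym (E.trans (value-mon (x K.+ embed c) K.0#)(K.+-identityˡ _)))
    (E.sym (E.trans (valueAt-++ (shiftedPoints 1 (others c v)) _ _)
    (cong₂ K._*_ (E.trans (valueAt-shifted 1 (others c v) x)(K.*-identityʳ _))(valueAt-shifted (suc k) w x))))))))))

   coeff-sum : CW.coeff 1 ≈ Σ K.elems (\d -> χ (CW.ρ (mon (d ∷ []))))
   coeff-sum = trans (Σ-pairs _∷_ K.elems ([] ∷ []) _)(Σ-cong K.elems (\d -> +-identityʳ _))

   weil-bound : ∀ M -> count c v ≡ 1 -> count c w ≡ 0 -> All (N._< p) v -> All (N._< p) w ->
    length v N.+ length w ≡ suc (suc M) -> ∣ completeSum v w ∣ R.≤ weilConstant (suc M)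
   weil-bound M cv cw v<p w<p len = R.≤-respˡ (∣∣-cong (trans (Σ-cong K.elems (term≈weight cv))
    (trans (Σ-cong K.elems (\x -> reflexive (E.cong (\d -> χ (CW.ρ (mon (d ∷ []))))
    (KS.solve 2 (\x c -> x KS.:+ c KS.:= c KS.:+ x KS.:* KS.:1) E.refl x (embed c)))))
    (trans (Σ-affine (embed c) K.1# K.1≢0 (\d -> χ (CW.ρ (mon (d ∷ [])))))(sym coeff-sum)))))
    (subst (\n -> ∣ CW.coeff 1 ∣ R.≤ weilConstant n) length≡
    (Weil.weil-coeff ψ points nonzero (subst (0 N.<_)(E.sym length≡)(s≤s z≤n)) k p≡))
    where
    length≡ : length points ≡ suc M
    length≡ = E.trans (length-++ (shiftedPoints 1 (others c v)))(E.trans (cong₂ N._+_ (length-map _ (others c v))(length-map _ w))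
     (N.suc-injective (E.trans (E.cong (N._+ length w)(E.trans (N.+-comm 1 _)(E.trans (E.cong (length (others c v) N.+_)(E.sym cv))(length-others c v)))) len)))
    nonzero : All (\x -> fst x ≢ K.0#) points
    nonzero = All-++ (shifted-nonzero 1 (others c v)(All.tabulate (\b∈ -> All.lookup v<p (∈-others⁻ c v b∈)))(others-≢ c v))
     (shifted-nonzero (suc k) w w<p (subst (All (_≢ c))(count-zero c w cw)(others-≢ c w)))
     where
     All-++ : ∀ {Q : K.Carrier × ℕ -> Set}{xs ys} -> All Q xs -> All Q ys -> All Q (xs ++ ys)
     All-++ [] qs = qs
     All-++ (q ∷ ps) qs = q ∷ All-++ ps qs

 shortSum : ℕ -> K.Carrier -> Carrier
 shortSum B x = Σ (upTo B)(\b -> χ (x K.+ embed b))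

 shortSum-^ : ∀ B x n -> shortSum B x ^ n ≈ Σ (tuples (upTo B) n)(\v -> χ (product v x))
 shortSum-^ B x zero = sym (trans (+-identityʳ _) χ-1)
 shortSum-^ B x (suc n) = sym (trans (Σ-pairs _∷_ (upTo B)(tuples (upTo B) n) _)
  (trans (Σ-cong (upTo B)(\b -> trans (Σ-cong (tuples (upTo B) n)(\v -> χ-* _ _))
  (trans (Σ-*ˡ (tuples (upTo B) n) _ _)(*-congˡ (sym (shortSum-^ B x n))))))(Σ-*ʳ (upTo B) _ _)))

 even-power : ∀ z r -> ι (∣ z ∣ R.^ (2 N.* r)) ≈ z ^ r * conj (z ^ r)
 even-power z r = trans (ι-cong (R.trans (R.≡-cong (∣ z ∣ R.^_)(E.cong (r N.+_)(N.+-identityʳ r)))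
  (R.trans (R.^-homo-* ∣ z ∣ r r)(R.sym (R.*-cong (∣^∣ z r)(∣^∣ z r))))))(sym (*-conj (z ^ r)))

 module _ (r' B : ℕ)(0<B : 0 N.< B)(B≤p : B N.≤ p) where
  private
   r = suc r'
   V = tuples (upTo B) r
   D = decodings B r (2 N.* r)

  moment : R.Carrier
  moment = R.Σ K.elems (\x -> ∣ shortSum B x ∣ R.^ (2 N.* r))

  moment-nonneg : R.0# R.≤ moment
  moment-nonneg = R.Σ-nonneg K.elems (\_ -> R.^-nonneg (2 N.* r)(∣∣-nonneg _))

  moment≈ : ι moment ≈ Σ V (\v -> Σ V (\w -> completeSum v w))
  moment≈ = trans (ι-Σ K.elems _)(trans (Σ-cong K.elems (\x -> trans (even-power (shortSum B x) r)
   (trans (*-cong (shortSum-^ B x r)(trans (conj-cong (shortSum-^ B x r))(conj-Σ V _)))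
   (trans (sym (Σ-*ʳ V _ _))(Σ-cong V (\v -> sym (Σ-*ˡ V _ _)))))))
   (trans (Σ-swap K.elems V _)(Σ-cong V (\v -> Σ-swap K.elems V _))))

  decoding? : ∀ z -> Dec (z ∈ D)
  decoding? z = any? (≡-dec N._≟_ z) D

  entries : ∀ {v} -> v ∈ V -> length v ≡ r × All (_∈ upTo B) v
  entries = ∈-tuples⁻ (upTo B) r

  below-p : ∀ {v} -> v ∈ V -> All (N._< p) v
  below-p v∈ = All.map (\b∈ -> N.<-≤-trans (∈-upTo⁻ b∈) B≤p)(snd (entries v∈))

  pair-bound : ∀ {v w} -> v ∈ V -> w ∈ V ->
   ∣ completeSum v w ∣ R.≤ R.[ decoding? (v ++ w) ] R.* R.# p R.+ weilConstant (suc (2 N.* r'))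
  pair-bound {v}{w} v∈ w∈ with singleton-or-decoding B r (v ++ w) 0<B len (All-++ (snd (entries v∈))(snd (entries w∈)))
   where
   len : length (v ++ w) ≡ 2 N.* r
   len = E.trans (length-++ v)(cong₂ N._+_ (fst (entries v∈))(E.trans (fst (entries w∈))(E.sym (N.+-identityʳ r))))
   All-++ : ∀ {Q : ℕ -> Set}{xs ys} -> All Q xs -> All Q ys -> All Q (xs ++ ys)
   All-++ [] qs = qs
   All-++ (q ∷ ps) qs = q ∷ All-++ ps qs
  ... | inr decoded = R.≤-trans (completeSum-trivial v w)(R.≤-respˡ (R.sym (R.trans (R.*-congʳ
   (R.[ decoding? (v ++ w) ]-yes decoded))(R.*-identityˡ _)))(R.x≤x+y (weilConstant-nonneg (suc (2 N.* r')))))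
  ... | inl (c , e) = R.≤-trans single (R.x≤y+x (R.*-nonneg (indicator-nonneg (decoding? (v ++ w)))(R.0≤# p)))
   where
   indicator-nonneg : ∀ {Q : Set}(d : Dec Q) -> R.0# R.≤ R.[ d ]
   indicator-nonneg (yes _) = R.0≤1
   indicator-nonneg (no _) = R.≤-refl
   lengths : ∀ {v w} -> v ∈ V -> w ∈ V -> length v N.+ length w ≡ suc (suc (2 N.* r'))
   lengths v∈ w∈ = E.trans (cong₂ N._+_ (fst (entries v∈))(fst (entries w∈)))
    (E.cong suc (E.trans (N.+-suc r' r')(E.cong (\n -> suc (r' N.+ n))(E.sym (N.+-identityʳ r')))))
   below : ∀ v -> All (N._< p) v -> 0 N.< count c v -> c N.< p
   below (b ∷ v)(l ∷ ls) h with b N.≟ c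
   ... | yes E.refl = l
   ... | no _ = below v ls h
   counts : ∀ a b -> a N.+ b ≡ 1 -> (a ≡ 1 × b ≡ 0) ⊎ (a ≡ 0 × b ≡ 1)
   counts zero b e = inr (E.refl , e)
   counts (suc a) b e = inl (E.cong suc (N.m+n≡0⇒m≡0 a (N.suc-injective e)) , N.m+n≡0⇒n≡0 a (N.suc-injective e))
   single : ∣ completeSum v w ∣ R.≤ weilConstant (suc (2 N.* r'))
   single with counts (count c v)(count c w)(E.trans (E.sym (count-++ c v w)) e)
   ... | inl (cv , cw) = weil-bound c (below v (below-p v∈)(subst (0 N.<_)(E.sym cv)(s≤s z≤n))) v w (2 N.* r')
    cv cw (below-p v∈)(below-p w∈)(lengths v∈ w∈)
   ... | inr (cv , cw) = R.≤-respˡ (completeSum-swap v w)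
    (weil-bound c (below w (below-p w∈)(subst (0 N.<_)(E.sym cw)(s≤s z≤n))) w v (2 N.* r')
    cw cv (below-p w∈)(below-p v∈)(lengths w∈ v∈))

  length-V : length V ≡ B N.^ r
  length-V = E.trans (length-tuples (upTo B) r)(E.cong (N._^ r)(length-upTo B))

  concatenations-unique : Unique (cartesianProductWith _++_ V V)
  concatenations-unique = Unique-product (tuples-unique (Unique.upTo⁺ B) r)(\v∈ -> fst (entries v∈))
   where
   Unique-product : ∀ {vs} -> Unique vs -> (∀ {v} -> v ∈ vs -> length v ≡ r) -> Unique (cartesianProductWith _++_ vs V)
   Unique-product {[]} _ _ = []
   Unique-product {v ∷ vs}(v∉ ∷ u) l = Unique.++⁺ (Unique.map⁺ (++-cancelˡ v _ _)(tuples-unique (Unique.upTo⁺ B) r))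
    (Unique-product u (\v∈ -> l (there v∈))) disjoint
    where
    prefix : ∀ {a b c d : List ℕ} -> length a ≡ length b -> a ++ c ≡ b ++ d -> a ≡ b
    prefix {[]}{[]} _ _ = E.refl
    prefix {x ∷ a}{y ∷ b} e f = cong₂ _∷_ (fst (∷-injective f))(prefix (N.suc-injective e)(snd (∷-injective f)))
     where open import Data.List.Properties using (∷-injective)
    disjoint : ∀ {z} -> ¬ (z ∈ map (v ++_) V × z ∈ cartesianProductWith _++_ vs V)
    disjoint (a , b) with ∈-map⁻ (v ++_) a | ∈-cartesianProductWith⁻ _++_ vs V b
    ... | w , _ , E.refl | v' , w' , v'∈ , _ , eq = All.lookup v∉ v'∈
     (prefix (E.trans (l (here E.refl))(E.sym (l (there v'∈)))) eq)

  decoded-count : R.Σ V (\v -> R.Σ V (\w -> R.[ decoding? (v ++ w) ])) R.≤ R.# (B N.^ r N.* r N.^ (2 N.* r))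
  decoded-count = R.≤-respˡ (R.trans (R.sym (R.Σ-pairs _++_ V V (\z -> R.[ decoding? z ])))
   (R.trans (R.Σ-cong (cartesianProductWith _++_ V V)(\z -> R.sym (R.*-identityʳ _)))
   (R.trans (R.sym (R.Σ-filter decoding? (cartesianProductWith _++_ V V)(\_ -> R.1#)))(R.Σ-const (filter decoding? (cartesianProductWith _++_ V V)) R.1#))))
   (R.#-mono (≤-tr (unique-⊆-length (Unique.filter⁺ decoding? concatenations-unique)
   (\z∈ -> snd (∈-filter⁻ decoding? {xs = cartesianProductWith _++_ V V} z∈)))
   (≡⇒≤ (length-decodings B r (2 N.* r)))))

  moment-bound : moment R.≤ R.# (B N.^ r N.* r N.^ (2 N.* r)) R.* R.# p
   R.+ R.# (B N.^ (2 N.* r)) R.* weilConstant (suc (2 N.* r'))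
  moment-bound = begin
   moment
   ≈⟨ R.trans (∣∣-cong (sym moment≈))(∣ι∣ moment-nonneg) ⟨
   ∣ Σ V (\v -> Σ V (\w -> completeSum v w)) ∣
   ≤⟨ R.≤-trans (∣Σ∣ V _)(R.Σ-mono V (\_ -> ∣Σ∣ V _)) ⟩
   R.Σ V (\v -> R.Σ V (\w -> ∣ completeSum v w ∣))
   ≤⟨ R.Σ-mono V (\v∈ -> R.Σ-mono V (\w∈ -> pair-bound v∈ w∈)) ⟩
   R.Σ V (\v -> R.Σ V (\w -> R.[ decoding? (v ++ w) ] R.* R.# p R.+ W))
   ≈⟨ R.trans (R.Σ-cong V (\v -> R.trans (R.Σ-+ V _ _)(R.+-congʳ (R.Σ-*ʳ V _ _))))
   (R.trans (R.Σ-+ V _ _)(R.+-congʳ (R.Σ-*ʳ V _ _))) ⟩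
   R.Σ V (\v -> R.Σ V (\w -> R.[ decoding? (v ++ w) ])) R.* R.# p R.+ R.Σ V (\v -> R.Σ V (\w -> W))
   ≤⟨ R.+-mono-≤ (R.*-monoʳ (R.0≤# p) decoded-count)(R.≤-reflexive constant) ⟩
   _ ∎
   where
   open R.≤-Reasoning
   W = weilConstant (suc (2 N.* r'))
   constant : R.Σ V (\v -> R.Σ V (\w -> W)) R.≈ R.# (B N.^ (2 N.* r)) R.* W
   constant = R.trans (R.Σ-cong V (\_ -> R.trans (R.Σ-const V W)(R.·≈* (length V) W)))(R.trans (R.Σ-const V (R.# (length V) R.* W))(R.trans (R.·≈* (length V)(R.# (length V) R.* W))
    (R.trans (R.sym (R.*-assoc _ _ W))(R.*-congʳ (R.trans (R.sym (R.#-* (length V)(length V)))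
    (R.≡-cong R.# (E.trans (cong₂ N._*_ length-V length-V)(E.trans (E.sym (N.^-distribˡ-+-* B r r))
    (E.cong (\n -> B N.^ (r N.+ n))(E.sym (N.+-identityʳ r)))))))))))

 invert : K.Carrier -> K.Carrier
 invert y = y K.^ suc k

 invert-nonzero : ∀ {y} -> y ≢ K.0# -> invert y ≢ K.0#
 invert-nonzero y≢0 e = K.1≢0 (E.trans (E.sym (inverse-power y≢0))(E.trans (E.cong (_ K.*_) e)(K.zeroʳ _)))

 invert-involutive : ∀ y -> invert (invert y) ≡ y
 invert-involutive y with y K.≟ K.0#
 ... | yes E.refl = E.trans (E.cong invert (K.zeroˡ _))(K.zeroˡ _)
 ... | no y≢0 = begin
  z' ≡⟨ K.*-identityˡ z' ⟨
  K.1# K.* z' ≡⟨ E.cong (K._* z')(inverse-power y≢0) ⟨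
  y K.* z K.* z' ≡⟨ K.*-assoc y z z' ⟩
  y K.* (z K.* z') ≡⟨ E.cong (y K.*_)(inverse-power (invert-nonzero y≢0)) ⟩
  y K.* K.1# ≡⟨ K.*-identityʳ y ⟩
  y ∎
  where
  open E.≡-Reasoning
  z = invert y
  z' = invert z

 -- For y ≠ 0 the correlation χ(y + d) χ̄(y) is χ(1 + d / y), so only the value χ(1) is missing from a complete sum.
 correlation : ∀ {d} -> d ≢ K.0# -> Σ K.elems (\y -> χ ((y K.+ d) K.* invert y)) ≈ - 1#
 correlation {d} d≢0 = begin
  Σ K.elems (\y -> χ ((y K.+ d) K.* invert y))
  ≈⟨ Σ-cong K.elems (\y -> term≈ y (y K.≟ K.0#)) ⟩
  Σ K.elems (\y -> χ (K.1# K.+ invert y K.* d) + - 1# * [ y K.≟ K.0# ])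
  ≈⟨ Σ-+ K.elems _ _ ⟩
  Σ K.elems (\y -> χ (K.1# K.+ invert y K.* d)) + Σ K.elems (\y -> - 1# * [ y K.≟ K.0# ])
  ≈⟨ +-cong (sym (Σ-bijection K.elems-unique K.elems-unique invert invert (\_ -> K.∈-elems _)(\_ -> K.∈-elems _)
  (\_ -> invert-involutive _)(\_ -> invert-involutive _)(\z -> χ (K.1# K.+ z K.* d))))
  (trans (Σ-*ˡ K.elems (- 1#) _)(*-congˡ (Σ-single K.elems-unique (K.∈-elems K.0#) _ (\{x} _ -> [ x K.≟ K.0# ]-no)))) ⟩
  Σ K.elems (\z -> χ (K.1# K.+ z K.* d)) + - 1# * [ K.0# K.≟ K.0# ]
  ≈⟨ +-cong (Σχ-affine K.1# d d≢0)(*-congˡ ([ K.0# K.≟ K.0# ]-yes E.refl)) ⟩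
  0# + - 1# * 1#
  ≈⟨ trans (+-identityˡ _)(*-identityʳ _) ⟩
  - 1# ∎
  where
  open Setoid-Reasoning setoid
  term≈ : ∀ y (z : Dec (y ≡ K.0#)) -> χ ((y K.+ d) K.* invert y) ≈ χ (K.1# K.+ invert y K.* d) + - 1# * [ z ]
  term≈ y (yes E.refl) = trans (trans (reflexive (E.cong χ (E.trans (E.cong ((K.0# K.+ d) K.*_)(K.zeroˡ _))(K.zeroʳ _)))) χ-0)
   (trans (solve 0 (:0 := :1 :+ :- :1 :* :1) refl)
   (+-congʳ (sym (trans (reflexive (E.cong χ (E.trans (E.cong (\z -> K.1# K.+ z K.* d)(K.zeroˡ (K.0# K.^ k)))
   (E.trans (E.cong (K.1# K.+_)(K.zeroˡ d))(K.+-identityʳ _))))) χ-1))))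
  term≈ y (no y≢0) = trans (reflexive (E.cong χ (E.trans (K.distribʳ (invert y) y d)(cong₂ K._+_ (inverse-power y≢0)(K.*-comm d _)))))
   (sym (trans (+-congˡ (zeroʳ _))(+-identityʳ _)))

 completeSum-pair : ∀ b c -> b N.< p -> c N.< p -> b ≢ c -> completeSum (b ∷ [])(c ∷ []) ≈ - 1#
 completeSum-pair b c b<p c<p b≢c = trans (Σ-cong K.elems term≈)
  (trans (Σ-affine (embed c) K.1# K.1≢0 (\y -> χ ((y K.+ d) K.* invert y)))
  (correlation (\z -> b≢c (embed-injective b<p c<p (x∙y⁻¹≈ε⇒x≈y _ _ z)))))
  where
  open AbelianGroup K.+-abelianGroup using (x∙y⁻¹≈ε⇒x≈y)
  d = embed b K.+ (K.- embed c)
  term≈ : ∀ x -> term (b ∷ [])(c ∷ []) x ≈ χ ((embed c K.+ x K.* K.1# K.+ d) K.* invert (embed c K.+ x K.* K.1#))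
  term≈ x = trans (*-congˡ (conj-χ _))(trans (sym (χ-* _ _))(reflexive (E.cong χ (cong₂ (\u v -> u K.* invert v)
   (KS.solve 3 (\x b c -> (x KS.:+ b) KS.:* KS.:1 KS.:= c KS.:+ x KS.:* KS.:1 KS.:+ (b KS.:- c)) E.refl x (embed b)(embed c))
   (KS.solve 2 (\x c -> (x KS.:+ c) KS.:* KS.:1 KS.:= c KS.:+ x KS.:* KS.:1) E.refl x (embed c))))))

 second-moment : ∀ B (0<B : 0 N.< B)(B≤p : B N.≤ p) -> moment 0 B 0<B B≤p R.≤ R.# (2 N.* (B N.* p))
 second-moment B 0<B B≤p = begin
  moment 0 B 0<B B≤p
  ≈⟨ R.trans (∣∣-cong (sym (moment≈ 0 B 0<B B≤p)))(∣ι∣ (moment-nonneg 0 B 0<B B≤p)) ⟨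
  ∣ Σ V (\v -> Σ V (\w -> completeSum v w)) ∣
  ≤⟨ R.≤-trans (∣Σ∣ V _)(R.Σ-mono V (\_ -> ∣Σ∣ V _)) ⟩
  R.Σ V (\v -> R.Σ V (\w -> ∣ completeSum v w ∣))
  ≈⟨ R.trans (singletons _)(R.Σ-cong (upTo B)(\b -> singletons _)) ⟩
  R.Σ (upTo B)(\b -> R.Σ (upTo B)(\c -> ∣ completeSum (b ∷ [])(c ∷ []) ∣))
  ≤⟨ R.Σ-mono (upTo B)(\b∈ -> R.Σ-mono (upTo B)(\c∈ -> pair b∈ c∈ (_ N.≟ _))) ⟩
  R.Σ (upTo B)(\b -> R.Σ (upTo B)(\c -> R.[ c N.≟ b ] R.* R.# p R.+ R.1#))
  ≈⟨ R.Σ-cong (upTo B)(\b -> R.trans (R.Σ-+ (upTo B) _ _)(R.+-cong (R.Σ-*ʳ (upTo B) _ _)(R.Σ-const (upTo B) R.1#))) ⟩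
  R.Σ (upTo B)(\b -> R.Σ (upTo B)(\c -> R.[ c N.≟ b ]) R.* R.# p R.+ R.# (length (upTo B)))
  ≈⟨ R.Σ-cong∈ (upTo B)(\{b} b∈ -> R.+-cong (R.trans (R.*-congʳ (R.trans (R.Σ-single (Unique.upTo⁺ B) b∈ _ (\{x} _ -> R.[ x N.≟ b ]-no))
  (R.[ b N.≟ b ]-yes E.refl)))(R.*-identityˡ _))(R.≡-cong R.# (length-upTo B))) ⟩
  R.Σ (upTo B)(\_ -> R.# p R.+ R.# B)
  ≤⟨ R.Σ-bound (upTo B)(\_ -> R.+-mono-≤ R.≤-refl (R.#-mono B≤p)) ⟩
  R.# (length (upTo B)) R.* (R.# p R.+ R.# p)
  ≈⟨ R.trans (R.*-cong (R.≡-cong R.# (length-upTo B))(R.sym (R.#-+ p p)))(R.sym (R.#-* B (p N.+ p))) ⟩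
  R.# (B N.* (p N.+ p))
  ≈⟨ R.≡-cong R.# (id15 B p) ⟩
  R.# (2 N.* (B N.* p)) ∎
  where
  open R.≤-Reasoning
  V = tuples (upTo B) 1
  singletons : ∀ f -> R.Σ V f R.≈ R.Σ (upTo B)(\b -> f (b ∷ []))
  singletons f = R.trans (R.Σ-pairs _∷_ (upTo B)([] ∷ []) f)(R.Σ-cong (upTo B)(\_ -> R.+-identityʳ _))
  pair : ∀ {b c} -> b ∈ upTo B -> c ∈ upTo B -> (d : Dec (c ≡ b)) -> ∣ completeSum (b ∷ [])(c ∷ []) ∣ R.≤ R.[ d ] R.* R.# p R.+ R.1#
  pair {b}{c} b∈ c∈ (yes _) = R.≤-trans (completeSum-trivial (b ∷ [])(c ∷ []))(R.≤-respˡ (R.sym (R.*-identityˡ _))(R.x≤x+y R.0≤1))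
  pair {b}{c} b∈ c∈ (no c≢b) = R.≤-reflexive (R.trans (∣∣-cong (completeSum-pair b c (N.<-≤-trans (∈-upTo⁻ b∈) B≤p)(N.<-≤-trans (∈-upTo⁻ c∈) B≤p)(\e -> c≢b (E.sym e))))
   (R.trans (∣-∣ 1#)(R.trans ∣1∣ (R.sym (R.trans (R.+-congʳ (R.zeroˡ _))(R.+-identityˡ _))))))

 embed-+ : ∀ m n -> embed (m N.+ n) ≡ embed m K.+ embed n
 embed-+ = ×ᴷ-homo-+ K.1#

 embed-* : ∀ m n -> embed (m N.* n) ≡ embed m K.* embed n
 embed-* = ×ᴷ-homo-*

 interval : ℕ -> ℕ -> Carrier
 interval M N = Σ (upTo N)(\n -> χ (embed (M N.+ n)))

 ∣interval∣≤ : ∀ M N -> ∣ interval M N ∣ R.≤ R.# N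
 ∣interval∣≤ M N = R.≤-trans (∣Σ∣ (upTo N) _)(R.≤-trans (R.Σ-bound (upTo N)(\_ -> ∣χ∣≤1 _))
  (R.≤-reflexive (R.trans (R.*-identityʳ _)(R.≡-cong R.# (length-upTo N)))))

 ∣χ*∣≤ : ∀ x z -> ∣ χ x * z ∣ R.≤ ∣ z ∣
 ∣χ*∣≤ x z = R.≤-respˡ (∣∣-* (χ x) z)(R.≤-respʳ (R.*-identityˡ ∣ z ∣)(R.*-monoʳ (∣∣-nonneg z)(∣χ∣≤1 x)))

 interval-+ : ∀ M m n -> interval M (m N.+ n) ≈ interval M m + interval (M N.+ m) n
 interval-+ M m n = trans (Σ-upTo-+ m n _)(+-congˡ (Σ-cong (upTo n)(\i -> reflexive (E.cong (\j -> χ (embed j))(E.sym (N.+-assoc M m i))))))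

 shift-difference : ∀ M N h -> interval M N ≈ interval (M N.+ h) N + (interval M h - interval (M N.+ N) h)
 shift-difference M N h = trans (solve 2 (\x y -> x := x :+ y :- y) refl (interval M N)(interval (M N.+ N) h))
  (trans (+-congʳ (trans (sym (interval-+ M N h))(trans (reflexive (E.cong (interval M)(N.+-comm N h)))(interval-+ M h N))))
  (solve 3 (\x y z -> x :+ y :- z := y :+ (x :- z)) refl (interval M h)(interval (M N.+ h) N)(interval (M N.+ N) h)))

 module _ (A N M : ℕ) where
  scale : ℕ -> ℕ
  scale i = suc (A N.+ i)

  pairs : List (ℕ × ℕ)
  pairs = cartesianProductWith _,_ (upTo N)(upTo A)

  length-pairs : length pairs ≡ N N.* A
  length-pairs = E.trans (Enumeration.length-pairs _,_ (upTo N)(upTo A))(cong₂ N._*_ (length-upTo N)(length-upTo A))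

  quotient : ℕ × ℕ -> K.Carrier
  quotient (n , i) = embed (M N.+ n) K.* invert (embed (scale i))

  average : ℕ -> R.Carrier
  average B = R.Σ pairs (\x -> ∣ shortSum B (quotient x) ∣)

  scale-≤ : ∀ {i} -> i ∈ upTo A -> scale i N.≤ A N.+ A
  scale-≤ i∈ = N.+-monoʳ-< A (∈-upTo⁻ i∈)

  module _ (2A<p : A N.+ A N.< p) where
   scale-nonzero : ∀ {i} -> i ∈ upTo A -> embed (scale i) ≢ K.0#
   scale-nonzero i∈ e = contradiction (embed-injective (N.≤-<-trans (scale-≤ i∈) 2A<p)(N.≤-<-trans z≤n 2A<p) e) \()

   scale-quotient : ∀ {n i} -> i ∈ upTo A -> embed (scale i) K.* quotient (n , i) ≡ embed (M N.+ n)
   scale-quotient {n}{i} i∈ = E.trans (KS.solve 3 (\a b c -> a KS.:* (b KS.:* c) KS.:= b KS.:* (a KS.:* c)) E.refl (embed (scale i))(embed (M N.+ n)) _)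
    (E.trans (E.cong (embed (M N.+ n) K.*_)(inverse-power (scale-nonzero i∈)))(K.*-identityʳ _))

   shifted-≤ : ∀ B -> ∣ Σ (upTo A)(\i -> Σ (upTo B)(\b -> interval (M N.+ scale i N.* b) N)) ∣ R.≤ average B
   shifted-≤ B = begin
    ∣ Σ (upTo A)(\i -> Σ (upTo B)(\b -> interval (M N.+ scale i N.* b) N)) ∣
    ≈⟨ ∣∣-cong (trans (Σ-cong∈ (upTo A)(\i∈ -> trans (Σ-swap (upTo B)(upTo N) _)(Σ-cong (upTo N)(\n -> trans (Σ-cong (upTo B)(\b -> factor n b i∈))(Σ-*ˡ (upTo B) _ _)))))
    (trans (Σ-swap (upTo A)(upTo N) _)(sym (Σ-pairs _,_ (upTo N)(upTo A) summand)))) ⟩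
    ∣ Σ pairs summand ∣
    ≤⟨ R.≤-trans (∣Σ∣ pairs summand)(R.Σ-mono pairs (\_ -> ∣χ*∣≤ _ _)) ⟩
    average B ∎
    where
    open R.≤-Reasoning
    summand : ℕ × ℕ -> Carrier
    summand x = χ (embed (scale (snd x))) * shortSum B (quotient x)
    factor : ∀ n b {i} -> i ∈ upTo A -> χ (embed (M N.+ scale i N.* b N.+ n)) ≈ χ (embed (scale i)) * χ (quotient (n , i) K.+ embed b)
    factor n b {i} i∈ = trans (reflexive (E.cong χ (E.trans (E.cong embed (id16 M (scale i N.* b) n))
     (E.trans (embed-+ (M N.+ n)(scale i N.* b))(E.trans (cong₂ K._+_ (E.sym (scale-quotient i∈))(embed-* (scale i) b))
     (E.sym (K.distribˡ (embed (scale i))(quotient (n , i))(embed b))))))))(χ-* _ _)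

   shift-bound : ∀ B E -> R.# 2 R.* average B R.≤ R.# (A N.* B) R.* E ->
    (∀ M' h -> h N.≤ 2 N.* (A N.* B) -> R.# 4 R.* ∣ interval M' h ∣ R.≤ E) ->
    R.# (A N.* B) R.* ∣ interval M N ∣ R.≤ R.# (A N.* B) R.* E
   shift-bound B E avg short = R.*-cancelˡ-≤ (R.#suc≰0 1)(begin
    2' R.* (R.# (A N.* B) R.* ∣ interval M N ∣)
    ≈⟨ R.*-congˡ (R.sym (∣·∣' (interval M N))) ⟩
    2' R.* ∣ ΣΣ (\_ _ -> interval M N) ∣
    ≤⟨ R.*-monoˡ (R.0≤# 2)(R.≤-trans (R.≤-respˡ (∣∣-cong split)(∣∣-+ _ _))(R.+-mono-≤ (shifted-≤ B) ∣differences∣)) ⟩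
    2' R.* (average B R.+ R.Σ (upTo A)(\i -> R.Σ (upTo B)(\b -> ∣ difference i b ∣)))
    ≈⟨ R.trans (R.distribˡ 2' _ _)(R.+-congˡ (R.trans (R.sym (R.Σ-*ˡ (upTo A) 2' _))(R.Σ-cong (upTo A)(\i -> R.sym (R.Σ-*ˡ (upTo B) 2' _))))) ⟩
    2' R.* average B R.+ R.Σ (upTo A)(\i -> R.Σ (upTo B)(\b -> 2' R.* ∣ difference i b ∣))
    ≤⟨ R.+-mono-≤ avg (R.Σ-mono (upTo A)(\i∈ -> R.Σ-mono (upTo B)(\b∈ -> difference-≤ i∈ b∈))) ⟩
    R.# (A N.* B) R.* E R.+ R.Σ (upTo A)(\i -> R.Σ (upTo B)(\b -> E))
    ≈⟨ R.+-congˡ (R.trans (R.Σ-cong (upTo A)(\_ -> constant B E))(R.trans (constant A _)(R.trans (R.sym (R.*-assoc _ _ E))(R.*-congʳ (R.sym (R.#-* A B)))))) ⟩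
    R.# (A N.* B) R.* E R.+ R.# (A N.* B) R.* E
    ≈⟨ double _ ⟩
    2' R.* (R.# (A N.* B) R.* E) ∎)
    where
    open R.≤-Reasoning
    2' = R.# 2
    ΣΣ : (ℕ -> ℕ -> Carrier) -> Carrier
    ΣΣ f = Σ (upTo A)(\i -> Σ (upTo B)(f i))
    difference : ℕ -> ℕ -> Carrier
    difference i b = interval M (scale i N.* b) - interval (M N.+ N)(scale i N.* b)
    double : ∀ x -> x R.+ x R.≈ 2' R.* x
    double = R.solve 1 (\x -> x R.:+ x R.:= (R.:1 R.:+ (R.:1 R.:+ R.:0)) R.:* x) R.refl
    constant : ∀ n c -> R.Σ (upTo n)(\_ -> c) R.≈ R.# n R.* c
    constant n c = R.trans (R.Σ-const (upTo n) c)(R.trans (R.·≈* (length (upTo n)) c)(R.*-congʳ (R.≡-cong R.# (length-upTo n))))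
    ∣constant∣ : ∀ n c -> ∣ Σ (upTo n)(\_ -> c) ∣ R.≈ R.# n R.* ∣ c ∣
    ∣constant∣ n c = R.trans (∣∣-cong (Σ-const (upTo n) c))(R.trans (∣·∣ (length (upTo n)) c)(R.*-congʳ (R.≡-cong R.# (length-upTo n))))
    ∣·∣' : ∀ c -> ∣ ΣΣ (\_ _ -> c) ∣ R.≈ R.# (A N.* B) R.* ∣ c ∣
    ∣·∣' c = R.trans (∣constant∣ A _)(R.trans (R.*-congˡ (∣constant∣ B c))(R.trans (R.sym (R.*-assoc _ _ _))(R.*-congʳ (R.sym (R.#-* A B)))))
    split : ΣΣ (\_ _ -> interval M N) ≈ ΣΣ (\i b -> interval (M N.+ scale i N.* b) N) + ΣΣ difference
    split = trans (Σ-cong (upTo A)(\i -> trans (Σ-cong (upTo B)(\b -> shift-difference M N (scale i N.* b)))(Σ-+ (upTo B) _ _)))(Σ-+ (upTo A) _ _)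
    ∣differences∣ : ∣ ΣΣ difference ∣ R.≤ R.Σ (upTo A)(\i -> R.Σ (upTo B)(\b -> ∣ difference i b ∣))
    ∣differences∣ = R.≤-trans (∣Σ∣ (upTo A) _)(R.Σ-mono (upTo A)(\_ -> ∣Σ∣ (upTo B) _))
    difference-≤ : ∀ {i b} -> i ∈ upTo A -> b ∈ upTo B -> 2' R.* ∣ difference i b ∣ R.≤ E
    difference-≤ {i}{b} i∈ b∈ = R.*-cancelˡ-≤ (R.#suc≰0 1)(R.≤-trans (R.*-monoˡ (R.0≤# 2)(R.*-monoˡ (R.0≤# 2)(∣x-y∣≤ _ _)))
     (R.≤-respˡ (R.solve 2 (\x y -> two R.:* (two R.:* (x R.:+ y)) R.:= four R.:* x R.:+ four R.:* y) R.refl _ _)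
     (R.≤-respʳ (double E)(R.+-mono-≤ (short M _ h≤)(short (M N.+ N) _ h≤)))))
     where
     two = R.:1 R.:+ (R.:1 R.:+ R.:0)
     four = R.:1 R.:+ (R.:1 R.:+ two)
     h≤ : scale i N.* b N.≤ 2 N.* (A N.* B)
     h≤ = ≤-tr (N.*-mono-≤ (scale-≤ i∈)(N.<⇒≤ (∈-upTo⁻ b∈)))(≡⇒≤ (id17 A B))

  module _ (4AN≤p : 4 N.* (A N.* N) N.≤ p)(A≤N : A N.≤ N)(l : ℕ)(1≤l : 1 N.≤ l)(2A<2^l : A N.+ A N.< 2 N.^ l)(0<A : 0 N.< A) where
   private
    is = upTo A
    ns = upTo N
    open DivisorSums using (Σ-mono-≤;Σ-upTo-const;gap;multiples-gcd;Σ-gcd)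

    2A<p : A N.+ A N.< p
    2A<p = N.<-≤-trans (N.+-monoˡ-< A (N.m<m+n A 0<A))(≤-tr (≡⇒≤ (id18 A))(≤-tr
     (N.*-mono-≤ {3}{4}(N.n≤1+n 3)(N.m≤m*n A N {{N.>-nonZero (≤-tr 0<A A≤N)}})) 4AN≤p))

    collide : ∀ i j n n' -> Dec (quotient (n' , j) ≡ quotient (n , i))
    collide i j n n' = quotient (n' , j) K.≟ quotient (n , i)

    Hit : ℕ -> ℕ -> ℕ -> Set
    Hit i j n = Any (\n' -> quotient (n' , j) ≡ quotient (n , i)) ns

    hit? : ∀ i j n -> Dec (Hit i j n)
    hit? i j n = any? (collide i j n) ns

    at-most-one : ∀ {Q : ℕ -> Set}(Q? : ∀ n -> Dec (Q n)){xs} -> Unique xs ->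
     (∀ {m n} -> m ∈ xs -> n ∈ xs -> Q m -> Q n -> m ≡ n) ->
     (d : Dec (Any Q xs)) -> ℕΣ.Σ xs (\n -> ℕΣ.[ Q? n ]) N.≤ ℕΣ.[ d ]
    at-most-one Q? {[]} [] h d = z≤n
    at-most-one Q? {x ∷ xs}(x∉ ∷ u) h d with Q? x
    ... | yes q = ≡⇒≤ (E.trans (E.cong suc (ℕΣ.Σ-zero xs (\{y} y∈ -> ℕΣ.[ Q? y ]-no
     (\q' -> All.lookup x∉ y∈ (h (here E.refl)(there y∈) q q')))))(E.sym (ℕΣ.[ d ]-yes (here q))))
    ... | no ¬q = ≤-tr (at-most-one Q? u (\m∈ n∈ -> h (there m∈)(there n∈))(any? Q? xs))(≡⇒≤ (ℕΣ.[ any? Q? xs ]-⇔ d there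
     \{ (here q) -> contradiction q ¬q; (there a) -> a }))

    cross : ∀ {i j n n'} -> i ∈ is -> j ∈ is -> quotient (n' , j) ≡ quotient (n , i) ->
     embed (scale i N.* (M N.+ n')) ≡ embed (scale j N.* (M N.+ n))
    cross {i}{j}{n}{n'} i∈ j∈ e = E.trans (embed-* (scale i)(M N.+ n'))(E.trans (E.cong (embed (scale i) K.*_)(E.trans (E.sym (scale-quotient 2A<p j∈))(E.cong (embed (scale j) K.*_) e)))
     (E.trans (KS.solve 3 (\a b c -> a KS.:* (b KS.:* c) KS.:= b KS.:* (a KS.:* c)) E.refl (embed (scale i))(embed (scale j)) _)
     (E.trans (E.cong (embed (scale j) K.*_)(scale-quotient 2A<p i∈))(E.sym (embed-* (scale j)(M N.+ n))))))

    separated : ∀ {i j n n'} -> i ∈ is -> j ∈ is -> n' ∈ ns -> ∀ {n″} d -> suc d N.+ n N.< N -> n″ ∈ ns ->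
     quotient (n' , j) ≡ quotient (n , i) -> quotient (n″ , j) ≡ quotient (suc d N.+ n , i) -> scale i ∣ scale j N.* suc d
    separated {i}{j}{n}{n'} i∈ j∈ n'∈ {n″} d lt n″∈ e e' =
     ∣m+n∣m⇒∣n (subst (scale i ∣_)(E.trans (E.sym equal)(N.+-comm (scale j N.* suc d)(scale i N.* n')))(m∣m*n n″))(m∣m*n n')
     where
     u = scale i; v = scale j
     2A*_<2AN : ∀ {m} -> m N.< N -> (A N.+ A) N.* m N.< (A N.+ A) N.* N
     2A*_<2AN = N.*-monoʳ-< (A N.+ A){{N.>-nonZero (≤-tr 0<A (N.m≤m+n A A))}}
     scale*< : ∀ {i m} -> i ∈ is -> m N.< N -> scale i N.* m N.< (A N.+ A) N.* N
     scale*< {i}{m} i∈ m<N = N.≤-<-trans (N.*-monoˡ-≤ m (scale-≤ i∈))(2A*_<2AN m<N)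
     left : v N.* suc d N.+ u N.* n' N.< p
     left = N.<-≤-trans (N.+-mono-< (scale*< j∈ (N.≤-<-trans (N.m≤m+n (suc d) n) lt))(scale*< i∈ (∈-upTo⁻ n'∈)))
      (≤-tr (≡⇒≤ (id19 A N)) 4AN≤p)
     right : u N.* n″ N.< p
     right = N.<-≤-trans (scale*< i∈ (∈-upTo⁻ n″∈))(≤-tr (N.m≤m+n _ _)(≤-tr (≡⇒≤ (id19 A N)) 4AN≤p))
     equal : v N.* suc d N.+ u N.* n' ≡ u N.* n″
     equal = embed-injective left right (+ᴷ-cancelʳ (embed (u N.* M)) _ _ (begin
      embed (v N.* suc d N.+ u N.* n') K.+ embed (u N.* M) ≡⟨ embed-+ (v N.* suc d N.+ u N.* n')(u N.* M) ⟨
      embed (v N.* suc d N.+ u N.* n' N.+ u N.* M) ≡⟨ E.cong embed (id20 v d u n' M) ⟩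
      embed (u N.* (M N.+ n') N.+ v N.* suc d) ≡⟨ embed-+ (u N.* (M N.+ n'))(v N.* suc d) ⟩
      embed (u N.* (M N.+ n')) K.+ embed (v N.* suc d) ≡⟨ E.cong (K._+ embed (v N.* suc d))(cross i∈ j∈ e) ⟩
      embed (v N.* (M N.+ n)) K.+ embed (v N.* suc d) ≡⟨ embed-+ (v N.* (M N.+ n))(v N.* suc d) ⟨
      embed (v N.* (M N.+ n) N.+ v N.* suc d) ≡⟨ E.cong embed (id21 v d n M) ⟩
      embed (v N.* (M N.+ (suc d N.+ n))) ≡⟨ cross i∈ j∈ e' ⟨
      embed (u N.* (M N.+ n″)) ≡⟨ E.cong embed (id22 u n″ M) ⟩
      embed (u N.* n″ N.+ u N.* M) ≡⟨ embed-+ (u N.* n″)(u N.* M) ⟩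
      embed (u N.* n″) K.+ embed (u N.* M) ∎))
      where open E.≡-Reasoning

    N≤p : N N.≤ p
    N≤p = ≤-tr (N.m≤n*m N (4 N.* A){{N.>-nonZero (≤-tr 0<A (N.m≤n*m A 4))}})(≤-tr (≡⇒≤ (N.*-assoc 4 A N)) 4AN≤p)

    injective : ∀ {j m n} -> j ∈ is -> m ∈ ns -> n ∈ ns -> quotient (m , j) ≡ quotient (n , j) -> m ≡ n
    injective {j}{m}{n} j∈ m∈ n∈ e = embed-injective (N.<-≤-trans (∈-upTo⁻ m∈) N≤p)(N.<-≤-trans (∈-upTo⁻ n∈) N≤p)(+ᴷ-cancelʳ (embed M) _ _
     (E.trans (swap m)(E.trans (E.trans (E.sym (scale-quotient 2A<p j∈))(E.trans (E.cong (embed (scale j) K.*_) e)(scale-quotient 2A<p j∈)))(E.sym (swap n)))))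
     where
     swap : ∀ m -> embed m K.+ embed M ≡ embed (M N.+ m)
     swap m = E.trans (E.sym (embed-+ m M))(E.cong embed (N.+-comm m M))

    pair-count : ∀ {i j} -> i ∈ is -> j ∈ is -> A N.* ℕΣ.Σ ns (\n -> ℕΣ.Σ ns (\n' -> ℕΣ.[ collide i j n n' ])) N.≤ A N.+ N N.* gcd (scale i)(scale j)
    pair-count {i}{j} i∈ j∈ = begin
     A N.* ℕΣ.Σ ns (\n -> ℕΣ.Σ ns (\n' -> ℕΣ.[ collide i j n n' ]))
     ≤⟨ N.*-monoʳ-≤ A (Σ-mono-≤ ns (\{n} _ -> at-most-one (collide i j n)(Unique.upTo⁺ N)
     (\m∈ n∈ e e' -> injective j∈ m∈ n∈ (E.trans e (E.sym e')))(hit? i j n))) ⟩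
     A N.* ℕΣ.Σ ns (\n -> ℕΣ.[ hit? i j n ])
     ≤⟨ N.*-monoʳ-≤ A (gap N (hit? i j)(\d -> scale i ∣? scale j N.* d) step) ⟩
     A N.* (1 N.+ C)
     ≡⟨ E.trans (N.*-suc A C) E.refl ⟩
     A N.+ A N.* C
     ≤⟨ N.+-monoʳ-≤ A (≤-tr (N.*-monoˡ-≤ C (≤-tr (N.m≤m+n A i)(N.n≤1+n _)))(multiples-gcd (scale i)(scale j) N)) ⟩
     A N.+ N N.* gcd (scale i)(scale j) ∎
     where
     open N.≤-Reasoning
     C = ℕΣ.Σ ns (\d -> ℕΣ.[ scale i ∣? scale j N.* suc d ])
     step : ∀ n d -> suc d N.+ n N.< N -> Hit i j n -> Hit i j (suc d N.+ n) -> scale i ∣ scale j N.* suc d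
     step n d lt h h' with find h | find h'
     ... | _ , n'∈ , e | _ , n″∈ , e' = separated i∈ j∈ n'∈ d lt n″∈ e e'

    collisions : ℕ
    collisions = ℕΣ.Σ is (\i -> ℕΣ.Σ is (\j -> ℕΣ.Σ ns (\n -> ℕΣ.Σ ns (\n' -> ℕΣ.[ collide i j n n' ]))))

    collisions-≤ : collisions N.≤ 5 N.* l N.* (N N.* A)
    collisions-≤ = N.*-cancelˡ-≤ A {{N.>-nonZero 0<A}}(begin
     A N.* collisions
     ≡⟨ E.trans (E.sym (ℕΣ.Σ-*ˡ is A _))(ℕΣ.Σ-cong is (\i -> E.sym (ℕΣ.Σ-*ˡ is A _))) ⟩
     ℕΣ.Σ is (\i -> ℕΣ.Σ is (\j -> A N.* ℕΣ.Σ ns (\n -> ℕΣ.Σ ns (\n' -> ℕΣ.[ collide i j n n' ]))))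
     ≤⟨ Σ-mono-≤ is (\i∈ -> Σ-mono-≤ is (\j∈ -> pair-count i∈ j∈)) ⟩
     ℕΣ.Σ is (\i -> ℕΣ.Σ is (\j -> A N.+ N N.* gcd (scale i)(scale j)))
     ≡⟨ E.trans (ℕΣ.Σ-cong is (\i -> E.trans (ℕΣ.Σ-+ is _ _)(cong₂ N._+_ (constant A)(ℕΣ.Σ-*ˡ is N _))))
     (E.trans (ℕΣ.Σ-+ is _ _)(cong₂ N._+_ (constant (A N.* A))(ℕΣ.Σ-*ˡ is N _))) ⟩
     A N.* (A N.* A) N.+ N N.* ℕΣ.Σ is (\i -> ℕΣ.Σ is (\j -> gcd (scale i)(scale j)))
     ≤⟨ N.+-mono-≤ (N.*-monoʳ-≤ A (≤-tr (N.*-monoʳ-≤ A A≤N)(N.m≤n*m (A N.* N) l {{N.>-nonZero 1≤l}})))(N.*-monoʳ-≤ N (Σ-gcd A l 2A<2^l)) ⟩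
     A N.* (l N.* (A N.* N)) N.+ N N.* ((A N.+ A) N.* (l N.* (A N.+ A)))
     ≡⟨ id23 A N l ⟩
     A N.* (5 N.* l N.* (N N.* A)) ∎)
     where
     open N.≤-Reasoning
     constant : ∀ c -> ℕΣ.Σ is (\_ -> c) ≡ A N.* c
     constant = Σ-upTo-const A

   module _ (B : ℕ) where
    private module H = Inequalities.Hölder ℝ K._≟_ K.elems K.elems-unique K.∈-elems pairs quotient (\x -> ∣ shortSum B x ∣)(\_ -> ∣∣-nonneg _)

    fibres-≤ : R.Σ K.elems (\x -> H.fibre x R.* H.fibre x) R.≤ R.# (5 N.* l N.* (N N.* A))
    fibres-≤ = R.≤-trans (R.≤-reflexive (R.trans (R.sym (H.Σ-fibre H.fibre))(R.trans flatten (R.sym #collisions))))(R.#-mono collisions-≤)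
     where
     #Σ : ∀ {X : Set}(xs : List X) f -> R.# (ℕΣ.Σ xs f) R.≈ R.Σ xs (\x -> R.# (f x))
     #Σ [] f = R.refl
     #Σ (x ∷ xs) f = R.trans (R.#-+ (f x)(ℕΣ.Σ xs f))(R.+-congˡ (#Σ xs f))
     #[] : ∀ {Q : Set}(d : Dec Q) -> R.# (ℕΣ.[ d ]) R.≈ R.[ d ]
     #[] (yes _) = R.#1
     #[] (no _) = R.refl
     #collisions : R.# collisions R.≈ R.Σ is (\i -> R.Σ is (\j -> R.Σ ns (\n -> R.Σ ns (\n' -> R.[ collide i j n n' ]))))
     #collisions = R.trans (#Σ is _)(R.Σ-cong is (\i -> R.trans (#Σ is _)(R.Σ-cong is (\j -> R.trans (#Σ ns _)(R.Σ-cong ns (\n ->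
      R.trans (#Σ ns _)(R.Σ-cong ns (\n' -> #[] (collide i j n n')))))))))
     flatten : R.Σ pairs (\x -> H.fibre (quotient x)) R.≈ R.Σ is (\i -> R.Σ is (\j -> R.Σ ns (\n -> R.Σ ns (\n' -> R.[ collide i j n n' ]))))
     flatten = R.trans (R.Σ-pairs _,_ ns is _)(R.trans (R.Σ-swap ns is _)(R.Σ-cong is (\i ->
      R.trans (R.Σ-cong ns (\n -> R.trans (R.Σ-pairs _,_ ns is _)(R.Σ-swap ns is _)))(R.Σ-swap ns is _))))

    average-bound : ∀ r' (0<B : 0 N.< B)(B≤p : B N.≤ p) -> average B R.^ (2 N.* suc r') R.≤
     R.# (N N.* A) R.^ (2 N.* r') R.* (R.# (5 N.* l N.* (N N.* A)) R.* moment r' B 0<B B≤p)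
    average-bound r' 0<B B≤p = R.≤-trans (H.hölder r')(R.≤-trans (R.≤-reflexive (R.*-congʳ (R.≡-cong (\n -> R.# n R.^ (2 N.* r')) length-pairs)))
     (R.*-monoˡ (R.^-nonneg (2 N.* r')(R.0≤# (N N.* A)))(R.*-monoʳ (moment-nonneg r' B 0<B B≤p) fibres-≤)))

module IntegerParts where
 open import Data.Nat
 open import Data.Nat.Properties
 open E using (refl;trans;cong)

 ^-distribʳ-* : ∀ k m n -> (m * n) ^ k ≡ m ^ k * n ^ k
 ^-distribʳ-* zero m n = refl
 ^-distribʳ-* (suc k) m n = trans (cong (m * n *_)(^-distribʳ-* k m n))(id24 m n (m ^ k)(n ^ k))

 bracket : ∀ (f : ℕ -> ℕ) x m -> f 0 ≤ x -> x < f m -> ∃[ n ] f n ≤ x × x < f (suc n)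
 bracket f x zero f0≤x x<f0 = contradiction x<f0 (≤⇒≯ f0≤x)
 bracket f x (suc m) f0≤x x<f with x <? f m
 ... | yes x<fm = bracket f x m f0≤x x<fm
 ... | no x≮fm = m , ≮⇒≥ x≮fm , x<f

 quotient : ∀ c -> 0 < c -> ∀ x -> ∃[ n ] n * c ≤ x × x < suc n * c
 quotient c 0<c x = bracket (_* c) x (suc x) z≤n (m≤m*n (suc x) c {{>-nonZero 0<c}})

 quotient-positive : ∀ {c n x} -> x < suc n * c -> 1 * c ≤ x -> 0 < n
 quotient-positive {n = zero} x<c c≤x = contradiction c≤x (<⇒≱ x<c)
 quotient-positive {n = suc n} _ _ = z<s

 integer-root : ∀ k x -> ∃[ n ] n ^ suc k ≤ x × x < suc n ^ suc k
 integer-root k x = bracket (_^ suc k) x (suc x) z≤n (m≤m*n (suc x)(suc x ^ k){{m^n≢0 (suc x) k}})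

module BurgessConstants {ℝ}(ℂ : NormedRing ℝ)(s : ℕ) where
 open RealProperties ℝ
 open GraeffeBound ℂ using (κ;κ-nonneg)

 r' r : ℕ
 r' = suc s
 r = suc r'

 momentConstant : Carrier
 momentConstant = # (2 N.^ r N.* r N.^ (2 N.* r)) + κ (suc (2 N.* r')) * # 2

 momentConstant-nonneg : 0# ≤ momentConstant
 momentConstant-nonneg = +-nonneg (0≤# (2 N.^ r N.* r N.^ (2 N.* r)))(*-nonneg (κ-nonneg (suc (2 N.* r')))(0≤# 2))

 C : Carrier
 C = # 2 ^ (2 N.* r) * # 640 * momentConstant + # 5120 ^ r

 part-nonneg : 0# ≤ # 2 ^ (2 N.* r) * # 640 * momentConstant
 part-nonneg = *-nonneg (*-nonneg (^-nonneg (2 N.* r)(0≤# 2))(0≤# 640)) momentConstant-nonneg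

 5120^r≤C : # 5120 ^ r ≤ C
 5120^r≤C = x≤y+x part-nonneg

 5120≤C : # 5120 ≤ C
 5120≤C = ≤-trans (≤-respˡ (sym (*-identityʳ _))(*-monoˡ (0≤# 5120)(1≤^ r' (1≤#suc 5119)))) 5120^r≤C

 1≤C : 1# ≤ C
 1≤C = ≤-trans (1≤#suc 5119) 5120≤C

 0≤C : 0# ≤ C
 0≤C = ≤-trans 0≤1 1≤C

module BurgessBound {p}{F : PrimeField p}{ℝ}{ℂ : NormedRing ℝ}(ψ : Character F ℂ)
 (k : ℕ)(p≡ : p ≡ 3 N.+ k)(s L : ℕ)(2^L≤p : 2 N.^ L N.≤ p)(p<2^1+L : p N.< 2 N.^ suc L) where
 open Character ψ
 open Characters ψ
 open ShiftedSums ψ k p≡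
 open BurgessConstants ℂ s
 private
  module K = FieldPolynomials.K F
 open NormedRing ℂ using (∣_∣;∣∣-cong;∣∣-+;∣∣-nonneg)
 private
  module C = NormedRing ℂ
  module ℂΣ = Summation C.commutativeSemiring
 open RealProperties ℝ
 open GraeffeBound ℂ using (κ;κ-nonneg)

 0<p : 0 N.< p
 0<p = subst (0 N.<_)(E.sym p≡)(s≤s z≤n)

 1≤L : 1 N.≤ L
 1≤L = positive L p<2^1+L
  where
  positive : ∀ L -> p N.< 2 N.^ suc L -> 1 N.≤ L
  positive zero h = contradiction (subst (N._< 2) p≡ h) \{ (s≤s (s≤s ())) }
  positive (suc L) _ = s≤s z≤n

 B : ℕ
 B = fst (IntegerParts.integer-root (N.pred (2 N.* r)) p)

 B^2r≤p : B N.^ (2 N.* r) N.≤ p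
 B^2r≤p = fst (snd (IntegerParts.integer-root (N.pred (2 N.* r)) p))

 1≤B : 1 N.≤ B
 1≤B = N.≮⇒≥ \B<1 -> N.<-irrefl E.refl (N.<-≤-trans (snd (snd (IntegerParts.integer-root (N.pred (2 N.* r)) p)))
  (≤-tr (N.^-monoˡ-≤ (2 N.* r) B<1)(≤-tr (≡⇒≤ (N.^-zeroˡ (2 N.* r))) 0<p)))

 p≤[2B]^2r : p N.≤ (2 N.* B) N.^ (2 N.* r)
 p≤[2B]^2r = ≤-tr (N.<⇒≤ (snd (snd (IntegerParts.integer-root (N.pred (2 N.* r)) p))))
  (N.^-monoˡ-≤ (2 N.* r)(≤-tr (N.+-monoˡ-≤ B 1≤B)(≡⇒≤ (E.cong (B N.+_)(E.sym (N.+-identityʳ B))))))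

 B≤p : B N.≤ p
 B≤p = ≤-tr (N.m≤m*n B (B N.^ N.pred (2 N.* r)){{N.m^n≢0 B (N.pred (2 N.* r)){{N.>-nonZero 1≤B}}}}) B^2r≤p

 w Q : Carrier
 w = root 2 (# p)
 Q = root (4 N.* r)(# p ^ suc r)

 0≤w : 0# ≤ w
 0≤w = root-nonneg 1 (# p)

 0≤Q : 0# ≤ Q
 0≤Q = root-nonneg (N.pred (4 N.* r))(# p ^ suc r)

 w*w : w * w ≈ # p
 w*w = trans (*-congˡ (sym (*-identityʳ w)))(root-power 1 (0≤# p))

 Q^4r : Q ^ (4 N.* r) ≈ # p ^ suc r
 Q^4r = root-power (N.pred (4 N.* r))(^-nonneg (suc r)(0≤# p))

 [Q²]^2r : (Q * Q) ^ (2 N.* r) ≈ # p ^ suc r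
 [Q²]^2r = trans (^-distrib-* Q Q (2 N.* r))(trans (sym (^-homo-* Q (2 N.* r)(2 N.* r)))
  (trans (≡-cong (Q ^_)(id25 r)) Q^4r))

 #B^2r≤ : # B ^ (2 N.* r) ≤ # p
 #B^2r≤ = ≤-respˡ (sym (#-^ B (2 N.* r)))(#-mono B^2r≤p)

 0≤Q² : 0# ≤ Q * Q
 0≤Q² = *-nonneg 0≤Q 0≤Q

 Bw≤Q² : # B * w ≤ Q * Q
 Bw≤Q² = ^-cancel-≤ (N.pred (2 N.* r)) 0≤Q² (begin
  (# B * w) ^ (2 N.* r) ≈⟨ ^-distrib-* (# B) w (2 N.* r) ⟩
  # B ^ (2 N.* r) * w ^ (2 N.* r) ≤⟨ *-mono (^-nonneg (2 N.* r)(0≤# B))(^-nonneg r (0≤# p)) #B^2r≤ (≤-reflexive w^2r) ⟩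
  # p ^ suc r ≈⟨ [Q²]^2r ⟨
  (Q * Q) ^ (2 N.* r) ∎)
  where
  open ≤-Reasoning
  w^2r : w ^ (2 N.* r) ≈ # p ^ r
  w^2r = trans (double w r)(trans (sym (^-distrib-* w w r))(^-congˡ r w*w))

 1≤#p : 1# ≤ # p
 1≤#p = ≤-respˡ (sym #1)(#-mono 0<p)

 B≤Q : # B ≤ Q
 B≤Q = ^-cancel-≤ (N.pred (4 N.* r)) 0≤Q (begin
  # B ^ (4 N.* r) ≈⟨ ≡-cong ((# B) ^_)(id26 r) ⟩
  # B ^ (2 N.* r N.+ 2 N.* r) ≈⟨ ^-homo-* (# B)(2 N.* r)(2 N.* r) ⟩
  # B ^ (2 N.* r) * # B ^ (2 N.* r) ≤⟨ *-mono (^-nonneg (2 N.* r)(0≤# B))(0≤# p) #B^2r≤ #B^2r≤ ⟩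
  # p * # p ≤⟨ *-monoˡ (0≤# p)(≤-respˡ (sym (*-identityʳ _))(*-monoˡ (0≤# p)(1≤^ r' 1≤#p))) ⟩
  # p ^ suc r ≈⟨ Q^4r ⟨
  Q ^ (4 N.* r) ∎)
  where
  open ≤-Reasoning

 p≤[2B]^r'Q² : # p ≤ # (2 N.* B) ^ r' * (Q * Q)
 p≤[2B]^r'Q² = ^-cancel-≤ (N.pred (2 N.* r))(*-nonneg (^-nonneg r' (0≤# (2 N.* B))) 0≤Q²)(begin
  # p ^ (2 N.* r) ≈⟨ ≡-cong ((# p) ^_)(id27 r') ⟩
  # p ^ (r' N.+ suc r) ≈⟨ ^-homo-* (# p) r' (suc r) ⟩
  # p ^ r' * # p ^ suc r ≤⟨ *-monoʳ (^-nonneg (suc r)(0≤# p))(^-mono r' (0≤# p)(≤-respʳ (#-^ (2 N.* B)(2 N.* r))(#-mono p≤[2B]^2r))) ⟩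
  (# (2 N.* B) ^ (2 N.* r)) ^ r' * # p ^ suc r ≈⟨ *-cong (trans (^-assocʳ (# (2 N.* B))(2 N.* r) r')(trans (≡-cong ((# (2 N.* B)) ^_)(N.*-comm (2 N.* r) r'))
  (sym (^-assocʳ (# (2 N.* B)) r' (2 N.* r)))))(sym [Q²]^2r) ⟩
  (# (2 N.* B) ^ r') ^ (2 N.* r) * (Q * Q) ^ (2 N.* r) ≈⟨ ^-distrib-* (# (2 N.* B) ^ r')(Q * Q)(2 N.* r) ⟨
  (# (2 N.* B) ^ r' * (Q * Q)) ^ (2 N.* r) ∎)
  where
  open ≤-Reasoning

 moment-≤ : moment r' B 1≤B B≤p ≤ # B ^ (2 N.* r) * (momentConstant * w)
 moment-≤ = ≤-trans (moment-bound r' B 1≤B B≤p)(begin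
  # (B N.^ r N.* R) * # p + # (B N.^ (2 N.* r)) * (κ M * # 2 * w)
  ≤⟨ +-mono-≤ (*-monoˡ (0≤# (B N.^ r N.* R)) p≤)(≤-reflexive (*-congʳ (#-^ B (2 N.* r)))) ⟩
  # (B N.^ r N.* R) * (# ((2 N.* B) N.^ r) * w) + β * (κ M * # 2 * w)
  ≈⟨ +-congʳ (trans (sym (*-assoc _ _ w))(*-congʳ (trans (sym (#-* (B N.^ r N.* R) _))(trans (≡-cong # rearrange)(trans (#-* (B N.^ (2 N.* r)) _)(*-congʳ (#-^ B (2 N.* r)))))))) ⟩
  β * # (2 N.^ r N.* R) * w + β * (κ M * # 2 * w)
  ≈⟨ solve 4 (\ β a w k -> β :* a :* w :+ β :* (k :* w) := β :* ((a :+ k) :* w)) refl β (# (2 N.^ r N.* R)) w (κ M * # 2) ⟩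
  β * (momentConstant * w) ∎)
  where
  open ≤-Reasoning
  M = suc (2 N.* r')
  R = r N.^ (2 N.* r)
  β = # B ^ (2 N.* r)
  rearrange : B N.^ r N.* R N.* (2 N.* B) N.^ r ≡ B N.^ (2 N.* r) N.* (2 N.^ r N.* R)
  rearrange = E.trans (E.cong (B N.^ r N.* R N.*_)(IntegerParts.^-distribʳ-* r 2 B))(E.trans (id28 (B N.^ r) R (2 N.^ r))
   (E.cong (N._* (2 N.^ r N.* R))(E.trans (E.sym (N.^-distribˡ-+-* B r r))(E.cong (\n -> B N.^ (r N.+ n))(E.sym (N.+-identityʳ r))))))
  w≤ : w ≤ # ((2 N.* B) N.^ r)
  w≤ = ^-cancel-≤ 1 (0≤# ((2 N.* B) N.^ r))(≤-respˡ (trans (*-congˡ (*-identityʳ w)) w*w)(≤-respʳ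
   (trans (≡-cong # (E.trans (E.cong ((2 N.* B) N.^_)(N.*-comm 2 r))(E.sym (N.^-*-assoc (2 N.* B) r 2))))
   (#-^ ((2 N.* B) N.^ r) 2))
   (#-mono p≤[2B]^2r)))
  p≤ : # p ≤ # ((2 N.* B) N.^ r) * w
  p≤ = ≤-respˡ (sym w*w)(*-monoʳ 0≤w w≤)

 F' : Carrier
 F' = Q * # L

 0≤F : 0# ≤ F'
 0≤F = *-nonneg 0≤Q (0≤# L)

 bound E : ℕ -> Carrier
 bound N = C * (# N ^ r' * F')
 E N = root r (bound N)

 0≤bound : ∀ N -> 0# ≤ bound N
 0≤bound N = *-nonneg 0≤C (*-nonneg (^-nonneg r' (0≤# N)) 0≤F)

 0≤E : ∀ N -> 0# ≤ E N
 0≤E N = root-nonneg r' (bound N)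

 E^r : ∀ N -> E N ^ r ≈ bound N
 E^r N = root-power r' (0≤bound N)

 E-mono : ∀ {m n} -> m N.≤ n -> E m ≤ E n
 E-mono {m}{n} m≤n = ^-cancel-≤ r' (0≤E n)(≤-respˡ (E^r m)(≤-respʳ (sym (E^r n))
  (*-monoˡ 0≤C (*-monoʳ 0≤F (^-mono r' (0≤# m)(#-mono m≤n))))))

 4E-≤ : ∀ {h N} -> 16 N.* h N.≤ N -> # 4 * E h ≤ E N
 4E-≤ {h}{N} 16h≤N = ^-cancel-≤ r' (0≤E N)(begin
  (# 4 * E h) ^ r ≈⟨ trans (^-distrib-* (# 4)(E h) r)(*-congˡ (E^r h)) ⟩
  # 4 ^ r * (C * (# h ^ r' * F')) ≈⟨ solve 4 (\a c h f -> a :* (c :* (h :* f)) := c :* (a :* h :* f)) refl _ C _ F' ⟩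
  C * (# 4 ^ r * # h ^ r' * F') ≈⟨ *-congˡ (*-congʳ (trans (#-* (4 N.^ r)(h N.^ r'))(*-cong (#-^ 4 r)(#-^ h r')))) ⟨
  C * (# (4 N.^ r N.* h N.^ r') * F') ≤⟨ *-monoˡ 0≤C (*-monoʳ 0≤F (#-mono powers)) ⟩
  C * (# (N N.^ r') * F') ≈⟨ trans (*-congˡ (*-congʳ (#-^ N r')))(sym (E^r N)) ⟩
  E N ^ r ∎)
  where
  open ≤-Reasoning
  powers : 4 N.^ r N.* h N.^ r' N.≤ N N.^ r'
  powers = ≤-tr (N.*-monoˡ-≤ (h N.^ r')(≤-tr (N.^-monoʳ-≤ 4 (≤-tr (s≤s (s≤s (N.m≤n+m s _)))(≡⇒≤ (id29 s))))
   (≡⇒≤ (E.sym (N.^-*-assoc 4 2 r')))))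
   (≤-tr (≡⇒≤ (E.sym (IntegerParts.^-distribʳ-* r' 16 h)))(N.^-monoˡ-≤ r' 16h≤N))

 short-interval : ∀ M N -> N N.≤ 32 N.* (B N.* L) -> ∣ interval M N ∣ ≤ E N
 short-interval M N N≤ = ≤-trans (∣interval∣≤ M N)(^-cancel-≤ r' (0≤E N)(≤-respʳ (sym (E^r N))(begin
  # N * # N ^ r' ≤⟨ *-monoʳ (^-nonneg r' (0≤# N))(#-mono N≤) ⟩
  # (32 N.* (B N.* L)) * # N ^ r' ≈⟨ *-congʳ (trans (#-* 32 (B N.* L))(*-congˡ (#-* B L))) ⟩
  # 32 * (# B * # L) * # N ^ r' ≤⟨ *-monoʳ (^-nonneg r' (0≤# N))(*-mono (0≤# 32) 0≤F (≤-trans (#-mono (N.m≤m+n 32 5088)) 5120≤C)(*-monoʳ (0≤# L) B≤Q)) ⟩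
  C * F' * # N ^ r' ≈⟨ solve 3 (\c f n -> c :* f :* n := c :* (n :* f)) refl C F' _ ⟩
  C * (# N ^ r' * F') ∎)))
  where open ≤-Reasoning

 1≤2L : suc L N.≤ 2 N.* L
 1≤2L = ≤-tr (N.+-monoˡ-≤ L 1≤L)(≡⇒≤ (E.cong (L N.+_)(E.sym (N.+-identityʳ L))))

 cancel-shift : ∀ A B' M N -> 0 N.< A -> 0 N.< B' -> # (A N.* B') * ∣ interval M N ∣ ≤ # (A N.* B') * E N -> ∣ interval M N ∣ ≤ E N
 cancel-shift A B' M N 0<A 0<B' = *-cancelˡ-≤ (\h -> 1≰0 (≤-trans (≤-respˡ (sym #1)(#-mono (N.*-mono-≤ 0<A 0<B'))) h))

 2A< : ∀ A N -> 0 N.< N -> 4 N.* (A N.* N) N.≤ p -> 0 N.< A -> A N.+ A N.< p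
 2A< A N 0<N 4AN≤p 0<A = N.<-≤-trans (N.+-monoˡ-< A (N.m<m+n A 0<A))(≤-tr (≡⇒≤ (id18 A))(≤-tr
  (N.*-mono-≤ {3}{4}(N.n≤1+n 3)(N.m≤m*n A N {{N.>-nonZero 0<N}})) 4AN≤p))

 medium-average : ∀ A M N -> 0 N.< A -> A N.≤ N -> 4 N.* (A N.* N) N.≤ p -> N N.≤ 64 N.* (A N.* (B N.* L)) ->
  # 2 * average A N M B ≤ # (A N.* B) * E N
 medium-average A M N 0<A A≤N 4AN≤p N≤ = ^-cancel-≤ (N.pred (2 N.* r))(*-nonneg (0≤# (A N.* B))(0≤E N))(begin
  (# 2 * average A N M B) ^ (2 N.* r)
  ≈⟨ ^-distrib-* (# 2)(average A N M B)(2 N.* r) ⟩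
  θ * average A N M B ^ (2 N.* r)
  ≤⟨ *-monoˡ 0≤θ (average-bound A N M 4AN≤p A≤N (suc L)(s≤s z≤n)
  (N.<-trans (2A< A N (N.<-≤-trans 0<A A≤N) 4AN≤p 0<A) p<2^1+L) 0<A B r' 1≤B B≤p) ⟩
  θ * (# (N N.* A) ^ (2 N.* r') * (# (5 N.* suc L N.* (N N.* A)) * moment r' B 1≤B B≤p))
  ≤⟨ *-monoˡ 0≤θ (*-monoˡ (^-nonneg (2 N.* r')(0≤# (N N.* A)))(*-mono (0≤# (5 N.* suc L N.* (N N.* A)))
  (*-nonneg 0≤β (*-nonneg momentConstant-nonneg 0≤w))(#-mono count≤) moment-≤)) ⟩
  θ * (# (N N.* A) ^ (2 N.* r') * (# (640 N.* (A N.* (A N.* (B N.* (L N.* L))))) * (β * (momentConstant * w))))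
  ≈⟨ *-congˡ (*-cong (trans (^-congˡ (2 N.* r')(#-* N A))(trans (^-distrib-* n x (2 N.* r'))(*-cong (double n r')(double x r'))))
  (*-congʳ (trans (#-* 640 (A N.* (A N.* (B N.* (L N.* L)))))(*-congˡ (trans (#-* A (A N.* (B N.* (L N.* L))))(*-congˡ (trans (#-* A (B N.* (L N.* L)))(*-congˡ (trans (#-* B (L N.* L))(*-congˡ (#-* L L)))))))))) ) ⟩
  θ * (N' * N' * (X * X) * (# 640 * (x * (x * (# B * (λ' * λ')))) * (β * (momentConstant * w))))
  ≈⟨ solve 10 (\ θ n X s x b l β m w -> θ :* (n :* n :* (X :* X) :* (s :* (x :* (x :* (b :* (l :* l)))) :* (β :* (m :* w))))
  := (n :* n :* ((x :* X) :* (x :* X)) :* β :* (l :* l)) :* ((θ :* s :* m) :* (b :* w))) refl θ N' X (# 640) x (# B) λ' β momentConstant w ⟩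
  N' * N' * ((x * X) * (x * X)) * β * (λ' * λ') * ((θ * # 640 * momentConstant) * (# B * w))
  ≤⟨ *-monoˡ (*-nonneg (*-nonneg (*-nonneg (square-nonneg N')(square-nonneg (x * X))) 0≤β)(square-nonneg λ'))
  (*-mono part-nonneg 0≤Q² (≤-trans (x≤x+y (^-nonneg r (0≤# 5120)))(≤-respˡ (sym (*-identityʳ C))(*-monoˡ 0≤C 1≤C))) Bw≤Q²) ⟩
  N' * N' * ((x * X) * (x * X)) * β * (λ' * λ') * (C * C * (Q * Q))
  ≈⟨ solve 6 (\n X β l c q -> n :* n :* (X :* X) :* β :* (l :* l) :* (c :* c :* (q :* q)) := (X :* X) :* β :* ((c :* (n :* (q :* l))) :* (c :* (n :* (q :* l))))) refl N' (x * X) β λ' C Q ⟩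
  (x * X) * (x * X) * β * (bound N * bound N)
  ≈⟨ *-cong (*-congʳ (sym (double x r)))(trans (*-cong (sym (E^r N))(sym (E^r N)))(sym (double (E N) r))) ⟩
  x ^ (2 N.* r) * # B ^ (2 N.* r) * E N ^ (2 N.* r)
  ≈⟨ trans (*-congʳ (trans (sym (^-distrib-* x (# B)(2 N.* r)))(^-congˡ (2 N.* r)(sym (#-* A B)))))(sym (^-distrib-* (# (A N.* B))(E N)(2 N.* r))) ⟩
  (# (A N.* B) * E N) ^ (2 N.* r) ∎)
  where
  open ≤-Reasoning
  θ = # 2 ^ (2 N.* r)
  0≤θ = ^-nonneg (2 N.* r)(0≤# 2)
  β = # B ^ (2 N.* r)
  0≤β = ^-nonneg (2 N.* r)(0≤# B)
  n = # N
  x = # A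
  λ' = # L
  N' = n ^ r'
  X = x ^ r'
  count≤ : 5 N.* suc L N.* (N N.* A) N.≤ 640 N.* (A N.* (A N.* (B N.* (L N.* L))))
  count≤ = ≤-tr (N.*-mono-≤ (N.*-monoʳ-≤ 5 1≤2L)(N.*-monoˡ-≤ A N≤))(≡⇒≤ (id30 A B L))

 large-bound : ∀ N -> 8 N.* (p N.* (B N.* L)) N.≤ N N.* N -> # (5120 N.* (L N.* p)) ≤ E N * E N
 large-bound N large = ^-cancel-≤ r' (*-nonneg (0≤E N)(0≤E N))(begin
  # (5120 N.* (L N.* p)) ^ r
  ≈⟨ trans (^-congˡ r (trans (#-* 5120 (L N.* p))(*-congˡ (#-* L p))))(trans (^-distrib-* (# 5120)(λ' * # p) r)(*-congˡ (^-distrib-* λ' (# p) r))) ⟩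
  # 5120 ^ r * (λ' * λ″ * (# p * P))
  ≤⟨ *-mono (^-nonneg r (0≤# 5120))(*-nonneg (*-nonneg (*-nonneg (0≤# L)(0≤# L))(^-nonneg r' (0≤# L)))(*-nonneg (*-nonneg (^-nonneg r' (0≤# (2 N.* B))) 0≤Q²)(^-nonneg r' (0≤# p))))
  (≤-trans 5120^r≤C (≤-respˡ (sym (*-identityʳ C))(*-monoˡ 0≤C 1≤C)))
  (*-mono (*-nonneg (0≤# L)(^-nonneg r' (0≤# L)))(*-nonneg (*-nonneg (^-nonneg r' (0≤# (2 N.* B))) 0≤Q²)(^-nonneg r' (0≤# p)))
  (*-monoʳ (^-nonneg r' (0≤# L))(≤-respˡ (sym (*-identityˡ λ'))(*-monoʳ (0≤# L)(≤-respˡ (sym #1)(#-mono 1≤L)))))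
  (*-monoʳ (^-nonneg r' (0≤# p)) p≤[2B]^r'Q²)) ⟩
  C * C * (λ' * λ' * λ″ * (# (2 N.* B) ^ r' * (Q * Q) * P))
  ≈⟨ solve 6 (\c l m b q p -> c :* c :* (l :* l :* m :* (b :* (q :* q) :* p)) := b :* p :* m :* ((c :* (q :* l)) :* (c :* (q :* l)))) refl C λ' λ″ (# (2 N.* B) ^ r') Q P ⟩
  # (2 N.* B) ^ r' * P * λ″ * ((C * F') * (C * F'))
  ≈⟨ *-congʳ (trans (*-congʳ (sym (^-distrib-* (# (2 N.* B))(# p) r')))(trans (sym (^-distrib-* (# (2 N.* B) * # p) λ' r'))
  (^-congˡ r' (trans (*-congʳ (sym (#-* (2 N.* B) p)))(sym (#-* (2 N.* B N.* p) L)))))) ⟩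
  # (2 N.* B N.* p N.* L) ^ r' * ((C * F') * (C * F'))
  ≤⟨ *-monoʳ (square-nonneg (C * F'))(^-mono r' (0≤# (2 N.* B N.* p N.* L))(#-mono below)) ⟩
  # (N N.* N) ^ r' * ((C * F') * (C * F'))
  ≈⟨ *-congʳ (trans (^-congˡ r' (#-* N N))(^-distrib-* (# N)(# N) r')) ⟩
  # N ^ r' * # N ^ r' * ((C * F') * (C * F'))
  ≈⟨ solve 3 (\n c f -> n :* n :* ((c :* f) :* (c :* f)) := (c :* (n :* f)) :* (c :* (n :* f))) refl (# N ^ r') C F' ⟩
  bound N * bound N
  ≈⟨ trans (*-cong (sym (E^r N))(sym (E^r N)))(sym (^-distrib-* (E N)(E N) r)) ⟩
  (E N * E N) ^ r ∎)
  where
  open ≤-Reasoning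
  λ' = # L
  λ″ = λ' ^ r'
  P = # p ^ r'
  below : 2 N.* B N.* p N.* L N.≤ N N.* N
  below = ≤-tr (≤-tr (≡⇒≤ (id31 B p L))(N.*-monoˡ-≤ (p N.* (B N.* L))(N.m≤m+n 2 6))) large

 large-average : ∀ A B' M N (0<B' : 0 N.< B')(B'≤p : B' N.≤ p) -> 0 N.< A -> A N.≤ N -> 4 N.* (A N.* N) N.≤ p -> N N.≤ 64 N.* (A N.* B') ->
  8 N.* (p N.* (B N.* L)) N.≤ N N.* N -> # 2 * average A N M B' ≤ # (A N.* B') * E N
 large-average A B' M N 0<B' B'≤p 0<A A≤N 4AN≤p N≤ large = ^-cancel-≤ 1 (*-nonneg (0≤# (A N.* B'))(0≤E N))(begin
  (# 2 * average A N M B') ^ 2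
  ≈⟨ ^-distrib-* (# 2)(average A N M B') 2 ⟩
  # 2 ^ 2 * average A N M B' ^ 2
  ≤⟨ *-monoˡ (^-nonneg 2 (0≤# 2))(average-bound A N M 4AN≤p A≤N (suc L)(s≤s z≤n)
  (N.<-trans (2A< A N (N.<-≤-trans 0<A A≤N) 4AN≤p 0<A) p<2^1+L) 0<A B' 0 0<B' B'≤p) ⟩
  # 2 ^ 2 * (1# * (# (5 N.* suc L N.* (N N.* A)) * moment 0 B' 0<B' B'≤p))
  ≤⟨ *-monoˡ (^-nonneg 2 (0≤# 2))(*-monoˡ 0≤1 (*-monoˡ (0≤# (5 N.* suc L N.* (N N.* A)))(second-moment B' 0<B' B'≤p))) ⟩
  # 2 ^ 2 * (1# * (# (5 N.* suc L N.* (N N.* A)) * # (2 N.* (B' N.* p))))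
  ≈⟨ *-cong (sym (#-^ 2 2))(trans (*-identityˡ _)(sym (#-* (5 N.* suc L N.* (N N.* A))(2 N.* (B' N.* p))))) ⟩
  # 4 * # (5 N.* suc L N.* (N N.* A) N.* (2 N.* (B' N.* p)))
  ≤⟨ ≤-respˡ (sym (#-* 4 (5 N.* suc L N.* (N N.* A) N.* (2 N.* (B' N.* p)))))(#-mono count≤) ⟩
  # (A N.* B' N.* (A N.* B') N.* (5120 N.* (L N.* p)))
  ≈⟨ trans (#-* (A N.* B' N.* (A N.* B')) _)(*-congʳ (#-* (A N.* B')(A N.* B'))) ⟩
  # (A N.* B') * # (A N.* B') * # (5120 N.* (L N.* p))
  ≤⟨ *-monoˡ (square-nonneg (# (A N.* B')))(large-bound N large) ⟩
  # (A N.* B') * # (A N.* B') * (E N * E N)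
  ≈⟨ solve 2 (\a e -> a :* a :* (e :* e) := a :* e :* (a :* e :* :1)) refl (# (A N.* B'))(E N) ⟩
  (# (A N.* B') * E N) ^ 2 ∎)
  where
  open ≤-Reasoning
  count≤ : 4 N.* (5 N.* suc L N.* (N N.* A) N.* (2 N.* (B' N.* p))) N.≤ A N.* B' N.* (A N.* B') N.* (5120 N.* (L N.* p))
  count≤ = ≤-tr (N.*-monoʳ-≤ 4 (N.*-monoˡ-≤ (2 N.* (B' N.* p))(N.*-mono-≤ (N.*-monoʳ-≤ 5 1≤2L)(N.*-monoˡ-≤ A N≤))))
   (≡⇒≤ (id32 A B' p L))

 module _ (N : ℕ)(0<N : 0 N.< N)(4N≤p : 4 N.* N N.≤ p)
  (rec : ∀ {h} -> h N.< N -> 4 N.* h N.≤ p -> ∀ M -> ∣ interval M h ∣ ≤ E h)(M : ℕ) where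
  reduce : ∀ A B' -> 0 N.< A -> 0 N.< B' -> 4 N.* (A N.* N) N.≤ p -> 32 N.* (A N.* B') N.≤ N ->
   # 2 * average A N M B' ≤ # (A N.* B') * E N -> ∣ interval M N ∣ ≤ E N
  reduce A B' 0<A 0<B' 4AN≤p 32AB≤N avg = cancel-shift A B' M N 0<A 0<B' (shift-bound A N M (2A< A N 0<N 4AN≤p 0<A) B' (E N) avg
   (\M' h h≤ -> ≤-trans (*-monoˡ (0≤# 4)(rec (h<N h (16h≤ h h≤))(≤-tr (N.*-monoʳ-≤ 4 (N.<⇒≤ (h<N h (16h≤ h h≤)))) 4N≤p) M'))(4E-≤ {h}(16h≤ h h≤))))
   where
   16h≤ : ∀ h -> h N.≤ 2 N.* (A N.* B') -> 16 N.* h N.≤ N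
   16h≤ h h≤ = ≤-tr (N.*-monoʳ-≤ 16 h≤)(≤-tr (≡⇒≤ (E.sym (N.*-assoc 16 2 (A N.* B')))) 32AB≤N)
   h<N : ∀ h -> 16 N.* h N.≤ N -> h N.< N
   h<N zero _ = 0<N
   h<N (suc h) l = N.<-≤-trans (N.m<m+n (suc h)(s≤s z≤n)) l

  medium-interval : 32 N.* (B N.* L) N.< N -> N N.* N N.≤ 8 N.* (p N.* (B N.* L)) -> ∣ interval M N ∣ ≤ E N
  medium-interval short medium = reduce A B 0<A 1≤B 4AN≤p 32AB≤N (medium-average A M N 0<A A≤N 4AN≤p N≤)
   where
   c = 32 N.* (B N.* L)
   0<BL = N.*-mono-≤ 1≤B 1≤L
   0<c = N.*-mono-≤ {1}{32}(s≤s z≤n) 0<BL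
   q = IntegerParts.quotient c 0<c N
   A = fst q
   A*c≤N = fst (snd q)
   N< = snd (snd q)
   0<A : 0 N.< A
   0<A = IntegerParts.quotient-positive N< (N.<⇒≤ (N.≤-<-trans (≡⇒≤ (N.*-identityˡ c)) short))
   A≤N : A N.≤ N
   A≤N = ≤-tr (N.m≤m*n A c {{N.>-nonZero 0<c}}) A*c≤N
   4AN≤p : 4 N.* (A N.* N) N.≤ p
   4AN≤p = N.*-cancelˡ-≤ (8 N.* (B N.* L)){{N.>-nonZero (N.*-mono-≤ {1}{8}(s≤s z≤n) 0<BL)}}
    (≤-tr (≡⇒≤ (id33 (B N.* L) A N))(≤-tr (N.*-monoˡ-≤ N A*c≤N)(≤-tr medium (≡⇒≤ (id34 p (B N.* L))))))
   32AB≤N : 32 N.* (A N.* B) N.≤ N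
   32AB≤N = ≤-tr (N.*-monoʳ-≤ 32 (N.*-monoʳ-≤ A (N.m≤m*n B L {{N.>-nonZero 1≤L}})))(≤-tr (≡⇒≤ (id14 32 A (B N.* L))) A*c≤N)
   N≤ : N N.≤ 64 N.* (A N.* (B N.* L))
   N≤ = ≤-tr (N.<⇒≤ N<)(≤-tr (N.*-monoˡ-≤ c (N.+-monoˡ-≤ A 0<A))(≡⇒≤ (id36 A (B N.* L))))

  large-interval : 8 N.* (p N.* (B N.* L)) N.≤ N N.* N -> ∣ interval M N ∣ ≤ E N
  large-interval large = reduce A B' 0<A 0<B' 4AN≤p 32AB≤N (large-average A B' M N 0<B' B'≤p 0<A A≤N 4AN≤p N≤ large)
   where
   0<4N = N.*-mono-≤ {1}{4}(s≤s z≤n) 0<N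
   q = IntegerParts.quotient (4 N.* N) 0<4N p
   A = fst q
   0<A : 0 N.< A
   0<A = IntegerParts.quotient-positive (snd (snd q))(≤-tr (≡⇒≤ (N.*-identityˡ (4 N.* N))) 4N≤p)
   4AN≤p : 4 N.* (A N.* N) N.≤ p
   4AN≤p = ≤-tr (≡⇒≤ (id14 4 A N))(fst (snd q))
   p≤pBL : 8 N.* p N.≤ N N.* N
   p≤pBL = ≤-tr (N.*-monoʳ-≤ 8 (N.m≤m*n p (B N.* L){{N.>-nonZero (N.*-mono-≤ 1≤B 1≤L)}})) large
   A≤N : A N.≤ N
   A≤N = N.*-cancelʳ-≤ A N N {{N.>-nonZero 0<N}}(≤-tr (N.m≤n*m (A N.* N) 4)(≤-tr 4AN≤p (≤-tr (N.m≤n*m p 8) p≤pBL)))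
   32A≤N : 1 N.* (32 N.* A) N.≤ N
   32A≤N = N.*-cancelʳ-≤ (1 N.* (32 N.* A)) N N {{N.>-nonZero 0<N}}(≤-tr (≡⇒≤ (id38 A N))(≤-tr (N.*-monoʳ-≤ 8 4AN≤p) p≤pBL))
   0<32A = N.*-mono-≤ {1}{32}(s≤s z≤n) 0<A
   q' = IntegerParts.quotient (32 N.* A) 0<32A N
   B' = fst q'
   0<B' : 0 N.< B'
   0<B' = IntegerParts.quotient-positive (snd (snd q')) 32A≤N
   B'≤p : B' N.≤ p
   B'≤p = ≤-tr (N.m≤m*n B' (32 N.* A){{N.>-nonZero 0<32A}})(≤-tr (fst (snd q'))(≤-tr (N.m≤n*m N 4) 4N≤p))
   32AB≤N : 32 N.* (A N.* B') N.≤ N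
   32AB≤N = ≤-tr (≡⇒≤ (id39 A B'))(fst (snd q'))
   N≤ : N N.≤ 64 N.* (A N.* B')
   N≤ = ≤-tr (N.<⇒≤ (snd (snd q')))(≤-tr (N.*-monoˡ-≤ (32 N.* A)(N.+-monoˡ-≤ B' 0<B'))(≡⇒≤ (id40 A B')))

 quarter : ∀ N -> 4 N.* N N.≤ p -> ∀ M -> ∣ interval M N ∣ ≤ E N
 quarter = <-rec _ step
  where
  step : ∀ N -> (∀ {h} -> h N.< N -> 4 N.* h N.≤ p -> ∀ M -> ∣ interval M h ∣ ≤ E h) -> 4 N.* N N.≤ p -> ∀ M -> ∣ interval M N ∣ ≤ E N
  step N rec 4N≤p M = cases (N N.≤? 32 N.* (B N.* L))(N N.* N N.≤? 8 N.* (p N.* (B N.* L)))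
   where
   cases : Dec (N N.≤ 32 N.* (B N.* L)) -> Dec (N N.* N N.≤ 8 N.* (p N.* (B N.* L))) -> ∣ interval M N ∣ ≤ E N
   cases (yes short) _ = short-interval M N short
   cases (no ¬short)(yes medium) = medium-interval N (N.≤-<-trans z≤n (N.≰⇒> ¬short)) 4N≤p rec M (N.≰⇒> ¬short) medium
   cases (no ¬short)(no ¬medium) = large-interval N (N.≤-<-trans z≤n (N.≰⇒> ¬short)) 4N≤p rec M (N.<⇒≤ (N.≰⇒> ¬medium))

 pieces : ∀ j D -> 4 N.* D N.≤ p -> ∀ N M -> N N.≤ j N.* D -> ∣ interval M N ∣ ≤ # j * E N
 pieces zero D 4D≤p zero M z≤n = ≤-reflexive (trans (NormedProperties.∣0∣ ℂ)(sym (zeroˡ _)))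
 pieces (suc j) D 4D≤p N M N≤ = cases (N N.≤? D)
  where
  cases : Dec (N N.≤ D) -> ∣ interval M N ∣ ≤ # (suc j) * E N
  cases (yes N≤D) = ≤-trans (quarter N (≤-tr (N.*-monoʳ-≤ 4 N≤D) 4D≤p) M)(≤-respˡ (sym (*-identityˡ _))(*-monoʳ (0≤E N)(1≤#suc j)))
  cases (no N≰D) = ≤-respʳ (trans (+-congʳ (sym (*-identityˡ _)))(sym (distribʳ (E N) 1# (# j))))
   (≤-respˡ (trans (≡-cong (\n -> ∣ interval M n ∣)(E.sym D+R))(∣∣-cong (interval-+ M D R)))(≤-trans (∣∣-+ _ _)
   (+-mono-≤ (≤-trans (quarter D 4D≤p M)(E-mono D≤N))(≤-trans (pieces j D 4D≤p R (M N.+ D)(N.m≤n+o⇒m∸n≤o N D N≤))(*-monoˡ (0≤# j)(E-mono (N.m∸n≤m N D)))))))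
   where
   R = N N.∸ D
   D≤N = N.<⇒≤ (N.≰⇒> N≰D)
   D+R : D N.+ R ≡ N
   D+R = N.m+[n∸m]≡n D≤N

 below-period : ∀ N M -> N N.< p -> ∣ interval M N ∣ ≤ # 8 * E N
 below-period N M N<p = cases (N N.≤? 32 N.* (B N.* L))
  where
  q = IntegerParts.quotient 4 (s≤s z≤n) p
  D = fst q
  cases : Dec (N N.≤ 32 N.* (B N.* L)) -> ∣ interval M N ∣ ≤ # 8 * E N
  cases (yes short) = ≤-trans (short-interval M N short)(≤-respˡ (sym (*-identityˡ _))(*-monoʳ (0≤E N)(1≤#suc 7)))
  cases (no ¬short) = pieces 8 D (≤-tr (≡⇒≤ (N.*-comm 4 D))(fst (snd q))) N M
   (≤-tr (N.<⇒≤ (N.<-trans N<p (snd (snd q))))(≤-tr (N.*-monoˡ-≤ 4 (N.+-monoˡ-≤ D 0<D))(≡⇒≤ (id41 D))))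
   where
   4≤p : 4 N.≤ p
   4≤p = ≤-tr (≤-tr (N.m≤m+n 4 28)(N.*-monoʳ-≤ 32 (N.*-mono-≤ 1≤B 1≤L)))(N.<⇒≤ (N.<-trans (N.≰⇒> ¬short) N<p))
   0<D : 0 N.< D
   0<D = IntegerParts.quotient-positive (snd (snd q)) 4≤p

 full-period : ∀ M -> interval M p C.≈ C.0#
 full-period M = C.trans (ℂΣ.Σ-cong (upTo p)(\n -> C.reflexive (E.cong χ (E.trans (embed-+ M n)(E.cong (embed M K.+_)(E.sym (K.*-identityʳ (embed n))))))))
  (C.trans (C.sym (ℂΣ.Σ-bijection (Unique.upTo⁺ p) K.elems-unique embed K.residue (\_ -> K.∈-elems _)(\{y} _ -> ∈-upTo⁺ (K.residue-< y))
  (\n∈ -> K.×-residue (∈-upTo⁻ n∈))(\{y} _ -> K.residue-× y)(\c -> χ (embed M K.+ c K.* K.1#))))(Σχ-affine (embed M) K.1# K.1≢0))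

 burgess : ∀ N M -> ∣ interval M N ∣ ≤ # 8 * E N
 burgess = <-rec _ step
  where
  step : ∀ N -> (∀ {n} -> n N.< N -> ∀ M -> ∣ interval M n ∣ ≤ # 8 * E n) -> ∀ M -> ∣ interval M N ∣ ≤ # 8 * E N
  step N rec M = cases (N N.<? p)
   where
   R = N N.∸ p
   cases : Dec (N N.< p) -> ∣ interval M N ∣ ≤ # 8 * E N
   cases (yes N<p) = below-period N M N<p
   cases (no N≮p) = ≤-respˡ (trans (≡-cong (\n -> ∣ interval M n ∣)(E.sym p+R))(∣∣-cong (C.trans (interval-+ M p R)
    (C.trans (C.+-congʳ (full-period M))(C.+-identityˡ _)))))(≤-trans (rec (N.∸-monoʳ-< {o = 0} 0<p (N.≮⇒≥ N≮p))(M N.+ p))(*-monoˡ (0≤# 8)(E-mono (N.m∸n≤m N p))))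
    where
    p+R : p N.+ R ≡ N
    p+R = N.m+[n∸m]≡n (N.≮⇒≥ N≮p)

module Staircase {ℝ}(ℂ : NormedRing ℝ) where
 open import Data.Nat.DivMod using (_/_)
 private module R = RealProperties ℝ
 open NormedProperties ℂ

 segment : (ℕ -> Carrier) -> ℕ -> ℕ -> Carrier
 segment f M N = Σ (upTo N)(\n -> f (M N.+ n))

 segment-+ : ∀ f M m n -> segment f M (m N.+ n) ≈ segment f M m + segment f (M N.+ m) n
 segment-+ f M m n = trans (Σ-upTo-+ m n _)(+-congˡ (Σ-cong (upTo n)(\i -> reflexive (E.cong f (E.sym (N.+-assoc M m i))))))

 Controlled : R.Carrier -> R.Carrier -> (ℕ -> Carrier) -> Set
 Controlled φ κ f = ∀ M N j -> N N.≤ 2 N.^ j -> ∣ segment f M N ∣ R.≤ κ R.* φ R.^ j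

 hyperbolaSum : (f g : ℕ -> Carrier) -> ℕ -> Carrier
 hyperbolaSum f g t = Σ (upTo t)(\x -> Σ (upTo t)(\y -> [ suc x N.* suc y N.≤? t ] * (f x * g y)))

 from : ℕ -> (ℕ -> Carrier) -> ℕ -> Carrier
 from s f n = [ s N.≤? n ] * f n

 from-controlled : ∀ {φ κ f} s -> Controlled φ κ f -> R.0# R.≤ κ -> R.0# R.≤ φ -> Controlled φ κ (from s f)
 from-controlled {φ}{κ}{f} s cf 0≤κ 0≤φ M zero j N≤ = R.≤-respˡ ∣0∣ (R.*-nonneg 0≤κ (R.^-nonneg j 0≤φ))
 from-controlled {φ}{κ}{f} s cf 0≤κ 0≤φ M (suc N) j N≤ with s N.≤? M
 ... | yes s≤M = R.≤-respˡ (∣∣-cong (Σ-cong (upTo (suc N))(\n -> trans (*-congʳ ([ s N.≤? M N.+ n ]-yes (≤-tr s≤M (N.m≤m+n M n))))(*-identityˡ _))))(cf M (suc N) j N≤)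
 ... | no s≰M = R.≤-respˡ (∣∣-cong (trans (Σ-upTo-sucˡ N _)(trans (+-cong (trans (*-congʳ ([ s N.≤? M N.+ 0 ]-no (\h -> s≰M (subst (s N.≤_)(N.+-identityʳ M) h))))(zeroˡ _))
  (Σ-cong (upTo N)(\n -> reflexive (E.cong (from s f)(N.+-suc M n)))))(+-identityˡ _))))
  (from-controlled {f = f} s cf 0≤κ 0≤φ (suc M) N j (≤-tr (N.n≤1+n N) N≤))

 module _ (t l : ℕ)(2^l≤t : 2 N.^ l N.≤ t)(t<2^1+l : t N.< 2 N.^ suc l)
  (φ : R.Carrier)(1≤φ : R.1# R.≤ φ)
  (a : ℕ -> R.Carrier)(0≤a0 : R.0# R.≤ a 0)(a-step : ∀ n -> a n R.+ a n R.+ φ R.^ (2 N.* n) R.≤ a (suc n))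
  (Λ : ℕ)(1≤Λ : 1 N.≤ Λ)(a-≤ : ∀ n -> n N.≤ l -> a n R.≤ R.# (2 N.* Λ) R.* φ R.^ (2 N.* n)) where
  private
   0≤φ = R.≤-trans R.0≤1 1≤φ

   q : ℕ -> ℕ
   q zero = 0
   q (suc n) = t / suc n

   q-anti : ∀ {m n} -> 0 N.< m -> m N.≤ n -> q n N.≤ q m
   q-anti {suc m}{suc n} _ m≤n = N./-monoʳ-≤ t m≤n

   q*≤ : ∀ v -> q v N.* v N.≤ t
   q*≤ zero = z≤n
   q*≤ (suc n) = m/n*n≤m t (suc n)

   t<q* : ∀ v -> 0 N.< v -> t N.< suc (q v) N.* v
   t<q* (suc n) _ = N.≰⇒> \h -> N.<-irrefl E.refl (≤-tr (≡⇒≤ (E.sym (m*n/n≡m (suc (t / suc n))(suc n))))(/-monoˡ-≤ (suc n) h))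

   q<2^ : ∀ i j -> i N.+ j ≡ suc l -> q (2 N.^ i) N.< 2 N.^ j
   q<2^ i j e = N.*-cancelʳ-< (2 N.^ i) _ _ (N.≤-<-trans (q*≤ (2 N.^ i))(N.<-≤-trans t<2^1+l
    (≡⇒≤ (E.trans (E.cong (2 N.^_)(E.trans (E.sym e)(N.+-comm i j)))(N.^-distribˡ-+-* 2 j i)))))

  -- For v and v′ = v + 2ⁿ, both at least 2ⁱ, the interval (t/v′, t/v] is short.
  drop : ∀ i d u n -> 2 N.* i N.+ d ≡ suc l -> 2 N.^ i N.≤ u ->
   q (u N.+ 2 N.^ n) N.∸ q (u N.+ 2 N.^ n N.+ 2 N.^ n) N.≤ 2 N.^ (n N.+ d)
  drop i d u n e 2^i≤u = N.≮⇒≥ \long -> N.<-irrefl E.refl (begin-strict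
   t N.* b <⟨ N.*-monoˡ-< b {{N.m^n≢0 2 n}} t<2^1+l ⟩
   2 N.^ suc l N.* b ≡⟨ E.trans (E.cong (\m -> 2 N.^ m N.* b)(E.sym e)) powers ⟩
   2 N.^ (n N.+ d) N.* (2 N.^ i N.* 2 N.^ i) ≤⟨ N.*-mono-≤ (N.s≤s⁻¹ (subst (suc c N.≤_)(ℓ≡ long) long))(N.*-mono-≤ 2^i≤v (≤-tr 2^i≤v (N.m≤m+n v b))) ⟩
   ℓ' N.* (v N.* (v N.+ b)) ≤⟨ N.+-cancelʳ-≤ (v N.* (v N.+ b) N.+ q v' N.* v' N.* v) _ _ (key long) ⟩
   t N.* b ∎)
   where
   open N.≤-Reasoning
   b = 2 N.^ n
   c = 2 N.^ (n N.+ d)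
   v = u N.+ b
   v' = v N.+ b
   ℓ = q v N.∸ q v'
   ℓ' = N.pred ℓ
   2^i≤v = ≤-tr 2^i≤u (N.m≤m+n u b)
   0<v = N.<-≤-trans (N.m^n>0 2 i) 2^i≤v
   powers : 2 N.^ (2 N.* i N.+ d) N.* b ≡ 2 N.^ (n N.+ d) N.* (2 N.^ i N.* 2 N.^ i)
   powers = E.trans (E.cong (N._* b)(E.trans (N.^-distribˡ-+-* 2 (2 N.* i) d)(E.cong (N._* 2 N.^ d)(E.trans (E.cong (\m -> 2 N.^ (i N.+ m))(N.+-identityʳ i))(N.^-distribˡ-+-* 2 i i)))))
    (E.trans (id42 (2 N.^ i)(2 N.^ d) b)(E.cong (N._* (2 N.^ i N.* 2 N.^ i))(E.sym (N.^-distribˡ-+-* 2 n d))))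
   ℓ≡ : c N.< ℓ -> ℓ ≡ suc ℓ'
   ℓ≡ long = E.sym (N.suc-pred ℓ {{N.>-nonZero (N.≤-<-trans z≤n long)}})
   key : c N.< ℓ -> ℓ' N.* (v N.* v') N.+ (v N.* v' N.+ q v' N.* v' N.* v) N.≤ t N.* b N.+ (v N.* v' N.+ q v' N.* v' N.* v)
   key long = begin
    ℓ' N.* (v N.* v') N.+ (v N.* v' N.+ q v' N.* v' N.* v) ≡⟨ id43 ℓ' v v' (q v') ⟩
    (suc ℓ' N.+ q v') N.* v N.* v' ≡⟨ E.cong (\m -> m N.* v N.* v')(E.trans (E.cong (N._+ q v')(E.sym (ℓ≡ long)))(N.m∸n+n≡m (q-anti 0<v (N.m≤m+n v b)))) ⟩
    q v N.* v N.* v' ≤⟨ N.*-monoˡ-≤ v' (q*≤ v) ⟩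
    t N.* (v N.+ b) ≡⟨ E.trans (N.*-distribˡ-+ t v b)(N.+-comm (t N.* v) _) ⟩
    t N.* b N.+ t N.* v ≤⟨ N.+-monoʳ-≤ (t N.* b)(N.*-monoˡ-≤ v (N.<⇒≤ (t<q* v' (N.<-≤-trans 0<v (N.m≤m+n v b))))) ⟩
    t N.* b N.+ suc (q v') N.* v' N.* v ≡⟨ E.cong (t N.* b N.+_)(id44 v v' (q v')) ⟩
    t N.* b N.+ (v N.* v' N.+ q v' N.* v' N.* v) ∎

  module _ (f g : ℕ -> Carrier){κ1 κ2 : R.Carrier}(0≤κ1 : R.0# R.≤ κ1)(0≤κ2 : R.0# R.≤ κ2)
   (cf : Controlled φ κ1 f)(cg : Controlled φ κ2 g) where
   private
    κ = κ1 R.* κ2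
    0≤κ = R.*-nonneg 0≤κ1 0≤κ2
    G : ℕ -> Carrier
    G = segment g 0

   rectangle : ∀ {x y} i j -> ∣ x ∣ R.≤ κ1 R.* φ R.^ i -> ∣ y ∣ R.≤ κ2 R.* φ R.^ j -> ∣ x * y ∣ R.≤ κ R.* φ R.^ (i N.+ j)
   rectangle {x}{y} i j hx hy = R.≤-respˡ (∣∣-* x y)(R.≤-respʳ (R.trans (R.solve 4 (\a b c d -> a R.:* b R.:* (c R.:* d) R.:= a R.:* c R.:* (b R.:* d)) R.refl κ1 (φ R.^ i) κ2 (φ R.^ j))(R.*-congˡ (R.sym (R.^-homo-* φ i j))))
    (R.*-mono (∣∣-nonneg x)(R.*-nonneg 0≤κ2 (R.^-nonneg j 0≤φ)) hx hy))

   -- The part of the hyperbola above the rectangle of height t/(u + 2ⁿ).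
   triangle : ℕ -> ℕ -> Carrier
   triangle u n = Σ (upTo (2 N.^ n))(\k -> f (u N.+ k) * (G (q (suc (u N.+ k))) - G (q (u N.+ 2 N.^ n))))

   triangle-suc : ∀ u n -> triangle u (suc n) ≈ triangle u n + triangle (u N.+ 2 N.^ n) n
    + segment f u (2 N.^ n) * (G (q (u N.+ 2 N.^ n)) - G (q (u N.+ 2 N.^ n N.+ 2 N.^ n)))
   triangle-suc u n = begin
    triangle u (suc n)
    ≈⟨ reflexive (E.cong (\m -> Σ (upTo m)(\k -> f (u N.+ k) * (G (q (suc (u N.+ k))) - G (q (u N.+ m)))))(E.cong (b N.+_)(N.+-identityʳ b))) ⟩
    Σ (upTo (b N.+ b))(\k -> f (u N.+ k) * (G (q (suc (u N.+ k))) - G (q (u N.+ (b N.+ b)))))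
    ≈⟨ Σ-upTo-+ b b _ ⟩
    Σ (upTo b)(\k -> f (u N.+ k) * (G (q (suc (u N.+ k))) - G (q (u N.+ (b N.+ b)))))
    + Σ (upTo b)(\k -> f (u N.+ (b N.+ k)) * (G (q (suc (u N.+ (b N.+ k)))) - G (q (u N.+ (b N.+ b)))))
    ≈⟨ +-cong (trans (Σ-cong (upTo b)(\k -> trans (*-congˡ (+-congˡ (-‿cong (reflexive (E.cong (\m -> G (q m))(E.sym (N.+-assoc u b b)))))))
    (solve 4 (\x a b c -> x :* (a :- c) := x :* (a :- b) :+ x :* (b :- c)) refl (f (u N.+ k))(G (q (suc (u N.+ k))))(G (q (u N.+ b)))(G (q (u N.+ b N.+ b))))))
    (trans (Σ-+ (upTo b) _ _)(+-congˡ (Σ-*ʳ (upTo b) _ _))))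
    (Σ-cong (upTo b)(\k -> reflexive (cong₂ (\m v -> f m * (G (q (suc m)) - G (q v)))(E.sym (N.+-assoc u b k))(E.sym (N.+-assoc u b b))))) ⟩
    triangle u n + segment f u b * (G (q (u N.+ b)) - G (q (u N.+ b N.+ b))) + triangle (u N.+ b) n
    ≈⟨ solve 3 (\a b c -> a :+ b :+ c := a :+ c :+ b) refl (triangle u n) _ (triangle (u N.+ b) n) ⟩
    triangle u n + triangle (u N.+ b) n + segment f u b * (G (q (u N.+ b)) - G (q (u N.+ b N.+ b))) ∎
    where
    open Setoid-Reasoning setoid
    b = 2 N.^ n

   difference : ∀ m n -> n N.≤ m -> G m - G n ≈ segment g n (m N.∸ n)
   difference m n n≤m = trans (+-congʳ (trans (reflexive (E.cong G (E.sym (N.m+[n∸m]≡n n≤m))))(segment-+ g 0 n (m N.∸ n))))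
    (solve 2 (\a b -> a :+ b :- a := b) refl (G n)(segment g n (m N.∸ n)))

   triangle-≤ : ∀ i d -> 2 N.* i N.+ d ≡ suc l -> ∀ n u -> 2 N.^ i N.≤ u -> ∣ triangle u n ∣ R.≤ κ R.* φ R.^ d R.* a n
   triangle-≤ i d e zero u 2^i≤u = R.≤-respˡ (R.trans (∣∣-cong (trans (+-identityʳ _)(trans (*-congˡ (trans (+-congʳ (reflexive (E.cong (\m -> G (q m))(E.trans (E.cong suc (N.+-identityʳ u))(N.+-comm 1 u)))))(-‿inverseʳ _)))(zeroʳ _)))) ∣0∣)
    (R.*-nonneg (R.*-nonneg 0≤κ (R.^-nonneg d 0≤φ)) 0≤a0)
   triangle-≤ i d e (suc n) u 2^i≤u = begin
    ∣ triangle u (suc n) ∣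
    ≈⟨ ∣∣-cong (triangle-suc u n) ⟩
    ∣ triangle u n + triangle (u N.+ b) n + segment f u b * (G (q v) - G (q (v N.+ b))) ∣
    ≤⟨ R.≤-trans (∣∣-+ _ _)(R.+-mono-≤ (R.≤-trans (∣∣-+ _ _)(R.+-mono-≤ (triangle-≤ i d e n u 2^i≤u)(triangle-≤ i d e n v 2^i≤v)))
    (rectangle n (n N.+ d)(cf u b n N.≤-refl)(R.≤-respˡ (∣∣-cong (difference (q v)(q (v N.+ b))(q-anti 0<v (N.m≤m+n v b))))(cg _ _ (n N.+ d)(drop i d u n e 2^i≤u))))) ⟩
    κ R.* φ R.^ d R.* a n R.+ κ R.* φ R.^ d R.* a n R.+ κ R.* φ R.^ (n N.+ (n N.+ d))
    ≈⟨ R.+-congˡ (R.*-congˡ (R.trans (R.≡-cong (φ R.^_)(id45 n d))(R.^-homo-* φ d (2 N.* n)))) ⟩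
    κ R.* φ R.^ d R.* a n R.+ κ R.* φ R.^ d R.* a n R.+ κ R.* (φ R.^ d R.* φ R.^ (2 N.* n))
    ≈⟨ R.solve 4 (\k d a n -> k R.:* d R.:* a R.:+ k R.:* d R.:* a R.:+ k R.:* (d R.:* n) R.:= k R.:* d R.:* (a R.:+ a R.:+ n)) R.refl κ (φ R.^ d)(a n)(φ R.^ (2 N.* n)) ⟩
    κ R.* φ R.^ d R.* (a n R.+ a n R.+ φ R.^ (2 N.* n))
    ≤⟨ R.*-monoˡ (R.*-nonneg 0≤κ (R.^-nonneg d 0≤φ))(a-step n) ⟩
    κ R.* φ R.^ d R.* a (suc n) ∎
    where
    open R.≤-Reasoning
    b = 2 N.^ n
    v = u N.+ b
    2^i≤v = ≤-tr 2^i≤u (N.m≤m+n u b)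
    0<v = N.<-≤-trans (N.m^n>0 2 i) 2^i≤v

   row : ℕ -> Carrier
   row x = f x * G (q (suc x))

   block : ∀ i d -> 2 N.* i N.+ d ≡ suc l -> ∣ segment row (2 N.^ i)(2 N.^ i) ∣ R.≤ R.# (3 N.* Λ) R.* (κ R.* φ R.^ suc l)
   block i d e = begin
    ∣ segment row b b ∣
    ≈⟨ ∣∣-cong split ⟩
    ∣ triangle b i + segment f b b * G (q (b N.+ b)) ∣
    ≤⟨ R.≤-trans (∣∣-+ _ _)(R.+-mono-≤ (R.≤-trans (triangle-≤ i d e i b N.≤-refl)(R.*-monoˡ (R.*-nonneg 0≤κ (R.^-nonneg d 0≤φ))(a-≤ i i≤l)))
    (rectangle i (l N.∸ i)(cf b b i N.≤-refl)(cg 0 _ (l N.∸ i) q≤))) ⟩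
    κ R.* φ R.^ d R.* (R.# (2 N.* Λ) R.* φ R.^ (2 N.* i)) R.+ κ R.* φ R.^ (i N.+ (l N.∸ i))
    ≤⟨ R.+-mono-≤ (R.≤-reflexive (R.trans (R.solve 4 (\k d a n -> k R.:* d R.:* (a R.:* n) R.:= a R.:* (k R.:* (n R.:* d))) R.refl κ (φ R.^ d)(R.# (2 N.* Λ))(φ R.^ (2 N.* i)))
    (R.*-congˡ (R.*-congˡ (R.trans (R.sym (R.^-homo-* φ (2 N.* i) d))(R.≡-cong (φ R.^_) e))))))
    (R.≤-respˡ (R.≡-cong (\m -> κ R.* φ R.^ m)(N.m+[n∸m]≡n i≤l))(R.≤-respˡ (R.sym (R.trans (R.*-congʳ R.#1)(R.*-identityˡ _)))
    (R.*-mono (R.0≤# 1)(R.*-nonneg 0≤κ (R.^-nonneg (suc l) 0≤φ))(R.#-mono 1≤Λ)(R.*-monoˡ 0≤κ (R.≤-respˡ (R.sym (R.*-identityˡ _))(R.*-monoʳ (R.^-nonneg l 0≤φ) 1≤φ)))))) ⟩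
    R.# (2 N.* Λ) R.* (κ R.* φ R.^ suc l) R.+ R.# Λ R.* (κ R.* φ R.^ suc l)
    ≈⟨ R.trans (R.sym (R.distribʳ _ _ _))(R.*-congʳ (R.trans (R.sym (R.#-+ (2 N.* Λ) Λ))(R.≡-cong R.# (id46 Λ)))) ⟩
    R.# (3 N.* Λ) R.* (κ R.* φ R.^ suc l) ∎
    where
    open R.≤-Reasoning
    b = 2 N.^ i
    i≤l : i N.≤ l
    i≤l = N.≮⇒≥ \l<i -> N.<-irrefl E.refl (N.<-≤-trans (N.m<m+n (suc l){suc l}(s≤s z≤n))(≤-tr (N.+-mono-≤ l<i (≤-tr l<i (N.m≤m+n i 0)))(≤-tr (N.m≤m+n (2 N.* i) d)(≡⇒≤ e))))
    q≤ : q (b N.+ b) N.≤ 2 N.^ (l N.∸ i)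
    q≤ = N.<⇒≤ (subst (\m -> q m N.< 2 N.^ (l N.∸ i))(E.cong (b N.+_)(N.+-identityʳ b))(q<2^ (suc i)(l N.∸ i)(E.cong suc (N.m+[n∸m]≡n i≤l))))
    split : segment row b b ≈ triangle b i + segment f b b * G (q (b N.+ b))
    split = trans (Σ-cong (upTo b)(\k -> solve 3 (\x a b -> x :* a := x :* (a :- b) :+ x :* b) refl (f (b N.+ k))(G (q (suc (b N.+ k))))(G (q (b N.+ b)))))
     (trans (Σ-+ (upTo b) _ _)(+-congˡ (Σ-*ʳ (upTo b) _ _)))

   base : ∣ segment row 0 1 ∣ R.≤ R.# 1 R.* (κ R.* φ R.^ suc l)
   base = R.≤-respʳ (R.sym (R.trans (R.*-congʳ R.#1)(R.*-identityˡ _)))(R.≤-respˡ (∣∣-cong (+-identityʳ _))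
    (rectangle 0 (suc l)(R.≤-respˡ (∣∣-cong (sym (+-identityʳ (f 0))))(cf 0 1 0 N.≤-refl))(cg 0 _ (suc l)(≤-tr (N.m/n≤m t 1)(N.<⇒≤ t<2^1+l)))))

   rows-≤ : ∀ I -> (∀ i -> i N.< I -> 2 N.* i N.≤ suc l) -> ∣ segment row 0 (2 N.^ I) ∣ R.≤ R.# (1 N.+ I N.* (3 N.* Λ)) R.* (κ R.* φ R.^ suc l)
   rows-≤ zero h = base
   rows-≤ (suc I) h = R.≤-respˡ (∣∣-cong (trans (reflexive (E.cong (\m -> segment row 0 (2 N.^ I N.+ m))(N.+-identityʳ (2 N.^ I))))(segment-+ row 0 (2 N.^ I)(2 N.^ I))))
    (R.≤-respʳ (R.trans (R.sym (R.distribʳ _ _ _))(R.*-congʳ (R.trans (R.sym (R.#-+ (1 N.+ I N.* (3 N.* Λ))(3 N.* Λ)))(R.≡-cong R.# (E.cong suc (N.+-comm (I N.* (3 N.* Λ))(3 N.* Λ)))))))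
    (R.≤-trans (∣∣-+ _ _)(R.+-mono-≤ (rows-≤ I (\i i<I -> h i (N.m<n⇒m<1+n i<I)))(block I (suc l N.∸ 2 N.* I)(N.m+[n∸m]≡n (h I N.≤-refl))))))

   prefix : ∀ {P : ℕ -> Set}(P? : ∀ y -> Dec (P y)) m n -> m N.≤ n -> (∀ y -> P y -> y N.< m) -> (∀ y -> y N.< m -> P y) ->
    ∀ h -> Σ (upTo n)(\y -> [ P? y ] * h y) ≈ segment h 0 m
   prefix P? m n m≤n to from h = trans (Σ-upTo-extend _ m≤n (\i m≤i -> trans (*-congʳ ([ P? i ]-no (\p -> N.<⇒≱ (to i p) m≤i)))(zeroˡ _)))
    (Σ-cong∈ (upTo m)(\{y} y∈ -> trans (*-congʳ ([ P? y ]-yes (from y (∈-upTo⁻ y∈))))(*-identityˡ _)))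

   by-rows : hyperbolaSum f g t ≈ Σ (upTo t) row
   by-rows = Σ-cong (upTo t)(\x -> trans (Σ-cong (upTo t)(\y -> solve 3 (\a b c -> a :* (b :* c) := b :* (a :* c)) refl [ suc x N.* suc y N.≤? t ] (f x)(g y)))
    (trans (Σ-*ˡ (upTo t)(f x) _)(*-congˡ (prefix (\y -> suc x N.* suc y N.≤? t)(q (suc x)) t (N.m/n≤m t (suc x))
    (\y h -> ≤-tr (≡⇒≤ (E.sym (m*n/n≡m (suc y)(suc x))))(/-monoˡ-≤ (suc x)(≤-tr (≡⇒≤ (N.*-comm (suc y)(suc x))) h)))
    (\y h -> ≤-tr (≡⇒≤ (N.*-comm (suc x)(suc y)))(≤-tr (N.*-monoˡ-≤ (suc x) h)(q*≤ (suc x)))) g))))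

  hyperbolaSum-swap : ∀ f g -> hyperbolaSum f g t ≈ hyperbolaSum g f t
  hyperbolaSum-swap f g = trans (Σ-swap (upTo t)(upTo t) _)(Σ-cong (upTo t)(\y -> Σ-cong (upTo t)(\x ->
   *-cong ([ suc x N.* suc y N.≤? t ]-⇔ (suc y N.* suc x N.≤? t)(subst (N._≤ t)(N.*-comm (suc x)(suc y)))(subst (N._≤ t)(N.*-comm (suc y)(suc x))))(*-comm (f x)(g y)))))

  module _ {f g : ℕ -> Carrier}{κ1 κ2 : R.Carrier}(0≤κ1 : R.0# R.≤ κ1)(0≤κ2 : R.0# R.≤ κ2)
   (cf : Controlled φ κ1 f)(cg : Controlled φ κ2 g) where
   private
    σ = N.⌊ l /2⌋
    I = suc l N.∸ σ
    s = 2 N.^ σ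
    f̃ = from s f
    cf̃ = from-controlled {f = f} s cf 0≤κ1 0≤φ
    σ≤l : σ N.≤ l
    σ≤l = N.⌊n/2⌋≤n l
    s≤t : s N.≤ t
    s≤t = ≤-tr (N.^-monoʳ-≤ 2 σ≤l) 2^l≤t
    rowf rowf̃ rowg : ℕ -> Carrier
    rowf = row f g 0≤κ1 0≤κ2 cf cg
    rowf̃ = row f̃ g 0≤κ1 0≤κ2 cf̃ cg
    rowg = row g f̃ 0≤κ2 0≤κ1 cg cf̃

   upper-rows : hyperbolaSum f̃ g t ≈ segment rowf s (t N.∸ s)
   upper-rows = trans (by-rows f̃ g 0≤κ1 0≤κ2 cf̃ cg)(trans (reflexive (E.cong (\m -> Σ (upTo m) rowf̃)(E.sym (N.m+[n∸m]≡n s≤t))))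
    (trans (Σ-upTo-+ s (t N.∸ s) rowf̃)(trans (+-cong (Σ-zero (upTo s)(\{x} x∈ -> trans (*-congʳ (trans (*-congʳ ([ s N.≤? x ]-no (N.<⇒≱ (∈-upTo⁻ x∈))))(zeroˡ _)))(zeroˡ _)))
    (Σ-cong (upTo (t N.∸ s))(\x -> *-congʳ (trans (*-congʳ ([ s N.≤? s N.+ x ]-yes (N.m≤m+n s x)))(*-identityˡ _)))))(+-identityˡ _))))

   low-zero : ∀ m -> m N.≤ s -> segment f̃ 0 m ≈ 0#
   low-zero m m≤s = Σ-zero (upTo m)(\{x} x∈ -> trans (*-congʳ ([ s N.≤? x ]-no (N.<⇒≱ (N.<-≤-trans (∈-upTo⁻ x∈) m≤s))))(zeroˡ _))

   columns : Σ (upTo t) rowg ≈ segment rowg 0 (2 N.^ I)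
   columns = either (N.≤-total (2 N.^ I) t)
    where
    vanish : ∀ y -> 2 N.^ I N.≤ y -> rowg y ≈ 0#
    vanish y 2^I≤y = trans (*-congˡ (low-zero (q (suc y))(N.<⇒≤ (N.*-cancelʳ-< (suc y) _ _ (N.≤-<-trans (q*≤ (suc y))(N.<-≤-trans t<2^1+l
     (≤-tr (≡⇒≤ (E.trans (E.cong (2 N.^_)(E.sym (N.m+[n∸m]≡n (≤-tr σ≤l (N.n≤1+n l)))))(N.^-distribˡ-+-* 2 σ I)))(N.*-monoʳ-≤ s (≤-tr 2^I≤y (N.n≤1+n y))))))))))(zeroʳ _)
    vanish' : ∀ y -> t N.≤ y -> rowg y ≈ 0#
    vanish' y t≤y = trans (*-congˡ (low-zero (q (suc y))(≤-tr (≡⇒≤ (N.m<n⇒m/n≡0 (s≤s t≤y))) z≤n)))(zeroʳ _)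
    either : _ -> Σ (upTo t) rowg ≈ segment rowg 0 (2 N.^ I)
    either (inl h) = Σ-upTo-extend rowg h vanish
    either (inr h) = sym (Σ-upTo-extend rowg h vanish')

   hyperbola : hyperbolaSum f g t ≈ segment rowf 0 s + segment rowg 0 (2 N.^ I)
   hyperbola = trans (by-rows f g 0≤κ1 0≤κ2 cf cg)(trans (reflexive (E.cong (\m -> Σ (upTo m) rowf)(E.sym (N.m+[n∸m]≡n s≤t))))
    (trans (Σ-upTo-+ s (t N.∸ s) rowf)(+-congˡ (trans (sym upper-rows)(trans (hyperbolaSum-swap f̃ g)(trans (by-rows g f̃ 0≤κ2 0≤κ1 cg cf̃) columns))))))

   hyperbolaSum-≤ : ∣ hyperbolaSum f g t ∣ R.≤ R.# (8 N.* (suc l N.* Λ)) R.* (κ1 R.* κ2 R.* φ R.^ suc l)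
   hyperbolaSum-≤ = R.≤-respˡ (∣∣-cong hyperbola)(R.≤-trans (∣∣-+ _ _)(R.≤-trans (R.+-mono-≤
    (rows-≤ f g 0≤κ1 0≤κ2 cf cg σ (\i i<σ -> ≤-tr (N.*-monoʳ-≤ 2 (N.<⇒≤ i<σ))(≤-tr (2⌊/2⌋≤ l)(N.n≤1+n l))))
    (R.≤-respʳ (R.*-congˡ (R.*-congʳ (R.*-comm κ2 κ1)))(rows-≤ g f̃ 0≤κ2 0≤κ1 cg cf̃ I below)))
    (R.≤-respˡ (R.trans (R.sym (R.distribʳ _ _ _))(R.*-congʳ (R.sym (R.#-+ (1 N.+ σ N.* (3 N.* Λ))(1 N.+ I N.* (3 N.* Λ))))))
    (R.*-monoʳ (R.*-nonneg (R.*-nonneg 0≤κ1 0≤κ2)(R.^-nonneg (suc l) 0≤φ))(R.#-mono count)))))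
    where
    2⌊/2⌋≤ : ∀ n -> 2 N.* N.⌊ n /2⌋ N.≤ n
    2⌊/2⌋≤ n = ≤-tr (N.+-monoʳ-≤ N.⌊ n /2⌋ (≤-tr (≡⇒≤ (N.+-identityʳ _))(N.⌊n/2⌋≤⌈n/2⌉ n)))(≡⇒≤ (N.⌊n/2⌋+⌈n/2⌉≡n n))
    σ+I : σ N.+ I ≡ suc l
    σ+I = N.m+[n∸m]≡n (≤-tr σ≤l (N.n≤1+n l))
    below : ∀ i -> i N.< I -> 2 N.* i N.≤ suc l
    below i i<I = ≤-tr (N.*-monoʳ-≤ 2 (N.+-cancelˡ-≤ σ _ _ (≤-tr (N.s≤s⁻¹ (subst (σ N.+ i N.<_) σ+I (N.+-monoʳ-< σ i<I)))
     (≡⇒≤ (E.sym (N.⌊n/2⌋+⌈n/2⌉≡n l))))))(2⌊/2⌋≤ (suc l))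
    count : 1 N.+ σ N.* (3 N.* Λ) N.+ (1 N.+ I N.* (3 N.* Λ)) N.≤ 8 N.* (suc l N.* Λ)
    count = ≤-tr (≡⇒≤ (E.trans (id47 σ I Λ)(E.cong (\m -> 2 N.+ 3 N.* (m N.* Λ)) σ+I)))
     (≤-tr (N.+-monoˡ-≤ (3 N.* (suc l N.* Λ))(N.*-monoʳ-≤ 2 (N.*-mono-≤ (s≤s (z≤n {l})) 1≤Λ)))
     (≤-tr (≡⇒≤ (E.sym (N.*-distribʳ-+ (suc l N.* Λ) 2 3)))(N.*-monoˡ-≤ (suc l N.* Λ)(N.m≤m+n 5 3))))



module Growth (ℝ : RealField) where
 open RealProperties ℝ

 Growth : ℕ -> ℕ -> Carrier -> Set
 Growth l Λ φ = Σ[ a ∈ (ℕ -> Carrier) ] 0# ≤ a 0 × (∀ n -> a n + a n + φ ^ (2 N.* n) ≤ a (suc n)) × (∀ n -> n N.≤ l -> a n ≤ # (2 N.* Λ) * φ ^ (2 N.* n))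

 even-suc : ∀ φ n -> φ ^ (2 N.* suc n) ≈ φ * φ * φ ^ (2 N.* n)
 even-suc φ n = trans (≡-cong (\m -> φ * φ ^ m)(N.+-suc n (n N.+ 0)))(sym (*-assoc φ φ _))

 balanced : ∀ {φ} l -> 0# ≤ φ -> φ * φ ≈ # 2 -> Growth l (suc l) φ
 balanced {φ} l 0≤φ φ² = (\n -> # n * φ ^ (2 N.* n)) , *-nonneg (0≤# 0) 0≤1 , step ,
  \n n≤l -> *-monoʳ (^-nonneg (2 N.* n) 0≤φ)(#-mono (≤-tr n≤l (≤-tr (N.n≤1+n l)(N.m≤m+n (suc l) _))))
  where
  step : ∀ n -> # n * φ ^ (2 N.* n) + # n * φ ^ (2 N.* n) + φ ^ (2 N.* n) ≤ # (suc n) * φ ^ (2 N.* suc n)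
  step n = ≤-respʳ (trans (solve 2 (\n x -> n :* x :+ n :* x :+ x :+ x := (:1 :+ n) :* ((:1 :+ (:1 :+ :0)) :* x)) refl (# n)(φ ^ (2 N.* n)))
   (*-congˡ (sym (trans (even-suc φ n)(*-congʳ φ²)))))(x≤x+y (^-nonneg (2 N.* n) 0≤φ))

 steep : ∀ {φ} l -> 0# ≤ φ -> # 5 ≤ # 2 * (φ * φ) -> Growth l 1 φ
 steep {φ} l 0≤φ h = (\n -> # 2 * φ ^ (2 N.* n)) , *-nonneg (0≤# 2) 0≤1 , step , \n _ -> ≤-refl
  where
  step : ∀ n -> # 2 * φ ^ (2 N.* n) + # 2 * φ ^ (2 N.* n) + φ ^ (2 N.* n) ≤ # 2 * φ ^ (2 N.* suc n)
  step n = ≤-respˡ (solve 1 (\x -> (:1 :+ (:1 :+ :0)) :* x :+ (:1 :+ (:1 :+ :0)) :* x :+ x := (:1 :+ (:1 :+ (:1 :+ (:1 :+ (:1 :+ :0))))) :* x) refl (φ ^ (2 N.* n)))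
   (≤-respʳ (trans (*-assoc _ _ _)(*-congˡ (sym (even-suc φ n))))(*-monoʳ (^-nonneg (2 N.* n) 0≤φ) h))

 -- φ = 2^{1 - 1/r} for r = s + 2.
 exponential : ℕ -> Carrier
 exponential s = root (suc (suc s))(# 2 ^ suc s)

 exponential-power : ∀ s -> exponential s ^ suc (suc s) ≈ # 2 ^ suc s
 exponential-power s = root-power (suc s)(^-nonneg (suc s)(0≤# 2))

 1≤exponential : ∀ s -> 1# ≤ exponential s
 1≤exponential s = 1≤root (suc s)(1≤^ (suc s)(1≤#suc 1))

 growth : ∀ s l -> Growth l (suc l N.^ ν (suc (suc s)))(exponential s)
 growth zero l = subst (\ Λ -> Growth l Λ (exponential 0))(E.sym (N.*-identityʳ (suc l)))(balanced l (root-nonneg 1 _)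
  (trans (*-congˡ (sym (*-identityʳ _)))(trans (exponential-power 0)(*-identityʳ _))))
 growth (suc s) l = steep l 0≤φ (^-cancel-≤ (suc (suc s))(*-nonneg (0≤# 2)(*-nonneg 0≤φ 0≤φ))(begin
  # 5 ^ r ≈⟨ #-^ 5 r ⟨
  # (5 N.^ r) ≤⟨ #-mono (powers s) ⟩
  # (2 N.^ r N.* (2 N.^ r' N.* 2 N.^ r')) ≈⟨ trans (#-* (2 N.^ r) _)(*-cong (#-^ 2 r)(trans (#-* (2 N.^ r')(2 N.^ r'))(*-cong (#-^ 2 r')(#-^ 2 r')))) ⟩
  # 2 ^ r * (# 2 ^ r' * # 2 ^ r') ≈⟨ *-congˡ (trans (^-distrib-* φ φ r)(*-cong (exponential-power (suc s))(exponential-power (suc s)))) ⟨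
  # 2 ^ r * (φ * φ) ^ r ≈⟨ ^-distrib-* (# 2)(φ * φ) r ⟨
  (# 2 * (φ * φ)) ^ r ∎))
  where
  open ≤-Reasoning
  r' = suc (suc s)
  r = suc r'
  φ = exponential (suc s)
  0≤φ = root-nonneg r' (# 2 ^ r')
  powers : ∀ s -> 5 N.^ (3 N.+ s) N.≤ 2 N.^ (3 N.+ s) N.* (2 N.^ (2 N.+ s) N.* 2 N.^ (2 N.+ s))
  powers zero = N.m≤m+n 125 3
  powers (suc s) = ≤-tr (N.*-mono-≤ (N.m≤m+n 5 3)(powers s))(≡⇒≤ (id48 (2 N.^ (3 N.+ s))(2 N.^ (2 N.+ s))))

n<2^n : ∀ n -> n N.< 2 N.^ n
n<2^n zero = s≤s z≤n
n<2^n (suc n) = N.+-mono-≤ (N.m^n>0 2 n)(≤-tr (n<2^n n)(N.m≤m+n _ 0))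

binary : ∀ n -> 0 N.< n -> Σ[ l ∈ ℕ ] 2 N.^ l N.≤ n × n N.< 2 N.^ suc l
binary n 0<n = IntegerParts.bracket (2 N.^_) n n 0<n (n<2^n n)

module CharacterSegments {p}{F : PrimeField p}{ℝ}{ℂ : NormedRing ℝ}(ψ : Character F ℂ)
 (k : ℕ)(p≡ : p ≡ 3 N.+ k)(s : ℕ) where
 open RealProperties ℝ
 open Growth ℝ
 open Staircase ℂ using (Controlled;segment)
 open ShiftedSums ψ k p≡ using (embed;interval)
 open BurgessConstants ℂ s using (r;r';C;0≤C)
 private module C = NormedRing ℂ

 private
  0<p : 0 N.< p
  0<p = subst (0 N.<_)(E.sym p≡)(s≤s z≤n)
  bracketed = binary p 0<p

 L : ℕ
 L = fst bracketed

 2^L≤p : 2 N.^ L N.≤ p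
 2^L≤p = fst (snd bracketed)

 p<2^1+L : p N.< 2 N.^ suc L
 p<2^1+L = snd (snd bracketed)

 open BurgessBound ψ k p≡ s L 2^L≤p p<2^1+L using (Q;0≤Q;Q^4r;F';0≤F;bound;E;E^r;0≤E;burgess;1≤L) public

 sequence : ℕ -> C.Carrier
 sequence n = Character.χ ψ (embed (suc n))

 R κ : Carrier
 R = root r (C * F')
 κ = # 8 * R

 0≤R : 0# ≤ R
 0≤R = root-nonneg r' _

 0≤κ : 0# ≤ κ
 0≤κ = *-nonneg (0≤# 8) 0≤R

 R^r : R ^ r ≈ C * F'
 R^r = root-power r' (*-nonneg 0≤C 0≤F)

 controlled : Controlled (exponential s) κ sequence
 controlled M N j N≤ = ≤-trans (burgess N (suc M))(≤-respʳ (sym (*-assoc _ _ _))(*-monoˡ (0≤# 8)(^-cancel-≤ r' (*-nonneg 0≤R (^-nonneg j 0≤φ))(begin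
  E N ^ r ≈⟨ E^r N ⟩
  C * (# N ^ r' * F') ≤⟨ *-monoˡ 0≤C (*-monoʳ 0≤F (^-mono r' (0≤# N)(#-mono N≤))) ⟩
  C * (# (2 N.^ j) ^ r' * F') ≈⟨ solve 3 (\c n f -> c :* (n :* f) := c :* f :* n) refl C _ F' ⟩
  C * F' * # (2 N.^ j) ^ r' ≈⟨ *-cong (sym R^r)(trans (^-congˡ r' (#-^ 2 j))(trans (^-assocʳ (# 2) j r')(trans (≡-cong ((# 2) ^_)(N.*-comm j r'))
  (trans (sym (^-assocʳ (# 2) r' j))(trans (^-congˡ j (sym (exponential-power s)))(trans (^-assocʳ φ r j)(trans (≡-cong (φ ^_)(N.*-comm r j))(sym (^-assocʳ φ j r))))))))) ⟩
  R ^ r * (φ ^ j) ^ r ≈⟨ ^-distrib-* R (φ ^ j) r ⟨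
  (R * φ ^ j) ^ r ∎))))
  where
  open ≤-Reasoning
  φ = exponential s
  0≤φ = root-nonneg r' (# 2 ^ r')

open IntegerParts using (^-distribʳ-*;quotient)

-- Abstract, since conversion checking would unfold the numeral.
abstract
 power-≤-exponential : ∀ k -> Σ[ K ∈ ℕ ] (∀ l x -> x N.≤ suc l -> x N.^ k N.≤ K N.* 2 N.^ l)
 power-≤-exponential k = suc k N.^ k , \l x x≤ -> below l x x≤ (quotient (suc k)(s≤s z≤n) l)
  where
  open N.≤-Reasoning
  below : ∀ l x -> x N.≤ suc l -> Σ[ m ∈ ℕ ] m N.* suc k N.≤ l × l N.< suc m N.* suc k -> x N.^ k N.≤ suc k N.^ k N.* 2 N.^ l
  below l x x≤ (m , m*≤ , <*) = begin
   x N.^ k ≤⟨ N.^-monoˡ-≤ k (≤-tr x≤ (≤-tr <* (N.*-monoˡ-≤ (suc k)(n<2^n m)))) ⟩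
   (2 N.^ m N.* suc k) N.^ k ≡⟨ ^-distribʳ-* k (2 N.^ m)(suc k) ⟩
   (2 N.^ m) N.^ k N.* suc k N.^ k ≡⟨ E.trans (N.*-comm ((2 N.^ m) N.^ k)(suc k N.^ k))(E.cong (suc k N.^ k N.*_)(N.^-*-assoc 2 m k)) ⟩
   suc k N.^ k N.* 2 N.^ (m N.* k) ≤⟨ N.*-monoʳ-≤ (suc k N.^ k)(N.^-monoʳ-≤ 2 (≤-tr (N.*-monoʳ-≤ m (N.n≤1+n k)) m*≤)) ⟩
   suc k N.^ k N.* 2 N.^ l ∎

module HyperbolaConstants {ℝ}(ℂ : NormedRing ℝ)(s : ℕ) where
 open RealProperties ℝ
 open BurgessConstants ℂ s public

 v w m n E e : ℕ
 v = ν r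
 w = r N.+ 1
 m = v N.* (r N.* w) N.+ r N.^ 2 N.+ 1
 n = 1 N.+ (v N.+ 1) N.* r
 E = suc r N.* w N.+ suc r N.+ w N.+ m
 e = (2 N.* E N.+ 1) N.* 2

 multiplier : ℕ
 multiplier = fst (power-≤-exponential (suc v N.* r N.* w))

 smallConstant largeConstant finalConstant : Carrier
 smallConstant = (# 8 * # e ^ suc v) ^ r * (# 8 ^ r * (C * # 2)) * (# 8 ^ r * (C * # 2)) * # 2 ^ r'
 largeConstant = smallConstant ^ w * # multiplier
 finalConstant = smallConstant + 1# + (largeConstant + 1# + 1#)

 0≤smallConstant : 0# ≤ smallConstant
 0≤smallConstant = *-nonneg (*-nonneg (*-nonneg (^-nonneg r (*-nonneg (0≤# 8)(^-nonneg (suc v)(0≤# e)))) 0≤c) 0≤c)(^-nonneg r' (0≤# 2))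
  where 0≤c = *-nonneg (^-nonneg r (0≤# 8))(*-nonneg 0≤C (0≤# 2))

 0≤largeConstant : 0# ≤ largeConstant
 0≤largeConstant = *-nonneg (^-nonneg w 0≤smallConstant)(0≤# multiplier)

 small≤final : smallConstant + 1# ≤ finalConstant
 small≤final = x≤x+y (+-nonneg (+-nonneg 0≤largeConstant 0≤1) 0≤1)

 large≤final : largeConstant + 1# + 1# ≤ finalConstant
 large≤final = x≤y+x (+-nonneg 0≤smallConstant 0≤1)

 1≤final : 1# ≤ finalConstant
 1≤final = ≤-trans (x≤y+x 0≤smallConstant) small≤final

 extract : ∀ j {K S X} -> 0# ≤ K -> 0# ≤ X -> S ^ suc j ≤ K * X ^ suc j -> S ≤ (K + 1#) * X
 extract j {K}{S}{X} 0≤K 0≤X h = ^-cancel-≤ j (*-nonneg 0≤K+1 0≤X)(≤-trans h (≤-respʳ (sym (^-distrib-* (K + 1#) X (suc j)))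
  (*-monoʳ (^-nonneg (suc j) 0≤X)(≤-trans (x≤x+y 0≤1)(≤-respˡ (sym (*-identityʳ _))(*-monoˡ 0≤K+1 (1≤^ j (x≤y+x 0≤K))))))))
  where 0≤K+1 = +-nonneg 0≤K 0≤1

 ^-swap : ∀ x i j -> (x ^ i) ^ j ≈ (x ^ j) ^ i
 ^-swap x i j = trans (^-assocʳ x i j)(trans (≡-cong (x ^_)(N.*-comm i j))(sym (^-assocʳ x j i)))

module HyperbolaEstimate {p1 p2 : ℕ}{F1 : PrimeField p1}{F2 : PrimeField p2}{ℝ}{ℂ : NormedRing ℝ}
 (ψ1 : Character F1 ℂ)(ψ2 : Character F2 ℂ)(k1 k2 : ℕ)(p1≡ : p1 ≡ 3 N.+ k1)(p2≡ : p2 ≡ 3 N.+ k2)(p1≤p2 : p1 N.≤ p2)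
 (s : ℕ) where
 open IntegerParts using (^-distribʳ-*)
 open RealProperties ℝ
 open HyperbolaConstants ℂ s
 open Growth ℝ
 open Staircase ℂ using (hyperbolaSum;hyperbolaSum-≤)
 module A = CharacterSegments ψ1 k1 p1≡ s
 module B = CharacterSegments ψ2 k2 p2≡ s

 module _ (fromℕ : ℕ -> Carrier)(fromℕ≈ : ∀ n -> fromℕ n ≈ # n)
  (ℓ1 ℓ2 : Carrier)(L1≤ : # A.L ≤ # 2 * ℓ1)(L2≤ : # B.L ≤ # 2 * ℓ2)(ℓ1≤p1 : ℓ1 ≤ # p1)(ℓ2≤p2 : ℓ2 ≤ # p2)
  (t : ℕ)(0<t : 0 N.< t)(T : Carrier)(t≤T : # t ≤ T) where
  private
   a = A.Q
   b = B.Q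
   l = fst (binary t 0<t)
   2^l≤t = fst (snd (binary t 0<t))
   t<2^1+l = snd (snd (binary t 0<t))
   S = NormedRing.∣_∣ ℂ (hyperbolaSum A.sequence B.sequence t)
   P = root (4 N.* r N.^ 2)(fromℕ (p1 N.* p2) ^ w)
   X = root r (T ^ r') * P * root r (ℓ1 ^ 1) * root r (ℓ2 ^ n)
   Y0 = root w (T ^ r)
   Y1 = root (4 N.* r)(fromℕ p2 ^ 1)
   Y2 = root w (ℓ2 ^ 2)
   Y = Y0 * Y1 * Y2
   threshold = root (4 N.* r)(fromℕ p1 ^ (w N.^ 2)) * root (4 N.* r)(fromℕ p2 ^ w) * ℓ1 ^ w * ℓ2 ^ m
   w≡ : w ≡ suc r
   w≡ = N.+-comm r 1
   4r-1 = N.pred (4 N.* r)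
   4r²-1 = N.pred (4 N.* r N.^ 2)
   ^w≈ : ∀ x -> x ^ w ≈ x ^ suc r
   ^w≈ x = ≡-cong (x ^_) w≡
   0≤half : ∀ {L ℓ} -> # L ≤ # 2 * ℓ -> 0# ≤ ℓ
   0≤half {L} h = *-cancelˡ-≤ (#suc≰0 1)(≤-respˡ (zeroʳ _)(≤-trans (0≤# L) h))
   0≤ℓ1 = 0≤half {A.L} L1≤
   0≤ℓ2 = 0≤half {B.L} L2≤
   1≤T : 1# ≤ T
   1≤T = ≤-trans (≤-respˡ (sym #1)(#-mono 0<t)) t≤T
   0≤T = ≤-trans 0≤1 1≤T
   0≤fromℕ : ∀ n -> 0# ≤ fromℕ n
   0≤fromℕ n = ≤-respʳ (sym (fromℕ≈ n))(0≤# n)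
   0≤a^ = \j -> ^-nonneg j A.0≤Q
   0≤b^ = \j -> ^-nonneg j B.0≤Q
   0≤T^ = \j -> ^-nonneg j 0≤T
   0≤ℓ1^ = \j -> ^-nonneg j 0≤ℓ1
   0≤ℓ2^ = \j -> ^-nonneg j 0≤ℓ2
   0<p1 : 0 N.< p1
   0<p1 = subst (0 N.<_)(E.sym p1≡)(s≤s z≤n)
   1≤p2 : 1# ≤ # p2
   1≤p2 = ≤-respˡ (sym #1)(#-mono (≤-tr 0<p1 p1≤p2))

   0≤X : 0# ≤ X
   0≤X = *-nonneg (*-nonneg (*-nonneg (root-nonneg r' (T ^ r'))(root-nonneg 4r²-1 (fromℕ (p1 N.* p2) ^ w)))(root-nonneg r' (ℓ1 ^ 1)))(root-nonneg r' (ℓ2 ^ n))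

   0≤Y : 0# ≤ Y
   0≤Y = *-nonneg (*-nonneg (root-nonneg (suc (s N.+ 1))(T ^ r))(root-nonneg 4r-1 _))(root-nonneg (suc (s N.+ 1))(ℓ2 ^ 2))

   0≤ab = *-nonneg A.0≤Q B.0≤Q

   P^r : P ^ r ≈ a * b
   P^r = ^-injective 4r-1 (^-nonneg r (root-nonneg 4r²-1 _)) 0≤ab (begin-equality
    (P ^ r) ^ (4 N.* r) ≈⟨ trans (^-assocʳ P r (4 N.* r))(≡-cong (P ^_)(id49 r)) ⟩
    P ^ (4 N.* r N.^ 2) ≈⟨ root-power 4r²-1 (^-nonneg w (0≤fromℕ (p1 N.* p2))) ⟩
    fromℕ (p1 N.* p2) ^ w ≈⟨ trans (^w≈ _)(^-congˡ (suc r)(trans (fromℕ≈ _)(#-* p1 p2))) ⟩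
    (# p1 * # p2) ^ suc r ≈⟨ ^-distrib-* (# p1)(# p2)(suc r) ⟩
    # p1 ^ suc r * # p2 ^ suc r ≈⟨ *-cong A.Q^4r B.Q^4r ⟨
    a ^ (4 N.* r) * b ^ (4 N.* r) ≈⟨ ^-distrib-* a b (4 N.* r) ⟨
    (a * b) ^ (4 N.* r) ∎)
    where
    open ≤-Reasoning

   X^r : X ^ r ≈ T ^ r' * (a * b) * ℓ1 * ℓ2 ^ n
   X^r = trans (^-distrib-* (root r (T ^ r') * P * root r (ℓ1 ^ 1)) _ r)(*-cong (trans (^-distrib-* (root r (T ^ r') * P) _ r)(*-cong (trans (^-distrib-* (root r (T ^ r')) P r)
    (*-cong (root-power r' (0≤T^ r')) P^r))(trans (root-power r' (0≤ℓ1^ 1))(*-identityʳ ℓ1))))(root-power r' (0≤ℓ2^ n)))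

   first-root : root (4 N.* r)(fromℕ p1 ^ (w N.^ 2)) ≈ a ^ w
   first-root = root-unique 4r-1 (^-nonneg (w N.^ 2)(0≤fromℕ p1))(0≤a^ w)(trans (^-swap a w (4 N.* r))(trans (^-congˡ w A.Q^4r)
    (trans (^-assocʳ (# p1)(suc r) w)(trans (≡-cong ((# p1) ^_)(E.trans (E.cong (N._* w)(E.sym w≡))(E.cong (w N.*_)(E.sym (N.*-identityʳ w)))))
    (^-congˡ (w N.^ 2)(sym (fromℕ≈ p1)))))))

   second-root : root (4 N.* r)(fromℕ p2 ^ w) ≈ b
   second-root = root-cong 4r-1 (^-nonneg w (0≤fromℕ p2))(trans (^w≈ _)(^-congˡ (suc r)(fromℕ≈ p2)))

   threshold≈ : threshold ≈ a ^ w * b * ℓ1 ^ w * ℓ2 ^ m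
   threshold≈ = *-congʳ (*-congʳ (*-cong first-root second-root))

   threshold-≤ : threshold ≤ # p2 ^ E
   threshold-≤ = ≤-respˡ threshold≈ (≤-respʳ (sym (trans (^-homo-* (# p2)(suc r N.* w N.+ suc r N.+ w) m)(*-congʳ (trans (^-homo-* (# p2)(suc r N.* w N.+ suc r) w)
    (*-congʳ (^-homo-* (# p2)(suc r N.* w)(suc r)))))))
    (*-mono (*-nonneg (*-nonneg (0≤a^ w) B.0≤Q)(0≤ℓ1^ w))(^-nonneg m (0≤# p2))
    (*-mono (*-nonneg (0≤a^ w) B.0≤Q)(^-nonneg w (0≤# p2))
    (*-mono (0≤a^ w)(^-nonneg (suc r)(0≤# p2))(≤-respʳ (^-assocʳ (# p2)(suc r) w)(^-mono w A.0≤Q a≤)) b≤)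
    (^-mono w 0≤ℓ1 (≤-trans ℓ1≤p1 (#-mono p1≤p2))))
    (^-mono m 0≤ℓ2 ℓ2≤p2)))
    where
    one-≤ : ∀ {x y} -> 0# ≤ x -> 1# ≤ y -> x ^ (4 N.* r) ≈ y -> x ≤ y
    one-≤ {x}{y} 0≤x 1≤y e = ^-cancel-≤ 4r-1 (≤-trans 0≤1 1≤y)(≤-respˡ e (≤-respˡ (sym (*-identityʳ y))(*-monoˡ (≤-trans 0≤1 1≤y)(1≤^ 4r-1 1≤y))))
    1≤p1 : 1# ≤ # p1
    1≤p1 = ≤-respˡ (sym #1)(#-mono 0<p1)
    a≤ : a ≤ # p2 ^ suc r
    a≤ = ≤-trans (one-≤ A.0≤Q (1≤^ (suc r) 1≤p1) A.Q^4r)(^-mono (suc r)(0≤# p1)(#-mono p1≤p2))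
    b≤ : b ≤ # p2 ^ suc r
    b≤ = one-≤ B.0≤Q (1≤^ (suc r) 1≤p2) B.Q^4r

   below-threshold : T ≤ threshold -> l N.≤ suc B.L N.* E
   below-threshold h = N.≮⇒≥ \lt -> N.<-irrefl E.refl (N.<-≤-trans (N.^-monoʳ-< 2 (s≤s (s≤s z≤n)) lt)(≤-tr
    (#-reflect (≤-trans (#-mono 2^l≤t)(≤-trans t≤T (≤-trans h (≤-respʳ (sym (#-^ p2 E)) threshold-≤)))))
    (≤-tr (N.^-monoˡ-≤ E (N.<⇒≤ B.p<2^1+L))(≡⇒≤ (N.^-*-assoc 2 (suc B.L) E)))))

   l0 = suc B.L N.* E
   h = l N.∸ l0
   H = # (suc h) ^ (suc v N.* r)

   main-bound : S ^ r ≤ smallConstant * (H * X ^ r)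
   main-bound = begin
    S ^ r
    ≤⟨ ^-mono r (NormedRing.∣∣-nonneg ℂ _) S≤ ⟩
    (# 8 * (y * η) ^ suc v * (A.κ * B.κ * φ ^ suc l)) ^ r
    ≈⟨ trans (^-distrib-* (# 8 * (y * η) ^ suc v) _ r)(*-congˡ (trans (^-distrib-* (A.κ * B.κ) _ r)(*-congʳ (^-distrib-* A.κ B.κ r)))) ⟩
    (# 8 * (y * η) ^ suc v) ^ r * (A.κ ^ r * B.κ ^ r * (φ ^ suc l) ^ r)
    ≤⟨ *-monoˡ (^-nonneg r 0≤8y)(*-mono (*-nonneg (^-nonneg r A.0≤κ)(^-nonneg r B.0≤κ))(^-nonneg r' (*-nonneg (0≤# 2) 0≤T))
    (*-mono (^-nonneg r A.0≤κ)(*-nonneg (^-nonneg r (0≤# 8))(*-nonneg 0≤C (*-nonneg B.0≤Q (*-nonneg (0≤# 2) 0≤ℓ2))))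
    (κ≤ {L = A.L} A.R^r A.0≤Q L1≤)(κ≤ {L = B.L} B.R^r B.0≤Q L2≤)) φ≤) ⟩
    (# 8 * (y * η) ^ suc v) ^ r * (# 8 ^ r * (C * (a * (# 2 * ℓ1))) * (# 8 ^ r * (C * (b * (# 2 * ℓ2)))) * (# 2 * T) ^ r')
    ≈⟨ *-cong 8y (*-congˡ (^-distrib-* (# 2) T r')) ⟩
    (# 8 * # e ^ suc v) ^ r * ℓ2 ^ ((v N.+ 1) N.* r) * H * (# 8 ^ r * (C * (a * (# 2 * ℓ1))) * (# 8 ^ r * (C * (b * (# 2 * ℓ2)))) * (# 2 ^ r' * T ^ r'))
    ≈⟨ solve 12 (\y z h e c a t ℓ b ℓ' u T -> y :* z :* h :* (e :* (c :* (a :* (t :* ℓ))) :* (e :* (c :* (b :* (t :* ℓ')))) :* (u :* T))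
    := y :* (e :* (c :* t)) :* (e :* (c :* t)) :* u :* (h :* (T :* (a :* b) :* ℓ :* (ℓ' :* z))))
    refl ((# 8 * # e ^ suc v) ^ r)(ℓ2 ^ ((v N.+ 1) N.* r)) H (# 8 ^ r) C a (# 2) ℓ1 b ℓ2 (# 2 ^ r')(T ^ r') ⟩
    smallConstant * (H * (T ^ r' * (a * b) * ℓ1 * ℓ2 ^ n))
    ≈⟨ *-congˡ (*-congˡ X^r) ⟨
    smallConstant * (H * X ^ r) ∎
    where
    open ≤-Reasoning
    φ = exponential s
    Λ = suc l N.^ ν r
    y = # e * ℓ2
    0≤y = *-nonneg (0≤# e) 0≤ℓ2
    η = # (suc h)
    0≤8y = *-nonneg (0≤# 8)(^-nonneg (suc v)(*-nonneg 0≤y (0≤# (suc h))))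
    g = growth s l
    suc-l≤y : # (suc l) ≤ y * η
    suc-l≤y = ≤-trans (#-mono (≤-tr split (N.*-monoˡ-≤ (suc h) count)))(≤-respˡ (trans (#-* ((2 N.* E N.+ 1) N.* B.L)(suc h))(*-congʳ (#-* (2 N.* E N.+ 1) B.L)))
     (*-monoʳ (0≤# (suc h))(≤-respʳ (trans (sym (*-assoc _ _ _))(*-congʳ (sym (#-* (2 N.* E N.+ 1) 2))))(*-monoˡ (0≤# (2 N.* E N.+ 1)) L2≤))))
     where
     split : suc l N.≤ suc l0 N.* suc h
     split = ≤-tr (s≤s (≤-tr (N.m≤n+m∸n l l0)(≤-tr (≡⇒≤ (N.+-comm l0 h))(N.+-monoʳ-≤ h (N.m≤m*n l0 (suc h)))))) N.≤-refl
     count : suc l0 N.≤ (2 N.* E N.+ 1) N.* B.L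
     count = ≤-tr (N.+-mono-≤ B.1≤L (N.*-monoˡ-≤ E (N.+-monoˡ-≤ B.L B.1≤L)))(≡⇒≤ (id50 B.L E))
    S≤ : S ≤ # 8 * (y * η) ^ suc v * (A.κ * B.κ * φ ^ suc l)
    S≤ = ≤-trans (hyperbolaSum-≤ t l 2^l≤t t<2^1+l φ (1≤exponential s)(fst g)(fst (snd g))(fst (snd (snd g))) Λ (N.m^n>0 (suc l)(ν r))(snd (snd (snd g)))
     A.0≤κ B.0≤κ A.controlled B.controlled)
     (*-monoʳ (*-nonneg (*-nonneg A.0≤κ B.0≤κ)(^-nonneg (suc l)(≤-trans 0≤1 (1≤exponential s))))
     (≤-respˡ (trans (#-* 8 (suc l N.* Λ))(*-congˡ (#-^ (suc l)(suc v))))(*-monoˡ (0≤# 8)(^-mono (suc v)(0≤# (suc l)) suc-l≤y))))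
    κ≤ : ∀ {R Q L ℓ} -> R ^ r ≈ C * (Q * # L) -> 0# ≤ Q -> # L ≤ # 2 * ℓ -> (# 8 * R) ^ r ≤ # 8 ^ r * (C * (Q * (# 2 * ℓ)))
    κ≤ {R} h 0≤Q L≤ = ≤-respˡ (trans (^-distrib-* (# 8) R r)(*-congˡ h))(*-monoˡ (^-nonneg r (0≤# 8))(*-monoˡ 0≤C (*-monoˡ 0≤Q L≤)))
    φ≤ : (φ ^ suc l) ^ r ≤ (# 2 * T) ^ r'
    φ≤ = ≤-respˡ (trans (^-swap φ (suc l) r)(trans (^-congˡ (suc l)(exponential-power s))(^-swap (# 2) r' (suc l))))
     (^-mono r' (^-nonneg (suc l)(0≤# 2))(≤-respˡ (sym (#-^ 2 (suc l)))(≤-trans (#-mono (N.*-monoʳ-≤ 2 2^l≤t))(≤-respˡ (#-* 2 t)(*-monoˡ (0≤# 2) t≤T)))))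
    8y : (# 8 * (y * η) ^ suc v) ^ r ≈ (# 8 * # e ^ suc v) ^ r * ℓ2 ^ ((v N.+ 1) N.* r) * H
    8y = trans (^-congˡ r (trans (*-congˡ (trans (^-distrib-* y η (suc v))(*-congʳ (^-distrib-* (# e) ℓ2 (suc v)))))(trans (sym (*-assoc _ _ _))(*-congʳ (sym (*-assoc _ _ _))))))
     (trans (^-distrib-* (# 8 * # e ^ suc v * ℓ2 ^ suc v)(η ^ suc v) r)(*-cong (trans (^-distrib-* (# 8 * # e ^ suc v)(ℓ2 ^ suc v) r)
     (*-congˡ (trans (^-assocʳ ℓ2 (suc v) r)(≡-cong (\j -> ℓ2 ^ (j N.* r))(N.+-comm 1 v)))))(^-assocʳ η (suc v) r)))

   Y1^w : Y1 ^ w ≈ b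
   Y1^w = sym (root-unique 4r-1 (^-nonneg (suc r)(0≤# p2))(^-nonneg w (root-nonneg 4r-1 _))(trans (^-swap Y1 w (4 N.* r))
    (trans (^-congˡ w (trans (root-power 4r-1 (^-nonneg 1 (0≤fromℕ p2)))(trans (*-identityʳ _)(fromℕ≈ p2))))(^w≈ _))))

   Y0^w : Y0 ^ w ≈ T ^ r
   Y0^w = root-power (suc (s N.+ 1))(0≤T^ r)

   Y2^w : Y2 ^ w ≈ ℓ2 ^ 2
   Y2^w = root-power (suc (s N.+ 1))(0≤ℓ2^ 2)

   Y^w : Y ^ w ≈ T ^ r * b * ℓ2 ^ 2
   Y^w = trans (^-distrib-* (Y0 * Y1) Y2 w)(*-cong (trans (^-distrib-* Y0 Y1 w)(*-cong Y0^w Y1^w)) Y2^w)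

   X-Y : threshold * # (2 N.^ h) ≤ T -> # (2 N.^ h) * (X ^ r) ^ w ≤ (Y ^ r) ^ w
   X-Y below = begin
    # (2 N.^ h) * (X ^ r) ^ w
    ≈⟨ *-congˡ (trans (^-congˡ w X^r)(trans (^-distrib-* (T ^ r' * (a * b) * ℓ1)(ℓ2 ^ n) w)(*-cong (trans (^-distrib-* (T ^ r' * (a * b)) ℓ1 w)
    (*-congʳ (trans (^-distrib-* (T ^ r')(a * b) w)(*-congˡ (^-distrib-* a b w)))))(trans (^-assocʳ ℓ2 n w)
    (trans (≡-cong (ℓ2 ^_)(id51 v r))(trans (^-homo-* ℓ2 m (2 N.* r))(*-congˡ (sym (^-assocʳ ℓ2 2 r))))))))) ⟩
    u * ((T ^ r') ^ w * (a ^ w * b ^ w) * ℓ1 ^ w * (ℓ2 ^ m * (ℓ2 ^ 2) ^ r))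
    ≈⟨ *-congˡ (*-congʳ (*-congʳ (*-congˡ (*-congˡ (^w≈ b))))) ⟩
    u * ((T ^ r') ^ w * (a ^ w * (b * b ^ r)) * ℓ1 ^ w * (ℓ2 ^ m * (ℓ2 ^ 2) ^ r))
    ≈⟨ solve 8 (\w t a b b' ℓ u v -> w :* (t :* (a :* (b :* b')) :* ℓ :* (u :* v)) := a :* b :* ℓ :* u :* w :* (t :* b' :* v)) refl u ((T ^ r') ^ w)(a ^ w) b (b ^ r)(ℓ1 ^ w)(ℓ2 ^ m)((ℓ2 ^ 2) ^ r) ⟩
    a ^ w * b * ℓ1 ^ w * ℓ2 ^ m * u * ((T ^ r') ^ w * b ^ r * (ℓ2 ^ 2) ^ r)
    ≤⟨ *-monoʳ (*-nonneg (*-nonneg (^-nonneg w (0≤T^ r'))(0≤b^ r))(^-nonneg r (0≤ℓ2^ 2)))(≤-respˡ (*-congʳ (sym threshold≈)) below) ⟩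
    T * ((T ^ r') ^ w * b ^ r * (ℓ2 ^ 2) ^ r)
    ≈⟨ trans (solve 4 (\T t b v -> T :* (t :* b :* v) := T :* t :* b :* v) refl T ((T ^ r') ^ w)(b ^ r)((ℓ2 ^ 2) ^ r))
    (*-congʳ (*-congʳ (trans (*-congˡ (^-assocʳ T r' w))(trans (≡-cong (T ^_)(id52 s))(sym (^-assocʳ T r r)))))) ⟩
    (T ^ r) ^ r * b ^ r * (ℓ2 ^ 2) ^ r
    ≈⟨ trans (^-distrib-* (T ^ r * b)(ℓ2 ^ 2) r)(*-congʳ (^-distrib-* (T ^ r) b r)) ⟨
    (T ^ r * b * ℓ2 ^ 2) ^ r
    ≈⟨ trans (^-swap Y r w)(^-congˡ r Y^w) ⟨
    (Y ^ r) ^ w ∎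
    where
    open ≤-Reasoning
    u = # (2 N.^ h)

   beyond-threshold : threshold ≤ T -> threshold * # (2 N.^ h) ≤ T
   beyond-threshold above = cases (l N.≤? l0)
    where
    cases : Dec (l N.≤ l0) -> threshold * # (2 N.^ h) ≤ T
    cases (yes l≤) = ≤-respˡ (trans (*-congˡ (trans (≡-cong (\h -> # (2 N.^ h))(N.m≤n⇒m∸n≡0 l≤)) #1))(*-identityʳ _)) above
    cases (no l≰) = ≤-trans (*-monoʳ (0≤# (2 N.^ h)) threshold-≤)(≤-respˡ (trans (*-congʳ (sym (#-^ p2 E)))(sym (#-* (p2 N.^ E)(2 N.^ h))))
     (≤-trans (#-mono (≤-tr (N.*-monoˡ-≤ (2 N.^ h)(≤-tr (N.^-monoˡ-≤ E (N.<⇒≤ B.p<2^1+L))(≡⇒≤ (N.^-*-assoc 2 (suc B.L) E))))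
     (≤-tr (≡⇒≤ (E.trans (E.sym (N.^-distribˡ-+-* 2 l0 h))(E.cong (2 N.^_)(N.m+[n∸m]≡n (N.<⇒≤ (N.≰⇒> l≰)))))) 2^l≤t))) t≤T))

  first-range : T ≤ threshold -> S ≤ finalConstant * X
  first-range below = ≤-trans (extract r' 0≤smallConstant 0≤X (≤-respʳ (*-congˡ (trans (*-congʳ (trans (^-congˡ (suc v N.* r)(trans (≡-cong (\h -> # (suc h))
   (N.m≤n⇒m∸n≡0 (below-threshold below))) #1))(1^ (suc v N.* r))))(*-identityˡ _))) main-bound))(*-monoʳ 0≤X small≤final)

  second-range : threshold ≤ T -> S ≤ finalConstant * Y
  second-range above = ≤-trans (extract r' (+-nonneg 0≤largeConstant 0≤1) 0≤Y (extract (suc (s N.+ 1)) 0≤largeConstant (^-nonneg r 0≤Y)(begin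
   (S ^ r) ^ w
   ≤⟨ ^-mono w (^-nonneg r (NormedRing.∣∣-nonneg ℂ _)) main-bound ⟩
   (smallConstant * (H * X ^ r)) ^ w
   ≈⟨ trans (^-distrib-* smallConstant _ w)(*-congˡ (trans (^-distrib-* H (X ^ r) w)(*-congʳ (trans (^-assocʳ (# (suc h))(suc v N.* r) w)(sym (#-^ (suc h)(suc v N.* r N.* w))))))) ⟩
   smallConstant ^ w * (# (suc h N.^ (suc v N.* r N.* w)) * (X ^ r) ^ w)
   ≤⟨ *-monoˡ (^-nonneg w 0≤smallConstant)(*-monoʳ (^-nonneg w (^-nonneg r 0≤X))(#-mono (snd (power-≤-exponential (suc v N.* r N.* w)) h (suc h) N.≤-refl))) ⟩
   smallConstant ^ w * (# (multiplier N.* 2 N.^ h) * (X ^ r) ^ w)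
   ≈⟨ *-congˡ (trans (*-congʳ (#-* multiplier (2 N.^ h)))(*-assoc _ _ _)) ⟩
   smallConstant ^ w * (# multiplier * (# (2 N.^ h) * (X ^ r) ^ w))
   ≤⟨ *-monoˡ (^-nonneg w 0≤smallConstant)(*-monoˡ (0≤# multiplier)(X-Y (beyond-threshold above))) ⟩
   smallConstant ^ w * (# multiplier * (Y ^ r) ^ w)
   ≈⟨ *-assoc _ _ _ ⟨
   largeConstant * (Y ^ r) ^ w ∎)))(*-monoʳ 0≤Y large≤final)
   where open ≤-Reasoning

module Reals where
 open import Defs
 open ℝ
 open Rational
 open import Data.Rational.Solver renaming (module +-*-Solver to ℚ-Solver)
 open E using (refl;sym;trans;cong;cong₂;subst;subst₂)
 open ℚ-Solver using (solve;_:=_;_:+_;_:*_;_:-_;:-_;con)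

 pointwise-≤ : ∀ {x y} -> (∀ n -> seq x n ℚ.≤ seq y n) -> x ≤ y
 pointwise-≤ h 0<ε = 0 , \n _ -> ℚ.≤-trans (h n)(≤-+ʳ _ (ℚ.<⇒≤ 0<ε))

 pointwise : ∀ {x y} -> (∀ n -> seq x n ≡ seq y n) -> x ≈ y
 pointwise {x}{y} h = pointwise-≤ {x}{y}(\n -> ℚ.≤-reflexive (h n)) , pointwise-≤ {y}{x}(\n -> ℚ.≤-reflexive (sym (h n)))

 ≤-trans : ∀ {x y z} -> x ≤ y -> y ≤ z -> x ≤ z
 ≤-trans {x}{y}{z} h k {ε} 0<ε with h (half-pos 0<ε) | k (half-pos 0<ε)
 ... | M , H | N , K = M N.⊔ N , \n le -> ℚ.≤-trans (H n (N.m⊔n≤o⇒m≤o M N le))(ℚ.≤-trans (ℚ.+-monoˡ-≤ (half ε)(K n (N.m⊔n≤o⇒n≤o M N le)))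
  (ℚ.≤-reflexive (trans (ℚ.+-assoc (seq z n) _ _)(cong (seq z n ℚ.+_)(half+half ε)))))

 +-mono-≤ : ∀ {x y u v} -> x ≤ y -> u ≤ v -> x + u ≤ y + v
 +-mono-≤ {x}{y}{u}{v} h k {ε} 0<ε with h (half-pos 0<ε) | k (half-pos 0<ε)
 ... | M , H | N , K = M N.⊔ N , \n le -> ℚ.≤-trans (ℚ.+-mono-≤ (H n (N.m⊔n≤o⇒m≤o M N le))(K n (N.m⊔n≤o⇒n≤o M N le)))
  (ℚ.≤-reflexive (trans (solve 3 (\a b e -> a :+ e :+ (b :+ e) := a :+ b :+ (e :+ e)) refl (seq y n)(seq v n)(half ε))(cong (seq y n ℚ.+ seq v n ℚ.+_)(half+half ε))))

 *-nonneg-≤ : ∀ {x y} -> 0ℝ ≤ x -> 0ℝ ≤ y -> 0ℝ ≤ x * y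
 *-nonneg-≤ {x}{y} h k {ε} 0<ε =
  let A , 0<A , M1 , K1 = Cauchy.bounded x
      D , 0<D , M2 , K2 = Cauchy.bounded y
      1≤B = ℚ.≤-trans (≤-+ʳ 1ℚ (ℚ.<⇒≤ (ℚ.<-trans 0<A (<-+ʳ A 0<D))))(ℚ.≤-reflexive (ℚ.+-comm 1ℚ (A ℚ.+ D)))
      0<B = ℚ.<-≤-trans (ℚ.positive⁻¹ 1ℚ) 1≤B
      η = ε ℚ.⊓ 1ℚ
      0<η : 0ℚ ℚ.< η
      0<η = [ (\e -> subst (0ℚ ℚ.<_)(sym e) 0<ε) , (\e -> subst (0ℚ ℚ.<_)(sym e)(ℚ.positive⁻¹ 1ℚ)) ]′ (ℚ.⊓-sel ε 1ℚ)
      δ , 0<δ , eq = Cauchy.divide 0<B 0<η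
      N1 , H1 = h 0<δ
      N2 , H2 = k 0<δ
      δ≤1 : δ ℚ.≤ 1ℚ
      δ≤1 = ℚ.≤-trans (ℚ.≤-reflexive (sym (ℚ.*-identityˡ δ)))(ℚ.≤-trans (*-mono (ℚ.nonNegative⁻¹ 1ℚ) 1≤B (ℚ.<⇒≤ 0<δ) ℚ.≤-refl)(ℚ.≤-trans (ℚ.≤-reflexive eq)(ℚ.p⊓q≤q ε 1ℚ)))
      M = M1 N.⊔ M2
      N = N1 N.⊔ N2
  in M N.⊔ N , \n le ->
  let a = seq x n; b = seq y n
      ≤M = N.m⊔n≤o⇒m≤o M N le
      ≤N = N.m⊔n≤o⇒n≤o M N le
      open ℚ.≤-Reasoning
  in begin
  0ℚ ≤⟨ *-nonneg (H1 n (N.m⊔n≤o⇒m≤o N1 N2 ≤N))(H2 n (N.m⊔n≤o⇒n≤o N1 N2 ≤N)) ⟩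
  (a ℚ.+ δ) ℚ.* (b ℚ.+ δ) ≡⟨ solve 3 (\a b d -> (a :+ d) :* (b :+ d) := a :* b :+ (a :+ b :+ d) :* d) refl a b δ ⟩
  a ℚ.* b ℚ.+ (a ℚ.+ b ℚ.+ δ) ℚ.* δ ≤⟨ ℚ.+-monoʳ-≤ (a ℚ.* b)(ℚ.*-monoʳ-≤-nonNeg δ {{ℚ.nonNegative (ℚ.<⇒≤ 0<δ)}}
  (ℚ.+-mono-≤ (ℚ.+-mono-≤ (ℚ.≤-trans (p≤∣p∣ a)(K1 n (N.m⊔n≤o⇒m≤o M1 M2 ≤M)))(ℚ.≤-trans (p≤∣p∣ b)(K2 n (N.m⊔n≤o⇒n≤o M1 M2 ≤M)))) δ≤1)) ⟩
  a ℚ.* b ℚ.+ (A ℚ.+ D ℚ.+ 1ℚ) ℚ.* δ ≤⟨ ℚ.+-monoʳ-≤ (a ℚ.* b)(ℚ.≤-trans (ℚ.≤-reflexive eq)(ℚ.p⊓q≤p ε 1ℚ)) ⟩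
  a ℚ.* b ℚ.+ ε ∎

 close : ∀ {x y} -> x ≈ y -> ∀ {ε} -> 0ℚ ℚ.< ε -> ∃[ N ] (∀ n -> N N.≤ n -> ℚ.∣ seq x n ℚ.- seq y n ∣ ℚ.≤ ε)
 close {x}{y}(h , k) 0<ε with h 0<ε | k 0<ε
 ... | M , H | N , K = M N.⊔ N , \n le -> ∣-∣≤ (seq x n)(seq y n)(H n (N.m⊔n≤o⇒m≤o M N le))(K n (N.m⊔n≤o⇒n≤o M N le))

 *-cong-≤ : ∀ {x x' y y'} -> x ≈ x' -> y ≈ y' -> x * y ≤ x' * y'
 *-cong-≤ {x}{x'}{y}{y'} h k {ε} 0<ε =
  let A , 0<A , M1 , K1 = Cauchy.bounded x
      D , 0<D , M2 , K2 = Cauchy.bounded y'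
      δ , 0<δ , eq = Cauchy.divide (ℚ.<-trans 0<A (<-+ʳ A 0<D)) 0<ε
      N1 , H1 = close {y}{y'} k 0<δ
      N2 , H2 = close {x}{x'} h 0<δ
      M = M1 N.⊔ M2
      N = N1 N.⊔ N2
  in M N.⊔ N , \n le ->
  let ≤M = N.m⊔n≤o⇒m≤o M N le
      ≤N = N.m⊔n≤o⇒n≤o M N le
  in ≤-∣-∣ _ _ (ℚ.≤-trans (Cauchy.*-diff (K1 n (N.m⊔n≤o⇒m≤o M1 M2 ≤M))(K2 n (N.m⊔n≤o⇒n≤o M1 M2 ≤M))
  (H1 n (N.m⊔n≤o⇒m≤o N1 N2 ≤N))(H2 n (N.m⊔n≤o⇒n≤o N1 N2 ≤N)))(ℚ.≤-reflexive eq))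

 neg-≤ : ∀ {x y} -> x ≤ y -> - y ≤ - x
 neg-≤ {x}{y} h {ε} 0<ε with h 0<ε
 ... | N , H = N , \n le -> ℚ.≤-trans (ℚ.≤-reflexive (solve 2 (\y e -> :- y := :- (y :+ e) :+ e) refl (seq y n) ε))(ℚ.+-monoˡ-≤ ε (ℚ.neg-antimono-≤ (H n le)))

 ring : CommutativeRing 0ℓ 0ℓ
 ring = record
  { Carrier = ℝ; _≈_ = _≈_; _+_ = _+_; _*_ = _*_; -_ = -_; 0# = 0ℝ; 1# = 1ℝ
  ; isCommutativeRing = record
  { isRing = record
  { +-isAbelianGroup = record
  { isGroup = record
  { isMonoid = record
  { isSemigroup = record
  { isMagma = record
  { isEquivalence = record
  { refl = \{x} -> pointwise {x}{x}(\_ -> refl)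
  ; sym = \(h , k) -> (\{ε} -> k {ε}) , (\{ε} -> h {ε})
  ; trans = \{x}{y}{z}(h , k)(h' , k') -> ≤-trans {x}{y}{z} h h' , ≤-trans {z}{y}{x} k' k }
  ; ∙-cong = \{x}{y}{u}{v}(h , k)(h' , k') -> +-mono-≤ {x}{y}{u}{v} h h' , +-mono-≤ {y}{x}{v}{u} k k' }
  ; assoc = \x y z -> pointwise {x + y + z}{x + (y + z)}(\n -> ℚ.+-assoc (seq x n)(seq y n)(seq z n)) }
  ; identity = (\x -> pointwise {0ℝ + x}{x}(\n -> ℚ.+-identityˡ (seq x n))) , (\x -> pointwise {x + 0ℝ}{x}(\n -> ℚ.+-identityʳ (seq x n))) }
  ; inverse = (\x -> pointwise { - x + x}{0ℝ}(\n -> ℚ.+-inverseˡ (seq x n))) , (\x -> pointwise {x + - x}{0ℝ}(\n -> ℚ.+-inverseʳ (seq x n)))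
  ; ⁻¹-cong = \{x}{y}(h , k) -> neg-≤ {y}{x} k , neg-≤ {x}{y} h }
  ; comm = \x y -> pointwise {x + y}{y + x}(\n -> ℚ.+-comm (seq x n)(seq y n)) }
  ; *-cong = \{x}{x'}{y}{y'} h k -> *-cong-≤ {x}{x'}{y}{y'} h k , *-cong-≤ {x'}{x}{y'}{y}(snd h , fst h)(snd k , fst k)
  ; *-assoc = \x y z -> pointwise {x * y * z}{x * (y * z)}(\n -> ℚ.*-assoc (seq x n)(seq y n)(seq z n))
  ; *-identity = (\x -> pointwise {1ℝ * x}{x}(\n -> ℚ.*-identityˡ (seq x n))) , (\x -> pointwise {x * 1ℝ}{x}(\n -> ℚ.*-identityʳ (seq x n)))
  ; distrib = (\x y z -> pointwise {x * (y + z)}{x * y + x * z}(\n -> ℚ.*-distribˡ-+ (seq x n)(seq y n)(seq z n)))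
  , (\x y z -> pointwise {(y + z) * x}{y * x + z * x}(\n -> ℚ.*-distribʳ-+ (seq x n)(seq y n)(seq z n))) }
  ; *-comm = \x y -> pointwise {x * y}{y * x}(\n -> ℚ.*-comm (seq x n)(seq y n)) } }

 dichotomy : ∀ x y {ε} -> 0ℚ ℚ.< ε -> (∃[ N ] (∀ n -> N N.≤ n -> seq x n ℚ.≤ seq y n ℚ.+ ε)) ⊎ y < x
 dichotomy x y {ε} 0<ε = cases (cauchy x 0<δ)(cauchy y 0<δ)
  where
  open ℚ.≤-Reasoning
  h = half ε
  k = half h
  δ = half k
  0<k = half-pos (half-pos 0<ε)
  0<δ = half-pos 0<k
  cases : (∃[ N ] _) -> (∃[ N ] _) -> _
  cases (N1 , H1)(N2 , H2) = split (seq x N ℚ.≤? seq y N ℚ.+ h)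
   where
   N = N1 N.⊔ N2
   x-close : ∀ m n -> N N.≤ m -> N N.≤ n -> seq x m ℚ.≤ seq x n ℚ.+ δ
   x-close m n le le' = ≤-∣-∣ _ _ (H1 m n (N.m⊔n≤o⇒m≤o N1 N2 le)(N.m⊔n≤o⇒m≤o N1 N2 le'))
   y-close : ∀ m n -> N N.≤ m -> N N.≤ n -> seq y m ℚ.≤ seq y n ℚ.+ δ
   y-close m n le le' = ≤-∣-∣ _ _ (H2 m n (N.m⊔n≤o⇒n≤o N1 N2 le)(N.m⊔n≤o⇒n≤o N1 N2 le'))
   split : Dec (seq x N ℚ.≤ seq y N ℚ.+ h) -> (∃[ N ] (∀ n -> N N.≤ n -> seq x n ℚ.≤ seq y n ℚ.+ ε)) ⊎ y < x
   split (yes ≤h) = inl (N , \n le -> begin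
    seq x n ≤⟨ x-close n N le N.≤-refl ⟩
    seq x N ℚ.+ δ ≤⟨ ℚ.+-monoˡ-≤ δ ≤h ⟩
    seq y N ℚ.+ h ℚ.+ δ ≤⟨ ℚ.+-monoˡ-≤ δ (ℚ.+-monoˡ-≤ h (y-close N n N.≤-refl le)) ⟩
    seq y n ℚ.+ δ ℚ.+ h ℚ.+ δ ≡⟨ trans (solve 3 (\y d h -> y :+ d :+ h :+ d := y :+ h :+ (d :+ d)) refl (seq y n) δ h)(cong (seq y n ℚ.+ h ℚ.+_)(half+half k)) ⟩
    seq y n ℚ.+ h ℚ.+ k ≤⟨ ≤-+ʳ _ (ℚ.<⇒≤ 0<k) ⟩
    seq y n ℚ.+ h ℚ.+ k ℚ.+ k ≡⟨ trans (trans (ℚ.+-assoc (seq y n ℚ.+ h) k k)(cong (seq y n ℚ.+ h ℚ.+_)(half+half h)))(trans (ℚ.+-assoc (seq y n) h h)(cong (seq y n ℚ.+_)(half+half ε))) ⟩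
    seq y n ℚ.+ ε ∎)
   split (no ≰h) = inr (k , 0<k , N , \n le -> ℚ.≤-trans (ℚ.+-monoˡ-≤ k (y-close n N le N.≤-refl))(cancel (begin
    seq y N ℚ.+ δ ℚ.+ k ℚ.+ δ ≡⟨ trans (solve 3 (\y d k -> y :+ d :+ k :+ d := y :+ (k :+ (d :+ d))) refl (seq y N) δ k)(cong (seq y N ℚ.+_)(trans (cong (k ℚ.+_)(half+half k))(half+half h))) ⟩
    seq y N ℚ.+ h ≤⟨ ℚ.<⇒≤ (ℚ.≰⇒> ≰h) ⟩
    seq x N ≤⟨ x-close N n N.≤-refl le ⟩
    seq x n ℚ.+ δ ∎)))
    where
    cancel : ∀ {a b} -> a ℚ.+ δ ℚ.≤ b ℚ.+ δ -> a ℚ.≤ b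
    cancel {a}{b} le = subst₂ ℚ._≤_ (undo a)(undo b)(ℚ.+-monoˡ-≤ (ℚ.- δ) le)
     where
     undo : ∀ a -> a ℚ.+ δ ℚ.+ ℚ.- δ ≡ a
     undo a = solve 2 (\a d -> a :+ d :+ :- d := a) refl a δ

 <⇒≤ : ∀ {x y} -> x < y -> x ≤ y
 <⇒≤ (γ , 0<γ , N , H) 0<ε = N , \n le -> ℚ.≤-trans (≤-+ʳ _ (ℚ.<⇒≤ 0<γ))(ℚ.≤-trans (H n le)(≤-+ʳ _ (ℚ.<⇒≤ 0<ε)))

 <⇒≱ : ∀ {x y} -> x < y -> ¬ y ≤ x
 <⇒≱ {x}{y}(γ , 0<γ , N , H) h with h (half-pos 0<γ)
 ... | M , K = ℚ.<-irrefl refl (begin-strict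
  half γ ≡⟨ solve 2 (\g x -> g := x :+ g :- x) refl (half γ) a ⟩
  a ℚ.+ half γ ℚ.- a <⟨ ℚ.+-monoˡ-< (ℚ.- a)(<-+ʳ (a ℚ.+ half γ)(half-pos 0<γ)) ⟩
  a ℚ.+ half γ ℚ.+ half γ ℚ.- a ≡⟨ cong (ℚ._- a)(trans (ℚ.+-assoc a _ _)(cong (a ℚ.+_)(half+half γ))) ⟩
  a ℚ.+ γ ℚ.- a ≤⟨ ℚ.+-monoˡ-≤ (ℚ.- a)(ℚ.≤-trans (H n (N.m≤m⊔n N M))(K n (N.m≤n⊔m N M))) ⟩
  a ℚ.+ half γ ℚ.- a ≡⟨ solve 2 (\g x -> x :+ g :- x := g) refl (half γ) a ⟩
  half γ ∎)
  where
  open ℚ.≤-Reasoning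
  n = N N.⊔ M
  a = seq x n

 stable : ∀ {x y} -> ¬ ¬ x ≤ y -> x ≤ y
 stable {x}{y} h 0<ε = [ (\le -> le) , (\y<x -> contradiction (<⇒≱ {y}{x} y<x) h) ]′ (dichotomy x y 0<ε)

 ≰⇒> : ∀ {x y} -> ¬ x ≤ y -> ¬ ¬ y < x
 ≰⇒> {x}{y} h k = h \ 0<ε -> [ (\le -> le) , (\y<x -> contradiction y<x k) ]′ (dichotomy x y 0<ε)

 inverse : ∀ {x} -> 0ℝ < x -> ∃[ y ] 0ℝ ≤ y × y * x ≈ 1ℝ
 inverse {x}(γ , 0<γ , N , H) = Y , pointwise-≤ {0ℝ}{Y}(\n -> ℚ.<⇒≤ (0<y n)) , eventually
  where
  a : ℕ -> ℚ
  a n = γ ℚ.⊔ seq x n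
  γ≤a : ∀ n -> γ ℚ.≤ a n
  γ≤a n = ℚ.p≤p⊔q γ (seq x n)
  0<a : ∀ n -> 0ℚ ℚ.< a n
  0<a n = ℚ.<-≤-trans 0<γ (γ≤a n)
  y : ℕ -> ℚ
  y n = (ℚ.1/ a n){{ℚ.>-nonZero (0<a n)}}
  0<y : ∀ n -> 0ℚ ℚ.< y n
  0<y n = ℚ.positive⁻¹ (y n){{ℚ.1/pos⇒pos (a n){{ℚ.positive (0<a n)}}}}
  y*a : ∀ n -> y n ℚ.* a n ≡ 1ℚ
  y*a n = ℚ.*-inverseˡ (a n){{ℚ.>-nonZero (0<a n)}}
  y-cauchy : ∀ {ε} -> 0ℚ ℚ.< ε -> ∃[ M ] (∀ m n -> M N.≤ m -> M N.≤ n -> y m ℚ.≤ y n ℚ.+ ε)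
  y-cauchy {ε} 0<ε with cauchy x (*-pos (*-pos 0<γ 0<γ) 0<ε)
  ... | M , K = M , \m n le le' -> begin
   y m ≡⟨ trans (sym (ℚ.*-identityʳ (y m)))(cong (y m ℚ.*_)(sym (y*a n))) ⟩
   y m ℚ.* (y n ℚ.* a n) ≡⟨ ℚ.*-assoc (y m)(y n)(a n) ⟨
   y m ℚ.* y n ℚ.* a n ≤⟨ ℚ.*-monoˡ-≤-nonNeg (y m ℚ.* y n){{ℚ.nonNegative (*-nonneg (ℚ.<⇒≤ (0<y m))(ℚ.<⇒≤ (0<y n)))}}(a-close m n le le') ⟩
   y m ℚ.* y n ℚ.* (a m ℚ.+ a m ℚ.* a n ℚ.* ε) ≡⟨ solve 5 (\u v a b e -> u :* v :* (a :+ a :* b :* e) := v :* (u :* a) :+ u :* a :* (v :* b) :* e) refl (y m)(y n)(a m)(a n) ε ⟩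
   y n ℚ.* (y m ℚ.* a m) ℚ.+ y m ℚ.* a m ℚ.* (y n ℚ.* a n) ℚ.* ε
   ≡⟨ cong₂ (\u v -> y n ℚ.* u ℚ.+ u ℚ.* v ℚ.* ε)(y*a m)(y*a n) ⟩
   y n ℚ.* 1ℚ ℚ.+ 1ℚ ℚ.* 1ℚ ℚ.* ε ≡⟨ cong₂ ℚ._+_ (ℚ.*-identityʳ (y n))(ℚ.*-identityˡ ε) ⟩
   y n ℚ.+ ε ∎
   where
   open ℚ.≤-Reasoning
   a-close : ∀ m n -> M N.≤ m -> M N.≤ n -> a n ℚ.≤ a m ℚ.+ a m ℚ.* a n ℚ.* ε
   a-close m n le le' = ℚ.≤-trans (ℚ.⊔-lub (ℚ.≤-trans (γ≤a m)(≤-+ʳ (a m)(ℚ.<⇒≤ 0<δ)))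
    (ℚ.≤-trans (≤-∣-∣ _ _ (K n m le' le))(ℚ.+-monoˡ-≤ (γ ℚ.* γ ℚ.* ε)(ℚ.p≤q⊔p γ (seq x m)))))
    (ℚ.+-monoʳ-≤ (a m)(ℚ.*-monoʳ-≤-nonNeg ε {{ℚ.nonNegative (ℚ.<⇒≤ 0<ε)}}(*-mono (ℚ.<⇒≤ 0<γ)(γ≤a m)(ℚ.<⇒≤ 0<γ)(γ≤a n))))
    where 0<δ = *-pos (*-pos 0<γ 0<γ) 0<ε
  product≡ : ∀ n -> N N.≤ n -> y n ℚ.* seq x n ≡ 1ℚ
  product≡ n le = trans (cong (y n ℚ.*_)(sym (ℚ.p≤q⇒p⊔q≡q (ℚ.≤-trans (ℚ.≤-reflexive (sym (ℚ.+-identityˡ γ)))(H n le)))))(y*a n)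
  Y : ℝ
  Y = mkℝ y (Cauchy.one-sided {y} y-cauchy)
  eventually : Y * x ≈ 1ℝ
  eventually = (\ 0<ε -> N , \n le -> ℚ.≤-trans (ℚ.≤-reflexive (product≡ n le))(≤-+ʳ 1ℚ (ℚ.<⇒≤ 0<ε)))
   , (\ 0<ε -> N , \n le -> ℚ.≤-trans (ℚ.≤-reflexive (sym (product≡ n le)))(≤-+ʳ _ (ℚ.<⇒≤ 0<ε)))

 seq-^ : ∀ x m n -> seq (x ^ m) n ≡ seq x n ^ℚ m
 seq-^ x zero n = refl
 seq-^ x (suc m) n = cong (seq x n ℚ.*_)(seq-^ x m n)

 root-nonneg : ∀ k x -> 0ℝ ≤ root (suc k) x
 root-nonneg k x = pointwise-≤ {0ℝ}{root (suc k) x}(\n -> Root.search-nonneg (suc k)(0ℚ ℚ.⊔ seq x n) n (Z.∣ ℚ.numerator (0ℚ ℚ.⊔ seq x n) ∣ N.* suc n))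

 infinitesimal : ℝ
 infinitesimal = mkℝ inv (Cauchy.one-sided {inv} \ 0<ε -> let N , A = archimedean 0<ε in
  N , \m n le _ -> ℚ.≤-trans (ℚ.≤-trans (inv-anti le) A)(ℚ.≤-trans (ℚ.≤-reflexive (sym (ℚ.+-identityˡ _)))(ℚ.+-monoˡ-≤ _ (ℚ.<⇒≤ (inv-pos n)))))

 +-infinitesimal : ∀ x -> x + infinitesimal ≈ x
 +-infinitesimal x = (\ 0<ε -> let N , A = archimedean 0<ε in N , \n le -> ℚ.+-monoʳ-≤ (seq x n)(ℚ.≤-trans (inv-anti le) A))
  , pointwise-≤ {x}{x + infinitesimal}(\n -> ≤-+ʳ (seq x n)(ℚ.<⇒≤ (inv-pos n)))

 root-below : ∀ k {x} -> 0ℝ ≤ x -> root (suc k) x ^ suc k ≤ x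
 root-below k {x} 0≤x {ε} 0<ε = fst (0≤x 0<ε) , \n le -> ℚ.≤-trans (ℚ.≤-reflexive (seq-^ (root (suc k) x)(suc k) n))
  (ℚ.≤-trans (Root.lower k (0ℚ ℚ.⊔ seq x n) n (ℚ.p≤p⊔q 0ℚ (seq x n)))(ℚ.⊔-lub (snd (0≤x 0<ε) n le)(≤-+ʳ (seq x n)(ℚ.<⇒≤ 0<ε))))

 root-above : ∀ k x -> x ≤ (root (suc k) x + infinitesimal) ^ suc k
 root-above k x = pointwise-≤ {x}{(root (suc k) x + infinitesimal) ^ suc k}(\n -> ℚ.≤-trans (ℚ.p≤q⊔p 0ℚ (seq x n))
  (ℚ.≤-trans (ℚ.<⇒≤ (Root.upper k (0ℚ ℚ.⊔ seq x n) n (ℚ.p≤p⊔q 0ℚ (seq x n))))(ℚ.≤-reflexive (sym (seq-^ (root (suc k) x + infinitesimal)(suc k) n)))))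

 ^-cong-≈ : ∀ n {x y} -> x ≈ y -> x ^ n ≈ y ^ n
 ^-cong-≈ zero {x}{y} h = pointwise {1ℝ}{1ℝ}(\_ -> refl)
 ^-cong-≈ (suc n){x}{y} h = CommutativeRing.*-cong ring {x}{y}{x ^ n}{y ^ n} h (^-cong-≈ n {x}{y} h)

 root-power : ∀ k {x} -> 0ℝ ≤ x -> root (suc k) x ^ suc k ≈ x
 root-power k {x} 0≤x = root-below k {x} 0≤x , ≤-trans {x}{(root (suc k) x + infinitesimal) ^ suc k}{root (suc k) x ^ suc k}(root-above k x)
  (fst (^-cong-≈ (suc k){root (suc k) x + infinitesimal}{root (suc k) x}(+-infinitesimal (root (suc k) x))))

 real-field : RealField
 real-field = record
  { ring = ring; _≤_ = _≤_; ≤-reflexive = \e -> fst e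
  ; ≤-trans = \{x}{y}{z} -> ≤-trans {x}{y}{z}; ≤-antisym = \h k -> (\{ε} -> h {ε}) , (\{ε} -> k {ε})
  ; +-mono-≤ = \{x}{y}{u}{v} -> +-mono-≤ {x}{y}{u}{v}; *-nonneg = \{x}{y} -> *-nonneg-≤ {x}{y}
  ; 1≰0 = <⇒≱ {0ℝ}{1ℝ}(1ℚ , ℚ.positive⁻¹ 1ℚ , 0 , \_ _ -> ℚ.≤-refl)
  ; stable = \{x}{y} -> stable {x}{y}
  ; total = \x y h -> ≰⇒> {x}{y}(\le -> h (inl le)) \y<x -> h (inr (<⇒≤ {y}{x} y<x))
  ; inverse = \{x} h k -> ≰⇒> {x}{0ℝ} h \ 0<x -> k (inverse {x} 0<x)
  ; root = root; root-nonneg = root-nonneg; root-power = \k {x} -> root-power k {x} }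

module ComplexNumbers (ℝ : RealField) where
 open RealProperties ℝ

 ℂ : Set
 ℂ = Carrier × Carrier

 infix 4 _≈ᶜ_
 infixl 6 _+ᶜ_
 infixl 7 _*ᶜ_

 _≈ᶜ_ : ℂ -> ℂ -> Set
 (a , b) ≈ᶜ (c , d) = a ≈ c × b ≈ d

 _+ᶜ_ _*ᶜ_ : ℂ -> ℂ -> ℂ
 (a , b) +ᶜ (c , d) = a + c , b + d
 (a , b) *ᶜ (c , d) = a * c + - (b * d) , a * d + b * c

 -ᶜ_ conj : ℂ -> ℂ
 -ᶜ (a , b) = - a , - b
 conj (a , b) = a , - b

 ι : Carrier -> ℂ
 ι a = a , 0#

 norm² : ℂ -> Carrier
 norm² (a , b) = a * a + b * b

 ∣_∣ : ℂ -> Carrier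
 ∣ z ∣ = root 2 (norm² z)

 complex-ring : CommutativeRing 0ℓ 0ℓ
 complex-ring = record
  { Carrier = ℂ; _≈_ = _≈ᶜ_; _+_ = _+ᶜ_; _*_ = _*ᶜ_; -_ = -ᶜ_; 0# = ι 0#; 1# = ι 1#
  ; isCommutativeRing = record
  { isRing = record
  { +-isAbelianGroup = record
  { isGroup = record
  { isMonoid = record
  { isSemigroup = record
  { isMagma = record
  { isEquivalence = record
  { refl = refl , refl
  ; sym = \(p , q) -> sym p , sym q
  ; trans = \(p , q)(p' , q') -> trans p p' , trans q q' }
  ; ∙-cong = \(p , q)(p' , q') -> +-cong p p' , +-cong q q' }
  ; assoc = \_ _ _ -> +-assoc _ _ _ , +-assoc _ _ _ }
  ; identity = (\_ -> +-identityˡ _ , +-identityˡ _) , (\_ -> +-identityʳ _ , +-identityʳ _) }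
  ; inverse = (\_ -> -‿inverseˡ _ , -‿inverseˡ _) , (\_ -> -‿inverseʳ _ , -‿inverseʳ _)
  ; ⁻¹-cong = \(p , q) -> -‿cong p , -‿cong q }
  ; comm = \_ _ -> +-comm _ _ , +-comm _ _ }
  ; *-cong = \(p , q)(p' , q') -> +-cong (*-cong p p')(-‿cong (*-cong q q')) , +-cong (*-cong p q')(*-cong q p')
  ; *-assoc = \(a , b)(c , d)(e , f) ->
  solve 6 (\a b c d e f -> (a :* c :- b :* d) :* e :- (a :* d :+ b :* c) :* f := a :* (c :* e :- d :* f) :- b :* (c :* f :+ d :* e)) refl a b c d e f ,
  solve 6 (\a b c d e f -> (a :* c :- b :* d) :* f :+ (a :* d :+ b :* c) :* e := a :* (c :* f :+ d :* e) :+ b :* (c :* e :- d :* f)) refl a b c d e f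
  ; *-identity = (\(a , b) -> solve 2 (\a b -> :1 :* a :- :0 :* b := a) refl a b , solve 2 (\a b -> :1 :* b :+ :0 :* a := b) refl a b) ,
  (\(a , b) -> solve 2 (\a b -> a :* :1 :- b :* :0 := a) refl a b , solve 2 (\a b -> a :* :0 :+ b :* :1 := b) refl a b)
  ; distrib = (\(a , b)(c , d)(e , f) ->
  solve 6 (\a b c d e f -> a :* (c :+ e) :- b :* (d :+ f) := a :* c :- b :* d :+ (a :* e :- b :* f)) refl a b c d e f ,
  solve 6 (\a b c d e f -> a :* (d :+ f) :+ b :* (c :+ e) := a :* d :+ b :* c :+ (a :* f :+ b :* e)) refl a b c d e f) ,
  (\(a , b)(c , d)(e , f) ->
  solve 6 (\a b c d e f -> (c :+ e) :* a :- (d :+ f) :* b := c :* a :- d :* b :+ (e :* a :- f :* b)) refl a b c d e f ,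
  solve 6 (\a b c d e f -> (c :+ e) :* b :+ (d :+ f) :* a := c :* b :+ d :* a :+ (e :* b :+ f :* a)) refl a b c d e f) }
  ; *-comm = \(a , b)(c , d) -> solve 4 (\a b c d -> a :* c :- b :* d := c :* a :- d :* b) refl a b c d ,
  solve 4 (\a b c d -> a :* d :+ b :* c := c :* b :+ d :* a) refl a b c d } }

 0≤norm² : ∀ z -> 0# ≤ norm² z
 0≤norm² (a , b) = +-nonneg (square-nonneg a)(square-nonneg b)

 ∣∣-nonneg : ∀ z -> 0# ≤ ∣ z ∣
 ∣∣-nonneg z = root-nonneg 1 (norm² z)

 ∣∣² : ∀ z -> ∣ z ∣ * ∣ z ∣ ≈ norm² z
 ∣∣² z = trans (*-congˡ (sym (*-identityʳ _)))(root-power 1 (0≤norm² z))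

 square-≤ : ∀ {x y} -> 0# ≤ y -> x * x ≤ y * y -> x ≤ y
 square-≤ 0≤y h = ^-cancel-≤ 1 0≤y (≤-respˡ (*-congˡ (*-identityʳ _))(≤-respʳ (*-congˡ (sym (*-identityʳ _))) h))

 square-≈ : ∀ {x y} -> 0# ≤ x -> 0# ≤ y -> x * x ≈ y * y -> x ≈ y
 square-≈ 0≤x 0≤y e = ≤-antisym (square-≤ 0≤y (≤-reflexive e))(square-≤ 0≤x (≤-reflexive (sym e)))

 ∣∣-* : ∀ z w -> ∣ z *ᶜ w ∣ ≈ ∣ z ∣ * ∣ w ∣
 ∣∣-* z@(a , b) w@(c , d) = square-≈ (∣∣-nonneg (z *ᶜ w))(*-nonneg (∣∣-nonneg z)(∣∣-nonneg w))(trans (∣∣² (z *ᶜ w))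
  (trans (solve 4 (\a b c d -> (a :* c :- b :* d) :* (a :* c :- b :* d) :+ (a :* d :+ b :* c) :* (a :* d :+ b :* c) := (a :* a :+ b :* b) :* (c :* c :+ d :* d)) refl a b c d)
  (trans (*-cong (sym (∣∣² z))(sym (∣∣² w)))(solve 2 (\x y -> x :* x :* (y :* y) := x :* y :* (x :* y)) refl ∣ z ∣ ∣ w ∣))))

 -- The real part of z w̄ is at most |z||w|, by Lagrange's identity.
 inner-≤ : ∀ z w -> fst z * fst w + snd z * snd w ≤ ∣ z ∣ * ∣ w ∣
 inner-≤ z@(a , b) w@(c , d) = square-≤ (*-nonneg (∣∣-nonneg z)(∣∣-nonneg w))(≤-respʳ
  (trans (solve 4 (\a b c d -> (a :* c :+ b :* d) :* (a :* c :+ b :* d) :+ (a :* d :- b :* c) :* (a :* d :- b :* c) := (a :* a :+ b :* b) :* (c :* c :+ d :* d)) refl a b c d)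
  (trans (*-cong (sym (∣∣² z))(sym (∣∣² w)))(solve 2 (\x y -> x :* x :* (y :* y) := x :* y :* (x :* y)) refl ∣ z ∣ ∣ w ∣)))
  (x≤x+y (square-nonneg (a * d + - (b * c)))))

 ∣∣-+ : ∀ z w -> ∣ z +ᶜ w ∣ ≤ ∣ z ∣ + ∣ w ∣
 ∣∣-+ z@(a , b) w@(c , d) = square-≤ (+-nonneg (∣∣-nonneg z)(∣∣-nonneg w))(≤-respˡ (trans (∣∣² (z +ᶜ w))
  (solve 4 (\a b c d -> (a :+ c) :* (a :+ c) :+ (b :+ d) :* (b :+ d) := a :* a :+ b :* b :+ (c :* c :+ d :* d) :+ ((a :* c :+ b :* d) :+ (a :* c :+ b :* d))) refl a b c d))
  (≤-respʳ (trans (+-congʳ (+-cong (sym (∣∣² z))(sym (∣∣² w))))(solve 2 (\x y -> x :* x :+ y :* y :+ (x :* y :+ x :* y) := (x :+ y) :* (x :+ y)) refl ∣ z ∣ ∣ w ∣))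
  (+-mono-≤ ≤-refl (+-mono-≤ (inner-≤ z w)(inner-≤ z w)))))

 ∣∣-0 : ∀ {z} -> ∣ z ∣ ≤ 0# -> z ≈ᶜ ι 0#
 ∣∣-0 {z@(a , b)} h = vanish a (x≤x+y (square-nonneg b)) , vanish b (x≤y+x (square-nonneg a))
  where
  norm²≤0 : norm² z ≤ 0#
  norm²≤0 = ≤-respˡ (sym (∣∣² z))(≤-respʳ (zeroˡ _)(*-monoʳ (∣∣-nonneg z) h))
  vanish : ∀ x -> x * x ≤ norm² z -> x ≈ 0#
  vanish x x²≤ = ≤-antisym (square-≤ ≤-refl (≤-respʳ (sym (zeroˡ 0#)) x²≤0))
   (0≤y-x⇒x≤y (≤-trans (≤-reflexive refl)(≤-respʳ (solve 1 (\x -> :0 :- (:0 :- x) := x :- :0) refl x)(x≤y⇒0≤y-x (square-≤ {0# - x} ≤-refl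
   (≤-respˡ (solve 1 (\x -> (:0 :- x) :* (:0 :- x) := x :* x) refl x)(≤-respʳ (sym (zeroˡ 0#)) x²≤0)))))))
   where x²≤0 = ≤-trans x²≤ norm²≤0

 complex : NormedRing ℝ
 complex = record
  { ring = complex-ring; ∣_∣ = ∣_∣
  ; ∣∣-cong = \{z}{w}(p , q) -> root-cong 1 (0≤norm² z)(+-cong (*-cong p p)(*-cong q q))
  ; ∣∣-nonneg = ∣∣-nonneg; ∣∣-* = ∣∣-*; ∣∣-+ = ∣∣-+; ∣∣-0 = ∣∣-0
  ; ι = ι; ι-cong = \e -> e , refl; ι-+ = \_ _ -> refl , sym (+-identityˡ 0#)
  ; ι-0 = refl , refl; ι-1 = refl , refl
  ; ∣ι∣ = \{x} 0≤x -> square-≈ (∣∣-nonneg (ι x)) 0≤x (trans (∣∣² (ι x))(solve 1 (\x -> x :* x :+ :0 :* :0 := x :* x) refl x))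
  ; conj = conj; conj-cong = \(p , q) -> p , -‿cong q
  ; conj-+ = \(_ , b)(_ , d) -> refl , solve 2 (\b d -> :- (b :+ d) := :- b :+ :- d) refl b d
  ; conj-* = \(a , b)(c , d) -> solve 4 (\a b c d -> a :* c :- b :* d := a :* c :- (:- b) :* (:- d)) refl a b c d ,
  solve 4 (\a b c d -> :- (a :* d :+ b :* c) := a :* (:- d) :+ (:- b) :* c) refl a b c d
  ; conj-0 = refl , solve 0 (:- :0 := :0) refl
  ; conj-conj = \(_ , b) -> refl , solve 1 (\b -> :- (:- b) := b) refl b
  ; *-conj = \z@(a , b) -> trans (solve 2 (\a b -> a :* a :- b :* (:- b) := a :* a :+ b :* b) refl a b)(sym (∣∣² z)) , solve 2 (\a b -> a :* (:- b) :+ b :* a := :0) refl a b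
  ; ∣conj∣ = \z@(a , b) -> root-cong 1 (0≤norm² (conj z))(solve 2 (\a b -> a :* a :+ (:- b) :* (:- b) := a :* a :+ b :* b) refl a b) }

module PrimeFields {p : ℕ}(prime : Prime p) where
 open import Data.Nat.DivMod using (_%_;_mod_)
 open import Data.Nat.Divisibility using (_∣_)
 open import Function using (id)
 open E using (refl;sym;trans;cong;cong₂;subst)
 private instance _ = prime⇒nonZero prime

 [_]ₚ : ℕ -> Fin p
 [ n ]ₚ = n mod p

 toℕ-[] : ∀ n -> toℕ [ n ]ₚ ≡ n % p
 toℕ-[] n = Fin.toℕ-fromℕ< (m%n<n n p)

 []-cong : ∀ {m n} -> m % p ≡ n % p -> [ m ]ₚ ≡ [ n ]ₚ
 []-cong {m}{n} e = Fin.toℕ-injective (trans (toℕ-[] m)(trans e (sym (toℕ-[] n))))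

 []-toℕ : ∀ x -> [ toℕ x ]ₚ ≡ x
 []-toℕ x = Fin.toℕ-injective (trans (toℕ-[] (toℕ x))(m<n⇒m%n≡m (Fin.toℕ<n x)))

 infixl 6 _+_
 infixl 7 _*_
 infix 8 -_

 _+_ _*_ : Fin p -> Fin p -> Fin p
 x + y = [ toℕ x N.+ toℕ y ]ₚ
 x * y = [ toℕ x N.* toℕ y ]ₚ

 -_ : Fin p -> Fin p
 - x = [ p N.∸ toℕ x ]ₚ

 []-+ : ∀ m n -> [ m ]ₚ + [ n ]ₚ ≡ [ m N.+ n ]ₚ
 []-+ m n = []-cong (trans (cong (_% p)(cong₂ N._+_ (toℕ-[] m)(toℕ-[] n)))(sym (%-distribˡ-+ m n p)))

 []-* : ∀ m n -> [ m ]ₚ * [ n ]ₚ ≡ [ m N.* n ]ₚ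
 []-* m n = []-cong (trans (cong (_% p)(cong₂ N._*_ (toℕ-[] m)(toℕ-[] n)))(sym (%-distribˡ-* m n p)))

 lift : (P : Fin p -> Set) -> (∀ n -> P [ n ]ₚ) -> ∀ x -> P x
 lift P h x = subst P ([]-toℕ x)(h (toℕ x))

 neg-inverse : ∀ x -> - x + x ≡ [ 0 ]ₚ
 neg-inverse x = trans (cong (- x +_)(sym ([]-toℕ x)))(trans ([]-+ (p N.∸ toℕ x)(toℕ x))
  (trans (cong [_]ₚ (N.m∸n+n≡m (N.<⇒≤ (Fin.toℕ<n x))))([]-cong (trans (n%n≡0 p)(sym (m<n⇒m%n≡m (N.>-nonZero⁻¹ p)))))))

 +-comm : ∀ x y -> x + y ≡ y + x
 +-comm x y = cong [_]ₚ (N.+-comm (toℕ x)(toℕ y))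

 *-comm : ∀ x y -> x * y ≡ y * x
 *-comm x y = cong [_]ₚ (N.*-comm (toℕ x)(toℕ y))

 +-identityˡ : ∀ x -> [ 0 ]ₚ + x ≡ x
 +-identityˡ = lift _ ([]-+ 0)

 *-identityˡ : ∀ x -> [ 1 ]ₚ * x ≡ x
 *-identityˡ = lift _ (\n -> trans ([]-* 1 n)(cong [_]ₚ (N.*-identityˡ n)))

 +-assoc : ∀ x y z -> x + y + z ≡ x + (y + z)
 +-assoc = lift _ \a -> lift _ \b -> lift _ \c -> trans (cong (_+ [ c ]ₚ)([]-+ a b))(trans ([]-+ (a N.+ b) c)(trans (cong [_]ₚ (N.+-assoc a b c))
  (sym (trans (cong ([ a ]ₚ +_)([]-+ b c))([]-+ a (b N.+ c))))))

 *-assoc : ∀ x y z -> x * y * z ≡ x * (y * z)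
 *-assoc = lift _ \a -> lift _ \b -> lift _ \c -> trans (cong (_* [ c ]ₚ)([]-* a b))(trans ([]-* (a N.* b) c)(trans (cong [_]ₚ (N.*-assoc a b c))
  (sym (trans (cong ([ a ]ₚ *_)([]-* b c))([]-* a (b N.* c))))))

 distribˡ : ∀ x y z -> x * (y + z) ≡ x * y + x * z
 distribˡ = lift _ \a -> lift _ \b -> lift _ \c -> trans (cong ([ a ]ₚ *_)([]-+ b c))(trans ([]-* a (b N.+ c))(trans (cong [_]ₚ (N.*-distribˡ-+ a b c))
  (sym (trans (cong₂ _+_ ([]-* a b)([]-* a c))([]-+ (a N.* b)(a N.* c))))))

 ring : CommutativeRing 0ℓ 0ℓ
 ring = record
  { Carrier = Fin p; _≈_ = _≡_; _+_ = _+_; _*_ = _*_; -_ = -_; 0# = [ 0 ]ₚ; 1# = [ 1 ]ₚ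
  ; isCommutativeRing = record
  { isRing = record
  { +-isAbelianGroup = record
  { isGroup = record
  { isMonoid = record
  { isSemigroup = record { isMagma = record { isEquivalence = E.isEquivalence; ∙-cong = cong₂ _+_ }; assoc = +-assoc }
  ; identity = +-identityˡ , (\x -> trans (+-comm x [ 0 ]ₚ)(+-identityˡ x)) }
  ; inverse = neg-inverse , (\x -> trans (+-comm x (- x))(neg-inverse x))
  ; ⁻¹-cong = cong -_ }
  ; comm = +-comm }
  ; *-cong = cong₂ _*_
  ; *-assoc = *-assoc
  ; *-identity = *-identityˡ , (\x -> trans (*-comm x [ 1 ]ₚ)(*-identityˡ x))
  ; distrib = distribˡ , (\x y z -> trans (*-comm (y + z) x)(trans (distribˡ x y z)(cong₂ _+_ (*-comm x y)(*-comm x z)))) }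
  ; *-comm = *-comm } }

 private
  module K = CommutativeRing ring
  module KS = IntegerSolver ring
 open AbelianGroup K.+-abelianGroup using (x≈y⇒x∙y⁻¹≈ε;x∙y⁻¹≈ε⇒x≈y)
 open Power K.semiring using (_^_)
 open Mult K.semiring using () renaming (_×_ to _·_)

 ·1 : ∀ n -> n · K.1# ≡ [ n ]ₚ
 ·1 zero = refl
 ·1 (suc n) = trans (cong ([ 1 ]ₚ +_)(·1 n))([]-+ 1 n)

 characteristic : p · K.1# ≡ K.0#
 characteristic = trans (·1 p)([]-cong (trans (n%n≡0 p)(sym (m<n⇒m%n≡m (N.>-nonZero⁻¹ p)))))

 toℕ-·1 : ∀ x -> toℕ x · K.1# ≡ x
 toℕ-·1 x = trans (·1 (toℕ x))([]-toℕ x)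

 fermat : ∀ x -> x ^ p ≡ x
 fermat x = subst (\y -> y ^ p ≡ y)(toℕ-·1 x)(multiples (toℕ x))
  where
  zero-power : ∀ n -> N.NonZero n -> K.0# ^ n ≡ K.0#
  zero-power (suc n) _ = K.zeroˡ (K.0# ^ n)
  one-power : ∀ n -> K.1# ^ n ≡ K.1#
  one-power zero = refl
  one-power (suc n) = trans (K.*-identityˡ _)(one-power n)
  multiples : ∀ n -> (n · K.1#) ^ p ≡ n · K.1#
  multiples zero = zero-power p (prime⇒nonZero prime)
  multiples (suc n) = trans (PrimeCharacteristic.Of.frobenius ring prime characteristic K.1# (n · K.1#))(cong₂ _+_ (one-power p)(multiples n))

 []≡0⇒∣ : ∀ {n} -> [ n ]ₚ ≡ K.0# -> p ∣ n
 []≡0⇒∣ {n} e = m%n≡0⇒n∣m n p (trans (sym (toℕ-[] n))(trans (cong toℕ e)(trans (toℕ-[] 0)(m<n⇒m%n≡m (N.>-nonZero⁻¹ p)))))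

 no-zero-divisors : ∀ {x y} -> x * y ≡ K.0# -> x ≢ K.0# -> y ≡ K.0#
 no-zero-divisors {x}{y} e x≢0 = [ (\d -> contradiction (vanish x d) x≢0) , vanish y ]′ (euclidsLemma (toℕ x)(toℕ y) prime ([]≡0⇒∣ e))
  where
  vanish : ∀ z -> p ∣ toℕ z -> z ≡ K.0#
  vanish z d = trans (sym ([]-toℕ z))([]-cong (trans (n∣m⇒m%n≡0 (toℕ z) p d)(sym (m<n⇒m%n≡m (N.>-nonZero⁻¹ p)))))

 inverse : ∀ {x} -> x ≢ K.0# -> ∃[ y ] x * y ≡ K.1#
 inverse {x} x≢0 = split p refl (prime⇒nonTrivial prime)
  where
  split : ∀ n -> n ≡ p -> N.NonTrivial n -> ∃[ y ] x * y ≡ K.1#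
  split (suc (suc n)) n≡p _ = x ^ n , x∙y⁻¹≈ε⇒x≈y _ _ (no-zero-divisors (trans
   (KS.solve 2 (\x y -> x KS.:* (x KS.:* y KS.:- KS.:1) KS.:= x KS.:* (x KS.:* y) KS.:- x) refl x (x ^ n))
   (x≈y⇒x∙y⁻¹≈ε (trans (cong (x ^_) n≡p)(fermat x)))) x≢0)

 field-of : PrimeField p
 field-of = record
  { Carrier = Fin p; _+_ = _+_; _*_ = _*_; -_ = -_; 0# = [ 0 ]ₚ; 1# = [ 1 ]ₚ
  ; isCommutativeRing = K.isCommutativeRing; _≟_ = Fin._≟_
  ; 1≢0 = \e -> N.<⇒≢ (N.s≤s N.z≤n)(sym (trans (sym (m<n⇒m%n≡m (N.nonTrivial⇒n>1 p {{prime⇒nonTrivial prime}})))(n∣m⇒m%n≡0 1 p ([]≡0⇒∣ e))))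
  ; inverse = inverse; prime = prime; elems = allFin p; elems-unique = Unique.allFin⁺ p; ∈-elems = ∈-allFin
  ; length-elems = length-tabulate id; characteristic = characteristic; fermat = fermat
  ; residue = toℕ; residue-< = Fin.toℕ<n; residue-× = toℕ-·1
  ; ×-residue = \{n} n<p -> trans (cong toℕ (·1 n))(trans (toℕ-[] n)(m<n⇒m%n≡m n<p)) }

module Logarithms where
 open import Defs
 open ℝ
 open Rational
 open E using (refl;sym;trans;cong;cong₂;subst)
 open RealProperties Reals.real-field using (#)

 seq-# : ∀ n m -> seq (# n) m ≡ ι n
 seq-# zero m = refl
 seq-# (suc n) m = trans (cong (1ℚ ℚ.+_)(seq-# n m))(trans (ℚ.+-comm 1ℚ (ι n))(ι-suc n))

 fromℕ≈ : ∀ n -> fromℕ n ≈ # n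
 fromℕ≈ n = Reals.pointwise {fromℕ n}{# n}(\m -> sym (seq-# n m))

 Σ<-prefix : ∀ {m n} f -> (∀ i -> 0ℚ ℚ.≤ f i) -> m N.≤ n -> Σ< m f ℚ.≤ Σ< n f
 Σ<-prefix {m}{n} f 0≤f m≤n = subst (\k -> Σ< m f ℚ.≤ Σ< k f)(N.m∸n+n≡m m≤n)(ℚ.≤-trans (≤-+ʳ (Σ< m f)(nonneg (n N.∸ m)))(ℚ.≤-reflexive (sym (Σ<-+ m (n N.∸ m) f))))
  where
  nonneg : ∀ k -> 0ℚ ℚ.≤ Σ< k (\i -> f (i N.+ m))
  nonneg zero = ℚ.≤-refl
  nonneg (suc k) = +-nonneg (nonneg k)(0≤f (k N.+ m))

 -- Each dyadic block of the Riemann sum, over an interval [2ʲ, 2ʲ⁺¹], is at least 1/2.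
 dyadic : ∀ L m -> ι L ℚ.≤ ι 2 ℚ.* Σ< ((2 N.^ L N.∸ 1) N.* suc m)(\i -> inv (i N.+ suc m))
 dyadic zero m = ℚ.≤-reflexive (sym (ℚ.*-zeroʳ (ι 2)))
 dyadic (suc L) m = begin
  ι (suc L) ≡⟨ ι-suc L ⟨
  ι L ℚ.+ ι 2 ℚ.* inv 1 ≤⟨ ℚ.+-mono-≤ (dyadic L m)(ℚ.*-monoˡ-≤-nonNeg (ι 2) block) ⟩
  ι 2 ℚ.* Σ< P f ℚ.+ ι 2 ℚ.* Σ< K (\i -> f (i N.+ P)) ≡⟨ ℚ.*-distribˡ-+ (ι 2)(Σ< P f)(Σ< K (\i -> f (i N.+ P))) ⟨
  ι 2 ℚ.* (Σ< P f ℚ.+ Σ< K (\i -> f (i N.+ P))) ≡⟨ cong (ι 2 ℚ.*_)(trans (sym (Σ<-+ P K f))(cong (\k -> Σ< k f) K+P)) ⟩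
  ι 2 ℚ.* Σ< ((2 N.^ suc L N.∸ 1) N.* suc m) f ∎
  where
  open ℚ.≤-Reasoning
  f : ℕ -> ℚ
  f i = inv (i N.+ suc m)
  u = 2 N.^ L
  P = (u N.∸ 1) N.* suc m
  K = u N.* suc m
  1+ : suc (u N.∸ 1) ≡ u
  1+ = N.m+[n∸m]≡n (N.m^n>0 2 L)
  P+ : P N.+ suc m ≡ K
  P+ = trans (N.+-comm P (suc m))(cong (N._* suc m) 1+)
  K+P : K N.+ P ≡ (2 N.^ suc L N.∸ 1) N.* suc m
  K+P = trans (sym (N.*-distribʳ-+ (suc m) u (u N.∸ 1)))(cong (N._* suc m)(cong N.pred (trans (sym (N.+-suc u (u N.∸ 1)))(cong (u N.+_)(trans 1+ (sym (N.+-identityʳ u)))))))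
  k = N.pred K
  K≡ : suc k ≡ K
  K≡ = N.suc-pred K {{N.m*n≢0 u (suc m){{N.m^n≢0 2 L}}}}
  block : inv 1 ℚ.≤ Σ< K (\i -> f (i N.+ P))
  block = ℚ.≤-trans (ℚ.≤-reflexive (sym (Σ<-inv k 1)))(subst (\n -> Σ< (suc k)(\_ -> inv (k N.+ 1 N.* suc k)) ℚ.≤ Σ< n (\i -> f (i N.+ P))) K≡
   (Σ<-mono (suc k)(\i i<K -> inv-anti (≤-tr (≡⇒≤ (trans (N.+-assoc i P (suc m))(cong (i N.+_)(trans P+ (trans (sym K≡)(sym (N.*-identityˡ (suc k))))))))
   (N.+-monoˡ-≤ (1 N.* suc k)(N.s≤s⁻¹ i<K))))))

 log-lower : ∀ q L -> 2 N.^ L N.≤ q -> # L ≤ # 2 * log q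
 log-lower q L 2^L≤q = Reals.pointwise-≤ {# L}{# 2 * log q}(\m -> ℚ.≤-trans (ℚ.≤-reflexive (seq-# L m))(ℚ.≤-trans (dyadic L m)
  (ℚ.≤-trans (ℚ.*-monoˡ-≤-nonNeg (ι 2)(Σ<-prefix _ (\i -> ℚ.<⇒≤ (inv-pos (i N.+ suc m)))(N.*-monoˡ-≤ (suc m)(N.∸-monoˡ-≤ 1 2^L≤q))))
  (ℚ.≤-reflexive (cong (ℚ._* riemannSum q m)(sym (seq-# 2 m)))))))

 log-upper : ∀ q -> log q ≤ # q
 log-upper q = Reals.pointwise-≤ {log q}{# q}(\m -> begin
  riemannSum q m ≤⟨ Σ<-mono (l N.* suc m)(\i _ -> inv-anti (≤-tr (N.n≤1+n m)(N.m≤n+m (suc m) i))) ⟩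
  Σ< (l N.* suc m)(\_ -> inv m) ≡⟨ trans (Σ<-const (l N.* suc m)(inv m))(Root.ι-*-inv l m) ⟩
  ι l ≤⟨ ι-mono (N.m∸n≤m q 1) ⟩
  ι q ≡⟨ seq-# q m ⟨
  seq (# q) m ∎)
  where
  open ℚ.≤-Reasoning
  l = q N.∸ 1
  ι-mono : ∀ {m n} -> m N.≤ n -> ι m ℚ.≤ ι n
  ι-mono {m}{n} m≤n = subst (\k -> ι m ℚ.≤ ι k)(N.m∸n+n≡m m≤n)(step (n N.∸ m))
   where
   step : ∀ k -> ι m ℚ.≤ ι (k N.+ m)
   step zero = ℚ.≤-refl
   step (suc k) = ℚ.≤-trans (step k)(ℚ.≤-trans (≤-+ʳ (ι (k N.+ m))(ℚ.nonNegative⁻¹ 1ℚ))(ℚ.≤-reflexive (ι-suc (k N.+ m))))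

module DirichletCharacters {ℝ}(ℂ : NormedRing ℝ) where
 open import Data.Integer using (+_)
 open import Data.Nat.DivMod using (_%_)
 open import Data.Nat.Divisibility using (divides)
 private module C = NormedRing ℂ

 record PrimitiveCharacter (q : ℕ) : Set where
  field
   prime : Prime q
   χ : ℤ -> C.Carrier
   periodic : ∀ a b -> + q Z.∣ a Z.- b -> χ a C.≈ χ b
   multiplicative : ∀ a b -> χ (a Z.* b) C.≈ χ a C.* χ b
   unital : χ (+ 1) C.≈ C.1#
   vanishing : ∀ a -> ¬ Z.Coprime a (+ q) -> χ a C.≈ C.0#
   nontrivial : ¬ (∀ a -> Z.Coprime a (+ q) -> χ a C.≈ C.1#)

 module _ {q : ℕ}(ψ : PrimitiveCharacter q) where
  open PrimitiveCharacter ψ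
  private instance _ = prime⇒nonZero prime

  χ-reduce : ∀ a -> χ a C.≈ χ (+ (a Z.%ℕ q))
  χ-reduce a = periodic a (+ r)(divides Z.∣ k ∣ (E.trans (E.cong Z.∣_∣ difference)(Z.abs-* k (+ q))))
   where
   r = a Z.%ℕ q
   k = a Z./ℕ q
   difference : a Z.- + r ≡ k Z.* + q
   difference = E.trans (E.cong (Z._- + r)(E.trans (Z.a≡a%ℕn+[a/ℕn]*n a q)(Z.+-comm (+ r)(k Z.* + q))))
    (E.trans (Z.+-assoc (k Z.* + q)(+ r)(Z.- + r))(E.trans (E.cong (\z -> k Z.* + q Z.+ z)(Z.+-inverseʳ (+ r)))(Z.+-identityʳ _)))

  private module K = PrimeFields prime
  private module F = PrimeField K.field-of

  2≤q : 2 N.≤ q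
  2≤q = N.nonTrivial⇒n>1 q {{prime⇒nonTrivial prime}}

  value : F.Carrier -> C.Carrier
  value x = χ (+ toℕ x)

  value-[] : ∀ n -> value K.[ n ]ₚ C.≈ χ (+ n)
  value-[] n = C.sym (C.trans (χ-reduce (+ n))(C.reflexive (E.cong (\m -> χ (+ m))(E.sym (K.toℕ-[] n)))))

  value-1 : value F.1# C.≈ C.1#
  value-1 = C.trans (value-[] 1) unital

  nonzero⇒all-one : ¬ (∀ x -> x ≢ F.0# -> value x C.≈ C.1#)
  nonzero⇒all-one h = nontrivial trivial
   where
   trivial : ∀ a -> Z.Coprime a (+ q) -> χ a C.≈ C.1#
   trivial a coprime = C.trans (χ-reduce a)(C.trans (C.sym (value-[] (a Z.%ℕ q)))(h K.[ a Z.%ℕ q ]ₚ nonzero))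
    where
    r = a Z.%ℕ q
    nonzero : K.[ r ]ₚ ≢ F.0#
    nonzero e = N.<⇒≢ 2≤q (E.sym (coprime (q∣a , N.∣-refl)))
     where
     r≡0 : r ≡ 0
     r≡0 = E.trans (E.sym (E.trans (K.toℕ-[] r)(m<n⇒m%n≡m (Z.n%ℕd<d a q))))(E.trans (E.cong toℕ e)(E.trans (K.toℕ-[] 0)(m<n⇒m%n≡m (≤-tr (s≤s z≤n) 2≤q))))
     q∣a : q N.∣ Z.∣ a ∣
     q∣a = divides Z.∣ a Z./ℕ q ∣ (E.trans (E.cong Z.∣_∣ (E.trans (Z.a≡a%ℕn+[a/ℕn]*n a q)(E.trans (E.cong (\m -> (+ m) Z.+ (a Z./ℕ q) Z.* (+ q)) r≡0)(Z.+-identityˡ ((a Z./ℕ q) Z.* (+ q))))))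
      (Z.abs-* (a Z./ℕ q)(+ q)))

  character : Character K.field-of ℂ
  character = record
   { χ = value
   ; χ-* = \x y -> C.trans (value-[] (toℕ x N.* toℕ y))(C.trans (C.reflexive (E.cong χ (Z.pos-* (toℕ x)(toℕ y))))(multiplicative (+ toℕ x)(+ toℕ y)))
   ; χ-0 = C.trans (value-[] 0)(vanishing (+ 0) \coprime -> N.<⇒≢ 2≤q (E.sym (coprime (divides 0 E.refl , N.∣-refl))))
   ; χ-1 = value-1
   ; nontrivial = nonzero⇒all-one }

  -- There is no primitive character modulo 2.
  3≤q : 3 N.≤ q
  3≤q = N.≮⇒≥ \q<3 -> nonzero⇒all-one \x x≢0 -> C.trans (C.reflexive (E.cong value (is-one x x≢0 (≤-tr (Fin.toℕ<n x)(N.s≤s⁻¹ q<3))))) value-1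
   where
   is-one : ∀ x -> x ≢ F.0# -> toℕ x N.< 2 -> x ≡ F.1#
   is-one x x≢0 x<2 = cases (toℕ x) E.refl x<2
    where
    cases : ∀ n -> toℕ x ≡ n -> n N.< 2 -> x ≡ F.1#
    cases zero e _ = contradiction (E.trans (E.sym (K.[]-toℕ x))(E.cong K.[_]ₚ e)) x≢0
    cases (suc zero) e _ = E.trans (E.sym (K.[]-toℕ x))(E.cong K.[_]ₚ e)
    cases (suc (suc _)) _ (s≤s (s≤s ()))

  q≡ : q ≡ 3 N.+ (q N.∸ 3)
  q≡ = E.sym (N.m+[n∸m]≡n 3≤q)

  value-embed : ∀ n -> value (F._·_ n F.1#) C.≈ χ (+ n)
  value-embed n = C.trans (C.reflexive (E.cong value (K.·1 n)))(value-[] n)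

module HyperbolaPairs where

 largest-product : ∀ (P : ℕ -> Set) ps -> (∀ x y -> (x , y) ∈ ps -> P (x N.* y)) ->
  ∃[ t ] (t ≡ 0 ⊎ P t) × (∀ x y -> (x , y) ∈ ps -> x N.* y N.≤ t)
 largest-product P [] h = 0 , inl E.refl , \_ _ ()
 largest-product P ((x , y) ∷ ps) h with largest-product P ps (\x y ∈ps -> h x y (there ∈ps))
 ... | t , attained , bound with N.≤-total t (x N.* y)
 ... | inl le = x N.* y , inr (h x y (here E.refl)) , \{ _ _ (here E.refl) -> N.≤-refl; x y (there ∈ps) -> ≤-tr (bound x y ∈ps) le }
 ... | inr ge = t , attained , \{ _ _ (here E.refl) -> ge; x y (there ∈ps) -> bound x y ∈ps }

 Σ-homomorphism : ∀ (A : CommutativeRing 0ℓ 0ℓ) -> let open CommutativeRing A in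
  ∀ {Z : Set}(_⊕_ : Z -> Z -> Z)(𝟘 : Z)(h : Z -> Carrier) -> h 𝟘 ≈ 0# -> (∀ x y -> h (x ⊕ y) ≈ h x + h y) ->
  ∀ {X : Set}(F : X -> Z) xs -> h (foldr _⊕_ 𝟘 (map F xs)) ≈ Summation.Σ commutativeSemiring xs (\x -> h (F x))
 Σ-homomorphism A _⊕_ 𝟘 h h0 h+ F [] = h0
 Σ-homomorphism A _⊕_ 𝟘 h h0 h+ F (x ∷ xs) = trans (h+ (F x) _)(+-congˡ (Σ-homomorphism A _⊕_ 𝟘 h h0 h+ F xs))
  where open CommutativeRing A

 module _ {ℝ}(ℂ : NormedRing ℝ)(f g : ℕ -> NormedRing.Carrier ℂ)(t : ℕ){ps : List (ℕ × ℕ)}(unique : Unique ps)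
  (complete : ∀ x y -> (x , y) ∈ ps ⇔ (0 N.< x × 0 N.< y × x N.* y N.≤ t)) where
  private module C = NormedProperties ℂ
  open Staircase ℂ using (hyperbolaSum)

  hyperbolaSum≈ : C.Σ ps (\(x , y) -> f x C.* g y) C.≈ hyperbolaSum (\n -> f (suc n))(\n -> g (suc n)) t
  hyperbolaSum≈ = C.trans (C.Σ-bijection (Unique.filter⁺ below? (Unique.cartesianProduct⁺ (Unique.upTo⁺ t)(Unique.upTo⁺ t))) unique
   (\(x , y) -> suc x , suc y)(\(x , y) -> N.pred x , N.pred y) to∈ from∈ (\_ -> E.refl) retract (\(x , y) -> f x C.* g y))
   (C.trans (C.Σ-filter below? box summand)(C.Σ-pairs _,_ (upTo t)(upTo t)(\x -> C.[ below? x ] C.* summand x)))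
   where
   box = cartesianProduct (upTo t)(upTo t)
   below? : ∀ (x : ℕ × ℕ) -> Dec (suc (fst x) N.* suc (snd x) N.≤ t)
   below? (x , y) = suc x N.* suc y N.≤? t
   summand : ℕ × ℕ -> C.Carrier
   summand (x , y) = f (suc x) C.* g (suc y)
   to∈ : ∀ {x} -> x ∈ filter below? box -> (suc (fst x) , suc (snd x)) ∈ ps
   to∈ {x , y} ∈ = Equivalence.from (complete (suc x)(suc y))(s≤s z≤n , s≤s z≤n , snd (∈-filter⁻ below? {xs = box} ∈))
   positive : ∀ {x y} -> (x , y) ∈ ps -> suc (N.pred x) ≡ x × suc (N.pred y) ≡ y × x N.* y N.≤ t
   positive {x}{y} ∈ps = let 0<x , 0<y , le = Equivalence.to (complete x y) ∈ps in
    N.suc-pred x {{N.>-nonZero 0<x}} , N.suc-pred y {{N.>-nonZero 0<y}} , le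
   retract : ∀ {x} -> x ∈ ps -> (suc (N.pred (fst x)) , suc (N.pred (snd x))) ≡ x
   retract ∈ps = let e , e' , _ = positive ∈ps in cong₂ _,_ e e'
   from∈ : ∀ {x} -> x ∈ ps -> (N.pred (fst x) , N.pred (snd x)) ∈ filter below? box
   from∈ {x , y} ∈ps = let e , e' , le = positive ∈ps
                           le' = subst (N._≤ t)(E.sym (cong₂ N._*_ e e')) le in
    ∈-filter⁺ below? (∈-cartesianProduct⁺ (∈-upTo⁺ (≤-tr (N.m≤m*n (suc (N.pred x))(suc (N.pred y))) le'))(∈-upTo⁺ (≤-tr (N.m≤n*m (suc (N.pred y))(suc (N.pred x))) le'))) le'

module CharacterSums where
 open import Data.Integer using (+_)
 open DirichletCharacters using (PrimitiveCharacter;module PrimitiveCharacter)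

 module Over {ℝ}(ℂ : NormedRing ℝ)
  (fromℕ : ℕ -> RealField.Carrier ℝ)(fromℕ≈ : ∀ n -> RealField._≈_ ℝ (fromℕ n)(RealProperties.# ℝ n))
  (log : ℕ -> RealField.Carrier ℝ)
  (log-lower : ∀ q L -> 2 N.^ L N.≤ q -> RealField._≤_ ℝ (RealProperties.# ℝ L)(RealField._*_ ℝ (RealProperties.# ℝ 2)(log q)))
  (log-upper : ∀ q -> RealField._≤_ ℝ (log q)(RealProperties.# ℝ q)) where
  open RealProperties ℝ hiding (Σ)
  private module C = NormedProperties ℂ
  open Staircase ℂ using (hyperbolaSum)
  open DirichletCharacters ℂ using (character;q≡;value-embed)

  module _ {q1 q2 : ℕ}(ψ1 : PrimitiveCharacter ℂ q1)(ψ2 : PrimitiveCharacter ℂ q2)(q1≤q2 : q1 N.≤ q2)(s : ℕ)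
   (T : Carrier)(1≤T : 1# ≤ T) ps (unique : Unique ps)
   (complete : ∀ x y -> (x , y) ∈ ps ⇔ (0 N.< x × 0 N.< y × fromℕ (x N.* y) ≤ T))
   (f g : ℕ -> C.Carrier)(f≈ : ∀ n -> f n C.≈ PrimitiveCharacter.χ ψ1 (+ n))(g≈ : ∀ n -> g n C.≈ PrimitiveCharacter.χ ψ2 (+ n))
   (z : C.Carrier)(z≈ : z C.≈ Summation.Σ (NormedRing.commutativeSemiring ℂ) ps (\(x , y) -> f x C.* g y)) where
   private
    module H = HyperbolaEstimate (character ψ1)(character ψ2)(q1 N.∸ 3)(q2 N.∸ 3)(q≡ ψ1)(q≡ ψ2) q1≤q2 s
    largest = HyperbolaPairs.largest-product (\n -> fromℕ n ≤ T) ps (\x y ∈ps -> snd (snd (Equivalence.to (complete x y) ∈ps)))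
    t = fst largest
    products-≤ = snd (snd largest)

    0<t : 0 N.< t
    0<t = products-≤ 1 1 (Equivalence.from (complete 1 1)(s≤s z≤n , s≤s z≤n , ≤-respˡ (trans (fromℕ≈ 1) #1) 1≤T))

    t≤T : # t ≤ T
    t≤T = attained (fst (snd largest))
     where
     attained : t ≡ 0 ⊎ fromℕ t ≤ T -> # t ≤ T
     attained (inl t≡0) = contradiction (E.sym t≡0)(N.<⇒≢ 0<t)
     attained (inr h) = ≤-respˡ (sym (fromℕ≈ t)) h

    complete-t : ∀ x y -> (x , y) ∈ ps ⇔ (0 N.< x × 0 N.< y × x N.* y N.≤ t)
    complete-t x y = mk⇔
     (\ ∈ps -> let 0<x , 0<y , _ = Equivalence.to (complete x y) ∈ps in 0<x , 0<y , products-≤ x y ∈ps)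
     (\(0<x , 0<y , le) -> Equivalence.from (complete x y)(0<x , 0<y , ≤-respˡ (fromℕ≈ (x N.* y))(≤-trans (#-mono le) t≤T)))

    z≈hyperbolaSum : z C.≈ hyperbolaSum H.A.sequence H.B.sequence t
    z≈hyperbolaSum = C.trans z≈ (C.trans (HyperbolaPairs.hyperbolaSum≈ ℂ f g t unique complete-t)(C.Σ-cong (upTo t)(\x -> C.Σ-cong (upTo t)(\y ->
     C.*-congˡ (C.*-cong (C.trans (f≈ (suc x))(C.sym (value-embed ψ1 (suc x))))(C.trans (g≈ (suc y))(C.sym (value-embed ψ2 (suc y)))))))))

    first-range' = H.first-range fromℕ fromℕ≈ (log q1)(log q2)(log-lower q1 H.A.L H.A.2^L≤p)(log-lower q2 H.B.L H.B.2^L≤p)(log-upper q1)(log-upper q2) t 0<t T t≤T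
    second-range' = H.second-range fromℕ fromℕ≈ (log q1)(log q2)(log-lower q1 H.A.L H.A.2^L≤p)(log-lower q2 H.B.L H.B.2^L≤p)(log-upper q1)(log-upper q2) t 0<t T t≤T

   open HyperbolaConstants ℂ s using (r;r';w;m;n;finalConstant)

   private
    threshold = root (4 N.* r)(fromℕ q1 ^ (w N.^ 2)) * root (4 N.* r)(fromℕ q2 ^ w) * log q1 ^ w * log q2 ^ m

   first-range : T ≤ threshold -> C.∣ z ∣ ≤ finalConstant *
    (root r (T ^ r') * root (4 N.* r N.^ 2)(fromℕ (q1 N.* q2) ^ w) * root r (log q1 ^ 1) * root r (log q2 ^ n))
   first-range h = ≤-respˡ (C.∣∣-cong z≈hyperbolaSum)(first-range' h)

   second-range : threshold ≤ T -> C.∣ z ∣ ≤ finalConstant * (root w (T ^ r) * root (4 N.* r)(fromℕ q2 ^ 1) * root w (log q2 ^ 2))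
   second-range h = ≤-respˡ (C.∣∣-cong z≈hyperbolaSum)(second-range' h)

open import Defs
open import Data.Nat as N using (ℕ)
open import Data.Nat.Primality using (Prime)
open import Data.Product using (_×_; ∃-syntax)
open import Data.Integer using (+_)
open DirichletCharacter using (χ)

module Instances where
 open import Data.Nat.Divisibility using (divides)
 open DirichletCharacters using (PrimitiveCharacter)
 open ℂ

 complex : NormedRing Reals.real-field
 complex = ComplexNumbers.complex Reals.real-field
 module C = NormedRing complex

 pair : ℂ -> C.Carrier
 pair z = re z , im z

 -- The setoid forms are essential here: a propositional equation would compare Cauchy proofs.
 pair-Σ : ∀ ps (f g : ℕ -> ℂ) -> pair (∑ ps (\x y -> f x *ᶜ g y)) C.≈ Summation.Σ C.commutativeSemiring ps (\(x , y) -> pair (f x) C.* pair (g y))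
 pair-Σ ps f g = C.trans {pair (∑ ps (\x y -> f x *ᶜ g y))}{Summation.Σ C.commutativeSemiring ps (\(x , y) -> pair (f x *ᶜ g y))}
  {Summation.Σ C.commutativeSemiring ps (\(x , y) -> pair (f x) C.* pair (g y))}
  (HyperbolaPairs.Σ-homomorphism (NormedRing.ring complex) _+ᶜ_ 0ℂ pair (C.refl {pair 0ℂ})(\z w -> C.refl {pair z C.+ pair w})(\(x , y) -> f x *ᶜ g y) ps)
  (Summation.Σ-cong C.commutativeSemiring ps {\(x , y) -> pair (f x *ᶜ g y)}{\(x , y) -> pair (f x) C.* pair (g y)}(\(x , y) -> C.refl {pair (f x) C.* pair (g y)}))

 primitive-character : ∀ {q} -> Prime q -> (ψ : DirichletCharacter q) -> Primitive ψ -> PrimitiveCharacter complex q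
 primitive-character {q} q-prime ψ minimal = record
  { prime = q-prime; χ = \a -> pair (χ ψ a); periodic = periodic; multiplicative = multiplicative; unital = unital; vanishing = vanishing
  ; nontrivial = \h -> N.<⇒≱ (N.nonTrivial⇒n>1 q {{prime⇒nonTrivial q-prime}})
  (snd minimal (divides q (E.sym (N.*-identityʳ q)) , \a coprime _ -> h a coprime)) }
  where open DirichletCharacter ψ hiding (χ)

 0<-from-1≤ : ∀ x -> 1ℝ ≤ x -> 0ℝ < x
 0<-from-1≤ x h = ½ , 0<½ , fst (h 0<½) , \n le -> bound (snd (h 0<½) n le)
  where
  0<½ = ℚ.positive⁻¹ ½
  bound : ∀ {a} -> 1ℚ ℚ.≤ a ℚ.+ ½ -> 0ℚ ℚ.+ ½ ℚ.≤ a
  bound {a} le = subst (½ ℚ.≤_)(E.trans (ℚ.+-assoc a ½ (ℚ.- ½))(ℚ.+-identityʳ a))(ℚ.+-monoˡ-≤ (ℚ.- ½) le)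

 module Bounds = CharacterSums.Over complex fromℕ Logarithms.fromℕ≈ log Logarithms.log-lower Logarithms.log-upper

import Data.Nat as ℕ

theorem2 :
    ∀ r → 2 ℕ.≤ r →
    ∃[ C ] 0ℝ < C ×
      (∀ {q₁ q₂} → Prime q₁ → Prime q₂ → q₁ ℕ.≤ q₂ →
       (ψ₁ : DirichletCharacter q₁) (ψ₂ : DirichletCharacter q₂) →
       Primitive ψ₁ → Primitive ψ₂ →
       ∀ T → 1ℝ < T → ∀ ps → Enumerates ps T →
       let S  = ∣ ∑ ps (λ x y → χ ψ₁ (+ x) *ᶜ χ ψ₂ (+ y)) ∣
           Tᵣ = threshold r q₁ q₂
       in
         (fromℕ (q₁ ℕ.* q₂) ^[ r ℕ.+ 1 / 4 ℕ.* r ] ≤ T → T ≤ Tᵣ →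
          S ≤ C * (T ^[ r ℕ.∸ 1 / r ]
                 * fromℕ (q₁ ℕ.* q₂) ^[ r ℕ.+ 1 / 4 ℕ.* r ℕ.^ 2 ]
                 * log q₁ ^[ 1 / r ]
                 * log q₂ ^[ 1 ℕ.+ (ν r ℕ.+ 1) ℕ.* r / r ]))
         ×
         (Tᵣ ≤ T →
          S ≤ C * (T ^[ r / r ℕ.+ 1 ]
                 * fromℕ q₂ ^[ 1 / 4 ℕ.* r ]
                 * log q₂ ^[ 2 / r ℕ.+ 1 ])))
theorem2 (ℕ.suc (ℕ.suc s)) (ℕ.s≤s (ℕ.s≤s ℕ.z≤n)) =
    finalConstant , 0<-from-1≤ finalConstant 1≤final , λ prime₁ prime₂ q₁≤q₂ ψ₁ ψ₂ minimal₁ minimal₂ T 1<T ps (unique , complete) →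
      let χ₁ = primitive-character prime₁ ψ₁ minimal₁
          χ₂ = primitive-character prime₂ ψ₂ minimal₂
          f = λ x → χ ψ₁ (+ x)
          g = λ y → χ ψ₂ (+ y)
          1≤T = Reals.<⇒≤ {1ℝ} {T} 1<T
      in (λ _ → Bounds.first-range χ₁ χ₂ q₁≤q₂ s T 1≤T ps unique complete (λ n → pair (f n)) (λ n → pair (g n)) (λ n → C.refl {pair (f n)}) (λ n → C.refl {pair (g n)})
                  (pair (∑ ps (λ x y → f x *ᶜ g y))) (pair-Σ ps f g))
       , Bounds.second-range χ₁ χ₂ q₁≤q₂ s T 1≤T ps unique complete (λ n → pair (f n)) (λ n → pair (g n)) (λ n → C.refl {pair (f n)}) (λ n → C.refl {pair (g n)})
                  (pair (∑ ps (λ x y → f x *ᶜ g y))) (pair-Σ ps f g)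
  where
  open Instances
  open HyperbolaConstants complex s using (finalConstant; 1≤final)
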